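{- Let $Q$ be a connected quiver of finite mutation type with at least three vertices, on the vertex set $\{1,\dots,n\}$. Let $S$ be a subquiver of $Q$ which is either a double edge (two vertices joined by an edge of weight $2$) or a non-oriented cycle, and let $u\in(\mathbb{Z}/2\mathbb{Z})^n$ be the vector with coordinate $1$ at the vertices of $S$ and $0$ elsewhere. Then $u$ is a radical vector of $\bar B^Q$. Furthermore, if $Q$ comes from the triangulation of a surface or $Q$ is mutation-equivalent to $X_6$ or $X_7$, then: (i) $\dim(\bar V^Q_0/\bar V^Q_{00})\le 1$; (ii) if $Q'$ is mutation-equivalent to $Q$, then $\dim \bar V^Q_{00}=\dim \bar V^{Q'}_{00}$.
   Context: A quiver is a finite directed graph with no loops and no 2-cycles, each edge carrying a positive integer weight (weight 1: single edge, weight 2: double edge); simply-laced means all edges single. A subquiver is an induced subgraph with the same weights. For $Q$ on $\{1,\dots,n\}$, $B^Q$ is the skew-symmetric integer matrix with $B_{ij}=w$, $B_{ji}=-w$ for an edge $i\to j$ of weight $w$, and $0$ for non-adjacent $i,j$. Mutation at $k$: $B'_{ij}=-B_{ij}$ if $k\in\{i,j\}$, else $B'_{ij}=B_{ij}+\mathrm{sgn}(B_{ik})[B_{ik}B_{kj}]_+$ with $[x]_+=\max\{x,0\}$; mutation-equivalence is generated by mutations (and isomorphism); finite mutation type means finite mutation class. A cycle is a subquiver whose vertices can be labelled by $\mathbb{Z}/m\mathbb{Z}$ so that its edges are exactly $\{i,i+1\}$; it is oriented if all edges go $i\to i+1$ for a suitable labelling, non-oriented otherwise. $\bar B^Q$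 is $B^Q$ with entries reduced mod $2$, a matrix over the field $\mathbb{Z}/2\mathbb{Z}$; $\bar V^Q_0$ is its space of radical vectors $\{u\in(\mathbb{Z}/2\mathbb{Z})^n:\bar B^Qu=0\}$. For $u$, $\mathrm{supp}_Q(u)$ is the subquiver on vertices with non-zero coordinate. A basic radical vector is a $u\in\bar V^Q_0$ such that $\mathrm{supp}_Q(u)$ has exactly two vertices or is a cycle (oriented or not); $\bar V^Q_{00}$ is the subspace spanned by the basic radical vectors (zero if there are none). $X_6$: vertices $c,a,b,p,q,d$ with edges $c\to a$ (weight 1), $a\to b$ (weight 2), $b\to c$ (weight 1), $c\to p$ (weight 1), $p\to q$ (weight 2), $q\to c$ (weight 1), and a single edge between $c$ and $d$ (either orientation). $X_7$: vertices $c,a,b,p,q,d,e$ with edges $c\to a,\ a\to b\,(2),\ b\to c,\ c\to p,\ p\to q\,(2),\ q\to c,\ c\to d,\ d\to e\,(2),\ e\to c$ (unmarked weights 1). "$Q$ comes from the triangulation of a surface" is in the sense of Fomin–Shapiro–Thurston: $Q$ is the quiver associated with a (tagged) ideal triangulation of a bordered oriented surface with marked points (equivalently, $Q$ is block-decomposable). -}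

module Defs where

open import Data.Nat as ℕ using (ℕ; zero; suc; _≤_)
open import Data.Integer as ℤ using (ℤ; +_; -[1+_]; +[1+_]; _+_; _*_; -_; _⊔_; _<_)
open import Data.Fin using (Fin; zero; suc; toℕ; fromℕ<; _≟_)
open import Data.Fin.Permutation using (Permutation′; _⟨$⟩ʳ_)
open import Data.Bool using (Bool; true; false; _∧_; _xor_; not; if_then_else_)
open import Data.Vec using (Vec; []; _∷_; lookup)
open import Data.List using (List; []; _∷_)
open import Data.List.Relation.Unary.All using (All)
open import Data.List.Relation.Unary.Any using (Any)
open import Data.Product using (Σ; ∃; ∃-syntax; _×_; _,_)
open import Data.Sum using (_⊎_)
open import Relation.Nullary using (¬_; yes; no)
open import Relation.Binary.PropositionalEquality using (_≡_; _≢_; subst)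
open import Relation.Binary.Construct.Closure.ReflexiveTransitive using (Star)
open import Function.Bundles using (_⇔_)
open import Agda.Builtin.FromNat
open import Data.Unit using (⊤; tt)
import Data.Fin.Literals as FinLit
import Data.Nat.Literals as NatLit

instance
  finNumber : ∀ {n} → Number (Fin n)
  finNumber {n} = FinLit.number n
  natNumber : Number ℕ
  natNumber = NatLit.number

Mat : ℕ → Set
Mat n = Fin n → Fin n → ℤ

-- A quiver on {1..n} is the same as a skew-symmetric integer matrix:
-- B i j = w > 0  iff  there is an edge i → j of weight w.
SkewSym : ∀ {n} → Mat n → Set
SkewSym B = ∀ i j → B j i ≡ - B i j

Adj : ∀ {n} → Mat n → Fin n → Fin n → Set
Adj B i j = B i j ≢ + 0

Connected : ∀ {n} → Mat n → Set
Connected B = ∀ i j → Star (Adj B) i j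

sgn : ℤ → ℤ
sgn (+ zero)  = + 0
sgn +[1+ _ ]  = + 1
sgn -[1+ _ ]  = - (+ 1)

[_]₊ : ℤ → ℤ
[ x ]₊ = x ⊔ + 0

mutate : ∀ {n} → Fin n → Mat n → Mat n
mutate k B i j with i ≟ k | j ≟ k
... | yes _ | _     = - B i j
... | no _  | yes _ = - B i j
... | no _  | no _  = B i j + sgn (B i k) * [ B i k * B k j ]₊

data MutEq {n : ℕ} : Mat n → Mat n → Set where
  base : ∀ {B C} → (∀ i j → B i j ≡ C i j) → MutEq B C
  sym' : ∀ {B C} → MutEq B C → MutEq C B
  trans' : ∀ {B C D} → MutEq B C → MutEq C D → MutEq B D
  mut : ∀ {B C} (k : Fin n) → (∀ i j → C i j ≡ mutate k B i j) → MutEq B C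
  iso : ∀ {B C} (σ : Permutation′ n) →
        (∀ i j → C i j ≡ B (σ ⟨$⟩ʳ i) (σ ⟨$⟩ʳ j)) → MutEq B C

FiniteMutationType : ∀ {n} → Mat n → Set
FiniteMutationType {n} B =
  Σ (List (Mat n)) λ L → ∀ C → MutEq B C → Any (λ D → ∀ i j → C i j ≡ D i j) L

-- Vertex subsets / vectors over ℤ/2ℤ (Bool with xor as addition)

Vect : ℕ → Set
Vect n = Fin n → Bool

oddℕ : ℕ → Bool
oddℕ zero    = false
oddℕ (suc m) = not (oddℕ m)

mod2 : ℤ → Bool
mod2 x = oddℕ ℤ.∣ x ∣

sum2 : ∀ {m} → (Fin m → Bool) → Bool
sum2 {zero}  f = false
sum2 {suc m} f = f zero xor sum2 (λ i → f (suc i))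

Radical : ∀ {n} → Mat n → Vect n → Set
Radical B u = ∀ i → sum2 (λ j → mod2 (B i j) ∧ u j) ≡ false

TwoVertices : ∀ {n} → Vect n → Fin n → Fin n → Set
TwoVertices S i j = i ≢ j × (∀ k → S k ≡ true ⇔ (k ≡ i ⊎ k ≡ j))

IsDoubleEdge : ∀ {n} → Mat n → Vect n → Set
IsDoubleEdge B S = ∃[ i ] ∃[ j ] TwoVertices S i j × ℤ.∣ B i j ∣ ≡ 2

next : ∀ {l} → Fin (suc l) → Fin (suc l)
next {l} a with suc (toℕ a) ℕ.<? suc l
... | yes p = fromℕ< p
... | no _  = zero

CycleLabelling : ∀ {n} → Mat n → Vect n → (l : ℕ) → (Fin (3 ℕ.+ l) → Fin n) → Set
CycleLabelling B S l c =
    (∀ a b → c a ≡ c b → a ≡ b)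
  × (∀ k → S k ≡ true ⇔ (∃[ a ] c a ≡ k))
  × (∀ a b → Adj B (c a) (c b) ⇔ (b ≡ next a ⊎ a ≡ next b))

IsCycle : ∀ {n} → Mat n → Vect n → Set
IsCycle B S = ∃[ l ] ∃[ c ] CycleLabelling B S l c

IsOrientedCycle : ∀ {n} → Mat n → Vect n → Set
IsOrientedCycle B S =
  ∃[ l ] ∃[ c ] (CycleLabelling B S l c × (∀ a → + 0 < B (c a) (c (next a))))

IsNonOrientedCycle : ∀ {n} → Mat n → Vect n → Set
IsNonOrientedCycle B S = IsCycle B S × ¬ IsOrientedCycle B S

xorSum : ∀ {n} → List (Vect n) → Vect n
xorSum []       i = false
xorSum (v ∷ vs) i = v i xor xorSum vs i

Span : ∀ {n} → (Vect n → Set) → Vect n → Set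
Span {n} P u = Σ (List (Vect n)) λ ps → All P ps × (∀ i → u i ≡ xorSum ps i)

BasicRadical : ∀ {n} → Mat n → Vect n → Set
BasicRadical B u =
  Radical B u × ((∃[ i ] ∃[ j ] TwoVertices u i j) ⊎ IsCycle B u)

V0 : ∀ {n} → Mat n → Vect n → Set
V0 = Radical

V00 : ∀ {n} → Mat n → Vect n → Set
V00 B = Span (BasicRadical B)

comb : ∀ {n d} → Vec Bool d → Vec (Vect n) d → Vect n
comb []       []       i = false
comb (c ∷ cs) (w ∷ ws) i = (c ∧ w i) xor comb cs ws i

QuotDim : ∀ {n} → (Vect n → Set) → (Vect n → Set) → ℕ → Set
QuotDim {n} V W d =
  Σ (Vec (Vect n) d) λ ws →
      (∀ k → V (lookup ws k))
    × (∀ cs → W (comb cs ws) → ∀ k → lookup cs k ≡ false)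
    × (∀ v → V v → ∃[ cs ] ∃[ w ] (W w × (∀ i → v i ≡ comb cs ws i xor w i)))

ZeroSpace : ∀ {n} → Vect n → Set
ZeroSpace u = ∀ i → u i ≡ false

Dim : ∀ {n} → (Vect n → Set) → ℕ → Set
Dim V d = QuotDim V ZeroSpace d

-- Quivers given by lists of weighted edges (i , j , w) meaning i → j

sumFin : ∀ {m} → (Fin m → ℤ) → ℤ
sumFin {zero}  f = + 0
sumFin {suc m} f = f zero + sumFin (λ i → f (suc i))

δ : ∀ {n} → Fin n → Fin n → ℤ → ℤ
δ i j w with i ≟ j
... | yes _ = w
... | no _  = + 0

fromEdges : ∀ {n} → List (Fin n × Fin n × ℕ) → Mat n
fromEdges []              i j = + 0
fromEdges ((a , b , w) ∷ es) i j =
  δ i a (δ j b (+ w)) + δ i b (δ j a (- (+ w))) + fromEdges es i j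

-- X₆ : c,a,b,p,q,d = 0,1,2,3,4,5 ; the Bool chooses orientation of c — d
X6 : Bool → Mat 6
X6 o = fromEdges
  ( (0 , 1 , 1) ∷ (1 , 2 , 2) ∷ (2 , 0 , 1)
  ∷ (0 , 3 , 1) ∷ (3 , 4 , 2) ∷ (4 , 0 , 1)
  ∷ (if o then (0 , 5 , 1) else (5 , 0 , 1)) ∷ [])

-- X₇ : c,a,b,p,q,d,e = 0,...,6
X7 : Mat 7
X7 = fromEdges
  ( (0 , 1 , 1) ∷ (1 , 2 , 2) ∷ (2 , 0 , 1)
  ∷ (0 , 3 , 1) ∷ (3 , 4 , 2) ∷ (4 , 0 , 1)
  ∷ (0 , 5 , 1) ∷ (5 , 6 , 2) ∷ (6 , 0 , 1) ∷ [])

MutEqX6 : ∀ {n} → Mat n → Set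
MutEqX6 {n} B = Σ (n ≡ 6) λ e → ∃[ o ] MutEq (subst Mat e B) (X6 o)

MutEqX7 : ∀ {n} → Mat n → Set
MutEqX7 {n} B = Σ (n ≡ 7) λ e → MutEq (subst Mat e B) X7

-- Block decomposition (Fomin–Shapiro–Thurston, Def. 13.1)

data BlockType : Set where
  I II IIIa IIIb IV V : BlockType

size : BlockType → ℕ
size I    = 2
size II   = 3
size IIIa = 3
size IIIb = 3
size IV   = 4
size V    = 5

outlet : (t : BlockType) → Fin (size t) → Bool
outlet I    _ = true
outlet II   _ = true
outlet IIIa zero = true
outlet IIIa (suc _) = false
outlet IIIb zero = true
outlet IIIb (suc _) = false
outlet IV   zero = true
outlet IV   (suc zero) = true
outlet IV   (suc (suc _)) = false
outlet V    zero = true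
outlet V    (suc _) = false

blockMat : (t : BlockType) → Mat (size t)
blockMat I    = fromEdges ((0 , 1 , 1) ∷ [])
blockMat II   = fromEdges ((0 , 1 , 1) ∷ (1 , 2 , 1) ∷ (2 , 0 , 1) ∷ [])
blockMat IIIa = fromEdges ((0 , 1 , 1) ∷ (0 , 2 , 1) ∷ [])
blockMat IIIb = fromEdges ((1 , 0 , 1) ∷ (2 , 0 , 1) ∷ [])
blockMat IV   = fromEdges
  ((0 , 2 , 1) ∷ (0 , 3 , 1) ∷ (2 , 1 , 1) ∷ (3 , 1 , 1) ∷ (1 , 0 , 1) ∷ [])
blockMat V    = fromEdges
  ( (0 , 1 , 1) ∷ (0 , 2 , 1) ∷ (1 , 3 , 1) ∷ (1 , 4 , 1)
  ∷ (2 , 3 , 1) ∷ (2 , 4 , 1) ∷ (3 , 0 , 1) ∷ (4 , 0 , 1) ∷ [])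

-- A block decomposition: K blocks of types t k, with the vertices of
-- block k sent to vertices of Q by f k (gluing of outlets along a partial
-- matching), and B^Q the sum of the block matrices (this accounts for
-- arrows adding up and for the removal of 2-cycles).
record BlockDecomposition {n : ℕ} (B : Mat n) : Set where
  field
    K : ℕ
    t : Fin K → BlockType
    f : (k : Fin K) → Fin (size (t k)) → Fin n
    onto : ∀ v → ∃[ k ] ∃[ a ] f k a ≡ v
    glue : ∀ k a k' a' → f k a ≡ f k' a' →
             (Σ (k ≡ k') λ e → subst (λ x → Fin (size (t x))) e a ≡ a')
           ⊎ ( k ≢ k' × outlet (t k) a ≡ true × outlet (t k') a' ≡ true
             × (∀ k'' a'' → f k'' a'' ≡ f k a →
                  (Σ (k'' ≡ k) λ e → subst (λ x → Fin (size (t x))) e a'' ≡ a)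
                ⊎ (Σ (k'' ≡ k') λ e → subst (λ x → Fin (size (t x))) e a'' ≡ a')))
    sumB : ∀ i j → B i j ≡
      sumFin (λ k → sumFin (λ a → sumFin (λ b →
        δ (f k a) i (δ (f k b) j (blockMat (t k) a b)))))

BlockDecomposable : ∀ {n} → Mat n → Set
BlockDecomposable B = BlockDecomposition B

{-# OPTIONS --safe #-}

-- In an oriented triangle with an edge of weight at least 3, mutating alternately at the ends of
-- that edge makes the other weights grow without bound. So in finite mutation type a weight is at
-- most 2 as soon as a third vertex is adjacent to the edge, and a double edge and a third vertex
-- form a triangle whose two other weights are equal. A non-oriented cycle is shortened by mutating
-- at a vertex through which it passes; this keeps the parity of the row sums over the cycle, and a
-- non-oriented triangle becomes a double edge.
--
-- A block decomposition describes a triangulated surface, hence a multigraph whose edges are the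
-- arcs, that is the vertices of Q, and whose N nodes are the triangles, including the self-folded
-- ones. Modulo 2, B is the Gram matrix of the boundaries of the edges, so V₀ consists of the sets
-- of edges having the same degree modulo 2 at all nodes. Those of even degree form the cycle space,
-- which is spanned by basic radical vectors coming from the simple cycles of the multigraph. A basic
-- radical vector of odd degree exists only if N ≤ 4, and for N ≤ 4 all of V₀ is spanned by basic
-- radical vectors. Mutations are flips: they keep N, and they change V₀ by a transvection that keeps
-- the degrees. For X₆ and X₇ the mutation classes consist of five and two quivers up to
-- isomorphism, and in each of them V₀₀ = V₀.

module Submission where

open import Defs
open import Data.Nat as ℕ using (ℕ; zero; suc; _≤_; z≤n; s≤s)
import Data.Nat.Properties as ℕₚ
open import Data.Nat.Induction using (<-wellFounded)
open import Induction.WellFounded using (Acc; acc)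
open import Data.Integer as ℤ using (ℤ; +_; -[1+_]; +[1+_]; -_)
import Data.Integer.Properties as ℤₚ
open import Data.Integer.Solver using () renaming (module +-*-Solver to ℤ-Solver)
open import Data.Fin using (Fin; zero; suc; toℕ; fromℕ; inject₁; inject≤; _≟_; opposite; punchIn; punchOut; combine; splitAt; _↑ˡ_; _↑ʳ_)
import Data.Fin.Properties as Finₚ
open import Data.Fin.Permutation using (_⟨$⟩ʳ_; _⟨$⟩ˡ_; inverseˡ; inverseʳ)
open import Data.Bool using (Bool; true; false; _∧_; _xor_; not; if_then_else_)
import Data.Bool as Bool
import Data.Bool.Properties as Boolₚ
open import Data.Bool.Solver using (module xor-∧-Solver)
open import Data.Vec using (Vec; []; _∷_; lookup; tabulate)
import Data.Vec as Vec
import Data.Vec.Properties as Vecₚ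
open import Data.List using (List; []; _∷_)
import Data.List as List
open import Data.List.Relation.Unary.All using (All; []; _∷_)
open import Data.List.Relation.Unary.Any using (Any; here; there)
open import Data.Product using (Σ; ∃; ∃-syntax; _×_; _,_; proj₁; proj₂)
open import Data.Sum using (_⊎_; inj₁; inj₂; [_,_]′) renaming (swap to swap⊎)
open import Data.Empty using (⊥; ⊥-elim)
open import Data.Unit using (⊤; tt)
open import Function.Base using (_∘_; id; case_of_)
open import Function.Bundles using (_⇔_; mk⇔; Equivalence)
open import Relation.Nullary using (¬_; Dec; yes; no; does; contradiction)
open import Relation.Nullary.Decidable using (dec-true; dec-false; ¬?; _×-dec_; _⊎-dec_; map′; True; toWitness)
open import Relation.Binary.Definitions using (tri<; tri≈; tri>)
open import Relation.Binary.PropositionalEquality using (_≡_; _≢_; _≗_; refl; sym; trans; cong; cong₂; subst; subst₂; module ≡-Reasoning)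
open import Relation.Binary.Construct.Closure.ReflexiveTransitive using (Star; ε; _◅_; _◅◅_)
import Relation.Binary.Construct.Closure.ReflexiveTransitive as Star

-- Sums over ℤ/2ℤ and the cyclic order on Fin (suc l)

-- Mutation does not carry basic radical vectors to basic radical vectors, so the dimension of `V00`
-- cannot be followed along generators. It is followed through descriptions that mutation respects:
-- with more than four nodes `V00` is the space of vectors of even degree, with at most four nodes
-- it is all of `V0`. The number four comes from the odd case. A vector of odd degree touches every
-- node, and the arcs of a basic one end at four nodes or fewer: two arcs have four ends, the arcs
-- of a triangle are forced to share a node, and a longer cycle is forced to have length four, with
-- all its arcs on four nodes. The main obstacle is the self-folded triangle. Storing it as a cap
-- gives its two arcs the same boundary modulo 2, in accordance with their equal neighbourhoods, but
-- it splits the flip into three forms: an ordinary flip, one that creates a cap and one that opens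
-- a cap. Opening is obtained from creating because mutation is an involution.

infix 4 _==_
_==_ : ∀ {n} → Fin n → Fin n → Bool
i == j = does (i ≟ j)

==-refl : ∀ {n} (i : Fin n) → (i == i) ≡ true
==-refl i = dec-true (i ≟ i) refl

==-≢ : ∀ {n} {i j : Fin n} → i ≢ j → (i == j) ≡ false
==-≢ {i = i} {j} = dec-false (i ≟ j)

==-sound : ∀ {n} {i j : Fin n} → (i == j) ≡ true → i ≡ j
==-sound {i = i} {j} e with i ≟ j
... | yes p = p
... | no _  = contradiction e λ ()

==-iff : ∀ {m n} {i j : Fin m} {k l : Fin n} → (i ≡ j → k ≡ l) → (k ≡ l → i ≡ j) → (i == j) ≡ (k == l)
==-iff {i = i} {j} {k} {l} f g with i ≟ j | k ≟ l
... | yes _ | yes _ = refl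
... | no _  | no _  = refl
... | yes p | no q  = contradiction (f p) q
... | no p  | yes q = contradiction (g q) p

==-sym : ∀ {n} (i j : Fin n) → (i == j) ≡ (j == i)
==-sym i j = ==-iff {i = i} {j} {j} {i} sym sym

∧-splitˡ : ∀ {a b} → a ∧ b ≡ true → a ≡ true
∧-splitˡ {true} _ = refl

∧-splitʳ : ∀ {a b} → a ∧ b ≡ true → b ≡ true
∧-splitʳ {true} e = e

xor-self : ∀ a → a xor a ≡ false
xor-self = Boolₚ.xor-same

xor≡false : ∀ {a b} → a xor b ≡ false → a ≡ b
xor≡false {true}  {true}  _ = refl
xor≡false {false} {false} _ = refl

sum2-cong : ∀ {m} {f g : Fin m → Bool} → f ≗ g → sum2 f ≡ sum2 g
sum2-cong {zero}  e = refl
sum2-cong {suc m} e = cong₂ _xor_ (e zero) (sum2-cong (e ∘ suc))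

sum2-false : ∀ {m} {f : Fin m → Bool} → (∀ i → f i ≡ false) → sum2 f ≡ false
sum2-false {zero}  e = refl
sum2-false {suc m} e = cong₂ _xor_ (e zero) (sum2-false (e ∘ suc))

xor-interchange : ∀ a b c d → (a xor b) xor (c xor d) ≡ (a xor c) xor (b xor d)
xor-interchange = solve 4 (λ a b c d → (a :+ b) :+ (c :+ d) := (a :+ c) :+ (b :+ d)) refl
  where open xor-∧-Solver

sum2-xor : ∀ {m} (f g : Fin m → Bool) → sum2 (λ i → f i xor g i) ≡ sum2 f xor sum2 g
sum2-xor {zero}  f g = refl
sum2-xor {suc m} f g =
  trans (cong ((f zero xor g zero) xor_) (sum2-xor (f ∘ suc) (g ∘ suc)))
        (xor-interchange (f zero) (g zero) (sum2 (f ∘ suc)) (sum2 (g ∘ suc)))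

sum2-∧ : ∀ {m} b (f : Fin m → Bool) → sum2 (λ i → b ∧ f i) ≡ b ∧ sum2 f
sum2-∧ true  f = refl
sum2-∧ {m} false f = sum2-false {m} (λ _ → refl)

sum2-swap : ∀ {m k} (f : Fin m → Fin k → Bool) →
            sum2 (λ i → sum2 (f i)) ≡ sum2 (λ j → sum2 (λ i → f i j))
sum2-swap {zero}  {k} f = sym (sum2-false {k} λ _ → refl)
sum2-swap {suc m} f = trans (cong (sum2 (f zero) xor_) (sum2-swap (f ∘ suc)))
                            (sym (sum2-xor (f zero) (λ j → sum2 (λ i → f (suc i) j))))

sum2-single : ∀ {m} (k : Fin m) {f : Fin m → Bool} → (∀ i → i ≢ k → f i ≡ false) → sum2 f ≡ f k
sum2-single zero    {f} e =
  trans (cong (f zero xor_) (sum2-false (λ i → e (suc i) λ ()))) (Boolₚ.xor-identityʳ (f zero))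
sum2-single (suc k) {f} e =
  cong₂ _xor_ (e zero λ ()) (sum2-single k (λ i i≢k → e (suc i) (i≢k ∘ Finₚ.suc-injective)))

sum2-δ : ∀ {m} (k : Fin m) (f : Fin m → Bool) → sum2 (λ i → (i == k) ∧ f i) ≡ f k
sum2-δ k f = trans (sum2-single k (λ i i≢k → cong (_∧ f i) (==-≢ i≢k))) (cong (_∧ f k) (==-refl k))

sum2-witness : ∀ {m} (f : Fin m → Bool) → sum2 f ≡ true → ∃[ k ] f k ≡ true
sum2-witness {suc m} f e with f zero in eq
... | true  = zero , eq
... | false with sum2-witness (f ∘ suc) e
...   | k , p = suc k , p

sum2-remove : ∀ {m} (k : Fin m) (f : Fin m → Bool) → sum2 f ≡ f k xor sum2 (λ i → not (i == k) ∧ f i)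
sum2-remove k f =
  trans (sum2-cong (λ i → split (i == k) (f i)))
        (trans (sum2-xor (λ i → (i == k) ∧ f i) (λ i → not (i == k) ∧ f i))
               (cong (_xor sum2 (λ i → not (i == k) ∧ f i)) (sum2-δ k f)))
  where
  split : ∀ b x → x ≡ (b ∧ x) xor (not b ∧ x)
  split true  x = sym (Boolₚ.xor-identityʳ x)
  split false x = refl

not==-≢ : ∀ {n} {i k : Fin n} → not (i == k) ≡ true → i ≢ k
not==-≢ {i = i} e refl rewrite ==-refl i = contradiction e λ ()

even-other : ∀ {m} (f : Fin m → Bool) (k : Fin m) → sum2 f ≡ false → f k ≡ true → ∃[ i ] i ≢ k × f i ≡ true
even-other f k e p with sum2-witness (λ i → not (i == k) ∧ f i)
                          (helper (trans (sym e) (sum2-remove k f)))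
  where
  helper : ∀ {x} → false ≡ f k xor x → x ≡ true
  helper {true}  q = refl
  helper {false} q rewrite p = contradiction q λ ()
... | i , q = i , not==-≢ (∧-splitˡ q) , ∧-splitʳ {not (i == k)} q

odd-third : ∀ {m} (f : Fin m → Bool) (k l : Fin m) → k ≢ l → sum2 f ≡ true → f k ≡ true → f l ≡ true →
            ∃[ i ] i ≢ k × i ≢ l × f i ≡ true
odd-third f k l k≢l e p q with even-other (λ i → not (i == k) ∧ f i) l
                                (helper (trans (sym e) (sum2-remove k f)))
                                (cong₂ (λ a b → not a ∧ b) (==-≢ (k≢l ∘ sym)) q)
  where
  helper : ∀ {x} → true ≡ f k xor x → x ≡ false
  helper {false} r = refl
  helper {true}  r rewrite p = contradiction r λ ()
... | i , i≢l , r = i , not==-≢ (∧-splitˡ r) , i≢l , ∧-splitʳ {not (i == k)} r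

-- Counts occurrences modulo 2, hence the characteristic vector of the image when `c` is injective.
-- In this form a sum over vertices turns into a sum over positions by exchanging two summations.
indicator : ∀ {m n} → (Fin m → Fin n) → Vect n
indicator c k = sum2 (λ a → k == c a)

indicator-sum : ∀ {m n} (c : Fin m → Fin n) (f : Vect n) →
                sum2 (λ k → indicator c k ∧ f k) ≡ sum2 (f ∘ c)
indicator-sum c f =
  trans (sum2-cong (λ k → trans (Boolₚ.∧-comm (indicator c k) (f k)) (sym (sum2-∧ (f k) (λ a → k == c a)))))
        (trans (sum2-swap (λ k a → f k ∧ (k == c a)))
               (sum2-cong (λ a → trans (sum2-cong (λ k → Boolₚ.∧-comm (f k) (k == c a))) (sum2-δ (c a) f))))

indicator-∈ : ∀ {m n} (c : Fin m → Fin n) → (∀ a b → c a ≡ c b → a ≡ b) → ∀ a → indicator c (c a) ≡ true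
indicator-∈ c inj a =
  trans (sum2-single a (λ b b≢a → ==-≢ (λ e → b≢a (sym (inj a b e))))) (==-refl (c a))

indicator-∋ : ∀ {m n} (c : Fin m → Fin n) k → indicator c k ≡ true → ∃[ a ] c a ≡ k
indicator-∋ c k e with sum2-witness (λ a → k == c a) e
... | a , p = a , sym (==-sound p)

-- Both sides count the pairs (i , k) with k = σ i.
sum2-bijection : ∀ {n} (σ τ : Fin n → Fin n) → (∀ i → σ (τ i) ≡ i) → (∀ i → τ (σ i) ≡ i) →
                 (f : Fin n → Bool) → sum2 (f ∘ σ) ≡ sum2 f
sum2-bijection σ τ στ τσ f =
  trans (sym (indicator-sum σ f)) (sum2-cong (λ k → cong (_∧ f k) (all k)))
  where
  all : ∀ k → indicator σ k ≡ true
  all k = trans (cong (indicator σ) (sym (στ k)))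
                (indicator-∈ σ (λ a b e → trans (sym (τσ a)) (trans (cong τ e) (τσ b))) (τ k))

bool-iff : ∀ {a b} → (a ≡ true → b ≡ true) → (b ≡ true → a ≡ true) → a ≡ b
bool-iff {true}  {true}  f g = refl
bool-iff {false} {false} f g = refl
bool-iff {true}  {false} f g = sym (f refl)
bool-iff {false} {true}  f g = g refl

not-true : ∀ {a} → a ≢ true → a ≡ false
not-true {true}  h = contradiction refl h
not-true {false} h = refl

next-inject₁ : ∀ {l} (i : Fin l) → next (inject₁ i) ≡ suc i
next-inject₁ {l} i with suc (toℕ (inject₁ i)) ℕ.<? suc l
... | yes p = Finₚ.toℕ-injective (trans (Finₚ.toℕ-fromℕ< p) (cong suc (Finₚ.toℕ-inject₁ i)))
... | no ¬p = contradiction (s≤s (subst (ℕ._< l) (sym (Finₚ.toℕ-inject₁ i)) (Finₚ.toℕ<n i))) ¬p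

next-fromℕ : ∀ l → next (fromℕ l) ≡ zero
next-fromℕ l with suc (toℕ (fromℕ l)) ℕ.<? suc l
... | yes p = contradiction (subst (λ x → suc x ℕ.< suc l) (Finₚ.toℕ-fromℕ l) p) (ℕₚ.<-irrefl refl)
... | no _  = refl

prev : ∀ {l} → Fin (suc l) → Fin (suc l)
prev {l} zero = fromℕ l
prev (suc i)  = inject₁ i

next-prev : ∀ {l} (a : Fin (suc l)) → next (prev a) ≡ a
next-prev {l} zero = next-fromℕ l
next-prev (suc i)  = next-inject₁ i

-- The two cases in which `next` evaluates: it sends `fromℕ l` to `zero` and `inject₁ i` to `suc i`.
data Top? {l : ℕ} : Fin (suc l) → Set where
  top  : Top? (fromℕ l)
  below : (i : Fin l) → Top? (inject₁ i)

top? : ∀ {l} (a : Fin (suc l)) → Top? a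
top? {zero}  zero = top
top? {suc l} zero = below zero
top? {suc l} (suc a) with top? a
... | top   = top
... | below i = below (suc i)

prev-next : ∀ {l} (a : Fin (suc l)) → prev (next a) ≡ a
prev-next {l} a with top? a
... | top = cong prev (next-fromℕ l)
... | below i = cong prev (next-inject₁ i)

next-injective : ∀ {l} {a b : Fin (suc l)} → next a ≡ next b → a ≡ b
next-injective {a = a} {b} e = trans (sym (prev-next a)) (trans (cong prev e) (prev-next b))

-- Turns the cyclic order into arithmetic of `toℕ`. From it follows that one, two or three steps do
-- not return to the start when the cycle is longer than that.
next-steps : ∀ {l} (a : Fin (suc l)) → (toℕ (next a) ≡ 0 × toℕ a ≡ l) ⊎ toℕ (next a) ≡ suc (toℕ a)
next-steps {l} a with top? a
... | top     = inj₁ (cong toℕ (next-fromℕ l) , Finₚ.toℕ-fromℕ l)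
... | below i = inj₂ (trans (cong toℕ (next-inject₁ i)) (cong suc (sym (Finₚ.toℕ-inject₁ i))))

next≢ : ∀ {l} (a : Fin (suc (suc l))) → next a ≢ a
next≢ a e with next-steps a
... | inj₁ (p , q) = contradiction (trans (sym q) (trans (cong toℕ (sym e)) p)) λ ()
... | inj₂ p       = ℕₚ.1+n≢n (trans (sym p) (cong toℕ e))

next²≢ : ∀ {l} (a : Fin (suc (suc (suc l)))) → next (next a) ≢ a
next²≢ {l} a e with next-steps a | next-steps (next a)
... | inj₁ (p , q) | inj₁ (_ , s) = contradiction (trans (sym s) p) λ ()
... | inj₁ (p , q) | inj₂ r = contradiction (trans (sym q) (trans (cong toℕ (sym e)) (trans r (cong suc p)))) λ ()
... | inj₂ p | inj₁ (r , s) = contradiction (trans (sym s) (trans p (cong suc (trans (cong toℕ (sym e)) r)))) λ ()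
... | inj₂ p | inj₂ r = ℕₚ.m≢1+m+n (toℕ a) {1} (trans (cong toℕ (sym e)) (trans r (trans (cong suc p) (cong suc (ℕₚ.+-comm 1 (toℕ a))))))

sum2-pair : ∀ {m} (k l : Fin m) → k ≢ l → (f : Fin m → Bool) →
            (∀ i → i ≢ k → i ≢ l → f i ≡ false) → sum2 f ≡ f k xor f l
sum2-pair k l k≢l f e =
  trans (sum2-remove k f)
        (cong (f k xor_) (trans (sum2-single l off) (cong (λ b → not b ∧ f l) (==-≢ (k≢l ∘ sym)))))
  where
  off : ∀ i → i ≢ l → not (i == k) ∧ f i ≡ false
  off i i≢l with i ≟ k
  ... | yes _  = refl
  ... | no i≢k = e i i≢k i≢l

next³≢ : ∀ {l} (a : Fin (4 ℕ.+ l)) → next (next (next a)) ≢ a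
next³≢ {l} a e with next-steps a | next-steps (next a) | next-steps (next (next a))
... | inj₁ (p , q) | inj₁ (_ , s) | _ = contradiction (trans (sym s) p) λ ()
... | _ | inj₁ (p , q) | inj₁ (_ , s) = contradiction (trans (sym s) p) λ ()
... | inj₁ (p , q) | inj₂ r | inj₁ (t , s) = contradiction (trans (sym q) (trans (cong toℕ (sym e)) t)) λ ()
... | inj₁ (p , q) | inj₂ r | inj₂ s =
  contradiction (trans (sym q) (trans (cong toℕ (sym e)) (trans s (cong suc (trans r (cong suc p)))))) λ ()
... | inj₂ p | inj₁ (r , s) | inj₂ t =
  contradiction (trans (sym s) (trans p (cong suc (trans (cong toℕ (sym e)) (trans t (cong suc r)))))) λ ()
... | inj₂ p | inj₂ r | inj₁ (t , s) =
  contradiction (trans (sym s) (trans r (cong suc (trans p (cong suc (trans (cong toℕ (sym e)) t)))))) λ ()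
... | inj₂ p | inj₂ r | inj₂ t =
  ℕₚ.m≢1+m+n (toℕ a) {2} (trans (cong toℕ (sym e)) (trans t (trans (cong suc (trans r (cong suc p))) (cong suc (ℕₚ.+-comm 2 (toℕ a))))))

next-suc : ∀ {l} (i : Fin (suc l)) → next (suc (inject₁ i)) ≡ suc (next (inject₁ i))
next-suc i = trans (next-inject₁ (suc i)) (cong suc (sym (next-inject₁ i)))

-- Proof by evaluation over finite types

allᵇ : ∀ {m} → (Fin m → Bool) → Bool
allᵇ {zero}  f = true
allᵇ {suc m} f = f zero ∧ allᵇ (f ∘ suc)

allᵇ-sound : ∀ {m} {f : Fin m → Bool} → allᵇ f ≡ true → ∀ i → f i ≡ true
allᵇ-sound e zero    = ∧-splitˡ e
allᵇ-sound {f = f} e (suc i) = allᵇ-sound (∧-splitʳ {f zero} e) i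

does-sound : ∀ {A : Set} (A? : Dec A) → does A? ≡ true → A
does-sound (yes a) _ = a

-- The second argument becomes `refl` once the decision procedure has been evaluated at every index.
check : ∀ {m} {P : Fin m → Set} (P? : ∀ i → Dec (P i)) → allᵇ (λ i → does (P? i)) ≡ true → ∀ i → P i
check P? e i = does-sound (P? i) (allᵇ-sound {f = λ i → does (P? i)} e i)

check₂ : ∀ {m k} {P : Fin m → Fin k → Set} (P? : ∀ i j → Dec (P i j)) →
         allᵇ (λ i → allᵇ (λ j → does (P? i j))) ≡ true → ∀ i j → P i j
check₂ P? e i = check (P? i) (allᵇ-sound {f = λ i → allᵇ (λ j → does (P? i j))} e i)

check₃ : ∀ {m k l} {P : Fin m → Fin k → Fin l → Set} (P? : ∀ i j h → Dec (P i j h)) →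
         allᵇ (λ i → allᵇ (λ j → allᵇ (λ h → does (P? i j h)))) ≡ true → ∀ i j h → P i j h
check₃ P? e i = check₂ (P? i) (allᵇ-sound {f = λ i → allᵇ (λ j → allᵇ (λ h → does (P? i j h)))} e i)

check₄ : ∀ {m k l p} {P : Fin m → Fin k → Fin l → Fin p → Set} (P? : ∀ i j h q → Dec (P i j h q)) →
         allᵇ (λ i → allᵇ (λ j → allᵇ (λ h → allᵇ (λ q → does (P? i j h q))))) ≡ true → ∀ i j h q → P i j h q
check₄ P? e i = check₃ (P? i) (allᵇ-sound {f = λ i → allᵇ (λ j → allᵇ (λ h → allᵇ (λ q → does (P? i j h q))))} e i)

-- Mutation

-- Negative integers are written `- (+ a)`, so that both cases carry a natural weight and products
-- of weights are products in ℕ. Zero fits both cases.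
data Signed : ℤ → Set where
  pos : ∀ a → Signed (+ a)
  neg : ∀ a → Signed (- (+ a))

signed : ∀ x → Signed x
signed (+ a)    = pos a
signed -[1+ a ] = neg (suc a)

-- The term that mutation adds. It is nonzero only for entries of the same sign, that is for a path
-- through the mutated vertex, and then it is the product of the two weights with that sign. Hence
-- it is symmetric and odd, which is what keeps `mutate` skew-symmetric and involutive.
bump : ℤ → ℤ → ℤ
bump x y = sgn x ℤ.* [ x ℤ.* y ]₊

bump-pp : ∀ a b → bump (+ a) (+ b) ≡ + (a ℕ.* b)
bump-pp zero    b = refl
bump-pp (suc a) b =
  trans (ℤₚ.*-identityˡ [ + suc a ℤ.* + b ]₊)
    (trans (cong [_]₊ (sym (ℤₚ.pos-* (suc a) b))) (cong +_ (ℕₚ.⊔-identityʳ (suc a ℕ.* b))))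

bump-pn : ∀ a b → bump (+ a) (- (+ b)) ≡ + 0
bump-pn zero    b       = refl
bump-pn (suc a) zero    = trans (cong (λ x → + 1 ℤ.* [ x ]₊) (ℤₚ.*-zeroʳ (+ suc a))) refl
bump-pn (suc a) (suc b) = refl

bump-nn : ∀ a b → bump (- (+ a)) (- (+ b)) ≡ - (+ (a ℕ.* b))
bump-nn zero    b       = refl
bump-nn (suc a) zero    rewrite ℕₚ.*-zeroʳ a = refl
bump-nn (suc a) (suc b) = cong (λ x → - (+ suc x)) (ℕₚ.+-identityʳ _)

bump-np : ∀ a b → bump (- (+ a)) (+ b) ≡ + 0
bump-np zero    b       = refl
bump-np (suc a) zero    rewrite ℕₚ.*-zeroʳ a = refl
bump-np (suc a) (suc b) = refl

bump-comm : ∀ x y → bump x y ≡ bump y x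
bump-comm x y with signed x | signed y
... | pos a | pos b = trans (bump-pp a b) (trans (cong +_ (ℕₚ.*-comm a b)) (sym (bump-pp b a)))
... | pos a | neg b = trans (bump-pn a b) (sym (bump-np b a))
... | neg a | pos b = trans (bump-np a b) (sym (bump-pn b a))
... | neg a | neg b = trans (bump-nn a b) (trans (cong (λ x → - (+ x)) (ℕₚ.*-comm a b)) (sym (bump-nn b a)))

bump-neg : ∀ x y → bump (- x) (- y) ≡ - bump x y
bump-neg x y with signed x | signed y
... | pos a | pos b = trans (bump-nn a b) (cong -_ (sym (bump-pp a b)))
... | pos a | neg b rewrite ℤₚ.neg-involutive (+ b) = trans (bump-np a b) (cong -_ (sym (bump-pn a b)))
... | neg a | pos b rewrite ℤₚ.neg-involutive (+ a) = trans (bump-pn a b) (cong -_ (sym (bump-np a b)))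
... | neg a | neg b rewrite ℤₚ.neg-involutive (+ a) | ℤₚ.neg-involutive (+ b) =
  trans (bump-pp a b) (trans (sym (ℤₚ.neg-involutive (+ (a ℕ.* b)))) (cong -_ (sym (bump-nn a b))))

bump-zeroʳ : ∀ x → bump x (+ 0) ≡ + 0
bump-zeroʳ x = bump-comm x (+ 0)

module _ {n : ℕ} (k : Fin n) (B : Mat n) where

  mutate-row : ∀ j → mutate k B k j ≡ - B k j
  mutate-row j with k ≟ k | j ≟ k
  ... | yes _ | _ = refl
  ... | no ¬p | _ = contradiction refl ¬p

  mutate-col : ∀ i → mutate k B i k ≡ - B i k
  mutate-col i with i ≟ k | k ≟ k
  ... | yes _ | _     = refl
  ... | no _  | yes _ = refl
  ... | no _  | no ¬p = contradiction refl ¬p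

  mutate-off : ∀ {i j} → i ≢ k → j ≢ k → mutate k B i j ≡ B i j ℤ.+ bump (B i k) (B k j)
  mutate-off {i} {j} i≢k j≢k with i ≟ k | j ≟ k
  ... | yes p | _     = contradiction p i≢k
  ... | no _  | yes p = contradiction p j≢k
  ... | no _  | no _  = refl

  -- The case analysis on row, column and remaining positions, done once for all later proofs.
  mutate-elim : (P : Fin n → Fin n → ℤ → Set) → (∀ j → P k j (- B k j)) → (∀ i → P i k (- B i k)) →
                (∀ i j → i ≢ k → j ≢ k → P i j (B i j ℤ.+ bump (B i k) (B k j))) →
                ∀ i j → P i j (mutate k B i j)
  mutate-elim P row col off i j with i ≟ k | j ≟ k
  ... | yes refl | _        = row j
  ... | no _     | yes refl = col i
  ... | no i≢k   | no j≢k   = off i j i≢k j≢k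

infix 4 _≈_
_≈_ : ∀ {n} → Mat n → Mat n → Set
B ≈ C = ∀ i j → B i j ≡ C i j

negate : ∀ {n} → Mat n → Mat n
negate B i j = - B i j

≈-sym : ∀ {n} {B C : Mat n} → B ≈ C → C ≈ B
≈-sym e i j = sym (e i j)

≈-trans : ∀ {n} {B C D : Mat n} → B ≈ C → C ≈ D → B ≈ D
≈-trans e f i j = trans (e i j) (f i j)

mutate-cong : ∀ {n} (k : Fin n) {B C : Mat n} → B ≈ C → mutate k B ≈ mutate k C
mutate-cong k {B} {C} e = mutate-elim k B (λ i j x → x ≡ mutate k C i j)
  (λ j → trans (cong -_ (e k j)) (sym (mutate-row k C j)))
  (λ i → trans (cong -_ (e i k)) (sym (mutate-col k C i)))
  (λ i j i≢k j≢k → trans (cong₂ ℤ._+_ (e i j) (cong₂ bump (e i k) (e k j))) (sym (mutate-off k C i≢k j≢k)))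

mutate-involutive : ∀ {n} (k : Fin n) (B : Mat n) → mutate k (mutate k B) ≈ B
mutate-involutive k B = mutate-elim k (mutate k B) (λ i j x → x ≡ B i j)
  (λ j → trans (cong -_ (mutate-row k B j)) (ℤₚ.neg-involutive _))
  (λ i → trans (cong -_ (mutate-col k B i)) (ℤₚ.neg-involutive _))
  (λ i j i≢k j≢k → trans (cong₂ ℤ._+_ (mutate-off k B i≢k j≢k)
                              (trans (cong₂ bump (mutate-col k B i) (mutate-row k B j)) (bump-neg (B i k) (B k j))))
                      (trans (ℤₚ.+-assoc (B i j) _ _)
                        (trans (cong (λ x → B i j ℤ.+ x) (ℤₚ.+-inverseʳ (bump (B i k) (B k j)))) (ℤₚ.+-identityʳ (B i j)))))

mutate-negate : ∀ {n} (k : Fin n) (B : Mat n) → negate (mutate k B) ≈ mutate k (negate B)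
mutate-negate k B = mutate-elim k B (λ i j x → - x ≡ mutate k (negate B) i j)
  (λ j → sym (mutate-row k (negate B) j))
  (λ i → sym (mutate-col k (negate B) i))
  (λ i j i≢k j≢k → trans (ℤₚ.neg-distrib-+ (B i j) _)
     (trans (cong (λ x → - B i j ℤ.+ x) (sym (bump-neg (B i k) (B k j)))) (sym (mutate-off k (negate B) i≢k j≢k))))

mutate-skew : ∀ {n} (k : Fin n) {B : Mat n} → SkewSym B → SkewSym (mutate k B)
mutate-skew k {B} sk = mutate-elim k B (λ i j x → mutate k B j i ≡ - x)
  (λ j → trans (mutate-col k B j) (cong -_ (sk k j)))
  (λ i → trans (mutate-row k B i) (cong -_ (sk i k)))
  (λ i j i≢k j≢k → trans (mutate-off k B j≢k i≢k)
     (trans (cong₂ ℤ._+_ (sk i j)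
        (trans (cong₂ bump (sk k j) (sk i k)) (trans (bump-neg (B k j) (B i k)) (cong -_ (bump-comm (B k j) (B i k))))))
        (sym (ℤₚ.neg-distrib-+ (B i j) _))))

negate-skew : ∀ {n} {B : Mat n} → SkewSym B → SkewSym (negate B)
negate-skew sk i j = cong -_ (sk i j)

skew-diagonal : ∀ {n} {B : Mat n} → SkewSym B → ∀ i → B i i ≡ + 0
skew-diagonal {B = B} sk i with B i i | sk i i
... | + zero   | _  = refl
... | +[1+ _ ] | ()
... | -[1+ _ ] | ()

MutEq-refl : ∀ {n} {B : Mat n} → MutEq B B
MutEq-refl = base λ _ _ → refl

MutEq-mutate : ∀ {n} (k : Fin n) (B : Mat n) → MutEq B (mutate k B)
MutEq-mutate k B = mut k λ _ _ → refl

MutEq-negate : ∀ {n} {B C : Mat n} → MutEq B C → MutEq (negate B) (negate C)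
MutEq-negate (base e)     = base λ i j → cong -_ (e i j)
MutEq-negate (sym' p)     = sym' (MutEq-negate p)
MutEq-negate (trans' p q) = trans' (MutEq-negate p) (MutEq-negate q)
MutEq-negate {B = B} (mut k e) = mut k λ i j → trans (cong -_ (e i j)) (mutate-negate k B i j)
MutEq-negate (iso σ e)    = iso σ λ i j → cong -_ (e i j)

finite-mutEq : ∀ {n} {B C : Mat n} → MutEq B C → FiniteMutationType B → FiniteMutationType C
finite-mutEq p (L , all) = L , λ D q → all D (trans' p q)

finite-mutate : ∀ {n} {B : Mat n} k → FiniteMutationType B → FiniteMutationType (mutate k B)
finite-mutate {B = B} k = finite-mutEq (MutEq-mutate k B)

negate-involutive : ∀ {n} (B : Mat n) → negate (negate B) ≈ B
negate-involutive B i j = ℤₚ.neg-involutive (B i j)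

-- Reversing all arrows commutes with mutation. This symmetry halves the sign cases in the estimates
-- of weights.
finite-negate : ∀ {n} {B : Mat n} → FiniteMutationType B → FiniteMutationType (negate B)
finite-negate {B = B} (L , all) = List.map negate L , λ C p → transport C L
  (all (negate C) (trans' (base (≈-sym (negate-involutive B))) (MutEq-negate p)))
  where
  transport : ∀ C L → Any (λ D → negate C ≈ D) L → Any (C ≈_) (List.map negate L)
  transport C (D ∷ L) (here e)  = here λ i j → trans (sym (ℤₚ.neg-involutive (C i j))) (cong -_ (e i j))
  transport C (D ∷ L) (there a) = there (transport C L a)

bounded-family : ∀ {m} (f : Fin m → ℕ) → ∃[ M ] (∀ i → f i ≤ M)
bounded-family {zero}  f = 0 , λ ()
bounded-family {suc m} f with bounded-family (f ∘ suc)
... | M , b = f zero ℕ.⊔ M , λ { zero → ℕₚ.m≤m⊔n (f zero) M ; (suc i) → ℕₚ.≤-trans (b i) (ℕₚ.m≤n⊔m (f zero) M) }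

bounded-matrix : ∀ {n} (D : Mat n) → ∃[ M ] (∀ i j → ℤ.∣ D i j ∣ ≤ M)
bounded-matrix D = let rows i = bounded-family (λ j → ℤ.∣ D i j ∣) ; M , b = bounded-family (proj₁ ∘ rows) in
  M , λ i j → ℕₚ.≤-trans (proj₂ (rows i) j) (b i)

bounded-list : ∀ {n} (L : List (Mat n)) → ∃[ M ] (∀ C → Any (C ≈_) L → ∀ i j → ℤ.∣ C i j ∣ ≤ M)
bounded-list []      = 0 , λ _ ()
bounded-list (D ∷ L) with bounded-matrix D | bounded-list L
... | M , b | N , c = M ℕ.⊔ N , λ
  { C (here e)  i j → ℕₚ.≤-trans (subst (λ x → ℤ.∣ x ∣ ≤ M) (sym (e i j)) (b i j)) (ℕₚ.m≤m⊔n M N)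
  ; C (there a) i j → ℕₚ.≤-trans (c C a i j) (ℕₚ.m≤n⊔m M N) }

-- The form in which finiteness gets contradicted: a single bound for the weights of the whole
-- class.
finite-bounded : ∀ {n} {B : Mat n} → FiniteMutationType B →
                 ∃[ M ] (∀ C → MutEq B C → ∀ i j → ℤ.∣ C i j ∣ ≤ M)
finite-bounded (L , all) with bounded-list L
... | M , b = M , λ C p → b C (all C p)

-- Weights in finite mutation type

-- An oriented triangle i → j → k → i (possibly without the edge k → i) whose
-- mutation at j yields such a triangle again, with strictly larger second weight.
record Growing {n} (B : Mat n) (y : ℕ) : Set where
  field
    {i j k}     : Fin n
    i≢j         : i ≢ j
    j≢k         : j ≢ k
    i≢k         : i ≢ k
    {x z}       : ℕ
    ij          : B i j ≡ + x
    jk          : B j k ≡ + y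
    ki          : B k i ≡ + z
    3≤x         : 3 ≤ x
    1≤y         : 1 ≤ y
    z≤y         : z ≤ y

flip-entry : ∀ {n} {B : Mat n} → SkewSym B → ∀ {i j a} → B i j ≡ a → B j i ≡ - a
flip-entry sk {i} {j} e = trans (sk i j) (cong -_ e)

mutate-from : ∀ {n} {B : Mat n} → SkewSym B → ∀ {k j a} → B k j ≡ a → mutate k B j k ≡ a
mutate-from {B = B} sk {k} {j} e =
  trans (mutate-col k B j) (trans (cong -_ (sk k j)) (trans (ℤₚ.neg-involutive _) e))

mutate-into : ∀ {n} {B : Mat n} → SkewSym B → ∀ {k i a} → B i k ≡ a → mutate k B k i ≡ a
mutate-into {B = B} sk {k} {i} e =
  trans (mutate-row k B i) (trans (cong -_ (sk i k)) (trans (ℤₚ.neg-involutive _) e))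

mutate-at : ∀ {n} (B : Mat n) {i j k a b c} → i ≢ k → j ≢ k → B i j ≡ a → B i k ≡ b → B k j ≡ c →
            mutate k B i j ≡ a ℤ.+ bump b c
mutate-at B i≢k j≢k refl refl refl = mutate-off _ B i≢k j≢k

-⊕⊖ : ∀ z {m} → z ≤ m → - (+ z) ℤ.+ (+ m) ≡ + (m ℕ.∸ z)
-⊕⊖ z {m} z≤m = trans (ℤₚ.+-comm (- (+ z)) (+ m)) (trans (ℤₚ.m-n≡m⊖n m z) (ℤₚ.⊖-≥ z≤m))

-- The mutated vertex alternates between the two ends of the edge of weight `x`. The new weight is
-- `x * y - z`, at least `3 * y - y` and so larger than `y`, while the old `y` takes the place of
-- `z`.
growing-step : ∀ {n} {B : Mat n} {y} → SkewSym B → Growing B y →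
               ∃[ C ] ∃[ y' ] MutEq B C × SkewSym C × Growing C y' × y ℕ.< y'
growing-step {B = B} {y} sk g = mutate j B , x ℕ.* y ℕ.∸ z , MutEq-mutate j B , mutate-skew j sk , record
  { i≢j = i≢j ∘ sym ; j≢k = i≢k ; i≢k = j≢k
  ; ij = mutate-into sk ij
  ; jk = trans (mutate-at B i≢j (j≢k ∘ sym) (flip-entry sk ki) ij jk)
           (trans (cong (λ w → - (+ z) ℤ.+ w) (bump-pp x y)) (-⊕⊖ z (ℕₚ.≤-trans z≤y y≤xy)))
  ; ki = mutate-from sk jk
  ; 3≤x = 3≤x ; 1≤y = ℕₚ.≤-trans 1≤y (ℕₚ.<⇒≤ larger) ; z≤y = ℕₚ.<⇒≤ larger } , larger
  where
  open Growing g
  3y≤xy : y ℕ.+ (y ℕ.+ y) ≤ x ℕ.* y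
  3y≤xy = ℕₚ.≤-trans (ℕₚ.≤-reflexive (cong (λ w → y ℕ.+ (y ℕ.+ w)) (sym (ℕₚ.+-identityʳ y)))) (ℕₚ.*-monoˡ-≤ y 3≤x)
  y≤xy : y ≤ x ℕ.* y
  y≤xy = ℕₚ.≤-trans (ℕₚ.m≤m+n y (y ℕ.+ y)) 3y≤xy
  larger : y ℕ.< x ℕ.* y ℕ.∸ z
  larger = ℕₚ.≤-trans (ℕₚ.+-monoˡ-≤ y 1≤y)
    (ℕₚ.≤-trans (ℕₚ.≤-reflexive (sym (ℕₚ.m+n∸m≡n y (y ℕ.+ y)))) (ℕₚ.∸-mono 3y≤xy z≤y))

by-sign : ∀ x → (∃[ a ] x ≡ + a) ⊎ (∃[ a ] x ≡ - (+ a))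
by-sign (+ a)    = inj₁ (a , refl)
by-sign -[1+ a ] = inj₂ (suc a , refl)

∣-+∣ : ∀ {x a} → x ≡ - (+ a) → ℤ.∣ x ∣ ≡ a
∣-+∣ {a = a} e = trans (cong ℤ.∣_∣ e) (ℤₚ.∣-i∣≡∣i∣ (+ a))

∣∣-positive : ∀ {x a} → ℤ.∣ x ∣ ≡ a → x ≢ + 0 → 1 ≤ a
∣∣-positive {a = zero}  e x≢0 = contradiction (ℤₚ.∣i∣≡0⇒i≡0 e) x≢0
∣∣-positive {a = suc a} e x≢0 = s≤s z≤n

one-positive : ∀ {x y a b} → ℤ.∣ x ∣ ≡ a → ℤ.∣ y ∣ ≡ b → x ≢ + 0 ⊎ y ≢ + 0 → 1 ≤ a ℕ.+ b
one-positive {a = a} {b} p q (inj₁ h) = ℕₚ.≤-trans (∣∣-positive p h) (ℕₚ.m≤m+n a b)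
one-positive {a = a} {b} p q (inj₂ h) = ℕₚ.≤-trans (∣∣-positive q h) (ℕₚ.m≤n+m b a)

max-positive : ∀ {y z} → 1 ≤ y ℕ.+ z → z ≤ y → 1 ≤ y
max-positive {suc _} _ _   = s≤s z≤n
max-positive {zero}  p z≤y = ℕₚ.≤-trans p z≤y

growing-iterate : ∀ {n} (m : ℕ) {B : Mat n} {y} → SkewSym B → Growing B y →
                  ∃[ C ] ∃[ y' ] MutEq B C × SkewSym C × Growing C y' × m ≤ y'
growing-iterate zero    sk g = _ , _ , MutEq-refl , sk , g , z≤n
growing-iterate (suc m) sk g with growing-iterate m sk g
... | C , y' , p , skC , h , m≤y' with growing-step skC h
...   | D , y'' , q , skD , h' , lt = D , y'' , trans' p q , skD , h' , ℕₚ.≤-trans (s≤s m≤y') lt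

not-growing : ∀ {n} {B : Mat n} {y} → SkewSym B → FiniteMutationType B → ¬ Growing B y
not-growing sk fin g with finite-bounded fin
... | M , b with growing-iterate (suc M) sk g
...   | C , y' , p , _ , h , M<y' =
  ℕₚ.<-irrefl refl (ℕₚ.≤-trans M<y' (subst (_≤ M) (cong ℤ.∣_∣ (Growing.jk h)) (b C p (Growing.j h) (Growing.k h))))

module _ {n : ℕ} where

  -- The larger of the two other weights has to be the growing one. If that is `z`, reversing all
  -- arrows exchanges the parts of `y` and `z`.
  no-large-pp : ∀ {i j k : Fin n} → i ≢ j → j ≢ k → i ≢ k → ∀ {B : Mat n} {x y z} → SkewSym B → FiniteMutationType B → 3 ≤ x →
                B i j ≡ + x → B j k ≡ + y → B k i ≡ + z → 1 ≤ y ℕ.+ z → ⊥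
  no-large-pp {i} {j} {k} i≢j j≢k i≢k {B} {x} {y} {z} sk fin 3≤x ij jk ki 1≤y+z with z ℕ.≤? y
  ... | yes z≤y = not-growing {y = y} sk fin (record
        { i≢j = i≢j ; j≢k = j≢k ; i≢k = i≢k ; ij = ij ; jk = jk ; ki = ki ; 3≤x = 3≤x
        ; 1≤y = max-positive 1≤y+z z≤y ; z≤y = z≤y })
  ... | no z≰y = not-growing {y = z} (negate-skew sk) (finite-negate fin) (record
        { i≢j = i≢j ∘ sym ; j≢k = i≢k ; i≢k = j≢k
        ; ij = trans (cong -_ (flip-entry sk ij)) (ℤₚ.neg-involutive _)
        ; jk = trans (cong -_ (flip-entry sk ki)) (ℤₚ.neg-involutive _)
        ; ki = trans (cong -_ (flip-entry sk jk)) (ℤₚ.neg-involutive _)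
        ; 3≤x = 3≤x ; 1≤y = ℕₚ.≤-trans (s≤s z≤n) (ℕₚ.≰⇒> z≰y) ; z≤y = ℕₚ.<⇒≤ (ℕₚ.≰⇒> z≰y) })

  -- The path `i → j → k` runs parallel to `i → k`; mutating at `j` adds `x * y` to the latter and
  -- makes the triangle oriented. If `j` and `k` are not adjacent, mutating at `k` only reverses the
  -- edge between `i` and `k`, which also orients the configuration.
  no-large-pn : ∀ {i j k : Fin n} → i ≢ j → j ≢ k → i ≢ k → ∀ {B : Mat n} {x y z} →
                SkewSym B → FiniteMutationType B → 3 ≤ x →
                B i j ≡ + x → B j k ≡ + y → B k i ≡ - (+ z) → 1 ≤ y ℕ.+ z → ⊥
  no-large-pn {i} {j} {k} i≢j j≢k i≢k {B} {x} {suc y} {z} sk fin 3≤x ij jk ki 1≤y+z =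
    no-large-pp (i≢j ∘ sym) i≢k j≢k (mutate-skew j sk) (finite-mutate j fin) 3≤x
      (mutate-into sk ij)
      (trans (mutate-at B i≢j (j≢k ∘ sym) (trans (flip-entry sk ki) (ℤₚ.neg-involutive (+ z))) ij jk)
             (cong (λ w → + z ℤ.+ w) (bump-pp x (suc y))))
      (mutate-from sk jk)
      (ℕₚ.≤-trans (s≤s z≤n) (ℕₚ.m≤n+m (suc y) _))
  no-large-pn {i} {j} {k} i≢j j≢k i≢k {B} {x} {zero} {z} sk fin 3≤x ij jk ki 1≤y+z =
    no-large-pp i≢j j≢k i≢k (mutate-skew k sk) (finite-mutate k fin) 3≤x
      (trans (mutate-at B i≢k j≢k ij refl (flip-entry sk jk)) (trans (cong (λ w → + x ℤ.+ w) (bump-zeroʳ (B i k))) (ℤₚ.+-identityʳ (+ x))))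
      (trans (mutate-col k B j) (cong -_ jk))
      (trans (mutate-row k B i) (trans (cong -_ ki) (ℤₚ.neg-involutive (+ z))))
      1≤y+z

  -- Here the path `i → k → j` runs parallel to the heavy edge, so that mutating at `k` makes this
  -- edge heavier still and orients the triangle.
  no-large-nn : ∀ {i j k : Fin n} → i ≢ j → j ≢ k → i ≢ k → ∀ {B : Mat n} {x y z} →
                SkewSym B → FiniteMutationType B → 3 ≤ x →
                B i j ≡ + x → B j k ≡ - (+ y) → B k i ≡ - (+ z) → 1 ≤ y ℕ.+ z → ⊥
  no-large-nn {i} {j} {k} i≢j j≢k i≢k {B} {x} {y} {z} sk fin 3≤x ij jk ki 1≤y+z =
    no-large-pp i≢j j≢k i≢k (mutate-skew k sk) (finite-mutate k fin) (ℕₚ.≤-trans 3≤x (ℕₚ.m≤m+n x (z ℕ.* y)))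
      (trans (mutate-at B i≢k j≢k ij (trans (flip-entry sk ki) (ℤₚ.neg-involutive (+ z)))
                        (trans (flip-entry sk jk) (ℤₚ.neg-involutive (+ y))))
             (cong (λ w → + x ℤ.+ w) (bump-pp z y)))
      (trans (mutate-col k B j) (trans (cong -_ jk) (ℤₚ.neg-involutive (+ y))))
      (trans (mutate-row k B i) (trans (cong -_ ki) (ℤₚ.neg-involutive (+ z))))
      1≤y+z

  no-large-np : ∀ {i j k : Fin n} → i ≢ j → j ≢ k → i ≢ k → ∀ {B : Mat n} {x y z} →
                SkewSym B → FiniteMutationType B → 3 ≤ x →
                B i j ≡ + x → B j k ≡ - (+ y) → B k i ≡ + z → 1 ≤ y ℕ.+ z → ⊥
  no-large-np i≢j j≢k i≢k {y = y} {z} sk fin 3≤x ij jk ki 1≤y+z =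
    no-large-pn (i≢j ∘ sym) i≢k j≢k (negate-skew sk) (finite-negate fin) 3≤x
      (trans (cong -_ (flip-entry sk ij)) (ℤₚ.neg-involutive _))
      (trans (cong -_ (flip-entry sk ki)) (ℤₚ.neg-involutive _))
      (cong -_ (trans (flip-entry sk jk) (ℤₚ.neg-involutive _)))
      (subst (1 ≤_) (ℕₚ.+-comm y z) 1≤y+z)

  no-large : ∀ {i j k : Fin n} → i ≢ j → j ≢ k → i ≢ k → ∀ {B : Mat n} {x} →
             SkewSym B → FiniteMutationType B → 3 ≤ x → B i j ≡ + x → B j k ≢ + 0 ⊎ B k i ≢ + 0 → ⊥
  no-large {i} {j} {k} i≢j j≢k i≢k {B} sk fin 3≤x ij adj with by-sign (B j k) | by-sign (B k i)
  ... | inj₁ (y , p) | inj₁ (z , q) = no-large-pp i≢j j≢k i≢k sk fin 3≤x ij p q (one-positive (cong ℤ.∣_∣ p) (cong ℤ.∣_∣ q) adj)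
  ... | inj₁ (y , p) | inj₂ (z , q) = no-large-pn i≢j j≢k i≢k sk fin 3≤x ij p q (one-positive (cong ℤ.∣_∣ p) (∣-+∣ q) adj)
  ... | inj₂ (y , p) | inj₁ (z , q) = no-large-np i≢j j≢k i≢k sk fin 3≤x ij p q (one-positive (∣-+∣ p) (cong ℤ.∣_∣ q) adj)
  ... | inj₂ (y , p) | inj₂ (z , q) = no-large-nn i≢j j≢k i≢k sk fin 3≤x ij p q (one-positive (∣-+∣ p) (∣-+∣ q) adj)

  weight≤2 : ∀ {i j k : Fin n} → i ≢ j → j ≢ k → i ≢ k → ∀ {B : Mat n} →
             SkewSym B → FiniteMutationType B → B j k ≢ + 0 ⊎ B k i ≢ + 0 → ℤ.∣ B i j ∣ ≤ 2
  weight≤2 {i} {j} {k} i≢j j≢k i≢k {B} sk fin adj with ℤ.∣ B i j ∣ ℕ.≤? 2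
  ... | yes le = le
  ... | no ¬le with by-sign (B i j)
  ...   | inj₁ (x , p) = ⊥-elim (no-large i≢j j≢k i≢k sk fin (subst (3 ≤_) (cong ℤ.∣_∣ p) (ℕₚ.≰⇒> ¬le)) p adj)
  ...   | inj₂ (x , p) = ⊥-elim (no-large (i≢j ∘ sym) i≢k j≢k sk fin
            (subst (3 ≤_) (∣-+∣ p) (ℕₚ.≰⇒> ¬le)) (trans (flip-entry sk p) (ℤₚ.neg-involutive (+ x)))
            ([ (λ h → inj₂ (λ e → h (flip-entry sk e))) , (λ h → inj₁ (λ e → h (flip-entry sk e))) ]′ adj))

  double-step : ∀ {i j k : Fin n} → i ≢ j → j ≢ k → ∀ {B : Mat n} {y z} → SkewSym B →
                B i j ≡ + 2 → B j k ≡ + y → B k i ≡ + z → z ≤ y →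
                (mutate j B j i ≡ + 2) × (mutate j B i k ≡ + (2 ℕ.* y ℕ.∸ z)) × (mutate j B k j ≡ + y)
  double-step i≢j j≢k {B} {y} {z} sk ij jk ki z≤y =
    mutate-into sk ij ,
    trans (mutate-at B i≢j (j≢k ∘ sym) (flip-entry sk ki) ij jk)
      (trans (cong (λ w → - (+ z) ℤ.+ w) (bump-pp 2 y)) (-⊕⊖ z (ℕₚ.≤-trans z≤y (ℕₚ.m≤m+n y _)))) ,
    mutate-from sk jk

  doubling-grows : ∀ {y z} → z ℕ.< y → y ℕ.< 2 ℕ.* y ℕ.∸ z
  doubling-grows {y} {z} z<y = ℕₚ.≤-trans (ℕₚ.≤-reflexive (sym (ℕₚ.m+n∸n≡m (suc y) z)))
    (ℕₚ.∸-monoˡ-≤ z (ℕₚ.≤-trans (ℕₚ.≤-reflexive (sym (ℕₚ.+-suc y z)))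
      (ℕₚ.+-monoʳ-≤ y (ℕₚ.≤-trans z<y (ℕₚ.≤-reflexive (sym (ℕₚ.+-identityʳ y)))))))

  -- With an edge of weight 2 the alternating mutations send `(y , z)` to `(2 * y - z , y)`, which
  -- grows exactly as long as `z < y`. As `y` is at least 1, two steps reach a weight of at least 3
  -- in a triangle.
  double-pp< : ∀ {i j k : Fin n} → i ≢ j → j ≢ k → i ≢ k → ∀ {B : Mat n} {y z} →
               SkewSym B → FiniteMutationType B → B i j ≡ + 2 → B j k ≡ + y → B k i ≡ + z → z ℕ.< y → ⊥
  double-pp< {i} {j} {k} i≢j j≢k i≢k {B} {y} {z} sk fin ij jk ki z<y
    with double-step i≢j j≢k sk ij jk ki (ℕₚ.<⇒≤ z<y)
  ... | ji , ik , kj with double-step (i≢j ∘ sym) i≢k (mutate-skew j sk) ji ik kj (ℕₚ.<⇒≤ (doubling-grows z<y))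
  ...   | ij' , jk' , ki' =
    no-large j≢k (i≢k ∘ sym) (i≢j ∘ sym) (mutate-skew i (mutate-skew j sk)) (finite-mutate i (finite-mutate j fin))
      (ℕₚ.≤-trans (s≤s (ℕₚ.≤-trans (s≤s (ℕₚ.≤-trans (s≤s z≤n) z<y)) (doubling-grows z<y))) (doubling-grows (doubling-grows z<y)))
      jk' (inj₁ (λ e → ℕₚ.<-irrefl (sym (ℤₚ.+-injective (trans (sym ki') e))) (ℕₚ.≤-trans (s≤s z≤n) (doubling-grows z<y))))

  double-pp : ∀ {i j k : Fin n} → i ≢ j → j ≢ k → i ≢ k → ∀ {B : Mat n} {y z} →
              SkewSym B → FiniteMutationType B → B i j ≡ + 2 → B j k ≡ + y → B k i ≡ + z → y ≡ z
  double-pp {i} {j} {k} i≢j j≢k i≢k {B} {y} {z} sk fin ij jk ki with ℕₚ.<-cmp y z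
  ... | tri≈ _ e _ = e
  ... | tri> _ _ z<y = ⊥-elim (double-pp< i≢j j≢k i≢k sk fin ij jk ki z<y)
  ... | tri< y<z _ _ = ⊥-elim (double-pp< (i≢j ∘ sym) i≢k j≢k (negate-skew sk) (finite-negate fin)
          (trans (cong -_ (flip-entry sk ij)) (ℤₚ.neg-involutive _))
          (trans (cong -_ (flip-entry sk ki)) (ℤₚ.neg-involutive _))
          (trans (cong -_ (flip-entry sk jk)) (ℤₚ.neg-involutive _)) y<z)

  -- For `y = 0` mutating at `k` reverses its edge to `i` and gives unequal weights 0 and `suc z` in
  -- the oriented case. For positive `y` mutating at `j` produces an edge from `i` to `k` of weight
  -- at least 3.
  double-pn : ∀ {i j k : Fin n} → i ≢ j → j ≢ k → i ≢ k → ∀ {B : Mat n} {y z} →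
              SkewSym B → FiniteMutationType B → B i j ≡ + 2 → B j k ≡ + y → B k i ≢ - (+ suc z)
  double-pn {i} {j} {k} i≢j j≢k i≢k {B} {zero} {z} sk fin ij jk ki
    with double-pp i≢j j≢k i≢k (mutate-skew k sk) (finite-mutate k fin)
      (trans (mutate-at B i≢k j≢k ij refl (flip-entry sk jk)) (trans (cong (λ w → + 2 ℤ.+ w) (bump-zeroʳ (B i k))) refl))
      (trans (mutate-col k B j) (cong -_ jk))
      (trans (mutate-row k B i) (cong -_ ki))
  ... | ()
  double-pn {i} {j} {k} i≢j j≢k i≢k {B} {suc y} {z} sk fin ij jk ki =
    no-large i≢k (j≢k ∘ sym) i≢j {x = suc z ℕ.+ 2 ℕ.* suc y} (mutate-skew j sk) (finite-mutate j fin)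
      (s≤s (ℕₚ.≤-trans (s≤s (ℕₚ.≤-trans (s≤s z≤n) (ℕₚ.m≤n+m (suc (y ℕ.+ 0)) y))) (ℕₚ.m≤n+m (2 ℕ.* suc y) z)))
      (trans (mutate-at B i≢j (j≢k ∘ sym) (flip-entry sk ki) ij jk) (cong (λ w → + suc z ℤ.+ w) (bump-pp 2 (suc y))))
      (inj₁ (λ e → case trans (sym (mutate-from sk jk)) e of λ ()))

  double-np : ∀ {i j k : Fin n} → i ≢ j → j ≢ k → i ≢ k → ∀ {B : Mat n} {y z} →
              SkewSym B → FiniteMutationType B → B i j ≡ + 2 → B k i ≡ + z → B j k ≢ - (+ suc y)
  double-np i≢j j≢k i≢k sk fin ij ki jk =
    double-pn (i≢j ∘ sym) i≢k j≢k (negate-skew sk) (finite-negate fin)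
      (trans (cong -_ (flip-entry sk ij)) (ℤₚ.neg-involutive _))
      (trans (cong -_ (flip-entry sk ki)) (ℤₚ.neg-involutive _))
      (cong -_ (flip-entry sk jk))

  double-nn : ∀ {i j k : Fin n} → i ≢ j → j ≢ k → i ≢ k → ∀ {B : Mat n} {y z} →
              SkewSym B → FiniteMutationType B → B i j ≡ + 2 → B j k ≡ - (+ suc y) → B k i ≢ - (+ suc z)
  double-nn {i} {j} {k} i≢j j≢k i≢k {B} {y} {z} sk fin ij jk ki =
    no-large i≢j j≢k i≢k {x = 2 ℕ.+ suc z ℕ.* suc y} (mutate-skew k sk) (finite-mutate k fin)
      (s≤s (s≤s (s≤s z≤n)))
      (trans (mutate-at B i≢k j≢k ij (flip-entry sk ki) (flip-entry sk jk)) (cong (λ w → + 2 ℤ.+ w) (bump-pp (suc z) (suc y))))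
      (inj₁ (λ e → case trans (sym (trans (mutate-col k B j) (cong -_ jk))) e of λ ()))

  double⁺ : ∀ {i j k : Fin n} → i ≢ j → j ≢ k → i ≢ k → ∀ {B : Mat n} →
            SkewSym B → FiniteMutationType B → B i j ≡ + 2 → B j k ≡ B k i
  double⁺ {i} {j} {k} i≢j j≢k i≢k {B} sk fin ij with B j k in jk | B k i in ki
  ... | + y      | + z      = cong +_ (double-pp i≢j j≢k i≢k sk fin ij jk ki)
  ... | + y      | -[1+ z ] = ⊥-elim (double-pn i≢j j≢k i≢k sk fin ij jk ki)
  ... | -[1+ y ] | + z      = ⊥-elim (double-np i≢j j≢k i≢k sk fin ij ki jk)
  ... | -[1+ y ] | -[1+ z ] = ⊥-elim (double-nn i≢j j≢k i≢k sk fin ij jk ki)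

  double : ∀ {i j k : Fin n} → i ≢ j → j ≢ k → i ≢ k → ∀ {B : Mat n} →
           SkewSym B → FiniteMutationType B → ℤ.∣ B i j ∣ ≡ 2 → B j k ≡ B k i
  double {i} {j} {k} i≢j j≢k i≢k {B} sk fin e with by-sign (B i j)
  ... | inj₁ (x , p) = double⁺ i≢j j≢k i≢k sk fin (trans p (cong +_ (trans (sym (cong ℤ.∣_∣ p)) e)))
  ... | inj₂ (x , p) = trans (sk k j) (trans (cong -_ (sym (double⁺ (i≢j ∘ sym) i≢k j≢k sk fin ji))) (sym (sk i k)))
    where
    ji : B j i ≡ + 2
    ji = trans (flip-entry sk p) (trans (ℤₚ.neg-involutive (+ x)) (cong +_ (trans (sym (∣-+∣ p)) e)))

mod2-neg : ∀ x → mod2 (- x) ≡ mod2 x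
mod2-neg x = cong oddℕ (ℤₚ.∣-i∣≡∣i∣ x)

oddℕ-+ : ∀ m n → oddℕ (m ℕ.+ n) ≡ oddℕ m xor oddℕ n
oddℕ-+ zero    n = refl
oddℕ-+ (suc m) n = trans (cong not (oddℕ-+ m n)) (Boolₚ.not-distribˡ-xor (oddℕ m) (oddℕ n))

mod2-⊖ : ∀ m n → mod2 (m ℤ.⊖ n) ≡ oddℕ m xor oddℕ n
mod2-⊖ zero    zero    = refl
mod2-⊖ zero    (suc n) = refl
mod2-⊖ (suc m) zero    = sym (Boolₚ.xor-identityʳ (oddℕ (suc m)))
mod2-⊖ (suc m) (suc n) = trans (cong mod2 (ℤₚ.[1+m]⊖[1+n]≡m⊖n m n))
  (trans (mod2-⊖ m n) (nots (oddℕ m) (oddℕ n)))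
  where
  nots : ∀ a b → a xor b ≡ not a xor not b
  nots true  b = refl
  nots false b = sym (Boolₚ.not-involutive b)

mod2-+ : ∀ x y → mod2 (x ℤ.+ y) ≡ mod2 x xor mod2 y
mod2-+ (+ a)    (+ b)    = oddℕ-+ a b
mod2-+ (+ a)    -[1+ b ] = mod2-⊖ a (suc b)
mod2-+ -[1+ a ] (+ b)    = trans (mod2-⊖ b (suc a)) (Boolₚ.xor-comm (oddℕ b) (oddℕ (suc a)))
mod2-+ -[1+ a ] -[1+ b ] = trans (cong oddℕ (cong suc (sym (ℕₚ.+-suc a b)))) (oddℕ-+ (suc a) (suc b))

mod2-skew : ∀ {n} {B : Mat n} → SkewSym B → ∀ i j → mod2 (B i j) ≡ mod2 (B j i)
mod2-skew {B = B} sk i j = trans (cong mod2 (sk j i)) (mod2-neg (B j i))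

two-vertices-sum : ∀ {n} {u : Vect n} {i j} → TwoVertices u i j → (f : Vect n) →
                   sum2 (λ k → f k ∧ u k) ≡ f i xor f j
two-vertices-sum {u = u} {i} {j} (i≢j , ⇔) f =
  trans (sum2-pair i j i≢j (λ k → f k ∧ u k) off)
        (cong₂ _xor_ (at i (Equivalence.from (⇔ i) (inj₁ refl))) (at j (Equivalence.from (⇔ j) (inj₂ refl))))
  where
  at : ∀ k → u k ≡ true → f k ∧ u k ≡ f k
  at k e = trans (cong (f k ∧_) e) (Boolₚ.∧-identityʳ (f k))
  off : ∀ k → k ≢ i → k ≢ j → f k ∧ u k ≡ false
  off k k≢i k≢j with u k in eq
  ... | false = Boolₚ.∧-zeroʳ (f k)
  ... | true  = ⊥-elim ([ k≢i , k≢j ]′ (Equivalence.to (⇔ k) eq))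

double-edge-even : ∀ {n} {B : Mat n} → SkewSym B → FiniteMutationType B → ∀ {i j} → i ≢ j → ℤ.∣ B i j ∣ ≡ 2 →
                   ∀ k → mod2 (B k i) xor mod2 (B k j) ≡ false
double-edge-even {B = B} sk fin {i} {j} i≢j e k with k ≟ i | k ≟ j
... | yes refl | _        = cong₂ (λ x m → mod2 x xor oddℕ m) (skew-diagonal {B = B} sk k) e
... | no _     | yes refl = cong₂ (λ m x → m xor mod2 x) (trans (mod2-skew sk k i) (cong oddℕ e)) (skew-diagonal {B = B} sk k)
... | no k≢i   | no k≢j   =
  trans (cong (_xor mod2 (B k j)) (trans (cong mod2 (sym (double i≢j (k≢j ∘ sym) (k≢i ∘ sym) sk fin e))) (mod2-skew sk j k)))
        (xor-self (mod2 (B k j)))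

double-edge-radical : ∀ {n} {B : Mat n} → SkewSym B → FiniteMutationType B → ∀ S → IsDoubleEdge B S → Radical B S
double-edge-radical {B = B} sk fin S (i , j , two , e) k =
  trans (two-vertices-sum two (λ l → mod2 (B k l))) (double-edge-even sk fin (proj₁ two) e k)

-- Non-oriented cycles

record Cyclic {n} (B : Mat n) (l : ℕ) (c : Fin (3 ℕ.+ l) → Fin n) : Set where
  constructor cyclic
  field
    injective : ∀ a b → c a ≡ c b → a ≡ b
    adjacency : ∀ a b → Adj B (c a) (c b) ⇔ (b ≡ next a ⊎ a ≡ next b)
open Cyclic public

-- Refers to the given labelling and its two directions only, whereas `¬ IsOrientedCycle` speaks of
-- all labellings. This version can be carried along when positions are shifted or removed.
Mixed : ∀ {n} → Mat n → (l : ℕ) → (Fin (3 ℕ.+ l) → Fin n) → Set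
Mixed B l c = ¬ (∀ a → + 0 ℤ.< B (c a) (c (next a))) × ¬ (∀ a → + 0 ℤ.< B (c (next a)) (c a))

-- Radicality of the characteristic vector of the cycle, written over positions so that a position
-- can be split off.
EvenRows : ∀ {n m} → Mat n → (Fin m → Fin n) → Set
EvenRows B c = ∀ k → sum2 (λ a → mod2 (B k (c a))) ≡ false

positive? : ∀ {x} → x ≢ + 0 → + 0 ℤ.< x ⊎ + 0 ℤ.< - x
positive? {+ zero}   h = contradiction refl h
positive? {+ suc a}  h = inj₁ (ℤ.+<+ (s≤s z≤n))
positive? { -[1+ a ]} h = inj₂ (ℤ.+<+ (s≤s z≤n))

positive-value : ∀ {x} → + 0 ℤ.< x → ∃[ a ] x ≡ + suc a
positive-value {+ suc a} _ = a , refl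
positive-value {+ zero} (ℤ.+<+ ())

positive-one : ∀ {x} → + 0 ℤ.< x → ℤ.∣ x ∣ ≡ 1 → x ≡ + 1
positive-one p e with positive-value p
... | a , refl = cong +_ e

not-both-positive : ∀ {x} → + 0 ℤ.< x → ¬ (+ 0 ℤ.< - x)
not-both-positive {+ suc a} _ ()
not-both-positive {+ zero} (ℤ.+<+ ()) _

module _ {n : ℕ} {B : Mat n} {l : ℕ} {c : Fin (3 ℕ.+ l) → Fin n} (cyc : Cyclic B l c) where

  cycle-distinct : ∀ {a b} → a ≢ b → c a ≢ c b
  cycle-distinct a≢b e = a≢b (injective cyc _ _ e)

  cycle-edge : ∀ a → B (c a) (c (next a)) ≢ + 0
  cycle-edge a = Equivalence.from (adjacency cyc a (next a)) (inj₁ refl)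

  cycle-nonedge : ∀ a b → b ≢ next a → a ≢ next b → B (c a) (c b) ≡ + 0
  cycle-nonedge a b p q with B (c a) (c b) ℤ.≟ + 0
  ... | yes e = e
  ... | no ne = ⊥-elim ([ p , q ]′ (Equivalence.to (adjacency cyc a b) ne))

  cyclic-next : Cyclic B l (c ∘ next)
  cyclic-next = cyclic (λ a b e → next-injective (injective cyc _ _ e)) λ a b → mk⇔
    (λ h → [ (λ e → inj₁ (next-injective e)) , (λ e → inj₂ (next-injective e)) ]′ (Equivalence.to (adjacency cyc _ _) h))
    (λ h → Equivalence.from (adjacency cyc _ _) ([ (λ e → inj₁ (cong next e)) , (λ e → inj₂ (cong next e)) ]′ h))

  mixed-next : Mixed B l c → Mixed B l (c ∘ next)
  mixed-next (f , g) =
    (λ h → f λ a → subst (λ x → + 0 ℤ.< B (c x) (c (next x))) (next-prev a) (h (prev a))) ,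
    (λ h → g λ a → subst (λ x → + 0 ℤ.< B (c (next x)) (c x)) (next-prev a) (h (prev a)))

  even-next : EvenRows B (c ∘ next) → EvenRows B c
  even-next h k = trans (sym (sum2-bijection next prev next-prev prev-next (λ a → mod2 (B k (c a))))) (h k)

  cyclic-negate : Cyclic (negate B) l c
  cyclic-negate = cyclic (injective cyc) λ a b → mk⇔
    (λ h → Equivalence.to (adjacency cyc a b) (λ e → h (cong -_ e)))
    (λ h e → Equivalence.from (adjacency cyc a b) h (trans (sym (ℤₚ.neg-involutive _)) (cong -_ e)))

module _ {n : ℕ} {B : Mat n} (sk : SkewSym B) {l : ℕ} {c : Fin (3 ℕ.+ l) → Fin n} where

  mixed-negate : Mixed B l c → Mixed (negate B) l c
  mixed-negate (f , g) =
    (λ h → g λ a → subst (+ 0 ℤ.<_) (sym (sk _ _)) (h a)) ,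
    (λ h → f λ a → subst (+ 0 ℤ.<_) (sym (sk _ _)) (h a))

  even-negate : EvenRows (negate B) c → EvenRows B c
  even-negate h k = trans (sum2-cong (λ a → sym (mod2-neg (B k (c a))))) (h k)

-- A double edge and the next vertex of the cycle would form a triangle by `double`, so that `c a`
-- would be adjacent to the vertex two steps ahead; in a cycle of length at least four that would be
-- a chord.
weight-one : ∀ {n} {B : Mat n} → SkewSym B → FiniteMutationType B → ∀ {l c} → Cyclic B (suc l) c →
             ∀ a → ℤ.∣ B (c a) (c (next a)) ∣ ≡ 1
weight-one {B = B} sk fin {l} {c} cyc a with ℤ.∣ B (c a) (c (next a)) ∣ in eq
... | 0 = contradiction (ℤₚ.∣i∣≡0⇒i≡0 eq) (cycle-edge cyc a)
... | 1 = refl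
... | 2 = ⊥-elim ([ (λ e → next³≢ a (sym e)) , (λ e → next≢ a (next-injective e)) ]′
            (Equivalence.to (adjacency cyc (next (next a)) a) (λ e → cycle-edge cyc (next a) (trans d e))))
  where
  d : B (c (next a)) (c (next (next a))) ≡ B (c (next (next a))) (c a)
  d = double (cycle-distinct cyc (next≢ a ∘ sym)) (cycle-distinct cyc (next≢ (next a) ∘ sym))
             (cycle-distinct cyc (next²≢ a ∘ sym)) sk fin eq
... | suc (suc (suc m)) = contradiction
  (subst (_≤ 2) eq (weight≤2 (cycle-distinct cyc (next≢ a ∘ sym)) (cycle-distinct cyc (next≢ (next a) ∘ sym))
    (cycle-distinct cyc (next²≢ a ∘ sym)) sk fin (inj₁ (cycle-edge cyc (next a)))))
  λ { (s≤s (s≤s ())) }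

-- Whatever the sign of `x`, exactly one of the two unit arrows continues the arrow of weight `x` to
-- a path.
bump-unit-parity : ∀ x → mod2 (bump x (+ 1)) xor mod2 (bump x (- (+ 1))) ≡ mod2 x
bump-unit-parity x with by-sign x
... | inj₁ (a , refl) rewrite bump-pp a 1 | bump-pn a 1 | ℕₚ.*-identityʳ a = Boolₚ.xor-identityʳ (oddℕ a)
... | inj₂ (a , refl) rewrite bump-np a 1 | bump-nn a 1 | ℕₚ.*-identityʳ a = refl

zero≢next : ∀ {l} {a : Fin (suc l)} → a ≢ fromℕ l → zero ≢ next (suc a)
zero≢next {a = a} h e = h (Finₚ.suc-injective (trans (sym (prev-next (suc a))) (cong prev (sym e))))

next-zero : ∀ {l} → next {suc l} zero ≡ suc zero
next-zero = next-inject₁ zero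

module Through {n : ℕ} {B : Mat n} (sk : SkewSym B) {l : ℕ} {c : Fin (3 ℕ.+ l) → Fin n} (cyc : Cyclic B l c) where

  last : Fin (2 ℕ.+ l)
  last = fromℕ (suc l)

  spoke-zero : ∀ a → a ≢ zero → a ≢ last → B (c zero) (c (suc a)) ≡ + 0
  spoke-zero a a≢0 a≢last = cycle-nonedge cyc zero (suc a)
    (λ e → a≢0 (Finₚ.suc-injective (trans e next-zero))) (zero≢next a≢last)

  module _ (in₁ : B (c (suc last)) (c zero) ≡ + 1) (out₁ : B (c zero) (c (suc zero)) ≡ + 1) where

    in₁′ : B (c zero) (c (suc last)) ≡ - (+ 1)
    in₁′ = flip-entry sk in₁

    -- Mutating at c zero adds the entry of k at c zero to those at its two neighbours.
    through-even : (∀ k → sum2 (λ a → mod2 (mutate (c zero) B k (c (suc a)))) ≡ false) → EvenRows B c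
    through-even h k with k ≟ c zero
    ... | yes refl = cong₂ (λ x s → mod2 x xor s) (skew-diagonal {B = B} sk k)
            (trans (sum2-pair zero last (λ ()) (λ a → mod2 (B k (c (suc a)))) (λ a p q → cong mod2 (spoke-zero a p q)))
                   (cong₂ (λ x y → mod2 x xor mod2 y) out₁ in₁′))
    ... | no k≢b = begin
        f zero xor sum2 (f ∘ suc)
          ≡⟨ cong (_xor sum2 (f ∘ suc)) (sym g-sum) ⟩
        sum2 g xor sum2 (f ∘ suc)
          ≡⟨ sym (sum2-xor g (f ∘ suc)) ⟩
        sum2 (λ a → g a xor f (suc a))
          ≡⟨ sum2-cong (λ a → trans (Boolₚ.xor-comm (g a) (f (suc a))) (sym (mutated a))) ⟩
        sum2 (λ a → mod2 (mutate (c zero) B k (c (suc a))))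
          ≡⟨ h k ⟩
        false ∎
      where
      open ≡-Reasoning
      f : Fin (3 ℕ.+ l) → Bool
      f a = mod2 (B k (c a))
      g : Fin (2 ℕ.+ l) → Bool
      g a = mod2 (bump (B k (c zero)) (B (c zero) (c (suc a))))
      mutated : ∀ a → mod2 (mutate (c zero) B k (c (suc a))) ≡ f (suc a) xor g a
      mutated a = trans (cong mod2 (mutate-off (c zero) B k≢b (cycle-distinct cyc λ ()))) (mod2-+ (B k (c (suc a))) _)
      g-sum : sum2 g ≡ f zero
      g-sum = trans (sum2-pair zero last (λ ()) g
                 (λ a p q → trans (cong (λ x → mod2 (bump (B k (c zero)) x)) (spoke-zero a p q)) (cong mod2 (bump-zeroʳ (B k (c zero))))))
        (trans (cong₂ (λ x y → mod2 (bump (B k (c zero)) x) xor mod2 (bump (B k (c zero)) y)) out₁ in₁′)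
               (bump-unit-parity (B k (c zero))))

-- Since the triangle is not oriented, its third edge runs from position two to position one,
-- parallel to the path through position zero. Mutating there adds the product of the two path
-- weights, and the bound 2 on the sum forces all three weights to be 1 and the sum to be exactly 2.
triangle-through : ∀ {n} {B : Mat n} → SkewSym B → FiniteMutationType B → ∀ {c} → Cyclic B 0 c → Mixed B 0 c →
                   + 0 ℤ.< B (c (suc (suc zero))) (c zero) → + 0 ℤ.< B (c zero) (c (suc zero)) → EvenRows B c
triangle-through {B = B} sk fin {c} cyc mix in⁺ out⁺ = Through.through-even sk cyc in₁ out₁ even
  where
  0≢1 : c zero ≢ c (suc zero)
  0≢1 = cycle-distinct cyc λ ()
  0≢2 : c zero ≢ c (suc (suc zero))
  0≢2 = cycle-distinct cyc λ ()
  2≢1 : c (suc (suc zero)) ≢ c (suc zero)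
  2≢1 = cycle-distinct cyc λ ()
  third⁺ : + 0 ℤ.< B (c (suc (suc zero))) (c (suc zero))
  third⁺ with positive? (cycle-edge cyc (suc zero))
  ... | inj₁ p = ⊥-elim (proj₁ mix λ { zero → out⁺ ; (suc zero) → p ; (suc (suc zero)) → in⁺ })
  ... | inj₂ p = subst (+ 0 ℤ.<_) (sym (sk _ _)) p
  -- The weights of the three edges, each diminished by one.
  x y w : ℕ
  x = proj₁ (positive-value in⁺)
  y = proj₁ (positive-value out⁺)
  w = proj₁ (positive-value third⁺)
  C : Mat _
  C = mutate (c zero) B
  doubled : C (c (suc (suc zero))) (c (suc zero)) ≡ + (suc w ℕ.+ suc x ℕ.* suc y)
  doubled = trans (mutate-at B (0≢2 ∘ sym) (0≢1 ∘ sym) (proj₂ (positive-value third⁺)) (proj₂ (positive-value in⁺)) (proj₂ (positive-value out⁺)))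
                  (cong (λ v → + suc w ℤ.+ v) (bump-pp (suc x) (suc y)))
  small : suc w ℕ.+ suc x ℕ.* suc y ≤ 2
  small = subst (_≤ 2) (cong ℤ.∣_∣ doubled)
    (weight≤2 2≢1 (0≢1 ∘ sym) (0≢2 ∘ sym) (mutate-skew (c zero) sk) (finite-mutate (c zero) fin)
      (inj₁ (λ e → case trans (sym (trans (mutate-from sk refl) (proj₂ (positive-value out⁺)))) e of λ ())))
  ones : ∀ w x y → suc w ℕ.+ suc x ℕ.* suc y ≤ 2 → w ≡ 0 × x ≡ 0 × y ≡ 0
  ones zero    zero    zero    _ = refl , refl , refl
  ones zero    zero    (suc y) (s≤s (s≤s ()))
  ones zero    (suc x) y       (s≤s (s≤s p)) = contradiction (subst (_≤ 0) (ℕₚ.+-suc y _) p) λ ()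
  ones (suc w) x       y       (s≤s (s≤s p)) = contradiction (subst (_≤ 0) (ℕₚ.+-suc w _) p) λ ()
  in₁ : B (c (suc (suc zero))) (c zero) ≡ + 1
  in₁ = trans (proj₂ (positive-value in⁺)) (cong (λ v → + suc v) (proj₁ (proj₂ (ones w x y small))))
  out₁ : B (c zero) (c (suc zero)) ≡ + 1
  out₁ = trans (proj₂ (positive-value out⁺)) (cong (λ v → + suc v) (proj₂ (proj₂ (ones w x y small))))
  two : ℤ.∣ C (c (suc (suc zero))) (c (suc zero)) ∣ ≡ 2
  two with ones w x y small
  ... | p , q , r = trans (cong ℤ.∣_∣ doubled) (cong₂ (λ a b → suc a ℕ.+ b) p (cong₂ (λ a b → suc a ℕ.* suc b) q r))
  even : ∀ k → sum2 (λ a → mod2 (C k (c (suc a)))) ≡ false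
  even k = trans (cong (mod2 (C k (c (suc zero))) xor_) (Boolₚ.xor-identityʳ _))
    (double-edge-even (mutate-skew (c zero) sk) (finite-mutate (c zero) fin) (2≢1 ∘ sym)
      (trans (trans (cong ℤ.∣_∣ (mutate-skew (c zero) sk (c (suc (suc zero))) (c (suc zero)))) (ℤₚ.∣-i∣≡∣i∣ (C (c (suc (suc zero))) (c (suc zero))))) two) k)

-- The cycle passes through `c zero`. Mutation there creates a single edge from its predecessor to
-- its successor, and no other entry between the remaining positions changes, so that `c ∘ suc`
-- labels a cycle with one vertex less.
module Shorten {n : ℕ} {B : Mat n} (sk : SkewSym B) {l : ℕ} {c : Fin (4 ℕ.+ l) → Fin n} (cyc : Cyclic B (suc l) c)
  (in₁ : B (c (suc (fromℕ (2 ℕ.+ l)))) (c zero) ≡ + 1) (out₁ : B (c zero) (c (suc zero)) ≡ + 1) where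

  open Through sk cyc

  C : Mat n
  C = mutate (c zero) B

  c′ : Fin (3 ℕ.+ l) → Fin n
  c′ = c ∘ suc

  spoke : Fin (3 ℕ.+ l) → ℤ
  spoke a = B (c zero) (c′ a)

  entry : ∀ a b → C (c′ a) (c′ b) ≡ B (c′ a) (c′ b) ℤ.+ bump (- spoke a) (spoke b)
  entry a b = trans (mutate-off (c zero) B (cycle-distinct cyc λ ()) (cycle-distinct cyc λ ()))
    (cong (λ x → B (c′ a) (c′ b) ℤ.+ bump x (spoke b)) (sk (c zero) (c′ a)))

  far : B (c′ last) (c′ zero) ≡ + 0
  far = cycle-nonedge cyc (suc last) (suc zero)
    (λ e → case trans e (next-fromℕ (3 ℕ.+ l)) of λ ()) (λ e → case trans e (next-inject₁ (suc zero)) of λ ())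

  entry-new : C (c′ last) (c′ zero) ≡ + 1
  entry-new = trans (entry last zero)
    (trans (cong₂ ℤ._+_ far (cong₂ (λ x y → bump (- x) y) (in₁′ in₁ out₁) out₁)) refl)

  entry-new′ : C (c′ zero) (c′ last) ≡ - (+ 1)
  entry-new′ = flip-entry {B = C} (mutate-skew (c zero) sk) {c′ last} {c′ zero} entry-new

  entry-old : ∀ a b → ¬ (a ≡ last × b ≡ zero) → ¬ (a ≡ zero × b ≡ last) → C (c′ a) (c′ b) ≡ B (c′ a) (c′ b)
  entry-old a b p q = trans (entry a b) (trans (cong (λ x → B (c′ a) (c′ b) ℤ.+ x) vanish) (ℤₚ.+-identityʳ _))
    where
    vanish : bump (- spoke a) (spoke b) ≡ + 0
    vanish with a ≟ zero | a ≟ last | b ≟ zero | b ≟ last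
    ... | yes refl | _       | _        | yes e   = ⊥-elim (q (refl , e))
    ... | _        | yes e   | yes refl | _       = ⊥-elim (p (e , refl))
    ... | yes refl | _       | yes refl | _       = cong (λ x → bump (- x) x) out₁
    ... | yes refl | _       | no b≢0   | no b≢l  = trans (cong (bump (- spoke a)) (spoke-zero b b≢0 b≢l)) (bump-zeroʳ (- spoke a))
    ... | no _     | yes refl | _       | yes refl = cong (λ x → bump (- x) x) (in₁′ in₁ out₁)
    ... | no _     | yes refl | no b≢0  | no b≢l  = trans (cong (bump (- spoke a)) (spoke-zero b b≢0 b≢l)) (bump-zeroʳ (- spoke a))
    ... | no a≢0   | no a≢l  | _        | _       = cong (λ x → bump (- x) (spoke b)) (spoke-zero a a≢0 a≢l)

  next-suc-iff : ∀ a b → ¬ (a ≡ last × b ≡ zero) → (suc b ≡ next (suc a)) ⇔ (b ≡ next a)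
  next-suc-iff a b p with top? a
  ... | top   = mk⇔ (λ e → case trans e (next-fromℕ (3 ℕ.+ l)) of λ ()) (λ e → ⊥-elim (p (refl , trans e (next-fromℕ (2 ℕ.+ l)))))
  ... | below i = mk⇔ (λ e → Finₚ.suc-injective (trans e (next-suc i))) (λ e → trans (cong suc e) (sym (next-suc i)))

  cyclic′ : Cyclic C l c′
  cyclic′ = cyclic (λ a b e → Finₚ.suc-injective (injective cyc _ _ e)) adj
    where
    last-zero : Adj C (c′ last) (c′ zero) × Adj C (c′ zero) (c′ last)
    last-zero = (λ e → case trans (sym entry-new) e of λ ()) , (λ e → case trans (sym entry-new′) e of λ ())
    adj : ∀ a b → Adj C (c′ a) (c′ b) ⇔ (b ≡ next a ⊎ a ≡ next b)
    adj a b with (a ≟ last) ×-dec (b ≟ zero) | (a ≟ zero) ×-dec (b ≟ last)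
    ... | yes (refl , refl) | _ = mk⇔ (λ _ → inj₁ (sym (next-fromℕ (2 ℕ.+ l)))) (λ _ → proj₁ last-zero)
    ... | no _ | yes (refl , refl) = mk⇔ (λ _ → inj₂ (sym (next-fromℕ (2 ℕ.+ l)))) (λ _ → proj₂ last-zero)
    ... | no p | no q = mk⇔
      (λ h → [ (λ e → inj₁ (Equivalence.to (next-suc-iff a b p) e)) , (λ e → inj₂ (Equivalence.to (next-suc-iff b a q′) e)) ]′
               (Equivalence.to (adjacency cyc (suc a) (suc b)) (λ e → h (trans (entry-old a b p q) e))))
      (λ h e → Equivalence.from (adjacency cyc (suc a) (suc b))
         ([ (λ e → inj₁ (Equivalence.from (next-suc-iff a b p) e)) , (λ e → inj₂ (Equivalence.from (next-suc-iff b a q′) e)) ]′ h)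
         (trans (sym (entry-old a b p q)) e))
      where
      q′ : ¬ (b ≡ last × a ≡ zero)
      q′ (r , s) = q (s , r)

  -- The new edge points forward like the two edges it replaces: a forward orientation of the short
  -- cycle extends to the long one, and a backward orientation is excluded by the new edge itself.
  mixed′ : Mixed B (suc l) c → Mixed C l c′
  mixed′ (f , _) =
    (λ h → f λ { zero → subst (+ 0 ℤ.<_) (sym (trans (cong (λ x → B (c zero) (c x)) next-zero) out₁)) (ℤ.+<+ (s≤s z≤n))
               ; (suc a) → forward a (h a) }) ,
    (λ h → not-both-positive {+ 1} (ℤ.+<+ (s≤s z≤n))
       (subst (+ 0 ℤ.<_) (trans (cong (λ x → C (c′ x) (c′ last)) (next-fromℕ (2 ℕ.+ l))) entry-new′) (h last)))
    where
    forward : ∀ a → + 0 ℤ.< C (c′ a) (c′ (next a)) → + 0 ℤ.< B (c (suc a)) (c (next (suc a)))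
    forward a p with top? a
    ... | top   = subst (+ 0 ℤ.<_) (sym (trans (cong (λ x → B (c′ last) (c x)) (next-fromℕ (3 ℕ.+ l))) in₁)) (ℤ.+<+ (s≤s z≤n))
    ... | below i = subst (+ 0 ℤ.<_)
        (trans (entry-old (inject₁ i) (next (inject₁ i))
                  (λ { (e , _) → Finₚ.fromℕ≢inject₁ (sym e) })
                  (λ { (e , r) → two-step i e r }))
               (cong (λ x → B (c′ (inject₁ i)) (c x)) (sym (next-suc i)))) p
      where
      two-step : ∀ (i : Fin (2 ℕ.+ l)) → inject₁ i ≡ zero → next (inject₁ i) ≡ last → ⊥
      two-step zero _ r with trans (sym (next-inject₁ zero)) r
      ... | ()

  shorten-even : EvenRows C c′ → EvenRows B c
  shorten-even h = through-even in₁ out₁ h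

-- Here `c zero` is a source of the cycle. Mutation makes it a sink and creates nothing between the
-- other positions, since no path of the cycle runs through it. This turns an alternating stretch
-- into one where a neighbour is passed through.
module Flip {n : ℕ} {B : Mat n} (sk : SkewSym B) {l : ℕ} {c : Fin (4 ℕ.+ l) → Fin n} (cyc : Cyclic B (suc l) c)
  (in₁ : B (c zero) (c (suc (fromℕ (2 ℕ.+ l)))) ≡ + 1) (out₁ : B (c zero) (c (suc zero)) ≡ + 1) where

  open Through sk cyc

  C : Mat n
  C = mutate (c zero) B

  spoke : ∀ a → B (c zero) (c (suc a)) ≡ + 0 ⊎ B (c zero) (c (suc a)) ≡ + 1
  spoke a with a ≟ zero | a ≟ last
  ... | yes refl | _        = inj₂ out₁
  ... | no _     | yes refl = inj₂ in₁
  ... | no p     | no q     = inj₁ (spoke-zero a p q)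

  vanish : ∀ {x y} → x ≡ + 0 ⊎ x ≡ + 1 → y ≡ + 0 ⊎ y ≡ + 1 → bump (- x) y ≡ + 0
  vanish (inj₁ refl) (inj₁ refl) = refl
  vanish (inj₁ refl) (inj₂ refl) = refl
  vanish (inj₂ refl) (inj₁ refl) = refl
  vanish (inj₂ refl) (inj₂ refl) = refl

  entry : ∀ a b → C (c (suc a)) (c (suc b)) ≡ B (c (suc a)) (c (suc b))
  entry a b = trans (mutate-off (c zero) B (cycle-distinct cyc λ ()) (cycle-distinct cyc λ ()))
    (trans (cong (λ x → B (c (suc a)) (c (suc b)) ℤ.+ x)
             (trans (cong (λ x → bump x (B (c zero) (c (suc b)))) (sk (c zero) (c (suc a)))) (vanish (spoke a) (spoke b))))
           (ℤₚ.+-identityʳ _))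

  adj-⇔ : ∀ a b → Adj C (c a) (c b) ⇔ Adj B (c a) (c b)
  adj-⇔ zero b = mk⇔
    (λ h e → h (trans (mutate-row (c zero) B (c b)) (cong -_ e)))
    (λ h e → h (trans (sym (ℤₚ.neg-involutive _)) (cong -_ (trans (sym (mutate-row (c zero) B (c b))) e))))
  adj-⇔ (suc a) zero = mk⇔
    (λ h e → h (trans (mutate-col (c zero) B (c (suc a))) (cong -_ e)))
    (λ h e → h (trans (sym (ℤₚ.neg-involutive _)) (cong -_ (trans (sym (mutate-col (c zero) B (c (suc a)))) e))))
  adj-⇔ (suc a) (suc b) = mk⇔ (λ h e → h (trans (entry a b) e)) (λ h e → h (trans (sym (entry a b)) e))

  flipped-cyclic : Cyclic C (suc l) c
  flipped-cyclic = cyclic (injective cyc) λ a b → mk⇔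
    (λ h → Equivalence.to (adjacency cyc a b) (Equivalence.to (adj-⇔ a b) h))
    (λ h → Equivalence.from (adj-⇔ a b) (Equivalence.from (adjacency cyc a b) h))

  row₀ : ∀ {b} → B (c zero) (c b) ≡ + 1 → ¬ (+ 0 ℤ.< C (c zero) (c b))
  row₀ {b} e p with subst (+ 0 ℤ.<_) (trans (mutate-row (c zero) B (c b)) (cong -_ e)) p
  ... | ()

  flipped-mixed : Mixed C (suc l) c
  flipped-mixed = (λ h → row₀ out₁ (subst (λ x → + 0 ℤ.< C (c zero) (c x)) next-zero (h zero))) ,
    (λ h → row₀ in₁ (subst (λ x → + 0 ℤ.< C (c x) (c (suc last))) (next-fromℕ (3 ℕ.+ l)) (h (suc last))))

  -- Both neighbours of `c zero` on the cycle receive the same correction from row `k`, so that the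
  -- corrections cancel modulo 2.
  flipped-even : EvenRows C c → EvenRows B c
  flipped-even h k with k ≟ c zero
  ... | yes refl = trans (sum2-cong (λ a → sym (trans (cong mod2 (mutate-row (c zero) B (c a))) (mod2-neg (B k (c a)))))) (h k)
  ... | no k≢b = trans (cong₂ _xor_
      (sym (trans (cong mod2 (mutate-col (c zero) B k)) (mod2-neg (B k (c zero)))))
      (trans (trans (sym (Boolₚ.xor-identityʳ _)) (cong (sum2 (f ∘ suc) xor_) (sym g-sum)))
        (trans (sym (sum2-xor (f ∘ suc) g)) (sum2-cong (sym ∘ mutated))))) (h k)
    where
    f : Fin (4 ℕ.+ l) → Bool
    f a = mod2 (B k (c a))
    g : Fin (3 ℕ.+ l) → Bool
    g a = mod2 (bump (B k (c zero)) (B (c zero) (c (suc a))))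
    mutated : ∀ a → mod2 (C k (c (suc a))) ≡ f (suc a) xor g a
    mutated a = trans (cong mod2 (mutate-off (c zero) B k≢b (cycle-distinct cyc λ ()))) (mod2-+ (B k (c (suc a))) _)
    g-sum : sum2 g ≡ false
    g-sum = trans (sum2-pair zero last (λ ()) g
               (λ a p q → trans (cong (λ x → mod2 (bump (B k (c zero)) x)) (spoke-zero a p q)) (cong mod2 (bump-zeroʳ (B k (c zero))))))
      (trans (cong₂ (λ x y → mod2 (bump (B k (c zero)) x) xor mod2 (bump (B k (c zero)) y)) out₁ in₁) (xor-self (mod2 (bump (B k (c zero)) (+ 1)))))

NonOrientedEven : ℕ → ℕ → Set
NonOrientedEven n l = ∀ {B : Mat n} → SkewSym B → FiniteMutationType B → ∀ {c} → Cyclic B l c → Mixed B l c → EvenRows B c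

-- The hypothesis for the next shorter cycles, vacuous for triangles.
Shorter : ℕ → ℕ → Set
Shorter n zero    = ⊤
Shorter n (suc l) = NonOrientedEven n l

module _ {n l : ℕ} (ih : Shorter n l) where

  through⁺ : ∀ {B : Mat n} → SkewSym B → FiniteMutationType B → ∀ {c} → Cyclic B l c → Mixed B l c →
             + 0 ℤ.< B (c (fromℕ (2 ℕ.+ l))) (c zero) → + 0 ℤ.< B (c zero) (c (suc zero)) → EvenRows B c
  through⁺ = go l ih
    where
    go : ∀ l → Shorter n l → ∀ {B : Mat n} → SkewSym B → FiniteMutationType B → ∀ {c} → Cyclic B l c → Mixed B l c →
         + 0 ℤ.< B (c (fromℕ (2 ℕ.+ l))) (c zero) → + 0 ℤ.< B (c zero) (c (suc zero)) → EvenRows B c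
    go zero    ih sk fin cyc mix in⁺ out⁺ = triangle-through sk fin cyc mix in⁺ out⁺
    go (suc l) ih {B} sk fin {c} cyc mix in⁺ out⁺ =
      shorten-even (ih (mutate-skew (c zero) sk) (finite-mutate (c zero) fin) cyclic′ (mixed′ mix))
      where
      open Shorten sk cyc
        (positive-one in⁺ (trans (cong (λ x → ℤ.∣ B (c (fromℕ (3 ℕ.+ l))) (c x) ∣) (sym (next-fromℕ (3 ℕ.+ l)))) (weight-one sk fin cyc (fromℕ (3 ℕ.+ l)))))
        (positive-one out⁺ (trans (cong (λ x → ℤ.∣ B (c zero) (c x) ∣) (sym next-zero)) (weight-one sk fin cyc zero)))

  through⁻ : ∀ {B : Mat n} → SkewSym B → FiniteMutationType B → ∀ {c} → Cyclic B l c → Mixed B l c →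
             + 0 ℤ.< - B (c (fromℕ (2 ℕ.+ l))) (c zero) → + 0 ℤ.< - B (c zero) (c (suc zero)) → EvenRows B c
  through⁻ sk fin {c} cyc mix p q =
    even-negate sk {c = c} (through⁺ (negate-skew sk) (finite-negate fin) (cyclic-negate cyc) (mixed-negate sk mix) p q)

  shift-first : (P : Fin (3 ℕ.+ l) → Fin (3 ℕ.+ l) → Set) → P zero (suc zero) → P (next (fromℕ (2 ℕ.+ l))) (next zero)
  shift-first P = subst₂ P (sym (next-fromℕ (2 ℕ.+ l))) (sym next-zero)

  shift-second : (P : Fin (3 ℕ.+ l) → Fin (3 ℕ.+ l) → Set) → P (suc zero) (suc (suc zero)) → P (next zero) (next (suc zero))
  shift-second P = subst₂ P (sym next-zero) (sym (next-inject₁ (suc zero)))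

  module _ {B : Mat n} (sk : SkewSym B) (fin : FiniteMutationType B) {c : Fin (3 ℕ.+ l) → Fin n}
           (cyc : Cyclic B l c) (mix : Mixed B l c) where

    second⁺ : + 0 ℤ.< B (c zero) (c (suc zero)) → + 0 ℤ.< B (c (suc zero)) (c (suc (suc zero))) → EvenRows B c
    second⁺ p q = even-next cyc (through⁺ sk fin (cyclic-next cyc) (mixed-next cyc mix)
      (shift-first (λ a b → + 0 ℤ.< B (c a) (c b)) p) (shift-second (λ a b → + 0 ℤ.< B (c a) (c b)) q))

    second⁻ : + 0 ℤ.< - B (c zero) (c (suc zero)) → + 0 ℤ.< - B (c (suc zero)) (c (suc (suc zero))) → EvenRows B c
    second⁻ p q = even-next cyc (through⁻ sk fin (cyclic-next cyc) (mixed-next cyc mix)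
      (shift-first (λ a b → + 0 ℤ.< - B (c a) (c b)) p) (shift-second (λ a b → + 0 ℤ.< - B (c a) (c b)) q))

-- Around positions zero and one the directions alternate. In a triangle this leaves the path from
-- zero through two to one. In a longer cycle the flip of the source at zero creates the path from
-- two through one to zero.
alternating : ∀ {n} l (ih : Shorter n l) {B : Mat n} → SkewSym B → FiniteMutationType B → ∀ {c} → Cyclic B l c → Mixed B l c →
              + 0 ℤ.< - B (c (fromℕ (2 ℕ.+ l))) (c zero) → + 0 ℤ.< B (c zero) (c (suc zero)) →
              + 0 ℤ.< - B (c (suc zero)) (c (suc (suc zero))) → EvenRows B c
alternating zero ih {B} sk fin {c} cyc mix p q r =
  even-next cyc (second⁻ {l = zero} ih sk fin (cyclic-next cyc) (mixed-next cyc mix) r p)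
alternating (suc l) ih {B} sk fin {c} cyc mix p q r =
  flipped-even (second⁻ {l = suc l} ih (mutate-skew (c zero) sk) (finite-mutate (c zero) fin) flipped-cyclic flipped-mixed
    (subst (+ 0 ℤ.<_) (sym (trans (cong -_ (mutate-row (c zero) B (c (suc zero)))) (ℤₚ.neg-involutive _))) q)
    (subst (λ x → + 0 ℤ.< - x) (sym (entry zero (suc zero))) r))
  where
  open Flip sk cyc
    (positive-one (subst (+ 0 ℤ.<_) (sym (sk _ _)) p)
      (trans (cong ℤ.∣_∣ (sk _ _)) (trans (ℤₚ.∣-i∣≡∣i∣ (B (c (fromℕ (3 ℕ.+ l))) (c zero)))
        (trans (cong (λ x → ℤ.∣ B (c (fromℕ (3 ℕ.+ l))) (c x) ∣) (sym (next-fromℕ (3 ℕ.+ l)))) (weight-one sk fin cyc (fromℕ (3 ℕ.+ l)))))))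
    (positive-one q (trans (cong (λ x → ℤ.∣ B (c zero) (c x) ∣) (sym next-zero)) (weight-one sk fin cyc zero)))

-- The signs of three consecutive edges decide: either two neighbouring signs agree, and the cycle
-- passes through position zero or one, or the three signs alternate.
nonOriented-step : ∀ {n} l → Shorter n l → NonOrientedEven n l
nonOriented-step l ih {B} sk fin {c} cyc mix
  with positive? (λ e → cycle-edge cyc (fromℕ (2 ℕ.+ l)) (trans (cong (λ x → B (c (fromℕ (2 ℕ.+ l))) (c x)) (next-fromℕ (2 ℕ.+ l))) e))
     | positive? (λ e → cycle-edge cyc zero (trans (cong (λ x → B (c zero) (c x)) next-zero) e))
     | positive? (λ e → cycle-edge cyc (suc zero) (trans (cong (λ x → B (c (suc zero)) (c x)) (next-inject₁ (suc zero))) e))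
... | inj₁ p | inj₁ q | _      = through⁺ ih sk fin cyc mix p q
... | inj₂ p | inj₂ q | _      = through⁻ ih sk fin cyc mix p q
... | inj₁ p | inj₂ q | inj₂ r = second⁻ ih sk fin cyc mix q r
... | inj₂ p | inj₁ q | inj₁ r = second⁺ ih sk fin cyc mix q r
... | inj₂ p | inj₁ q | inj₂ r = alternating l ih sk fin cyc mix p q r
... | inj₁ p | inj₂ q | inj₁ r =
  even-negate sk {c = c} (alternating l ih (negate-skew sk) (finite-negate fin) (cyclic-negate cyc) (mixed-negate sk mix)
    (subst (+ 0 ℤ.<_) (sym (ℤₚ.neg-involutive _)) p) q (subst (+ 0 ℤ.<_) (sym (ℤₚ.neg-involutive _)) r))

nonOriented-even : ∀ {n} l → NonOrientedEven n l
nonOriented-even zero    = nonOriented-step zero tt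
nonOriented-even (suc l) = nonOriented-step (suc l) (nonOriented-even l)

-- Cycles read in the opposite direction

opposite-injective : ∀ {n} {a b : Fin n} → opposite a ≡ opposite b → a ≡ b
opposite-injective {a = a} {b} e = trans (sym (Finₚ.opposite-involutive a)) (trans (cong opposite e) (Finₚ.opposite-involutive b))

opposite-fromℕ : ∀ l → opposite (fromℕ l) ≡ zero
opposite-fromℕ l = opposite-injective (Finₚ.opposite-involutive (fromℕ l))

opposite-inject₁ : ∀ {l} (i : Fin l) → opposite (inject₁ i) ≡ suc (opposite i)
opposite-inject₁ {suc l} zero    = refl
opposite-inject₁ {suc l} (suc i) = cong inject₁ (opposite-inject₁ i)

next-opposite : ∀ {l} (a : Fin (suc l)) → next (opposite (next a)) ≡ opposite a
next-opposite {l} a with top? a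
... | top   = trans (cong (next ∘ opposite) (next-fromℕ l)) (trans (next-fromℕ l) (sym (opposite-fromℕ l)))
... | below i = trans (cong (next ∘ opposite) (next-inject₁ i)) (trans (next-inject₁ (opposite i)) (sym (opposite-inject₁ i)))

next≡-opposite : ∀ {l} (a b : Fin (suc l)) → a ≡ next b → opposite b ≡ next (opposite a)
next≡-opposite _ b refl = sym (next-opposite b)

opposite-next≡ : ∀ {l} (a b : Fin (suc l)) → opposite b ≡ next (opposite a) → a ≡ next b
opposite-next≡ a b e =
  opposite-injective (next-injective (trans (sym e) (sym (next-opposite b))))

-- `IsOrientedCycle` asks for forward arrows only, so a cycle with all arrows backward is recognised
-- as oriented through this labelling.
reversed : ∀ {n} {B : Mat n} {S l c} → CycleLabelling B S l c → CycleLabelling B S l (c ∘ opposite)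
reversed {c = c} (inj , img , adj) =
  (λ a b e → opposite-injective (inj _ _ e)) ,
  (λ k → mk⇔ (λ e → let a , p = Equivalence.to (img k) e in opposite a , trans (cong c (Finₚ.opposite-involutive a)) p)
             (λ { (a , p) → Equivalence.from (img k) (opposite a , p) })) ,
  (λ a b → mk⇔ (λ h → [ (λ e → inj₂ (opposite-next≡ a b e)) , (λ e → inj₁ (opposite-next≡ b a e)) ]′ (Equivalence.to (adj _ _) h))
               (λ h → Equivalence.from (adj _ _) ([ (λ e → inj₂ (next≡-opposite b a e)) , (λ e → inj₁ (next≡-opposite a b e)) ]′ h)))

indicator-support : ∀ {m n} {u : Vect n} (c : Fin m → Fin n) → (∀ a b → c a ≡ c b → a ≡ b) →
                    (∀ k → u k ≡ true ⇔ (∃[ a ] c a ≡ k)) → ∀ k → u k ≡ indicator c k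
indicator-support c inj img k = bool-iff
  (λ e → let a , p = Equivalence.to (img k) e in subst (λ x → indicator c x ≡ true) p (indicator-∈ c inj a))
  (λ e → Equivalence.from (img k) (indicator-∋ c k e))

support-sum : ∀ {m n} {u : Vect n} (c : Fin m → Fin n) → (∀ a b → c a ≡ c b → a ≡ b) →
              (∀ k → u k ≡ true ⇔ (∃[ a ] c a ≡ k)) → (f : Vect n) → sum2 (λ k → f k ∧ u k) ≡ sum2 (f ∘ c)
support-sum {u = u} c inj img f =
  trans (sum2-cong (λ k → trans (Boolₚ.∧-comm (f k) (u k)) (cong (_∧ f k) (indicator-support {u = u} c inj img k)))) (indicator-sum c f)

nonOriented-radical : ∀ {n} {B : Mat n} → SkewSym B → FiniteMutationType B → ∀ S → IsNonOrientedCycle B S → Radical B S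
nonOriented-radical {B = B} sk fin S ((l , c , lab@(inj , img , adj)) , notOriented) k =
  trans (support-sum c inj img (λ j → mod2 (B k j))) (nonOriented-even l sk fin (cyclic inj adj) mixed k)
  where
  mixed : Mixed B l c
  mixed = (λ h → notOriented (l , c , lab , h)) ,
          (λ h → notOriented (l , c ∘ opposite , reversed {B = B} {S} lab ,
             λ a → subst (λ x → + 0 ℤ.< B (c x) (c (opposite (next a)))) (next-opposite a) (h (opposite (next a)))))

-- Triangulated surfaces

Port : ℕ → Set
Port N = Fin N × Fin 3

node : ∀ {N} → Port N → Fin N
node = proj₁

-- The matrix of the oriented triangle `0 → 1 → 2 → 0`. Modulo 2 it only tells distinct ports from
-- equal ones, which is why degrees suffice to describe radical vectors.
turn : Fin 3 → Fin 3 → ℤ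
turn zero             (suc zero)       = + 1
turn (suc zero)       (suc (suc zero)) = + 1
turn (suc (suc zero)) zero             = + 1
turn (suc zero)       zero             = -[1+ 0 ]
turn (suc (suc zero)) (suc zero)       = -[1+ 0 ]
turn zero             (suc (suc zero)) = -[1+ 0 ]
turn zero             zero             = + 0
turn (suc zero)       (suc zero)       = + 0
turn (suc (suc zero)) (suc (suc zero)) = + 0

turn-skew : ∀ p q → turn q p ≡ - turn p q
turn-skew = check₂ (λ p q → turn q p ℤ.≟ - turn p q) refl

turn-parity : ∀ p q → mod2 (turn p q) ≡ not (p == q)
turn-parity = check₂ (λ p q → mod2 (turn p q) Bool.≟ not (p == q)) refl

weigh : ∀ {N} → (Fin N → Bool) → Port N → Port N → ℤ
weigh cap (t , p) (t' , q) = if (t == t') ∧ not (cap t) then turn p q else + 0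

module _ {N : ℕ} (cap : Fin N → Bool) where

  weigh-same : ∀ {t} → cap t ≡ false → ∀ p q → weigh cap (t , p) (t , q) ≡ turn p q
  weigh-same {t} e p q rewrite ==-refl t | e = refl

  weigh-apart : ∀ {x y} → node x ≢ node y → weigh cap x y ≡ + 0
  weigh-apart h rewrite ==-≢ h = refl

  weigh-cap : ∀ {x} y → cap (node x) ≡ true → weigh cap x y ≡ + 0
  weigh-cap {x} y e rewrite e | Boolₚ.∧-zeroʳ (node x == node y) = refl

  weigh-skew : ∀ x y → weigh cap y x ≡ - weigh cap x y
  weigh-skew (t , p) (t' , q) with t ≟ t'
  ... | no t≢t' rewrite ==-≢ (t≢t' ∘ sym) = refl
  ... | yes refl rewrite ==-refl t with cap t
  ...   | true  = refl
  ...   | false = turn-skew p q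

  weigh-diagonal : ∀ x → weigh cap x x ≡ + 0
  weigh-diagonal x = skew-diagonal {n = 1} {B = λ _ _ → weigh cap x x} (λ _ _ → weigh-skew x x) zero

  weigh-port : ∀ {x y} → x ≡ y → weigh cap x y ≡ + 0
  weigh-port {x} refl = weigh-diagonal x

  weigh-parity : ∀ {x y} → node x ≡ node y → cap (node x) ≡ false → x ≢ y → mod2 (weigh cap x y) ≡ true
  weigh-parity {t , p} {.t , q} refl e x≢y =
    trans (cong mod2 (weigh-same e p q)) (trans (turn-parity p q) (cong not (==-≢ (λ p≡q → x≢y (cong (t ,_) p≡q)))))

Σb : (Bool → ℤ) → ℤ
Σb f = f false ℤ.+ f true

Σb-cong : ∀ {f g : Bool → ℤ} → (∀ e → f e ≡ g e) → Σb f ≡ Σb g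
Σb-cong h = cong₂ ℤ._+_ (h false) (h true)

Σb-cong₂ : ∀ {f g : Bool → Bool → ℤ} → (∀ e e' → f e e' ≡ g e e') → (Σb λ e → Σb (f e)) ≡ (Σb λ e → Σb (g e))
Σb-cong₂ h = Σb-cong (λ e → Σb-cong (h e))

-- A triangulated surface up to its boundary. Every arc has two ends, sitting at ports of nodes.
-- A node is a triangle with three cyclically ordered ports (some of which may be empty), or a
-- cap: a self-folded triangle, whose two arcs (the loop and the folded side, which have the same
-- neighbours in the quiver) share a port of the triangle outside.
record Triangulation (N n : ℕ) : Set where
  field
    end        : Fin n → Bool → Port N
    cap        : Fin N → Bool
    apart      : ∀ i e → node (end i e) ≢ node (end i (not e))
    port-twins : ∀ i e j e' → i ≢ j → end i e ≡ end j e' → cap (node (end i e)) ≡ false →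
                 cap (node (end i (not e))) ≡ true × node (end j (not e')) ≡ node (end i (not e))
    cap-twins  : ∀ i e j e' → cap (node (end i e)) ≡ true → node (end j e') ≡ node (end i e) →
                 end j (not e') ≡ end i (not e) × cap (node (end i (not e))) ≡ false
    cap-twin   : ∀ i e → cap (node (end i e)) ≡ true → ∃[ j ] ∃[ e' ] j ≢ i × node (end j e') ≡ node (end i e)
    cap-two    : ∀ i e j e' k e'' → cap (node (end i e)) ≡ true →
                 node (end j e') ≡ node (end i e) → node (end k e'') ≡ node (end i e) → j ≢ i → k ≢ i → j ≡ k
    occupied   : ∀ t → ∃[ i ] ∃[ e ] node (end i e) ≡ t

  matrix : Mat n
  matrix i j = Σb λ e → Σb λ e' → weigh cap (end i e) (end j e')

  at : Fin n → Fin N → Bool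
  at j t = (node (end j false) == t) xor (node (end j true) == t)

  degree : Vect n → Fin N → Bool
  degree u t = sum2 (λ j → at j t ∧ u j)

-+-swap : ∀ a b c d → (- a ℤ.+ - b) ℤ.+ (- c ℤ.+ - d) ≡ - ((a ℤ.+ c) ℤ.+ (b ℤ.+ d))
-+-swap = solve 4 (λ a b c d → (:- a :+ :- b) :+ (:- c :+ :- d) := :- ((a :+ c) :+ (b :+ d))) refl
  where open ℤ-Solver

module _ {N n : ℕ} (T : Triangulation N n) where
  open Triangulation T

  at-end : ∀ i e → at i (node (end i e)) ≡ true
  at-end i false = cong₂ _xor_ (==-refl (node (end i false))) (==-≢ (apart i true))
  at-end i true  = cong₂ _xor_ (==-≢ (apart i false)) (==-refl (node (end i true)))

  end-at : ∀ {i t} → at i t ≡ true → ∃[ e ] node (end i e) ≡ t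
  end-at {i} {t} h with node (end i false) ≟ t | node (end i true) ≟ t
  ... | yes p | _     = false , p
  ... | no _  | yes p = true , p

  matrix-skew : SkewSym matrix
  matrix-skew i j = trans
    (cong₂ ℤ._+_ (cong₂ ℤ._+_ (weigh-skew cap (end i false) (end j false)) (weigh-skew cap (end i true) (end j false)))
                 (cong₂ ℤ._+_ (weigh-skew cap (end i false) (end j true)) (weigh-skew cap (end i true) (end j true))))
    (-+-swap (weigh cap (end i false) (end j false)) (weigh cap (end i true) (end j false))
             (weigh cap (end i false) (end j true)) (weigh cap (end i true) (end j true)))

  no-common-node : ∀ {i j} → (∀ e e' → node (end i e) ≢ node (end j e')) → matrix i j ≡ + 0
  no-common-node h = cong₂ ℤ._+_ (cong₂ ℤ._+_ (weigh-apart cap (h false false)) (weigh-apart cap (h false true)))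
                                 (cong₂ ℤ._+_ (weigh-apart cap (h true false)) (weigh-apart cap (h true true)))

  common-node : ∀ {i j} → matrix i j ≢ + 0 → ∃[ e ] ∃[ e' ] node (end i e) ≡ node (end j e')
  common-node {i} {j} h = search (at? false false) (at? false true) (at? true false) (at? true true)
    where
    at? : ∀ e e' → Dec (node (end i e) ≡ node (end j e'))
    at? e e' = node (end i e) ≟ node (end j e')
    search : Dec _ → Dec _ → Dec _ → Dec _ → ∃[ e ] ∃[ e' ] node (end i e) ≡ node (end j e')
    search (yes p) _ _ _ = false , false , p
    search _ (yes p) _ _ = false , true , p
    search _ _ (yes p) _ = true , false , p
    search _ _ _ (yes p) = true , true , p
    search (no p) (no q) (no r) (no s) = contradiction
      (no-common-node {i} {j} λ { false false → p ; false true → q ; true false → r ; true true → s }) h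

  -- The inner product of the boundaries of the two arcs in the space of nodes modulo 2.
  meet : Fin n → Fin n → Bool
  meet i j = at j (node (end i false)) xor at j (node (end i true))

  parity : Port N → Port N → Bool
  parity x y = mod2 (weigh cap x y)

  -- The position of the two arcs of a cap: the same nodes at both ends and no weight at either, at
  -- one end because of the cap, at the other because of the common port.
  Twins : Fin n → Bool → Fin n → Bool → Set
  Twins i e j e' = (node (end i e) ≡ node (end j e') × node (end i (not e)) ≡ node (end j (not e'))) ×
                   (parity (end i e) (end j e') ≡ false × parity (end i (not e)) (end j (not e')) ≡ false)

  -- Outside the exception of twins, two ends at a common node sit at distinct ports of an uncapped
  -- triangle, so their weight is odd; ends at different nodes have weight zero.
  twins? : ∀ {i j} → i ≢ j → ∀ e e' → Twins i e j e' ⊎ parity (end i e) (end j e') ≡ (node (end j e') == node (end i e))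
  twins? {i} {j} i≢j e e' = go (node (end i e) ≟ node (end j e')) (cap (node (end i e))) refl (end i e ≟ₚ end j e')
    where
    _≟ₚ_ : (x y : Port N) → Dec (x ≡ y)
    (t , a) ≟ₚ (s , b) = map′ (λ { (refl , refl) → refl }) (λ { refl → refl , refl }) ((t ≟ s) ×-dec (a ≟ b))
    go : Dec _ → ∀ b → cap (node (end i e)) ≡ b → Dec (end i e ≡ end j e') →
         Twins i e j e' ⊎ parity (end i e) (end j e') ≡ (node (end j e') == node (end i e))
    go (no p)  _     _ _       = inj₂ (trans (cong mod2 (weigh-apart cap {end i e} {end j e'} p)) (sym (==-≢ (p ∘ sym))))
    go (yes p) true  c _       = let q , r = cap-twins i e j e' c (sym p) in
      inj₁ ((p , cong node (sym q)) , cong mod2 (weigh-cap cap (end j e') c) , cong mod2 (weigh-port cap (sym q)))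
    go (yes p) false c (yes q) = let r , s = port-twins i e j e' i≢j q c in
      inj₁ ((p , sym s) , cong mod2 (weigh-port cap q) , cong mod2 (weigh-cap cap (end j (not e')) r))
    go (yes p) false c (no q)  = inj₂ (trans (weigh-parity cap p c q)
      (sym (trans (cong (_== node (end i e)) (sym p)) (==-refl (node (end i e))))))

  mod2-matrix : ∀ i j → mod2 (matrix i j) ≡
    (parity (end i false) (end j false) xor parity (end i false) (end j true)) xor
    (parity (end i true) (end j false) xor parity (end i true) (end j true))
  mod2-matrix i j = trans (mod2-+ (Σb λ e' → weigh cap (end i false) (end j e')) _)
    (cong₂ _xor_ (mod2-+ (weigh cap (end i false) (end j false)) _) (mod2-+ (weigh cap (end i true) (end j false)) _))

  twins-cross : ∀ {i e j e'} → Twins i e j e' → node (end i e) ≢ node (end j (not e'))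
  twins-cross {i} {e} ((p , q) , _) r = apart i e (trans r (sym q))

  twins-cross′ : ∀ {i e j e'} → Twins i e j e' → node (end i (not e)) ≢ node (end j e')
  twins-cross′ {i} {e} ((p , q) , _) r = apart i e (trans p (sym r))

  twins-even : ∀ {i e j e'} → Twins i e j e' → mod2 (matrix i j) ≡ false
  twins-even {i} {e} {j} {e'} tw@(_ , a , b) = trans (mod2-matrix i j) (lemma e e' a b
    (cong mod2 (weigh-apart cap (twins-cross tw))) (cong mod2 (weigh-apart cap (twins-cross′ tw))))
    where
    lemma : ∀ e e' → parity (end i e) (end j e') ≡ false → parity (end i (not e)) (end j (not e')) ≡ false →
            parity (end i e) (end j (not e')) ≡ false → parity (end i (not e)) (end j e') ≡ false →
            (parity (end i false) (end j false) xor parity (end i false) (end j true)) xor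
            (parity (end i true) (end j false) xor parity (end i true) (end j true)) ≡ false
    lemma false false p q r s rewrite p | q | r | s = refl
    lemma false true  p q r s rewrite p | q | r | s = refl
    lemma true  false p q r s rewrite p | q | r | s = refl
    lemma true  true  p q r s rewrite p | q | r | s = refl

  parallel-meet : ∀ {i e j e'} → node (end i e) ≡ node (end j e') → node (end i (not e)) ≡ node (end j (not e')) → meet i j ≡ false
  parallel-meet {i} {e} {j} {e'} p q = trans (lemma e)
    (cong₂ _xor_ (trans (cong (at j) p) (at-end j e')) (trans (cong (at j) q) (at-end j (not e'))))
    where
    lemma : ∀ e → meet i j ≡ at j (node (end i e)) xor at j (node (end i (not e)))
    lemma false = refl
    lemma true  = Boolₚ.xor-comm (at j (node (end i false))) _

  -- Modulo 2 the exchange matrix is the Gram matrix of the boundaries of the arcs.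
  gram : ∀ i j → mod2 (matrix i j) ≡ meet i j
  gram i j with i ≟ j
  ... | yes refl = trans (cong mod2 (skew-diagonal {B = matrix} matrix-skew i)) (sym (parallel-meet {i} {false} {i} {false} refl refl))
  ... | no i≢j with twins? i≢j false false | twins? i≢j false true | twins? i≢j true false | twins? i≢j true true
  ...   | inj₁ tw | _ | _ | _ = trans (twins-even tw) (sym (parallel-meet {i} {false} {j} {false} (proj₁ (proj₁ tw)) (proj₂ (proj₁ tw))))
  ...   | _ | inj₁ tw | _ | _ = trans (twins-even tw) (sym (parallel-meet {i} {false} {j} {true} (proj₁ (proj₁ tw)) (proj₂ (proj₁ tw))))
  ...   | _ | _ | inj₁ tw | _ = trans (twins-even tw) (sym (parallel-meet {i} {true} {j} {false} (proj₁ (proj₁ tw)) (proj₂ (proj₁ tw))))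
  ...   | _ | _ | _ | inj₁ tw = trans (twins-even tw) (sym (parallel-meet {i} {true} {j} {true} (proj₁ (proj₁ tw)) (proj₂ (proj₁ tw))))
  ...   | inj₂ a | inj₂ b | inj₂ c | inj₂ d = trans (mod2-matrix i j) (cong₂ _xor_ (cong₂ _xor_ a b) (cong₂ _xor_ c d))

  -- By `gram`, row `i` of the product compares the degrees of `u` at the two ends of `i`. So `u` is
  -- radical exactly when its degree does not change along any arc.
  radical-row : ∀ u i → sum2 (λ j → mod2 (matrix i j) ∧ u j) ≡ degree u (node (end i false)) xor degree u (node (end i true))
  radical-row u i = trans (sum2-cong (λ j → trans (cong (_∧ u j) (gram i j)) (Boolₚ.∧-distribʳ-xor (u j) (at j (node (end i false))) (at j (node (end i true))))))
                          (sum2-xor (λ j → at j (node (end i false)) ∧ u j) (λ j → at j (node (end i true)) ∧ u j))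

  radical-degree : ∀ {u} → Radical matrix u → ∀ i e → degree u (node (end i e)) ≡ degree u (node (end i false))
  radical-degree rad i false = refl
  radical-degree {u} rad i true = sym (xor≡false (trans (sym (radical-row u i)) (rad i)))

  constant-radical : ∀ {u} b → (∀ t → degree u t ≡ b) → Radical matrix u
  constant-radical {u} b h i = trans (radical-row u i) (trans (cong₂ _xor_ (h _) (h _)) (xor-self b))

  -- Adjacent arcs share a node, so a path in the quiver transports the degree; `occupied` lets
  -- every node be reached this way.
  radical-constant : Connected matrix → ∀ {u} → Radical matrix u → ∀ s t → degree u s ≡ degree u t
  radical-constant con {u} rad s t with occupied s | occupied t
  ... | i , e , refl | j , e' , refl =
    trans (radical-degree rad i e) (trans (along (con i j)) (sym (radical-degree rad j e')))
    where
    along : ∀ {i j} → Star (Adj matrix) i j → degree u (node (end i false)) ≡ degree u (node (end j false))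
    along ε = refl
    along (_◅_ {i} {j} h p) with common-node h
    ... | a , b , q = trans (sym (radical-degree rad i a)) (trans (cong (degree u) q) (trans (radical-degree rad j b) (along p)))

-- Flips

infixl 6 _⊕_
_⊕_ : ∀ {n} → Vect n → Vect n → Vect n
(u ⊕ w) i = u i xor w i

record LinearIso (n : ℕ) : Set where
  field
    to from   : Vect n → Vect n
    to-cong   : ∀ {u w} → u ≗ w → to u ≗ to w
    from-cong : ∀ {u w} → u ≗ w → from u ≗ from w
    to-⊕      : ∀ u w → to (u ⊕ w) ≗ to u ⊕ to w
    from-⊕    : ∀ u w → from (u ⊕ w) ≗ from u ⊕ from w
    to-from   : ∀ u → to (from u) ≗ u
    from-to   : ∀ u → from (to u) ≗ u
open LinearIso public

iso-id : ∀ {n} → LinearIso n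
iso-id = record { to = id ; from = id ; to-cong = id ; from-cong = id ; to-⊕ = λ _ _ _ → refl ; from-⊕ = λ _ _ _ → refl
                ; to-from = λ _ _ → refl ; from-to = λ _ _ → refl }

iso-inverse : ∀ {n} → LinearIso n → LinearIso n
iso-inverse φ = record { to = from φ ; from = to φ ; to-cong = from-cong φ ; from-cong = to-cong φ
  ; to-⊕ = from-⊕ φ ; from-⊕ = to-⊕ φ ; to-from = from-to φ ; from-to = to-from φ }

iso-compose : ∀ {n} → LinearIso n → LinearIso n → LinearIso n
iso-compose φ ψ = record
  { to = to ψ ∘ to φ ; from = from φ ∘ from ψ
  ; to-cong = λ e → to-cong ψ (to-cong φ e) ; from-cong = λ e → from-cong φ (from-cong ψ e)
  ; to-⊕ = λ u w i → trans (to-cong ψ (to-⊕ φ u w) i) (to-⊕ ψ (to φ u) (to φ w) i)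
  ; from-⊕ = λ u w i → trans (from-cong φ (from-⊕ ψ u w) i) (from-⊕ φ (from ψ u) (from ψ w) i)
  ; to-from = λ u i → trans (to-cong ψ (to-from φ (from ψ u)) i) (to-from ψ u i)
  ; from-to = λ u i → trans (from-cong φ (from-to ψ (to φ u)) i) (from-to φ u i) }

open Triangulation public

degree-cong : ∀ {N n} (T : Triangulation N n) {u w} → u ≗ w → ∀ t → degree T u t ≡ degree T w t
degree-cong T e t = sum2-cong (λ j → cong (at T j t ∧_) (e j))

degree-⊕ : ∀ {N n} (T : Triangulation N n) u w t → degree T (u ⊕ w) t ≡ degree T u t xor degree T w t
degree-⊕ T u w t = trans (sum2-cong (λ j → Boolₚ.∧-distribˡ-xor (at T j t) (u j) (w j)))
                         (sum2-xor (λ j → at T j t ∧ u j) (λ j → at T j t ∧ w j))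

Intertwines : ∀ {N n} → Triangulation N n → Triangulation N n → LinearIso n → Set
Intertwines T T' φ = ∀ u t → degree T' (to φ u) t ≡ degree T u t

intertwines-inverse : ∀ {N n} {T T' : Triangulation N n} {φ} → Intertwines T T' φ → Intertwines T' T (iso-inverse φ)
intertwines-inverse {T' = T'} {φ} h u t = trans (sym (h (from φ u) t)) (degree-cong T' (to-from φ u) t)

-- The map adding `form u` to coordinate `v`. As `g` vanishes at `v`, the form does not notice this
-- change, and the map is its own inverse.
module Transvection {n : ℕ} (v : Fin n) (g : Vect n) (gv : g v ≡ false) where

  form : Vect n → Bool
  form u = sum2 (λ i → g i ∧ u i)

  apply : Vect n → Vect n
  apply u j = u j xor ((j == v) ∧ form u)

  form-cong : ∀ {u w} → u ≗ w → form u ≡ form w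
  form-cong e = sum2-cong (λ i → cong (g i ∧_) (e i))

  form-⊕ : ∀ u w → form (u ⊕ w) ≡ form u xor form w
  form-⊕ u w = trans (sum2-cong (λ i → Boolₚ.∧-distribˡ-xor (g i) (u i) (w i))) (sum2-xor (λ i → g i ∧ u i) (λ i → g i ∧ w i))

  form-apply : ∀ u → form (apply u) ≡ form u
  form-apply u = sum2-cong same
    where
    same : ∀ i → g i ∧ apply u i ≡ g i ∧ u i
    same i with i ≟ v
    ... | yes refl rewrite gv = refl
    ... | no _     = cong (g i ∧_) (Boolₚ.xor-identityʳ (u i))

  apply-cong : ∀ {u w} → u ≗ w → apply u ≗ apply w
  apply-cong e j = cong₂ (λ a b → a xor ((j == v) ∧ b)) (e j) (form-cong e)

  apply-⊕ : ∀ u w → apply (u ⊕ w) ≗ apply u ⊕ apply w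
  apply-⊕ u w j = trans (cong (λ b → (u j xor w j) xor ((j == v) ∧ b)) (form-⊕ u w))
    (trans (cong ((u j xor w j) xor_) (Boolₚ.∧-distribˡ-xor (j == v) (form u) (form w)))
           (xor-interchange (u j) (w j) ((j == v) ∧ form u) ((j == v) ∧ form w)))

  apply-involutive : ∀ u → apply (apply u) ≗ u
  apply-involutive u j = trans (cong (λ b → apply u j xor ((j == v) ∧ b)) (form-apply u))
    (trans (Boolₚ.xor-assoc (u j) _ _) (trans (cong (u j xor_) (xor-self ((j == v) ∧ form u))) (Boolₚ.xor-identityʳ (u j))))

  transvection : LinearIso n
  transvection = record { to = apply ; from = apply ; to-cong = apply-cong ; from-cong = apply-cong
    ; to-⊕ = apply-⊕ ; from-⊕ = apply-⊕ ; to-from = apply-involutive ; from-to = apply-involutive }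

  -- The hypothesis is the transposed statement: the old boundary of arc `j` is the new one plus
  -- `g j` times the new boundary of `v`.
  intertwines : ∀ {N} (T T' : Triangulation N n) → (∀ j t → at T' j t xor (g j ∧ at T' v t) ≡ at T j t) →
                Intertwines T T' transvection
  intertwines T T' h u t = begin
    sum2 (λ j → at T' j t ∧ (u j xor ((j == v) ∧ form u)))
      ≡⟨ sum2-cong (λ j → expand (at T' j t) (u j) (j == v) (form u)) ⟩
    sum2 (λ j → (at T' j t ∧ u j) xor ((j == v) ∧ (at T' j t ∧ form u)))
      ≡⟨ sum2-xor (λ j → at T' j t ∧ u j) (λ j → (j == v) ∧ (at T' j t ∧ form u)) ⟩
    degree T' u t xor sum2 (λ j → (j == v) ∧ (at T' j t ∧ form u))
      ≡⟨ cong (degree T' u t xor_) (trans (sum2-δ v (λ j → at T' j t ∧ form u)) (sym (sum2-∧ (at T' v t) (λ j → g j ∧ u j)))) ⟩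
    degree T' u t xor sum2 (λ j → at T' v t ∧ (g j ∧ u j))
      ≡⟨ sym (sum2-xor (λ j → at T' j t ∧ u j) (λ j → at T' v t ∧ (g j ∧ u j))) ⟩
    sum2 (λ j → (at T' j t ∧ u j) xor (at T' v t ∧ (g j ∧ u j)))
      ≡⟨ sum2-cong (λ j → trans (collect (at T' j t) (u j) (at T' v t) (g j)) (cong (_∧ u j) (h j t))) ⟩
    degree T u t ∎
    where
    open ≡-Reasoning
    expand : ∀ a u b s → a ∧ (u xor (b ∧ s)) ≡ (a ∧ u) xor (b ∧ (a ∧ s))
    expand = solve 4 (λ a u b s → a :* (u :+ b :* s) := a :* u :+ b :* (a :* s)) refl where open xor-∧-Solver
    collect : ∀ a u b g → (a ∧ u) xor (b ∧ (g ∧ u)) ≡ (a xor (g ∧ b)) ∧ u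
    collect = solve 4 (λ a u b g → a :* u :+ b :* (g :* u) := (a :+ g :* b) :* u) refl where open xor-∧-Solver

not≢ : ∀ b → not b ≢ b
not≢ true ()
not≢ false ()

-- A change of ports that leaves the caps where they are keeps all the axioms about caps. Rotations
-- and ordinary flips are of this kind.
module Relocate {N n : ℕ} (T : Triangulation N n) (π : Port N → Port N)
  (π-injective : ∀ {x y} → π x ≡ π y → x ≡ y)
  (π-cap : ∀ x → cap T (node (π x)) ≡ cap T (node x))
  (π-fix : ∀ x → cap T (node x) ≡ true → π x ≡ x)
  (apart' : ∀ i e → node (π (end T i e)) ≢ node (π (end T i (not e))))
  (occupied' : ∀ t → ∃[ i ] ∃[ e ] node (π (end T i e)) ≡ t) where

  capped : ∀ x → cap T (node (π x)) ≡ true → cap T (node x) ≡ true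
  capped x h = trans (sym (π-cap x)) h

  fixed : ∀ x → cap T (node (π x)) ≡ true → node (π x) ≡ node x
  fixed x h = cong node (π-fix x (capped x h))

  at-cap : ∀ x y → cap T (node (π x)) ≡ true → node (π y) ≡ node (π x) → node y ≡ node x
  at-cap x y h e = trans (sym (fixed y (subst (λ t → cap T t ≡ true) (sym e) h))) (trans e (fixed x h))

  relocated : Triangulation N n
  end relocated i e = π (end T i e)
  cap relocated = cap T
  apart relocated = apart'
  port-twins relocated i e j e' i≢j p c with port-twins T i e j e' i≢j (π-injective p) (trans (sym (π-cap (end T i e))) c)
  ... | q , r = trans (π-cap _) q ,
    trans (cong node (π-fix (end T j (not e')) (trans (cong (cap T) r) q))) (trans r (sym (cong node (π-fix (end T i (not e)) q))))
  cap-twins relocated i e j e' c p with cap-twins T i e j e' (capped _ c) (at-cap _ _ c p)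
  ... | q , r = cong π q , trans (π-cap _) r
  cap-twin relocated i e c with cap-twin T i e (capped _ c)
  ... | j , e' , j≢i , p = j , e' , j≢i ,
    trans (cong node (π-fix (end T j e') (trans (cong (cap T) p) (capped _ c)))) (trans p (sym (fixed _ c)))
  cap-two relocated i e j e' k e'' c p q = cap-two T i e j e' k e'' (capped _ c) (at-cap _ _ c p) (at-cap _ _ c q)
  occupied relocated = occupied'

-- Subtraction modulo 3: `rot r p` is `p - r`, so that port `r` goes to `zero`.
rot : Fin 3 → Fin 3 → Fin 3
rot zero             p                = p
rot (suc zero)       zero             = suc (suc zero)
rot (suc zero)       (suc zero)       = zero
rot (suc zero)       (suc (suc zero)) = suc zero
rot (suc (suc zero)) zero             = suc zero
rot (suc (suc zero)) (suc zero)       = suc (suc zero)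
rot (suc (suc zero)) (suc (suc zero)) = zero

rot-injective : ∀ r p q → rot r p ≡ rot r q → p ≡ q
rot-injective r p q e = trans (sym (back r p)) (trans (cong (rot⁻ r) e) (back r q))
  where
  rot⁻ : Fin 3 → Fin 3 → Fin 3
  rot⁻ zero = id
  rot⁻ (suc zero) = rot (suc (suc zero))
  rot⁻ (suc (suc zero)) = rot (suc zero)
  back : ∀ r p → rot⁻ r (rot r p) ≡ p
  back = check₂ (λ r p → rot⁻ r (rot r p) ≟ p) refl

turn-rot : ∀ r p q → turn (rot r p) (rot r q) ≡ turn p q
turn-rot = check₃ (λ r p q → turn (rot r p) (rot r q) ℤ.≟ turn p q) refl

rot-self : ∀ p → rot p p ≡ zero
rot-self = check (λ p → rot p p ≟ zero) refl

-- Turning the triangles at the ends of `v` until `v` sits at port `zero` leaves the matrix alone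
-- and reduces all flips to fixed tables of ports.
module Rotate {N n : ℕ} (T : Triangulation N n) (v : Fin n) where

  amount : Fin N → Fin 3
  amount t = if cap T t then zero else
             if node (end T v false) == t then proj₂ (end T v false) else
             if node (end T v true) == t then proj₂ (end T v true) else zero

  spin : Port N → Port N
  spin (t , p) = t , rot (amount t) p

  rotated : Triangulation N n
  rotated = Relocate.relocated T spin
    (λ { {t , p} {s , q} e → inj-spin t p s q (cong proj₁ e) (cong proj₂ e) }) (λ _ → refl)
    (λ { (t , p) c → cong (t ,_) (cong (λ b → rot (if b then zero else
             if node (end T v false) == t then proj₂ (end T v false) else
             if node (end T v true) == t then proj₂ (end T v true) else zero) p) c) })
    (apart T) (occupied T)
    where
    inj-spin : ∀ t p s q → t ≡ s → rot (amount t) p ≡ rot (amount s) q → (t , p) ≡ (s , q)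
    inj-spin t p .t q refl e = cong (t ,_) (rot-injective (amount t) p q e)

  spin-weigh : ∀ x y → weigh (cap T) (spin x) (spin y) ≡ weigh (cap T) x y
  spin-weigh (t , p) (s , q) = go (t ≟ s)
    where
    go : Dec (t ≡ s) → weigh (cap T) (spin (t , p)) (spin (s , q)) ≡ weigh (cap T) (t , p) (s , q)
    go (no t≢s)   = trans (weigh-apart (cap T) t≢s) (sym (weigh-apart (cap T) t≢s))
    go (yes refl) = cong (λ w → if (t == t) ∧ not (cap T t) then w else + 0) (turn-rot (amount t) p q)

  rotated-matrix : matrix rotated ≈ matrix T
  rotated-matrix i j = Σb-cong₂ (λ e e' → spin-weigh (end T i e) (end T j e'))

  rotated-base : ∀ e → cap T (node (end T v e)) ≡ false → end rotated v e ≡ (node (end T v e) , zero)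
  rotated-base e c = cong (node (end T v e) ,_) (trans (cong (λ r → rot r (proj₂ (end T v e))) (amount-end e c)) (rot-self (proj₂ (end T v e))))
    where
    amount-end : ∀ e → cap T (node (end T v e)) ≡ false → amount (node (end T v e)) ≡ proj₂ (end T v e)
    amount-end false c rewrite c | ==-refl (node (end T v false)) = refl
    amount-end true  c rewrite c | ==-≢ (apart T v false) | ==-refl (node (end T v true)) = refl

-- Entries are written as a difference of two counts of which one is zero. In these counts the
-- correction of mutation is bilinear.
bump-exclusive : ∀ a b c d → a ≡ 0 ⊎ b ≡ 0 → c ≡ 0 ⊎ d ≡ 0 →
                 bump (+ a ℤ.- + b) (+ c ℤ.- + d) ≡ + a ℤ.* + c ℤ.- + b ℤ.* + d
bump-exclusive a b c d (inj₂ refl) (inj₂ refl) = trans (cong₂ bump (ℤₚ.+-identityʳ (+ a)) (ℤₚ.+-identityʳ (+ c)))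
  (trans (bump-pp a c) (trans (ℤₚ.pos-* a c) (sym (ℤₚ.+-identityʳ (+ a ℤ.* + c)))))
bump-exclusive a b c d (inj₂ refl) (inj₁ refl) = trans (cong₂ bump (ℤₚ.+-identityʳ (+ a)) (ℤₚ.+-identityˡ (- (+ d))))
  (trans (bump-pn a d) (sym (cong (λ x → x ℤ.+ + 0) (ℤₚ.*-zeroʳ (+ a)))))
bump-exclusive a b c d (inj₁ refl) (inj₂ refl) = trans (cong₂ bump (ℤₚ.+-identityˡ (- (+ b))) (ℤₚ.+-identityʳ (+ c)))
  (trans (bump-np b c) (sym (cong (λ x → + 0 ℤ.- x) (ℤₚ.*-zeroʳ (+ b)))))
bump-exclusive a b c d (inj₁ refl) (inj₁ refl) = trans (cong₂ bump (ℤₚ.+-identityˡ (- (+ b))) (ℤₚ.+-identityˡ (- (+ d))))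
  (trans (bump-nn b d) (trans (cong -_ (ℤₚ.pos-* b d)) (sym (ℤₚ.+-identityˡ (- (+ b ℤ.* + d))))))

neg-difference : ∀ a b → - (a ℤ.- b) ≡ b ℤ.- a
neg-difference = solve 2 (λ a b → :- (a :- b) := b :- a) refl where open ℤ-Solver

-- The counts add up over the ends of arcs, whereas `bump` does not. The condition that no vertex
-- has both arrows into and out of `v` is what lets mutation be checked end by end.
mutate-by-counts : ∀ {n} (v : Fin n) (M M' : Mat n) → SkewSym M → SkewSym M' → (ins outs : Fin n → ℕ) →
  (∀ i → i ≢ v → ins i ≡ 0 ⊎ outs i ≡ 0) →
  (∀ j → j ≢ v → M v j ≡ + outs j ℤ.- + ins j) →
  (∀ j → j ≢ v → M' v j ≡ + ins j ℤ.- + outs j) →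
  (∀ i j → i ≢ v → j ≢ v → M' i j ≡ M i j ℤ.+ (+ ins i ℤ.* + outs j ℤ.- + outs i ℤ.* + ins j)) → mutate v M ≈ M'
mutate-by-counts v M M' sk sk' ins outs exclusive row row' off = mutate-elim v M (λ i j x → x ≡ M' i j) first second third
  where
  first : ∀ j → - M v j ≡ M' v j
  first j with j ≟ v
  ... | yes refl = trans (cong -_ (skew-diagonal {B = M} sk j)) (sym (skew-diagonal {B = M'} sk' j))
  ... | no j≢v   = trans (cong -_ (row j j≢v)) (trans (neg-difference (+ outs j) (+ ins j)) (sym (row' j j≢v)))
  second : ∀ i → - M i v ≡ M' i v
  second i = trans (cong -_ (sk v i)) (trans (cong -_ (first i)) (sym (sk' v i)))
  third : ∀ i j → i ≢ v → j ≢ v → M i j ℤ.+ bump (M i v) (M v j) ≡ M' i j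
  third i j i≢v j≢v = trans (cong (λ x → M i j ℤ.+ x)
      (trans (cong₂ bump (trans (sk v i) (trans (cong -_ (row i i≢v)) (neg-difference (+ outs i) (+ ins i)))) (row j j≢v))
             (bump-exclusive (ins i) (outs i) (outs j) (ins j) (exclusive i i≢v) (swap⊎ (exclusive j j≢v)))))
    (sym (off i j i≢v j≢v))

Local : Set
Local = Bool × Fin 3

pattern one   = suc zero
pattern two   = suc (suc zero)

-- The weight between two ports at the nodes on either side of an arc, where capped says
-- which of the two nodes are caps.
localWeigh : (Bool → Bool) → Local → Local → ℤ
localWeigh capped (a , p) (b , q) = if does (a Bool.≟ b) ∧ not (capped a) then turn p q else + 0

uncapped : Bool → Bool
uncapped _ = false

-- Local coordinates in the two triangles at `v`. A side is named by the end of `v` lying there, and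
-- `base` puts `v` at port `zero` of both.
module Around {N n : ℕ} (T : Triangulation N n) (v : Fin n)
  (tri : ∀ e → cap T (node (end T v e)) ≡ false) (base : ∀ e → end T v e ≡ (node (end T v e) , zero)) where

  side : Bool → Fin N
  side b = node (end T v b)

  side-injective : ∀ {a b} → side a ≡ side b → a ≡ b
  side-injective {false} {false} _ = refl
  side-injective {true}  {true}  _ = refl
  side-injective {false} {true}  e = contradiction e (apart T v false)
  side-injective {true}  {false} e = contradiction e (apart T v true)

  loc : Local → Port N
  loc (b , p) = side b , p

  loc-injective : ∀ {x y} → loc x ≡ loc y → x ≡ y
  loc-injective e = cong₂ _,_ (side-injective (cong proj₁ e)) (cong proj₂ e)

  Away : Port N → Set
  Away x = ∀ b → node x ≢ side b

  data Place (x : Port N) : Set where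
    here : ∀ b → node x ≡ side b → Place x
    away : Away x → Place x

  place : ∀ x → Place x
  place x with node x ≟ side false | node x ≟ side true
  ... | yes p | _     = here false p
  ... | no _  | yes p = here true p
  ... | no p  | no q  = away λ { false → p ; true → q }

  locally : ∀ {A : Set} → (Local → A) → (Port N → A) → Port N → A
  locally f g x with place x
  ... | here b _ = f (b , proj₂ x)
  ... | away _   = g x

  locally-loc : ∀ {A : Set} (f : Local → A) (g : Port N → A) l → locally f g (loc l) ≡ f l
  locally-loc f g (b , p) with place (loc (b , p))
  ... | here c e = cong (λ b → f (b , p)) (side-injective (sym e))
  ... | away h   = contradiction refl (h b)

  locally-away : ∀ {A : Set} (f : Local → A) (g : Port N → A) {x} → Away x → locally f g x ≡ g x
  locally-away f g {x} h with place x
  ... | here b e = contradiction e (h b)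
  ... | away _   = refl

  -- `ok` describes the local ports that remain for the other arcs once those held by `v`, and by a
  -- folding partner, are excluded.
  data Spot (ok : Local → Set) : Port N → Set where
    local : ∀ l → ok l → Spot ok (loc l)
    away  : ∀ {x} → Away x → Spot ok x

  -- A second arc at this port would turn the other end of `v` into a cap.
  alone : ∀ {j e} b → end T j e ≡ loc (b , zero) → j ≡ v
  alone {j} {e} b p with j ≟ v
  ... | yes q = q
  ... | no j≢v = contradiction
    (trans (sym (proj₁ (port-twins T v b j e (j≢v ∘ sym) (trans (base b) (sym p)) (tri b)))) (tri (not b))) λ ()

  spot : ∀ (ok : Local → Set) {j e} → (∀ l → end T j e ≡ loc l → ok l) → Spot ok (end T j e)
  spot ok {j} {e} h = go (end T j e) (place (end T j e)) h
    where
    go : ∀ x → Place x → (∀ l → x ≡ loc l → ok l) → Spot ok x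
    go x (here b refl) h = local (b , proj₂ x) (h _ refl)
    go x (away k)      h = away k

  weigh-local : ∀ c {capped} → (∀ b → c (side b) ≡ capped b) → ∀ l m → weigh c (loc l) (loc m) ≡ localWeigh capped l m
  weigh-local c {capped} h (a , p) (b , q) with a Bool.≟ b
  ... | no a≢b = weigh-apart c (a≢b ∘ side-injective)
  ... | yes refl rewrite ==-refl (side a) | h a = refl

  weigh-local-away : ∀ c {l y} → Away y → weigh c (loc l) y ≡ + 0
  weigh-local-away c {b , _} h = weigh-apart c (λ e → h b (sym e))

  weigh-away-local : ∀ c {l x} → Away x → weigh c x (loc l) ≡ + 0
  weigh-away-local c {b , _} h = weigh-apart c (h b)

  -- A change confined to the two triangles at `v`. For a local port, `ins` and `outs` count the
  -- arrows towards `v` and away from it; `table`, `row` and `row'` are the mutation rule for single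
  -- ports, from which the rule for arcs follows by adding over ends.
  record Move : Set₁ where
    field
      move     : Local → Local
      ins outs : Local → ℕ
      cap'     : Fin N → Bool
      capped   : Bool → Bool
      cap-side : ∀ b → cap' (side b) ≡ capped b
      cap-away : ∀ t → (∀ b → t ≢ side b) → cap' t ≡ cap T t
      ok       : Local → Set
      stay     : ∀ b → move (b , zero) ≡ (b , zero)
      table    : ∀ l m → ok l → ok m → localWeigh capped (move l) (move m) ≡
                 localWeigh uncapped l m ℤ.+ (+ ins l ℤ.* + outs m ℤ.- + outs l ℤ.* + ins m)
      row      : ∀ m → ok m → localWeigh uncapped (false , zero) m ℤ.+ localWeigh uncapped (true , zero) m ≡ + outs m ℤ.- + ins m
      row'     : ∀ m → ok m → localWeigh capped (false , zero) (move m) ℤ.+ localWeigh capped (true , zero) (move m) ≡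
                 + ins m ℤ.- + outs m

    shift : Port N → Port N
    shift = locally (loc ∘ move) id

    entering leaving : Port N → ℕ
    entering = locally ins (λ _ → 0)
    leaving  = locally outs (λ _ → 0)

    Ins Outs : Fin n → ℕ
    Ins i  = entering (end T i false) ℕ.+ entering (end T i true)
    Outs i = leaving (end T i false) ℕ.+ leaving (end T i true)

    crossing : Port N → Port N → ℤ
    crossing x y = + entering x ℤ.* + leaving y ℤ.- + leaving x ℤ.* + entering y

    shift-loc : ∀ l → shift (loc l) ≡ loc (move l)
    shift-loc = locally-loc (loc ∘ move) id

    shift-away : ∀ {x} → Away x → shift x ≡ x
    shift-away = locally-away (loc ∘ move) id

    crossing-loc : ∀ l m → crossing (loc l) (loc m) ≡ + ins l ℤ.* + outs m ℤ.- + outs l ℤ.* + ins m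
    crossing-loc l m = cong₂ ℤ._-_
      (cong₂ (λ a b → + a ℤ.* + b) (locally-loc ins (λ _ → 0) l) (locally-loc outs (λ _ → 0) m))
      (cong₂ (λ a b → + a ℤ.* + b) (locally-loc outs (λ _ → 0) l) (locally-loc ins (λ _ → 0) m))

    crossing-awayˡ : ∀ {x} y → Away x → crossing x y ≡ + 0
    crossing-awayˡ y h = cong₂ (λ a b → + a ℤ.* + leaving y ℤ.- + b ℤ.* + entering y)
      (locally-away ins (λ _ → 0) h) (locally-away outs (λ _ → 0) h)

    crossing-awayʳ : ∀ x {y} → Away y → crossing x y ≡ + 0
    crossing-awayʳ x h = trans (cong₂ (λ a b → + entering x ℤ.* + a ℤ.- + leaving x ℤ.* + b)
      (locally-away outs (λ _ → 0) h) (locally-away ins (λ _ → 0) h))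
      (cong₂ ℤ._-_ (ℤₚ.*-zeroʳ (+ entering x)) (ℤₚ.*-zeroʳ (+ leaving x)))

    shift-weigh : ∀ {x y} → Spot ok x → Spot ok y → weigh cap' (shift x) (shift y) ≡ weigh (cap T) x y ℤ.+ crossing x y
    shift-weigh (local l p) (local m q) = trans (cong₂ (weigh cap') (shift-loc l) (shift-loc m))
      (trans (weigh-local cap' cap-side (move l) (move m)) (trans (table l m p q)
        (cong₂ ℤ._+_ (sym (weigh-local (cap T) tri l m)) (sym (crossing-loc l m)))))
    shift-weigh (local l p) (away {y} h) = trans (cong₂ (weigh cap') (shift-loc l) (shift-away h))
      (trans (weigh-local-away cap' h) (sym (cong₂ ℤ._+_ (weigh-local-away (cap T) h) (crossing-awayʳ (loc l) h))))
    shift-weigh (away {x} h) (local m q) = trans (cong₂ (weigh cap') (shift-away h) (shift-loc m))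
      (trans (weigh-away-local cap' h) (sym (cong₂ ℤ._+_ (weigh-away-local (cap T) h) (crossing-awayˡ (loc m) h))))
    shift-weigh (away {x} h) (away {y} k) = trans (cong₂ (weigh cap') (shift-away h) (shift-away k))
      (trans (cong (λ c → if (node x == node y) ∧ not c then turn (proj₂ x) (proj₂ y) else + 0) (cap-away (node x) h))
        (sym (trans (cong (λ z → weigh (cap T) x y ℤ.+ z) (crossing-awayˡ y h)) (ℤₚ.+-identityʳ _))))

    sum-crossing : ∀ w₁ w₂ w₃ w₄ i₁ o₁ i₂ o₂ j₁ q₁ j₂ q₂ →
      ((w₁ ℤ.+ (i₁ ℤ.* q₁ ℤ.- o₁ ℤ.* j₁)) ℤ.+ (w₂ ℤ.+ (i₁ ℤ.* q₂ ℤ.- o₁ ℤ.* j₂))) ℤ.+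
      ((w₃ ℤ.+ (i₂ ℤ.* q₁ ℤ.- o₂ ℤ.* j₁)) ℤ.+ (w₄ ℤ.+ (i₂ ℤ.* q₂ ℤ.- o₂ ℤ.* j₂))) ≡
      ((w₁ ℤ.+ w₂) ℤ.+ (w₃ ℤ.+ w₄)) ℤ.+ ((i₁ ℤ.+ i₂) ℤ.* (q₁ ℤ.+ q₂) ℤ.- (o₁ ℤ.+ o₂) ℤ.* (j₁ ℤ.+ j₂))
    sum-crossing = solve 12 (λ w₁ w₂ w₃ w₄ i₁ o₁ i₂ o₂ j₁ q₁ j₂ q₂ →
      ((w₁ :+ (i₁ :* q₁ :- o₁ :* j₁)) :+ (w₂ :+ (i₁ :* q₂ :- o₁ :* j₂))) :+
      ((w₃ :+ (i₂ :* q₁ :- o₂ :* j₁)) :+ (w₄ :+ (i₂ :* q₂ :- o₂ :* j₂))) :=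
      ((w₁ :+ w₂) :+ (w₃ :+ w₄)) :+ ((i₁ :+ i₂) :* (q₁ :+ q₂) :- (o₁ :+ o₂) :* (j₁ :+ j₂))) refl
      where open ℤ-Solver

    Spots : Fin n → Set
    Spots i = ∀ e → Spot ok (end T i e)

    shift-matrix : ∀ {i j} → Spots i → Spots j →
      (Σb λ e → Σb λ e' → weigh cap' (shift (end T i e)) (shift (end T j e'))) ≡
      matrix T i j ℤ.+ (+ Ins i ℤ.* + Outs j ℤ.- + Outs i ℤ.* + Ins j)
    shift-matrix {i} {j} si sj = trans (Σb-cong₂ (λ e e' → shift-weigh (si e) (sj e')))
      (sum-crossing (w false false) (w false true) (w true false) (w true true)
        (+ entering (end T i false)) (+ leaving (end T i false)) (+ entering (end T i true)) (+ leaving (end T i true))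
        (+ entering (end T j false)) (+ leaving (end T j false)) (+ entering (end T j true)) (+ leaving (end T j true)))
      where
      w : Bool → Bool → ℤ
      w e e' = weigh (cap T) (end T i e) (end T j e')

    interchange : ∀ a b c d → (a ℤ.+ b) ℤ.+ (c ℤ.+ d) ≡ (a ℤ.+ c) ℤ.+ (b ℤ.+ d)
    interchange = solve 4 (λ a b c d → (a :+ b) :+ (c :+ d) := (a :+ c) :+ (b :+ d)) refl where open ℤ-Solver

    collect : ∀ a b c d → (a ℤ.- b) ℤ.+ (c ℤ.- d) ≡ (a ℤ.+ c) ℤ.- (b ℤ.+ d)
    collect = solve 4 (λ a b c d → (a :- b) :+ (c :- d) := (a :+ c) :- (b :+ d)) refl where open ℤ-Solver

    spoke : ∀ {y} → Spot ok y → weigh (cap T) (end T v false) y ℤ.+ weigh (cap T) (end T v true) y ≡ + leaving y ℤ.- + entering y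
    spoke {y} s = trans (cong₂ (λ x x' → weigh (cap T) x y ℤ.+ weigh (cap T) x' y) (base false) (base true)) (go s)
      where
      go : ∀ {y} → Spot ok y → weigh (cap T) (loc (false , zero)) y ℤ.+ weigh (cap T) (loc (true , zero)) y ≡ + leaving y ℤ.- + entering y
      go (local m q) = trans (cong₂ ℤ._+_ (weigh-local (cap T) tri (false , zero) m) (weigh-local (cap T) tri (true , zero) m))
        (trans (row m q) (sym (cong₂ (λ a b → + a ℤ.- + b) (locally-loc outs (λ _ → 0) m) (locally-loc ins (λ _ → 0) m))))
      go (away h) = trans (cong₂ ℤ._+_ (weigh-local-away (cap T) h) (weigh-local-away (cap T) h))
        (sym (cong₂ (λ a b → + a ℤ.- + b) (locally-away outs (λ _ → 0) h) (locally-away ins (λ _ → 0) h)))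

    spoke' : ∀ {y} → Spot ok y → weigh cap' (loc (false , zero)) (shift y) ℤ.+ weigh cap' (loc (true , zero)) (shift y) ≡
             + entering y ℤ.- + leaving y
    spoke' (local m q) = trans (cong (λ y → weigh cap' (loc (false , zero)) y ℤ.+ weigh cap' (loc (true , zero)) y) (shift-loc m))
      (trans (cong₂ ℤ._+_ (weigh-local cap' cap-side (false , zero) (move m)) (weigh-local cap' cap-side (true , zero) (move m)))
        (trans (row' m q) (sym (cong₂ (λ a b → + a ℤ.- + b) (locally-loc ins (λ _ → 0) m) (locally-loc outs (λ _ → 0) m)))))
    spoke' {y} (away h) = trans (cong (λ y → weigh cap' (loc (false , zero)) y ℤ.+ weigh cap' (loc (true , zero)) y) (shift-away h))
      (trans (cong₂ ℤ._+_ (weigh-local-away cap' h) (weigh-local-away cap' h))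
        (sym (cong₂ (λ a b → + a ℤ.- + b) (locally-away ins (λ _ → 0) h) (locally-away outs (λ _ → 0) h))))

    matrix-row : ∀ {j} → Spots j → matrix T v j ≡ + Outs j ℤ.- + Ins j
    matrix-row {j} sj = trans (interchange (w false false) (w false true) (w true false) (w true true))
      (trans (cong₂ ℤ._+_ (spoke (sj false)) (spoke (sj true)))
        (collect (+ leaving (end T j false)) (+ entering (end T j false)) (+ leaving (end T j true)) (+ entering (end T j true))))
      where
      w : Bool → Bool → ℤ
      w e e' = weigh (cap T) (end T v e) (end T j e')

    shift-base : ∀ b → shift (end T v b) ≡ loc (b , zero)
    shift-base b = trans (cong shift (base b)) (trans (shift-loc (b , zero)) (cong loc (stay b)))

    shift-row : ∀ {j} → Spots j → (Σb λ e → Σb λ e' → weigh cap' (shift (end T v e)) (shift (end T j e'))) ≡ + Ins j ℤ.- + Outs j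
    shift-row {j} sj = trans (Σb-cong₂ (λ e e' → cong (λ x → weigh cap' x (shift (end T j e'))) (shift-base e)))
      (trans (interchange (w false false) (w false true) (w true false) (w true true))
      (trans (cong₂ ℤ._+_ (spoke' (sj false)) (spoke' (sj true)))
        (collect (+ entering (end T j false)) (+ leaving (end T j false)) (+ entering (end T j true)) (+ leaving (end T j true)))))
      where
      w : Bool → Bool → ℤ
      w e e' = weigh cap' (loc (e , zero)) (shift (end T j e'))

    crosses : Port N → Bool
    crosses = locally (λ l → proj₁ (move l) xor proj₁ l) (λ _ → false)

    coefficient : Vect n
    coefficient j = crosses (end T j false) xor crosses (end T j true)

    crosses-base : ∀ b → crosses (end T v b) ≡ false
    crosses-base b = trans (cong crosses (base b)) (trans (locally-loc _ _ (b , zero))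
      (trans (cong (λ l → proj₁ l xor b) (stay b)) (xor-self b)))

    coefficient-v : coefficient v ≡ false
    coefficient-v = cong₂ _xor_ (crosses-base false) (crosses-base true)

    -- An end that changes sides leaves one side and enters the other, so its contribution changes
    -- by the boundary of `v`.
    shift-at : ∀ x t → (node (shift x) == t) xor (crosses x ∧ ((side false == t) xor (side true == t))) ≡ (node x == t)
    shift-at x t = go (spot? x)
      where
      spot? : ∀ x → Spot (λ _ → ⊤) x
      spot? x = aux x (place x)
        where
        aux : ∀ x → Place x → Spot (λ _ → ⊤) x
        aux x (here b refl) = local (b , proj₂ x) tt
        aux x (away h)      = away h
      sides : ∀ a b → (side a == t) xor ((a xor b) ∧ ((side false == t) xor (side true == t))) ≡ (side b == t)
      sides false false = Boolₚ.xor-identityʳ _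
      sides true  true  = Boolₚ.xor-identityʳ _
      sides false true  = trans (sym (Boolₚ.xor-assoc (side false == t) _ _)) (cong (_xor (side true == t)) (xor-self (side false == t)))
      sides true  false = trans (cong ((side true == t) xor_) (Boolₚ.xor-comm (side false == t) _))
        (trans (sym (Boolₚ.xor-assoc (side true == t) _ _)) (cong (_xor (side false == t)) (xor-self (side true == t))))
      go : ∀ {x} → Spot (λ _ → ⊤) x → (node (shift x) == t) xor (crosses x ∧ ((side false == t) xor (side true == t))) ≡ (node x == t)
      go (local l _) = trans (cong₂ (λ x c → (node x == t) xor (c ∧ ((side false == t) xor (side true == t))))
                                    (shift-loc l) (locally-loc _ _ l)) (sides (proj₁ (move l)) (proj₁ l))
      go (away h) = trans (cong₂ (λ x c → (node x == t) xor (c ∧ ((side false == t) xor (side true == t))))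
                                 (shift-away h) (locally-away _ _ h)) (Boolₚ.xor-identityʳ _)

    -- The coefficient of `j` is the number of its ends that change sides, modulo 2. An arc with
    -- both ends changing keeps its boundary.
    shifted-intertwines : (T' : Triangulation N n) → (∀ j e → end T' j e ≡ shift (end T j e)) → ∃[ φ ] Intertwines T T' φ
    shifted-intertwines T' h = Transvection.transvection v coefficient coefficient-v ,
      Transvection.intertwines v coefficient coefficient-v T T' at-change
      where
      at-change : ∀ j t → at T' j t xor (coefficient j ∧ at T' v t) ≡ at T j t
      at-change j t = begin
        at T' j t xor (coefficient j ∧ at T' v t)
          ≡⟨ cong₂ _xor_ (cong₂ (λ x y → (node x == t) xor (node y == t)) (h j false) (h j true))
               (cong (coefficient j ∧_) (cong₂ (λ x y → (node x == t) xor (node y == t))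
                 (trans (h v false) (shift-base false)) (trans (h v true) (shift-base true)))) ⟩
        (a xor b) xor ((crosses (end T j false) xor crosses (end T j true)) ∧ s)
          ≡⟨ distribute a b (crosses (end T j false)) (crosses (end T j true)) s ⟩
        (a xor (crosses (end T j false) ∧ s)) xor (b xor (crosses (end T j true) ∧ s))
          ≡⟨ cong₂ _xor_ (shift-at (end T j false) t) (shift-at (end T j true) t) ⟩
        at T j t ∎
        where
        open ≡-Reasoning
        a b s : Bool
        a = node (shift (end T j false)) == t
        b = node (shift (end T j true)) == t
        s = (side false == t) xor (side true == t)
        distribute : ∀ a b c d s → (a xor b) xor ((c xor d) ∧ s) ≡ (a xor (c ∧ s)) xor (b xor (d ∧ s))
        distribute = solve 5 (λ a b c d s → (a :+ b) :+ (c :+ d) :* s := (a :+ c :* s) :+ (b :+ d :* s)) refl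
          where open xor-∧-Solver

-- Ordinary flips

Step : ∀ {N n} → Triangulation N n → Fin n → Triangulation N n → Set
Step T v T' = mutate v (matrix T) ≈ matrix T' × ∃[ φ ] Intertwines T T' φ

local-≡ : ∀ {b c : Bool} {p q : Fin 3} → b ≡ c → p ≡ q → (b , p) ≡ (c , q)
local-≡ refl refl = refl

-- The other diagonal of the quadrilateral around `v`: each new triangle keeps the side at port
-- `two` of its old triangle and takes over the side at port `one` of the opposite triangle.
flipMove flipBack : Local → Local
flipMove (b , zero) = b , zero
flipMove (b , one)  = not b , two
flipMove (b , two)  = b , one
flipBack (b , zero) = b , zero
flipBack (b , one)  = b , two
flipBack (b , two)  = not b , one

flipIns flipOuts : Local → ℕ
flipIns (_ , zero)  = 0
flipIns (_ , one)   = 0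
flipIns (_ , two)   = 1
flipOuts (_ , zero) = 0
flipOuts (_ , one)  = 1
flipOuts (_ , two)  = 0

flipBack-flipMove : ∀ l → flipBack (flipMove l) ≡ l
flipBack-flipMove (b , zero) = refl
flipBack-flipMove (b , one)  = local-≡ (Boolₚ.not-involutive b) refl
flipBack-flipMove (b , two)  = refl

-- `noFold` excludes an arc at port `one` of one side and port `two` of the other. The move would
-- bring both its ends to the same node, and in the matrix its arrows to and from `v` would cancel,
-- against the condition of `mutate-by-counts`.
module FlipArc {N n : ℕ} (T : Triangulation N n) (v : Fin n)
  (tri : ∀ e → cap T (node (end T v e)) ≡ false) (base : ∀ e → end T v e ≡ (node (end T v e) , zero))
  (noFold : ∀ b i e → end T i e ≡ (node (end T v b) , one) → end T i (not e) ≢ (node (end T v (not b)) , two)) where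

  open Around T v tri base

  moveData : Move
  moveData = record
    { move = flipMove ; ins = flipIns ; outs = flipOuts ; cap' = cap T ; capped = uncapped
    ; cap-side = tri ; cap-away = λ _ _ → refl ; ok = λ l → proj₂ l ≢ zero ; stay = λ _ → refl
    ; table = table ; row = row ; row' = row' }
    where
    table : ∀ l m → proj₂ l ≢ zero → proj₂ m ≢ zero → localWeigh uncapped (flipMove l) (flipMove m) ≡
            localWeigh uncapped l m ℤ.+ (+ flipIns l ℤ.* + flipOuts m ℤ.- + flipOuts l ℤ.* + flipIns m)
    table (_ , zero)    _            p q = contradiction refl p
    table _             (_ , zero)   p q = contradiction refl q
    table (false , one) (false , one) p q = refl
    table (false , one) (true , one)  p q = refl
    table (false , one) (false , two) p q = refl
    table (false , one) (true , two)  p q = refl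
    table (true , one)  (false , one) p q = refl
    table (true , one)  (true , one)  p q = refl
    table (true , one)  (false , two) p q = refl
    table (true , one)  (true , two)  p q = refl
    table (false , two) (false , one) p q = refl
    table (false , two) (true , one)  p q = refl
    table (false , two) (false , two) p q = refl
    table (false , two) (true , two)  p q = refl
    table (true , two)  (false , one) p q = refl
    table (true , two)  (true , one)  p q = refl
    table (true , two)  (false , two) p q = refl
    table (true , two)  (true , two)  p q = refl
    row : ∀ m → proj₂ m ≢ zero →
          localWeigh uncapped (false , zero) m ℤ.+ localWeigh uncapped (true , zero) m ≡ + flipOuts m ℤ.- + flipIns m
    row (_ , zero)    q = contradiction refl q
    row (false , one) q = refl
    row (true , one)  q = refl
    row (false , two) q = refl
    row (true , two)  q = refl
    row' : ∀ m → proj₂ m ≢ zero →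
           localWeigh uncapped (false , zero) (flipMove m) ℤ.+ localWeigh uncapped (true , zero) (flipMove m) ≡
           + flipIns m ℤ.- + flipOuts m
    row' (_ , zero)    q = contradiction refl q
    row' (false , one) q = refl
    row' (true , one)  q = refl
    row' (false , two) q = refl
    row' (true , two)  q = refl

  open Move moveData

  spots : ∀ {j} → j ≢ v → Spots j
  spots j≢v e = spot ok (λ { (b , p) q r → j≢v (alone b (trans q (cong (λ p → side b , p) r))) })

  unshift : Port N → Port N
  unshift = locally (loc ∘ flipBack) id

  unshift-shift : ∀ x → unshift (shift x) ≡ x
  unshift-shift x = go (place x)
    where
    go : Place x → unshift (shift x) ≡ x
    go (here b refl) = trans (cong unshift (shift-loc (b , proj₂ x)))
      (trans (locally-loc (loc ∘ flipBack) id (flipMove (b , proj₂ x))) (cong loc (flipBack-flipMove (b , proj₂ x))))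
    go (away h) = trans (cong unshift (shift-away h)) (locally-away (loc ∘ flipBack) id h)

  shift-cap : ∀ x → cap T (node (shift x)) ≡ cap T (node x)
  shift-cap x = go (place x)
    where
    go : Place x → cap T (node (shift x)) ≡ cap T (node x)
    go (here b refl) = trans (cong (cap T ∘ node) (shift-loc (b , proj₂ x)))
      (trans (tri (proj₁ (flipMove (b , proj₂ x)))) (sym (tri b)))
    go (away h) = cong (cap T ∘ node) (shift-away h)

  capped-away : ∀ x → cap T (node x) ≡ true → Away x
  capped-away x c b e = contradiction (trans (sym c) (trans (cong (cap T) e) (tri b))) λ ()

  shift-apart : ∀ i e → node (shift (end T i e)) ≢ node (shift (end T i (not e)))
  shift-apart i e with i ≟ v
  ... | yes refl = λ r → apart T v e (trans (cong node (sym (shift-base e))) (trans r (cong node (shift-base (not e)))))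
  ... | no i≢v   = go (end T i e) (end T i (not e)) (spots i≢v e) (spots i≢v (not e)) (apart T i e)
                      (λ b p → noFold b i e p)
                      (λ b p q → noFold b i (not e) q (trans (cong (end T i) (Boolₚ.not-involutive e)) p))
    where
    sides : ∀ l m → proj₂ l ≢ zero → proj₂ m ≢ zero → proj₁ l ≢ proj₁ m → proj₁ (flipMove l) ≡ proj₁ (flipMove m) →
            (∃[ b ] l ≡ (b , one) × m ≡ (not b , two)) ⊎ (∃[ b ] l ≡ (not b , two) × m ≡ (b , one))
    sides (_ , zero)    _            p q r s = contradiction refl p
    sides _             (_ , zero)   p q r s = contradiction refl q
    sides (a , two)     (b , two)    p q r s = contradiction s r
    sides (a , one)     (b , one)    p q r s = contradiction (Boolₚ.not-injective s) r
    sides (a , one)     (b , two)    p q r s = inj₁ (a , refl , local-≡ (sym s) refl)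
    sides (a , two)     (b , one)    p q r s = inj₂ (b , local-≡ s refl , refl)
    go : ∀ x y → Spot ok x → Spot ok y → node x ≢ node y →
         (∀ b → x ≡ loc (b , one) → y ≢ loc (not b , two)) → (∀ b → x ≡ loc (not b , two) → y ≢ loc (b , one)) →
         node (shift x) ≢ node (shift y)
    go _ _ (local l p) (local m q) h f g r with sides l m p q (λ s → h (cong side s))
      (side-injective (trans (sym (cong node (shift-loc l))) (trans r (cong node (shift-loc m)))))
    ... | inj₁ (b , refl , refl) = f b refl refl
    ... | inj₂ (b , refl , refl) = g b refl refl
    go _ y (local l p) (away k) h f g r = k (proj₁ (flipMove l))
      (trans (cong node (sym (shift-away k))) (trans (sym r) (cong node (shift-loc l))))
    go x _ (away k) (local m q) h f g r = k (proj₁ (flipMove m))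
      (trans (cong node (sym (shift-away k))) (trans r (cong node (shift-loc m))))
    go x y (away k) (away k') h f g r = h (trans (cong node (sym (shift-away k))) (trans r (cong node (shift-away k'))))

  shift-occupied : ∀ t → ∃[ i ] ∃[ e ] node (shift (end T i e)) ≡ t
  shift-occupied t with occupied T t
  ... | i , e , refl = go (place (end T i e))
    where
    go : Place (end T i e) → ∃[ j ] ∃[ e' ] node (shift (end T j e')) ≡ node (end T i e)
    go (here b p) = v , b , trans (cong node (shift-base b)) (sym p)
    go (away h)   = i , e , cong node (shift-away h)

  flipped : Triangulation N n
  flipped = Relocate.relocated T shift
    (λ {x} {y} e → trans (sym (unshift-shift x)) (trans (cong unshift e) (unshift-shift y)))
    shift-cap (λ x c → shift-away (capped-away x c)) shift-apart shift-occupied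

  exclusive : ∀ i → i ≢ v → Ins i ≡ 0 ⊎ Outs i ≡ 0
  exclusive i i≢v = go (end T i false) (end T i true) (spots i≢v false) (spots i≢v true) (apart T i false)
    (λ b p → noFold b i false p) (λ b p → noFold b i true p)
    where
    go : ∀ x y → Spot ok x → Spot ok y → node x ≢ node y →
         (∀ b → x ≡ loc (b , one) → y ≢ loc (not b , two)) → (∀ b → y ≡ loc (b , one) → x ≢ loc (not b , two)) →
         entering x ℕ.+ entering y ≡ 0 ⊎ leaving x ℕ.+ leaving y ≡ 0
    go _ _ (local (_ , zero) p) _ h f g = contradiction refl p
    go _ _ _ (local (_ , zero) q) h f g = contradiction refl q
    go _ _ (local l@(_ , one) p) (local m@(_ , one) q) h f g = inj₁ (cong₂ ℕ._+_ (locally-loc flipIns _ l) (locally-loc flipIns _ m))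
    go _ _ (local l@(_ , two) p) (local m@(_ , two) q) h f g = inj₂ (cong₂ ℕ._+_ (locally-loc flipOuts _ l) (locally-loc flipOuts _ m))
    go _ _ (local (a , one) p) (local (b , two) q) h f g =
      ⊥-elim (f a refl (cong loc (local-≡ (Boolₚ.¬-not λ e → h (cong side (sym e))) refl)))
    go _ _ (local (a , two) p) (local (b , one) q) h f g =
      ⊥-elim (g b refl (cong loc (local-≡ (Boolₚ.¬-not λ e → h (cong side e)) refl)))
    go _ _ (local l@(_ , one) p) (away k) h f g = inj₁ (cong₂ ℕ._+_ (locally-loc flipIns _ l) (locally-away flipIns _ k))
    go _ _ (local l@(_ , two) p) (away k) h f g = inj₂ (cong₂ ℕ._+_ (locally-loc flipOuts _ l) (locally-away flipOuts _ k))
    go _ _ (away k) (local l@(_ , one) p) h f g = inj₁ (cong₂ ℕ._+_ (locally-away flipIns _ k) (locally-loc flipIns _ l))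
    go _ _ (away k) (local l@(_ , two) p) h f g = inj₂ (cong₂ ℕ._+_ (locally-away flipOuts _ k) (locally-loc flipOuts _ l))
    go _ _ (away k) (away k') h f g = inj₁ (cong₂ ℕ._+_ (locally-away flipIns _ k) (locally-away flipIns _ k'))

  flip-step : Step T v flipped
  flip-step = mutate-by-counts v (matrix T) (matrix flipped) (matrix-skew T) (matrix-skew flipped) Ins Outs exclusive
      (λ j j≢v → matrix-row (spots j≢v)) (λ j j≢v → shift-row (spots j≢v)) (λ i j i≢v j≢v → shift-matrix (spots i≢v) (spots j≢v)) ,
    shifted-intertwines flipped (λ _ _ → refl)

-- Flips that create a self-folded triangle

-- `b` is the side where the partner sits at port `one`; on the other side it sits at `two`. These
-- two ports go to the ports `zero`, next to `v`. The remaining two, the outer sides of the digon,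
-- complete the triangle at side `b`, and the other side becomes the cap.
foldMove : Bool → Local → Local
foldMove b     (c , zero)    = c , zero
foldMove false (false , one) = false , zero
foldMove false (false , two) = false , one
foldMove false (true , one)  = false , two
foldMove false (true , two)  = true , zero
foldMove true  (true , one)  = true , zero
foldMove true  (true , two)  = true , one
foldMove true  (false , one) = true , two
foldMove true  (false , two) = false , zero

foldIns foldOuts : Bool → Local → ℕ
foldIns false (false , two)  = 1
foldIns true  (true , two)   = 1
foldIns _     _              = 0
foldOuts false (true , one)  = 1
foldOuts true  (false , one) = 1
foldOuts _     _             = 0

foldCapped : Bool → Bool → Bool
foldCapped false c = c
foldCapped true  c = not c

data FoldSpot (b : Bool) : Local → Set where
  inner : FoldSpot b (b , two)
  outer : FoldSpot b (not b , one)

weigh-disjoint : ∀ f a b → localWeigh f (a , zero) (b , zero) ≡ + 0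
weigh-disjoint f false false with f false
... | true  = refl
... | false = refl
weigh-disjoint f true  true with f true
... | true  = refl
... | false = refl
weigh-disjoint f false true  = refl
weigh-disjoint f true  false = refl

Σb-from : ∀ b (f : Bool → ℤ) → Σb f ≡ f b ℤ.+ f (not b)
Σb-from false f = refl
Σb-from true  f = ℤₚ.+-comm (f false) (f true)

module Partner {N n : ℕ} (T : Triangulation N n) (v : Fin n)
  (tri : ∀ e → cap T (node (end T v e)) ≡ false) (base : ∀ e → end T v e ≡ (node (end T v e) , zero))
  (b : Bool) (w : Fin n) (e₁ : Bool)
  (w-one : end T w e₁ ≡ (node (end T v b) , one)) (w-two : end T w (not e₁) ≡ (node (end T v (not b)) , two)) where

  open Around T v tri base

  w≢v : w ≢ v
  w≢v refl with trans (sym w-one) (base e₁)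
  ... | ()

  w-alone : ∀ {j e} → end T j e ≡ loc (b , one) → j ≡ w
  w-alone {j} {e} p with j ≟ w
  ... | yes q = q
  ... | no j≢w = contradiction (trans (sym (proj₁ (port-twins T w e₁ j e (j≢w ∘ sym) (trans w-one (sym p))
          (trans (cong (cap T ∘ node) w-one) (tri b))))) (trans (cong (cap T ∘ node) w-two) (tri (not b)))) λ ()

  w-alone′ : ∀ {j e} → end T j e ≡ loc (not b , two) → j ≡ w
  w-alone′ {j} {e} p with j ≟ w
  ... | yes q = q
  ... | no j≢w = contradiction (trans (sym (proj₁ (port-twins T w (not e₁) j e (j≢w ∘ sym) (trans w-two (sym p))
          (trans (cong (cap T ∘ node) w-two) (tri (not b))))))
          (trans (cong (λ e → cap T (node (end T w e))) (Boolₚ.not-involutive e₁)) (trans (cong (cap T ∘ node) w-one) (tri b)))) λ ()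

  w-sum : (f : Port N → ℤ) → (Σb λ e → f (end T w e)) ≡ f (loc (b , one)) ℤ.+ f (loc (not b , two))
  w-sum f = trans (Σb-from e₁ (λ e → f (end T w e))) (cong₂ (λ x y → f x ℤ.+ f y) w-one w-two)

  -- The partner follows `v` in one triangle and precedes it in the other, so the two arrows cancel.
  matrix-vw : matrix T v w ≡ + 0
  matrix-vw = trans (Σb-cong₂ (λ e e' → cong (λ x → weigh (cap T) x (end T w e')) (base e)))
    (trans (Σb-cong (λ e → w-sum (λ y → weigh (cap T) (loc (e , zero)) y)))
      (trans (Σb-cong (λ e → cong₂ ℤ._+_ (weigh-local (cap T) tri (e , zero) (b , one)) (weigh-local (cap T) tri (e , zero) (not b , two))))
             (compute b)))
    where
    compute : ∀ b → (Σb λ e → localWeigh uncapped (e , zero) (b , one) ℤ.+ localWeigh uncapped (e , zero) (not b , two)) ≡ + 0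
    compute false = refl
    compute true  = refl

-- The arcs v and w cut out a once-punctured digon, in which the flip of v is a loop around w:
-- the triangle on the other side of v becomes a cap with arcs v and w.
module FoldArc {N n : ℕ} (T : Triangulation N n) (v : Fin n)
  (tri : ∀ e → cap T (node (end T v e)) ≡ false) (base : ∀ e → end T v e ≡ (node (end T v e) , zero))
  (b : Bool) (w : Fin n) (e₁ : Bool)
  (w-one : end T w e₁ ≡ (node (end T v b) , one)) (w-two : end T w (not e₁) ≡ (node (end T v (not b)) , two))
  (noFold : ∀ i e → end T i e ≡ (node (end T v (not b)) , one) → end T i (not e) ≢ (node (end T v b) , two)) where

  open Around T v tri base public
  open Partner T v tri base b w e₁ w-one w-two public

  foldCap : Fin N → Bool
  foldCap t = if t == side (not b) then true else cap T t

  foldCap-side : ∀ c → foldCap (side c) ≡ foldCapped b c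
  foldCap-side c with c Bool.≟ b
  ... | yes refl = trans (cong (λ t → if t then true else cap T (side b)) (==-≢ (apart T v b))) (trans (tri b) (sym (compute b)))
    where
    compute : ∀ b → foldCapped b b ≡ false
    compute false = refl
    compute true  = refl
  ... | no c≢b with Boolₚ.¬-not c≢b
  ...   | refl = trans (cong (λ t → if t then true else cap T (side (not b))) (==-refl (side (not b)))) (sym (compute b))
    where
    compute : ∀ b → foldCapped b (not b) ≡ true
    compute false = refl
    compute true  = refl

  moveData : Move
  moveData = record
    { move = foldMove b ; ins = foldIns b ; outs = foldOuts b ; cap' = foldCap ; capped = foldCapped b
    ; cap-side = foldCap-side ; cap-away = λ t h → cong (λ c → if c then true else cap T t) (==-≢ (h (not b)))
    ; ok = FoldSpot b ; stay = λ _ → refl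
    ; table = table b ; row = row b ; row' = row' b }
    where
    table : ∀ b l m → FoldSpot b l → FoldSpot b m → localWeigh (foldCapped b) (foldMove b l) (foldMove b m) ≡
            localWeigh uncapped l m ℤ.+ (+ foldIns b l ℤ.* + foldOuts b m ℤ.- + foldOuts b l ℤ.* + foldIns b m)
    table false _ _ inner inner = refl
    table false _ _ inner outer = refl
    table false _ _ outer inner = refl
    table false _ _ outer outer = refl
    table true  _ _ inner inner = refl
    table true  _ _ inner outer = refl
    table true  _ _ outer inner = refl
    table true  _ _ outer outer = refl
    row : ∀ b m → FoldSpot b m →
          localWeigh uncapped (false , zero) m ℤ.+ localWeigh uncapped (true , zero) m ≡ + foldOuts b m ℤ.- + foldIns b m
    row false _ inner = refl
    row false _ outer = refl
    row true  _ inner = refl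
    row true  _ outer = refl
    row' : ∀ b m → FoldSpot b m →
           localWeigh (foldCapped b) (false , zero) (foldMove b m) ℤ.+ localWeigh (foldCapped b) (true , zero) (foldMove b m) ≡
           + foldIns b m ℤ.- + foldOuts b m
    row' false _ inner = refl
    row' false _ outer = refl
    row' true  _ inner = refl
    row' true  _ outer = refl

  open Move moveData public hiding (cap-side; cap-away; cap')

  Regular Special : Fin n → Set
  Regular j = j ≢ v × j ≢ w
  Special j = j ≡ v ⊎ j ≡ w

  kind : ∀ j → Special j ⊎ Regular j
  kind j with j ≟ v | j ≟ w
  ... | yes p | _     = inj₁ (inj₁ p)
  ... | no _  | yes q = inj₁ (inj₂ q)
  ... | no p  | no q  = inj₂ (p , q)

  spots : ∀ {j} → Regular j → Spots j
  spots {j} (j≢v , j≢w) e = spot ok λ { (c , p) q → classify c p q (Boolₚ._≟_ c b) }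
    where
    classify : ∀ c p → end T j e ≡ loc (c , p) → Dec (c ≡ b) → FoldSpot b (c , p)
    classify c zero q _ = contradiction (alone c q) j≢v
    classify c one  q (yes refl) = contradiction (w-alone q) j≢w
    classify c two  q (yes refl) = inner
    classify c one  q (no c≢b) = subst (λ c → FoldSpot b (c , one)) (sym (Boolₚ.¬-not c≢b)) outer
    classify c two  q (no c≢b) = contradiction (w-alone′ (trans q (cong loc (local-≡ (Boolₚ.¬-not c≢b) refl)))) j≢w

  shift-one : shift (end T w e₁) ≡ loc (b , zero)
  shift-one = trans (cong shift w-one) (trans (shift-loc (b , one)) (cong loc (compute b)))
    where
    compute : ∀ b → foldMove b (b , one) ≡ (b , zero)
    compute false = refl
    compute true  = refl

  shift-two : shift (end T w (not e₁)) ≡ loc (not b , zero)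
  shift-two = trans (cong shift w-two) (trans (shift-loc (not b , two)) (cong loc (compute b)))
    where
    compute : ∀ b → foldMove b (not b , two) ≡ (not b , zero)
    compute false = refl
    compute true  = refl

  special-end : ∀ {j} → Special j → ∀ e → ∃[ c ] shift (end T j e) ≡ loc (c , zero) × shift (end T j (not e)) ≡ loc (not c , zero)
  special-end (inj₁ refl) e = e , shift-base e , shift-base (not e)
  special-end (inj₂ refl) e with e Bool.≟ e₁
  ... | yes refl = b , shift-one , shift-two
  ... | no e≢e₁ with Boolₚ.¬-not e≢e₁
  ...   | refl = not b , shift-two , trans (cong (shift ∘ end T w) (Boolₚ.not-involutive e₁))
                   (trans shift-one (cong loc (local-≡ (sym (Boolₚ.not-involutive b)) refl)))

  cap-b : foldCap (side b) ≡ false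
  cap-b = trans (foldCap-side b) (compute b)
    where
    compute : ∀ b → foldCapped b b ≡ false
    compute false = refl
    compute true  = refl

  cap-not-b : foldCap (side (not b)) ≡ true
  cap-not-b = trans (foldCap-side (not b)) (compute b)
    where
    compute : ∀ b → foldCapped b (not b) ≡ true
    compute false = refl
    compute true  = refl

  capped-not-b : ∀ {c} → foldCap (side c) ≡ true → c ≡ not b
  capped-not-b {c} h with c Bool.≟ b
  ... | yes refl = contradiction (trans (sym h) cap-b) λ ()
  ... | no c≢b   = Boolₚ.¬-not c≢b

  capped-away : ∀ x → cap T (node x) ≡ true → Away x
  capped-away x c d e = contradiction (trans (sym c) (trans (cong (cap T) e) (tri d))) λ ()

  move-inside : ∀ {l} → FoldSpot b l → proj₁ (foldMove b l) ≡ b × proj₂ (foldMove b l) ≢ zero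
  move-inside = compute b
    where
    compute : ∀ b {l} → FoldSpot b l → proj₁ (foldMove b l) ≡ b × proj₂ (foldMove b l) ≢ zero
    compute false inner = refl , λ ()
    compute false outer = refl , λ ()
    compute true  inner = refl , λ ()
    compute true  outer = refl , λ ()

  shift-side : ∀ {l} → FoldSpot b l → node (shift (loc l)) ≡ side b
  shift-side {l} p = trans (cong node (shift-loc l)) (cong side (proj₁ (move-inside p)))

  shift-node-away : ∀ {x} → Away x → node (shift x) ≡ node x
  shift-node-away h = cong node (shift-away h)

  regular-cap : ∀ {x} → Spot ok x → foldCap (node (shift x)) ≡ cap T (node x)
  regular-cap (local l p) = trans (cong foldCap (shift-side p)) (trans cap-b (sym (tri (proj₁ l))))
  regular-cap (away h)    = trans (cong foldCap (shift-node-away h)) (Move.cap-away moveData _ h)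

  regular-nonzero : ∀ {x} → Spot ok x → ∀ c → shift x ≢ loc (c , zero)
  regular-nonzero (local l p) c e = proj₂ (move-inside p) (cong proj₂ (trans (sym (shift-loc l)) e))
  regular-nonzero (away h)    c e = h c (trans (sym (shift-node-away h)) (cong proj₁ e))

  regular-side : ∀ {x} → Spot ok x → node (shift x) ≢ side (not b)
  regular-side (local l p) e = not≢ b (side-injective (trans (sym e) (shift-side p)))
  regular-side (away h)    e = h (not b) (trans (sym (shift-node-away h)) e)

  regular-injective : ∀ {x y} → Spot ok x → Spot ok y → shift x ≡ shift y → x ≡ y
  regular-injective (local l p) (local m q) e = cong loc (inj b p q (loc-injective (trans (sym (shift-loc l)) (trans e (shift-loc m)))))
    where
    inj : ∀ b {l m} → FoldSpot b l → FoldSpot b m → foldMove b l ≡ foldMove b m → l ≡ m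
    inj b inner inner _ = refl
    inj b outer outer _ = refl
    inj false inner outer ()
    inj true  inner outer ()
    inj false outer inner ()
    inj true  outer inner ()
  regular-injective (local l p) (away k) e = contradiction (trans (sym (shift-node-away k)) (trans (cong node (sym e)) (shift-side p))) (k b)
  regular-injective (away k) (local m q) e = contradiction (trans (sym (shift-node-away k)) (trans (cong node e) (shift-side q))) (k b)
  regular-injective (away h) (away k)    e = trans (sym (shift-away h)) (trans e (shift-away k))

  special-apart : ∀ {c d} → loc (c , zero) ≡ loc (d , zero) → c ≡ d
  special-apart e = cong proj₁ (loc-injective e)

  fold-apart : ∀ j e → node (shift (end T j e)) ≢ node (shift (end T j (not e)))
  fold-apart j e with kind j
  ... | inj₁ s = λ r → let c , p , q = special-end s e in
          not≢ c (side-injective (sym (trans (cong node (sym p)) (trans r (cong node q)))))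
  ... | inj₂ r = go (spots r e) (spots r (not e)) (apart T j e)
          (λ p q → noFold j e p q) (λ p q → noFold j (not e) q (trans (cong (end T j) (Boolₚ.not-involutive e)) p))
    where
    go : ∀ {x y} → Spot ok x → Spot ok y → node x ≢ node y →
         (x ≡ loc (not b , one) → y ≢ loc (b , two)) → (x ≡ loc (b , two) → y ≢ loc (not b , one)) →
         node (shift x) ≢ node (shift y)
    go (local _ inner) (local _ inner) h f g _ = h refl
    go (local _ outer) (local _ outer) h f g _ = h refl
    go (local _ outer) (local _ inner) h f g _ = f refl refl
    go (local _ inner) (local _ outer) h f g _ = g refl refl
    go (local l p) (away k) h f g r = k b (trans (sym (shift-node-away k)) (trans (sym r) (shift-side p)))
    go (away k) (local m q) h f g r = k b (trans (sym (shift-node-away k)) (trans r (shift-side q)))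
    go (away k) (away k')   h f g r = h (trans (sym (shift-node-away k)) (trans r (shift-node-away k')))

  fold-port-twins : ∀ i e j e' → i ≢ j → shift (end T i e) ≡ shift (end T j e') → foldCap (node (shift (end T i e))) ≡ false →
    foldCap (node (shift (end T i (not e)))) ≡ true × node (shift (end T j (not e'))) ≡ node (shift (end T i (not e)))
  fold-port-twins i e j e' i≢j p c with kind i | kind j
  ... | inj₁ s | inj₁ s' with special-end s e | special-end s' e'
  ...   | a , q , r | a' , q' , r' with special-apart (trans (sym q) (trans p q')) | a Bool.≟ b
  ...     | refl | yes refl = trans (cong (foldCap ∘ node) r) cap-not-b , trans (cong node r') (cong node (sym r))
  ...     | refl | no a≢b with Boolₚ.¬-not a≢b
  ...       | refl = contradiction (trans (sym c) (trans (cong (foldCap ∘ node) q) cap-not-b)) λ ()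
  fold-port-twins i e j e' i≢j p c | inj₁ s | inj₂ r = let a , q , _ = special-end s e in
    contradiction (trans (sym p) q) (regular-nonzero (spots r e') a)
  fold-port-twins i e j e' i≢j p c | inj₂ r | inj₁ s = let a , q , _ = special-end s e' in
    contradiction (trans p q) (regular-nonzero (spots r e) a)
  fold-port-twins i e j e' i≢j p c | inj₂ r | inj₂ r' with port-twins T i e j e' i≢j
      (regular-injective (spots r e) (spots r' e') p) (trans (sym (regular-cap (spots r e))) c)
  ... | q , s = trans (regular-cap (spots r (not e))) q ,
    trans (shift-node-away (capped-away (end T j (not e')) (trans (cong (cap T) s) q))) (trans s (sym (shift-node-away (capped-away (end T i (not e)) q))))

  regular-cap-away : ∀ {i} → Regular i → ∀ e → foldCap (node (shift (end T i e))) ≡ true → Away (end T i e)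
  regular-cap-away {i} r e c = capped-away (end T i e) (trans (sym (regular-cap (spots r e))) c)

  same-away : ∀ i e j e' → Away (end T i e) → foldCap (node (shift (end T i e))) ≡ true →
              node (shift (end T j e')) ≡ node (shift (end T i e)) → Regular j × node (end T j e') ≡ node (end T i e)
  same-away i e j e' h c p with kind j
  ... | inj₁ s = let a , q , _ = special-end s e' in
    contradiction (trans (sym (shift-node-away h)) (trans (sym p) (cong node q))) (h a)
  ... | inj₂ r = r , trans (sym (shift-node-away (regular-cap-away r e' (trans (cong foldCap p) c)))) (trans p (shift-node-away h))

  fold-cap-twins : ∀ i e j e' → foldCap (node (shift (end T i e))) ≡ true → node (shift (end T j e')) ≡ node (shift (end T i e)) →
    shift (end T j (not e')) ≡ shift (end T i (not e)) × foldCap (node (shift (end T i (not e)))) ≡ false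
  fold-cap-twins i e j e' c p with kind i
  ... | inj₂ r = let h = regular-cap-away r e c ; r' , q = same-away i e j e' h c p
                     s , t = cap-twins T i e j e' (trans (sym (regular-cap (spots r e))) c) q in
    cong shift s , trans (regular-cap (spots r (not e))) t
  ... | inj₁ s with special-end s e
  ...   | a , q , q' with capped-not-b {a} (trans (cong (foldCap ∘ node) (sym q)) c)
  ...     | refl with kind j
  ...       | inj₂ r' = contradiction (trans p (cong node q)) (regular-side (spots r' e'))
  ...       | inj₁ s' with special-end s' e'
  ...         | a' , t , t' with side-injective (trans (cong node (sym t)) (trans p (cong node q)))
  ...           | refl = trans t' (sym q') ,
                         trans (cong (foldCap ∘ node) q') (trans (cong (foldCap ∘ side) (Boolₚ.not-involutive b)) cap-b)

  partner : ∀ {i} → Special i → ∃[ j ] ∃[ e ] j ≢ i × shift (end T j e) ≡ loc (not b , zero)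
  partner (inj₁ refl) = w , not e₁ , w≢v , shift-two
  partner (inj₂ refl) = v , not b , w≢v ∘ sym , shift-base (not b)

  fold-cap-twin : ∀ i e → foldCap (node (shift (end T i e))) ≡ true →
                  ∃[ j ] ∃[ e' ] j ≢ i × node (shift (end T j e')) ≡ node (shift (end T i e))
  fold-cap-twin i e c with kind i
  ... | inj₂ r with regular-cap-away r e c | trans (sym (regular-cap (spots r e))) c
  ...   | h | c' with cap-twin T i e c'
  ...     | j , e' , j≢i , p = j , e' , j≢i ,
              trans (shift-node-away (capped-away (end T j e') (trans (cong (cap T) p) c'))) (trans p (sym (shift-node-away h)))
  fold-cap-twin i e c | inj₁ s with special-end s e | partner s
  ... | a , q , _ | j , e' , j≢i , p with capped-not-b {a} (trans (cong (foldCap ∘ node) (sym q)) c)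
  ...   | refl = j , e' , j≢i , trans (cong node p) (cong node (sym q))

  fold-cap-two : ∀ i e j e' k e'' → foldCap (node (shift (end T i e))) ≡ true →
    node (shift (end T j e')) ≡ node (shift (end T i e)) → node (shift (end T k e'')) ≡ node (shift (end T i e)) →
    j ≢ i → k ≢ i → j ≡ k
  fold-cap-two i e j e' k e'' c p q j≢i k≢i with kind i
  ... | inj₂ r = let h = regular-cap-away r e c in
    cap-two T i e j e' k e'' (trans (sym (regular-cap (spots r e))) c) (proj₂ (same-away i e j e' h c p)) (proj₂ (same-away i e k e'' h c q)) j≢i k≢i
  ... | inj₁ s with special-end s e
  ...   | a , r , _ with capped-not-b {a} (trans (cong (foldCap ∘ node) (sym r)) c)
  ...     | refl with kind j | kind k
  ...       | inj₂ x | _ = contradiction (trans p (cong node r)) (regular-side (spots x e'))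
  ...       | _ | inj₂ x = contradiction (trans q (cong node r)) (regular-side (spots x e''))
  ...       | inj₁ x | inj₁ y = two-of s x y j≢i k≢i
    where
    two-of : ∀ {i j k} → Special i → Special j → Special k → j ≢ i → k ≢ i → j ≡ k
    two-of _           (inj₁ refl) (inj₁ refl) _ _ = refl
    two-of _           (inj₂ refl) (inj₂ refl) _ _ = refl
    two-of (inj₁ refl) (inj₁ refl) _           f _ = contradiction refl f
    two-of (inj₂ refl) (inj₂ refl) _           f _ = contradiction refl f
    two-of (inj₁ refl) _           (inj₁ refl) _ g = contradiction refl g
    two-of (inj₂ refl) _           (inj₂ refl) _ g = contradiction refl g

  fold-occupied : ∀ t → ∃[ i ] ∃[ e ] node (shift (end T i e)) ≡ t
  fold-occupied t with occupied T t
  ... | i , e , refl = go (place (end T i e))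
    where
    go : Place (end T i e) → ∃[ j ] ∃[ e' ] node (shift (end T j e')) ≡ node (end T i e)
    go (here b p) = v , b , trans (cong node (shift-base b)) (sym p)
    go (away h)   = i , e , shift-node-away h

  folded : Triangulation N n
  folded = record
    { end = λ i e → shift (end T i e) ; cap = foldCap ; apart = fold-apart ; port-twins = fold-port-twins
    ; cap-twins = fold-cap-twins ; cap-twin = fold-cap-twin ; cap-two = fold-cap-two ; occupied = fold-occupied }

  w-sum′ : (f : Port N → ℤ) → (Σb λ e → f (shift (end T w e))) ≡ f (loc (b , zero)) ℤ.+ f (loc (not b , zero))
  w-sum′ f = trans (Σb-from e₁ (λ e → f (shift (end T w e)))) (cong₂ (λ x y → f x ℤ.+ f y) shift-one shift-two)

  -- The tables `foldIns` and `foldOuts` count the outer sides only. Thus the partner counts zero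
  -- both ways instead of one each, as the cancellation in `matrix-vw` requires.
  counts-w : Ins w ≡ 0 × Outs w ≡ 0
  counts-w = count (foldIns b) (one₀ b) (two₀ b) , count (foldOuts b) (one₁ b) (two₁ b)
    where
    one₀ : ∀ b → foldIns b (b , one) ≡ 0
    one₀ false = refl
    one₀ true  = refl
    two₀ : ∀ b → foldIns b (not b , two) ≡ 0
    two₀ false = refl
    two₀ true  = refl
    one₁ : ∀ b → foldOuts b (b , one) ≡ 0
    one₁ false = refl
    one₁ true  = refl
    two₁ : ∀ b → foldOuts b (not b , two) ≡ 0
    two₁ false = refl
    two₁ true  = refl
    both : ∀ c (f : Bool → ℕ) → f c ≡ 0 → f (not c) ≡ 0 → f false ℕ.+ f true ≡ 0
    both false f p q = cong₂ ℕ._+_ p q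
    both true  f p q = cong₂ ℕ._+_ q p
    count : ∀ (g : Local → ℕ) → g (b , one) ≡ 0 → g (not b , two) ≡ 0 →
            locally g (λ _ → 0) (end T w false) ℕ.+ locally g (λ _ → 0) (end T w true) ≡ 0
    count g p q = both e₁ (λ e → locally g (λ _ → 0) (end T w e))
      (trans (cong (locally g (λ _ → 0)) w-one) (trans (locally-loc g (λ _ → 0) (b , one)) p))
      (trans (cong (locally g (λ _ → 0)) w-two) (trans (locally-loc g (λ _ → 0) (not b , two)) q))

  exclusive : ∀ i → i ≢ v → Ins i ≡ 0 ⊎ Outs i ≡ 0
  exclusive i i≢v with i ≟ w
  ... | yes refl = inj₁ (proj₁ counts-w)
  ... | no i≢w = go (spots (i≢v , i≢w) false) (spots (i≢v , i≢w) true) (noFold i false) (noFold i true)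
    where
    go : ∀ {x y} → Spot ok x → Spot ok y →
         (x ≡ loc (not b , one) → y ≢ loc (b , two)) → (y ≡ loc (not b , one) → x ≢ loc (b , two)) →
         entering x ℕ.+ entering y ≡ 0 ⊎ leaving x ℕ.+ leaving y ≡ 0
    in₀ : ∀ b → foldIns b (not b , one) ≡ 0
    in₀ false = refl
    in₀ true  = refl
    out₀ : ∀ b → foldOuts b (b , two) ≡ 0
    out₀ false = refl
    out₀ true  = refl
    outer₀ : entering (loc (not b , one)) ≡ 0
    outer₀ = trans (locally-loc (foldIns b) _ (not b , one)) (in₀ b)
    inner₀ : leaving (loc (b , two)) ≡ 0
    inner₀ = trans (locally-loc (foldOuts b) _ (b , two)) (out₀ b)
    go (local _ inner) (local _ inner) f g = inj₂ (cong₂ ℕ._+_ inner₀ inner₀)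
    go (local _ outer) (local _ outer) f g = inj₁ (cong₂ ℕ._+_ outer₀ outer₀)
    go (local _ outer) (local _ inner) f g = ⊥-elim (f refl refl)
    go (local _ inner) (local _ outer) f g = ⊥-elim (g refl refl)
    go (local _ inner) (away k) f g = inj₂ (cong₂ ℕ._+_ inner₀ (locally-away (foldOuts b) _ k))
    go (local _ outer) (away k) f g = inj₁ (cong₂ ℕ._+_ outer₀ (locally-away (foldIns b) _ k))
    go (away k) (local _ inner) f g = inj₂ (cong₂ ℕ._+_ (locally-away (foldOuts b) _ k) inner₀)
    go (away k) (local _ outer) f g = inj₁ (cong₂ ℕ._+_ (locally-away (foldIns b) _ k) outer₀)
    go (away k) (away k') f g = inj₁ (cong₂ ℕ._+_ (locally-away (foldIns b) _ k) (locally-away (foldIns b) _ k'))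

  Σb-swap : (f : Bool → Bool → ℤ) → (Σb λ e → Σb λ e' → f e e') ≡ (Σb λ e' → Σb λ e → f e e')
  Σb-swap f = interchange (f false false) (f false true) (f true false) (f true true)

  folded-vw : matrix folded v w ≡ + 0
  folded-vw = trans (Σb-cong₂ (λ e e' → cong (λ x → weigh foldCap x (shift (end T w e'))) (shift-base e)))
    (trans (Σb-cong (λ e → w-sum′ (λ y → weigh foldCap (loc (e , zero)) y)))
      (trans (Σb-cong (λ e → cong₂ ℤ._+_ (trans (weigh-local foldCap foldCap-side (e , zero) (b , zero)) (weigh-disjoint (foldCapped b) e b))
                                         (trans (weigh-local foldCap foldCap-side (e , zero) (not b , zero)) (weigh-disjoint (foldCapped b) e (not b)))))
             refl))

  row-w : ∀ m → FoldSpot b m → localWeigh uncapped (b , one) m ℤ.+ localWeigh uncapped (not b , two) m ≡ + foldIns b m ℤ.- + foldOuts b m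
  row-w = compute b
    where
    compute : ∀ b m → FoldSpot b m → localWeigh uncapped (b , one) m ℤ.+ localWeigh uncapped (not b , two) m ≡ + foldIns b m ℤ.- + foldOuts b m
    compute false _ inner = refl
    compute false _ outer = refl
    compute true  _ inner = refl
    compute true  _ outer = refl

  spoke-w : ∀ {y} → Spot ok y → weigh (cap T) (loc (b , one)) y ℤ.+ weigh (cap T) (loc (not b , two)) y ≡ + entering y ℤ.- + leaving y
  spoke-w (local m q) = trans (cong₂ ℤ._+_ (weigh-local (cap T) tri (b , one) m) (weigh-local (cap T) tri (not b , two) m))
    (trans (row-w m q) (sym (cong₂ (λ a c → + a ℤ.- + c) (locally-loc (foldIns b) (λ _ → 0) m) (locally-loc (foldOuts b) (λ _ → 0) m))))
  spoke-w (away h) = trans (cong₂ ℤ._+_ (weigh-local-away (cap T) h) (weigh-local-away (cap T) h))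
    (sym (cong₂ (λ a c → + a ℤ.- + c) (locally-away (foldIns b) (λ _ → 0) h) (locally-away (foldOuts b) (λ _ → 0) h)))

  -- After the fold the partner holds the same ports as `v`, so its row is the new row of `v`. By
  -- `row-w` its row before the fold has the same value.
  matrix-w : ∀ {j} → Spots j → matrix folded w j ≡ matrix T w j
  matrix-w {j} sj = trans (Σb-swap (λ e e' → weigh foldCap (shift (end T w e)) (shift (end T j e'))))
    (trans (Σb-cong (λ e' → trans (w-sum′ (λ x → weigh foldCap x (shift (end T j e'))))
              (trans (sym (Σb-from b (λ c → weigh foldCap (loc (c , zero)) (shift (end T j e')))))
                (trans (spoke' (sj e')) (trans (sym (spoke-w (sj e'))) (sym (w-sum (λ x → weigh (cap T) x (end T j e')))))))))
           (Σb-swap (λ e' e → weigh (cap T) (end T w e) (end T j e'))))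

  no-crossing : ∀ j → + Ins w ℤ.* + Outs j ℤ.- + Outs w ℤ.* + Ins j ≡ + 0
  no-crossing j = cong₂ (λ a c → + a ℤ.* + Outs j ℤ.- + c ℤ.* + Ins j) (proj₁ counts-w) (proj₂ counts-w)

  no-crossing′ : ∀ i → + Ins i ℤ.* + Outs w ℤ.- + Outs i ℤ.* + Ins w ≡ + 0
  no-crossing′ i = trans (cong₂ (λ a c → + Ins i ℤ.* + c ℤ.- + Outs i ℤ.* + a) (proj₁ counts-w) (proj₂ counts-w))
    (cong₂ ℤ._-_ (ℤₚ.*-zeroʳ (+ Ins i)) (ℤₚ.*-zeroʳ (+ Outs i)))

  plus-zero : ∀ {x y z} → x ≡ y → z ≡ + 0 → x ≡ y ℤ.+ z
  plus-zero {y = y} p q = trans p (sym (trans (cong (λ c → y ℤ.+ c) q) (ℤₚ.+-identityʳ y)))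

  folded-off : ∀ i j → i ≢ v → j ≢ v → matrix folded i j ≡ matrix T i j ℤ.+ (+ Ins i ℤ.* + Outs j ℤ.- + Outs i ℤ.* + Ins j)
  folded-off i j i≢v j≢v with i ≟ w | j ≟ w
  ... | no i≢w   | no j≢w   = shift-matrix (spots (i≢v , i≢w)) (spots (j≢v , j≢w))
  ... | yes refl | no j≢w   = plus-zero (matrix-w (spots (j≢v , j≢w))) (no-crossing j)
  ... | yes refl | yes refl = plus-zero (trans (skew-diagonal {B = matrix folded} (matrix-skew folded) i)
                                (sym (skew-diagonal {B = matrix T} (matrix-skew T) i))) (no-crossing i)
  ... | no i≢w   | yes refl = plus-zero (trans (matrix-skew folded j i)
                                (trans (cong -_ (matrix-w (spots (i≢v , i≢w)))) (sym (matrix-skew T j i)))) (no-crossing′ i)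

  folded-row : ∀ j → j ≢ v → matrix T v j ≡ + Outs j ℤ.- + Ins j
  folded-row j j≢v with j ≟ w
  ... | yes refl = trans matrix-vw (sym (cong₂ (λ a c → + c ℤ.- + a) (proj₁ counts-w) (proj₂ counts-w)))
  ... | no j≢w   = matrix-row (spots (j≢v , j≢w))

  folded-row' : ∀ j → j ≢ v → matrix folded v j ≡ + Ins j ℤ.- + Outs j
  folded-row' j j≢v with j ≟ w
  ... | yes refl = trans folded-vw (sym (cong₂ (λ a c → + a ℤ.- + c) (proj₁ counts-w) (proj₂ counts-w)))
  ... | no j≢w   = shift-row (spots (j≢v , j≢w))

  fold-step : Step T v folded
  fold-step = mutate-by-counts v (matrix T) (matrix folded) (matrix-skew T) (matrix-skew folded) Ins Outs exclusive
      folded-row folded-row' folded-off ,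
    shifted-intertwines folded (λ _ _ → refl)

-- The inverse of FoldArc: the cap with arcs v and w becomes a triangle.
module UnfoldArc {N n : ℕ} (T : Triangulation N n) (v : Fin n) (e₀ : Bool)
  (tri₀ : cap T (node (end T v e₀)) ≡ false) (base₀ : end T v e₀ ≡ (node (end T v e₀) , zero))
  (cap₀ : cap T (node (end T v (not e₀))) ≡ true) where

  A C : Fin N
  A = node (end T v e₀)
  C = node (end T v (not e₀))

  A≢C : A ≢ C
  A≢C = apart T v e₀

  w : Fin n
  w = proj₁ (cap-twin T v (not e₀) cap₀)

  e₁ : Bool
  e₁ = not (proj₁ (proj₂ (cap-twin T v (not e₀) cap₀)))

  w≢v : w ≢ v
  w≢v = proj₁ (proj₂ (proj₂ (cap-twin T v (not e₀) cap₀)))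

  w-C′ : node (end T w (not e₁)) ≡ C
  w-C′ = trans (cong (λ e → node (end T w e)) (Boolₚ.not-involutive _)) (proj₂ (proj₂ (proj₂ (cap-twin T v (not e₀) cap₀))))

  w-A : end T w e₁ ≡ (A , zero)
  w-A = trans (proj₁ (cap-twins T v (not e₀) w _ cap₀ (proj₂ (proj₂ (proj₂ (cap-twin T v (not e₀) cap₀))))))
              (trans (cong (end T v) (Boolₚ.not-involutive e₀)) base₀)

  Regular Special : Fin n → Set
  Regular j = j ≢ v × j ≢ w
  Special j = j ≡ v ⊎ j ≡ w

  kind : ∀ j → Special j ⊎ Regular j
  kind j with j ≟ v | j ≟ w
  ... | yes p | _     = inj₁ (inj₁ p)
  ... | no _  | yes q = inj₁ (inj₂ q)
  ... | no p  | no q  = inj₂ (p , q)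

  regular-C : ∀ {j} → Regular j → ∀ e → node (end T j e) ≢ C
  regular-C {j} (j≢v , j≢w) e p = j≢w (sym (cap-two T v (not e₀) w (not e₁) j e cap₀ w-C′ p w≢v j≢v))

  regular-A : ∀ {j} → Regular j → ∀ e → end T j e ≢ (A , zero)
  regular-A {j} r e p = regular-C r (not e) (proj₂ (port-twins T v e₀ j e (proj₁ r ∘ sym) (trans base₀ (sym p)) tri₀))

  data Spot : Port N → Set where
    first  : Spot (A , one)
    second : Spot (A , two)
    away   : ∀ {x} → node x ≢ A → node x ≢ C → Spot x

  spots : ∀ {j} → Regular j → ∀ e → Spot (end T j e)
  spots {j} r e = go (end T j e) (node (end T j e) ≟ A) (regular-C r e) (regular-A r e)
    where
    go : ∀ x → Dec (node x ≡ A) → node x ≢ C → x ≢ (A , zero) → Spot x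
    go (_ , zero) (yes refl) _ h = contradiction refl h
    go (_ , one)  (yes refl) _ h = first
    go (_ , two)  (yes refl) _ h = second
    go x          (no p)     q h = away p q

  -- `foldMove` read backwards: the two free sides of the triangle at `A` become the outer sides of
  -- a digon, one on each side of `v`.
  openPort : Fin 3 → Port N
  openPort zero = A , zero
  openPort one  = A , two
  openPort two  = C , one

  open′ : Port N → Port N
  open′ (t , p) = if t == A then openPort p else (t , p)

  open-A : ∀ p → open′ (A , p) ≡ openPort p
  open-A p = cong (λ b → if b then openPort p else (A , p)) (==-refl A)

  open-away : ∀ {x} → node x ≢ A → open′ x ≡ x
  open-away {t , p} h = cong (λ b → if b then openPort p else (t , p)) (==-≢ h)

  vPort wPort : Bool → Port N
  vPort e = if does (e Bool.≟ e₀) then (A , zero) else (C , zero)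
  wPort e = if does (e Bool.≟ e₁) then (A , one) else (C , two)

  newEnd : Fin n → Bool → Port N
  newEnd j e = if j == v then vPort e else if j == w then wPort e else open′ (end T j e)

  newEnd-v : ∀ e → newEnd v e ≡ vPort e
  newEnd-v e = cong (λ b → if b then vPort e else if v == w then wPort e else open′ (end T v e)) (==-refl v)

  newEnd-w : ∀ e → newEnd w e ≡ wPort e
  newEnd-w e = cong₂ (λ b c → if b then vPort e else if c then wPort e else open′ (end T w e)) (==-≢ w≢v) (==-refl w)

  newEnd-regular : ∀ {j} → Regular j → ∀ e → newEnd j e ≡ open′ (end T j e)
  newEnd-regular {j} (p , q) e = cong₂ (λ b c → if b then vPort e else if c then wPort e else open′ (end T j e)) (==-≢ p) (==-≢ q)

  data SpecialPort : Fin n → Port N → Set where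
    v₀ : SpecialPort v (A , zero)
    v₁ : SpecialPort v (C , zero)
    w₁ : SpecialPort w (A , one)
    w₂ : SpecialPort w (C , two)

  if-same : ∀ c {x y : Port N} → (if does (c Bool.≟ c) then x else y) ≡ x
  if-same false = refl
  if-same true  = refl

  if-not : ∀ c {x y : Port N} → (if does (not c Bool.≟ c) then x else y) ≡ y
  if-not false = refl
  if-not true  = refl

  special-port : ∀ {j} → Special j → ∀ e → SpecialPort j (newEnd j e)
  special-port (inj₁ refl) e = subst (SpecialPort v) (sym (newEnd-v e)) (go e)
    where
    go : ∀ e → SpecialPort v (vPort e)
    go e with e Bool.≟ e₀
    ... | yes _ = v₀
    ... | no _  = v₁
  special-port (inj₂ refl) e = subst (SpecialPort w) (sym (newEnd-w e)) (go e)
    where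
    go : ∀ e → SpecialPort w (wPort e)
    go e with e Bool.≟ e₁
    ... | yes _ = w₁
    ... | no _  = w₂

  special-node : ∀ {j x} → SpecialPort j x → node x ≡ A ⊎ node x ≡ C
  special-node v₀ = inj₁ refl
  special-node v₁ = inj₂ refl
  special-node w₁ = inj₁ refl
  special-node w₂ = inj₂ refl

  special-injective : ∀ {i j x y} → SpecialPort i x → SpecialPort j y → x ≡ y → i ≡ j
  special-injective v₀ v₀ _ = refl
  special-injective v₀ v₁ _ = refl
  special-injective v₁ v₀ _ = refl
  special-injective v₁ v₁ _ = refl
  special-injective w₁ w₁ _ = refl
  special-injective w₁ w₂ _ = refl
  special-injective w₂ w₁ _ = refl
  special-injective w₂ w₂ _ = refl
  special-injective v₀ w₁ e = contradiction (cong proj₂ e) λ ()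
  special-injective v₀ w₂ e = contradiction (cong proj₂ e) λ ()
  special-injective v₁ w₁ e = contradiction (cong proj₂ e) λ ()
  special-injective v₁ w₂ e = contradiction (cong proj₂ e) λ ()
  special-injective w₁ v₀ e = contradiction (cong proj₂ e) λ ()
  special-injective w₁ v₁ e = contradiction (cong proj₂ e) λ ()
  special-injective w₂ v₀ e = contradiction (cong proj₂ e) λ ()
  special-injective w₂ v₁ e = contradiction (cong proj₂ e) λ ()

  special-away : ∀ {j x y} → SpecialPort j x → node y ≢ A → node y ≢ C → node x ≢ node y
  special-away s p q e = [ (λ r → p (trans (sym e) r)) , (λ r → q (trans (sym e) r)) ]′ (special-node s)

  special-regular : ∀ {j x y} → SpecialPort j x → Spot y → x ≢ open′ y
  special-regular s (away {y} p q) e = special-away {y = y} s p q (cong node (trans e (open-away p)))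
  special-regular s first  e = go s (trans e (open-A one))
    where
    go : ∀ {j x} → SpecialPort j x → x ≢ (A , two)
    go v₀ e = contradiction (cong proj₂ e) λ ()
    go v₁ e = contradiction (cong proj₂ e) λ ()
    go w₁ e = contradiction (cong proj₂ e) λ ()
    go w₂ e = contradiction (sym (cong proj₁ e)) A≢C
  special-regular s second e = go s (trans e (open-A two))
    where
    go : ∀ {j x} → SpecialPort j x → x ≢ (C , one)
    go v₀ e = contradiction (cong proj₂ e) λ ()
    go v₁ e = contradiction (cong proj₂ e) λ ()
    go w₁ e = contradiction (cong proj₁ e) A≢C
    go w₂ e = contradiction (cong proj₂ e) λ ()

  openCap : Fin N → Bool
  openCap t = if t == C then false else cap T t

  openCap-C : openCap C ≡ false
  openCap-C = cong (λ b → if b then false else cap T C) (==-refl C)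

  openCap-other : ∀ {t} → t ≢ C → openCap t ≡ cap T t
  openCap-other {t} h = cong (λ b → if b then false else cap T t) (==-≢ h)

  openCap-A : openCap A ≡ false
  openCap-A = trans (openCap-other A≢C) tri₀

  special-cap : ∀ {j x} → SpecialPort j x → openCap (node x) ≡ false
  special-cap s = [ (λ r → trans (cong openCap r) openCap-A) , (λ r → trans (cong openCap r) openCap-C) ]′ (special-node s)

  regular-cap : ∀ {x} → Spot x → openCap (node (open′ x)) ≡ cap T (node x)
  regular-cap first      = trans (cong (openCap ∘ node) (open-A one)) (trans openCap-A (sym tri₀))
  regular-cap second     = trans (cong (openCap ∘ node) (open-A two)) (trans openCap-C (sym tri₀))
  regular-cap (away p q) = trans (cong (openCap ∘ node) (open-away p)) (openCap-other q)

  regular-injective : ∀ {x y} → Spot x → Spot y → open′ x ≡ open′ y → x ≡ y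
  regular-injective first  first  _ = refl
  regular-injective second second _ = refl
  regular-injective first second e = contradiction (cong proj₂ (trans (sym (open-A one)) (trans e (open-A two)))) λ ()
  regular-injective second first e = contradiction (cong proj₂ (trans (sym (open-A two)) (trans e (open-A one)))) λ ()
  regular-injective first (away p q) e = contradiction (cong node (sym (trans (sym (open-A one)) (trans e (open-away p))))) p
  regular-injective (away p q) first e = contradiction (cong node (trans (sym (open-away p)) (trans e (open-A one)))) p
  regular-injective second (away p q) e = contradiction (cong node (sym (trans (sym (open-A two)) (trans e (open-away p))))) q
  regular-injective (away p q) second e = contradiction (cong node (trans (sym (open-away p)) (trans e (open-A two)))) q
  regular-injective (away p q) (away p' q') e = trans (sym (open-away p)) (trans e (open-away p'))

  capped-A : ∀ {x} → cap T (node x) ≡ true → node x ≢ A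
  capped-A c e = contradiction (trans (sym c) (trans (cong (cap T) e) tri₀)) λ ()

  capped-open : ∀ x → cap T (node x) ≡ true → open′ x ≡ x
  capped-open x c = open-away {x} (capped-A {x} c)

  by-end : ∀ {P : Bool → Set} c → P c → P (not c) → ∀ e → P e
  by-end false p q false = p
  by-end false p q true  = q
  by-end true  p q true  = p
  by-end true  p q false = q

  special-sides : ∀ {j} → Special j → ∀ e →
                  (node (newEnd j e) ≡ A × node (newEnd j (not e)) ≡ C) ⊎ (node (newEnd j e) ≡ C × node (newEnd j (not e)) ≡ A)
  special-sides (inj₁ refl) = by-end e₀
    (inj₁ (cong node (trans (newEnd-v e₀) (if-same e₀)) , cong node (trans (newEnd-v (not e₀)) (if-not e₀))))
    (inj₂ (cong node (trans (newEnd-v (not e₀)) (if-not e₀)) ,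
           cong node (trans (newEnd-v (not (not e₀))) (trans (cong vPort (Boolₚ.not-involutive e₀)) (if-same e₀)))))
  special-sides (inj₂ refl) = by-end e₁
    (inj₁ (cong node (trans (newEnd-w e₁) (if-same e₁)) , cong node (trans (newEnd-w (not e₁)) (if-not e₁))))
    (inj₂ (cong node (trans (newEnd-w (not e₁)) (if-not e₁)) ,
           cong node (trans (newEnd-w (not (not e₁))) (trans (cong wPort (Boolₚ.not-involutive e₁)) (if-same e₁)))))

  new-apart : ∀ j e → node (newEnd j e) ≢ node (newEnd j (not e))
  new-apart j e with kind j
  ... | inj₁ s = λ r → [ (λ { (p , q) → A≢C (trans (sym p) (trans r q)) }) , (λ { (p , q) → A≢C (trans (sym q) (trans (sym r) p)) }) ]′ (special-sides s e)
  ... | inj₂ r = λ p → go (spots r e) (spots r (not e)) (apart T j e)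
                   (trans (cong node (sym (newEnd-regular r e))) (trans p (cong node (newEnd-regular r (not e)))))
    where
    go : ∀ {x y} → Spot x → Spot y → node x ≢ node y → node (open′ x) ≢ node (open′ y)
    go first  first  h _ = h refl
    go first  second h _ = h refl
    go second first  h _ = h refl
    go second second h _ = h refl
    go first  (away p q) h e = p (sym (trans (cong node (sym (open-A one))) (trans e (cong node (open-away p)))))
    go second (away p q) h e = q (sym (trans (cong node (sym (open-A two))) (trans e (cong node (open-away p)))))
    go (away p q) first  h e = p (trans (cong node (sym (open-away p))) (trans e (cong node (open-A one))))
    go (away p q) second h e = q (trans (cong node (sym (open-away p))) (trans e (cong node (open-A two))))
    go (away p q) (away p' q') h e = h (trans (cong node (sym (open-away p))) (trans e (cong node (open-away p'))))

  new-port-twins : ∀ i e j e' → i ≢ j → newEnd i e ≡ newEnd j e' → openCap (node (newEnd i e)) ≡ false →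
    openCap (node (newEnd i (not e))) ≡ true × node (newEnd j (not e')) ≡ node (newEnd i (not e))
  new-port-twins i e j e' i≢j p c with kind i | kind j
  ... | inj₁ s | inj₁ s' = contradiction (special-injective (special-port s e) (special-port s' e') p) i≢j
  ... | inj₁ s | inj₂ r  = contradiction (trans p (newEnd-regular r e')) (special-regular (special-port s e) (spots r e'))
  ... | inj₂ r | inj₁ s  = contradiction (trans (sym p) (newEnd-regular r e)) (special-regular (special-port s e') (spots r e))
  ... | inj₂ r | inj₂ r' with port-twins T i e j e' i≢j
        (regular-injective (spots r e) (spots r' e') (trans (sym (newEnd-regular r e)) (trans p (newEnd-regular r' e'))))
        (trans (sym (regular-cap (spots r e))) (trans (cong (openCap ∘ node) (sym (newEnd-regular r e))) c))
  ...   | q , s = trans (cong (openCap ∘ node) (newEnd-regular r (not e))) (trans (regular-cap (spots r (not e))) q) ,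
          trans (cong node (trans (newEnd-regular r' (not e')) (capped-open _ (trans (cong (cap T) s) q))))
                (trans s (cong node (sym (trans (newEnd-regular r (not e)) (capped-open _ q)))))

  record CappedEnd (i : Fin n) (e : Bool) : Set where
    field
      regular  : Regular i
      original : cap T (node (end T i e)) ≡ true
      same     : newEnd i e ≡ end T i e
      not-C    : node (end T i e) ≢ C

  capped-end : ∀ i e → openCap (node (newEnd i e)) ≡ true → CappedEnd i e
  capped-end i e c with kind i
  ... | inj₁ s = contradiction (trans (sym c) (special-cap (special-port s e))) λ ()
  ... | inj₂ r = record { regular = r ; original = orig ; same = trans (newEnd-regular r e) (capped-open _ orig) ; not-C = regular-C r e }
    where
    orig : cap T (node (end T i e)) ≡ true
    orig = trans (sym (regular-cap (spots r e))) (trans (cong (openCap ∘ node) (sym (newEnd-regular r e))) c)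

  open CappedEnd

  also-capped : ∀ i e j e' → openCap (node (newEnd i e)) ≡ true → node (newEnd j e') ≡ node (newEnd i e) →
                CappedEnd j e' × node (end T j e') ≡ node (end T i e)
  also-capped i e j e' c p = let x = capped-end i e c ; y = capped-end j e' (trans (cong openCap p) c) in
    y , trans (cong node (sym (same y))) (trans p (cong node (same x)))

  new-cap-twins : ∀ i e j e' → openCap (node (newEnd i e)) ≡ true → node (newEnd j e') ≡ node (newEnd i e) →
    newEnd j (not e') ≡ newEnd i (not e) × openCap (node (newEnd i (not e))) ≡ false
  new-cap-twins i e j e' c p with capped-end i e c | also-capped i e j e' c p
  ... | x | y , q with cap-twins T i e j e' (original x) q
  ...   | r , s = trans (newEnd-regular (regular y) (not e')) (trans (cong open′ r) (sym (newEnd-regular (regular x) (not e)))) ,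
                  trans (cong (openCap ∘ node) (newEnd-regular (regular x) (not e))) (trans (regular-cap (spots (regular x) (not e))) s)

  new-cap-twin : ∀ i e → openCap (node (newEnd i e)) ≡ true → ∃[ j ] ∃[ e' ] j ≢ i × node (newEnd j e') ≡ node (newEnd i e)
  new-cap-twin i e c with capped-end i e c
  ... | x with cap-twin T i e (original x)
  ...   | j , e' , j≢i , p with kind j
  ...     | inj₂ r = j , e' , j≢i , trans (cong node (trans (newEnd-regular r e') (capped-open _ (trans (cong (cap T) p) (original x)))))
                       (trans p (cong node (sym (same x))))
  ...     | inj₁ s = contradiction p (special-not s e')
    where
    special-not : ∀ {j} → Special j → ∀ e' → node (end T j e') ≢ node (end T i e)
    special-not (inj₁ refl) = by-end e₀ (λ q → capped-A {end T i e} (original x) (sym q)) (λ q → not-C x (sym q))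
    special-not (inj₂ refl) = by-end e₁ (λ q → capped-A {end T i e} (original x) (trans (sym q) (cong node w-A)))
                                        (λ q → not-C x (trans (sym q) w-C′))

  new-cap-two : ∀ i e j e' k e'' → openCap (node (newEnd i e)) ≡ true → node (newEnd j e') ≡ node (newEnd i e) →
                node (newEnd k e'') ≡ node (newEnd i e) → j ≢ i → k ≢ i → j ≡ k
  new-cap-two i e j e' k e'' c p q = cap-two T i e j e' k e'' (original (capped-end i e c))
    (proj₂ (also-capped i e j e' c p)) (proj₂ (also-capped i e k e'' c q))

  new-occupied : ∀ t → ∃[ i ] ∃[ e ] node (newEnd i e) ≡ t
  new-occupied t = go (t ≟ A) (t ≟ C) (occupied T t)
    where
    special-in : ∀ {j} → Special j → ∀ e → node (end T j e) ≡ A ⊎ node (end T j e) ≡ C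
    special-in (inj₁ refl) = by-end e₀ (inj₁ refl) (inj₂ refl)
    special-in (inj₂ refl) = by-end e₁ (inj₁ (cong node w-A)) (inj₂ w-C′)
    go : Dec (t ≡ A) → Dec (t ≡ C) → (∃[ i ] ∃[ e ] node (end T i e) ≡ t) → ∃[ i ] ∃[ e ] node (newEnd i e) ≡ t
    go (yes p) _ _ = v , e₀ , trans (cong node (trans (newEnd-v e₀) (if-same e₀))) (sym p)
    go (no _) (yes q) _ = v , not e₀ , trans (cong node (trans (newEnd-v (not e₀)) (if-not e₀))) (sym q)
    go (no p) (no q) (i , e , r) with kind i
    ... | inj₂ k = i , e , trans (cong node (newEnd-regular k e)) (trans (cong node (open-away (λ s → p (trans (sym r) s)))) r)
    ... | inj₁ s = ⊥-elim ([ (λ a → p (trans (sym r) a)) , (λ c → q (trans (sym r) c)) ]′ (special-in s e))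

  unfolded : Triangulation N n
  unfolded = record
    { end = newEnd ; cap = openCap ; apart = new-apart ; port-twins = new-port-twins
    ; cap-twins = new-cap-twins ; cap-twin = new-cap-twin ; cap-two = new-cap-two ; occupied = new-occupied }

  end-v₀ : newEnd v e₀ ≡ (A , zero)
  end-v₀ = trans (newEnd-v e₀) (if-same e₀)

  end-v₁ : newEnd v (not e₀) ≡ (C , zero)
  end-v₁ = trans (newEnd-v (not e₀)) (if-not e₀)

  open-no-fold : ∀ i e → newEnd i e ≡ (C , one) → newEnd i (not e) ≢ (A , two)
  open-no-fold i e p q with kind i
  ... | inj₁ s = go (special-port s e) p
    where
    go : ∀ {j x} → SpecialPort j x → x ≢ (C , one)
    go v₀ e = contradiction (cong proj₂ e) λ ()
    go v₁ e = contradiction (cong proj₂ e) λ ()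
    go w₁ e = contradiction (cong proj₁ e) A≢C
    go w₂ e = contradiction (cong proj₂ e) λ ()
  ... | inj₂ r = apart T i e (trans (at-A (spots r e) (inj₁ (trans (sym (newEnd-regular r e)) p)))
                               (sym (at-A (spots r (not e)) (inj₂ (trans (sym (newEnd-regular r (not e))) q)))))
    where
    at-A : ∀ {x} → Spot x → open′ x ≡ (C , one) ⊎ open′ x ≡ (A , two) → node x ≡ A
    at-A first  _ = refl
    at-A second _ = refl
    at-A (away p q) (inj₁ e) = contradiction (cong node (trans (sym (open-away p)) e)) q
    at-A (away p q) (inj₂ e) = contradiction (cong node (trans (sym (open-away p)) e)) p

  abstract
    refold-tri : ∀ e → openCap (node (newEnd v e)) ≡ false
    refold-tri = by-end e₀ (trans (cong (openCap ∘ node) end-v₀) openCap-A) (trans (cong (openCap ∘ node) end-v₁) openCap-C)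

    refold-base : ∀ e → newEnd v e ≡ (node (newEnd v e) , zero)
    refold-base = by-end e₀ (trans end-v₀ (cong (λ x → node x , zero) (sym end-v₀))) (trans end-v₁ (cong (λ x → node x , zero) (sym end-v₁)))

    refold-one : newEnd w e₁ ≡ (node (newEnd v e₀) , one)
    refold-one = trans (trans (newEnd-w e₁) (if-same e₁)) (cong (λ x → node x , one) (sym end-v₀))

    refold-two : newEnd w (not e₁) ≡ (node (newEnd v (not e₀)) , two)
    refold-two = trans (trans (newEnd-w (not e₁)) (if-not e₁)) (cong (λ x → node x , two) (sym end-v₁))

    refold-no-fold : ∀ i e → newEnd i e ≡ (node (newEnd v (not e₀)) , one) → newEnd i (not e) ≢ (node (newEnd v e₀) , two)
    refold-no-fold i e p q = open-no-fold i e (trans p (cong (λ x → node x , one) end-v₁)) (trans q (cong (λ x → node x , two) end-v₀))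

  module Refold = FoldArc unfolded v refold-tri refold-base e₀ w e₁ refold-one refold-two refold-no-fold

  refold-cap : ∀ t → Refold.foldCap t ≡ cap T t
  refold-cap t = go (t ≟ C)
    where
    test : (t == node (newEnd v (not e₀))) ≡ (t == C)
    test = cong (t ==_) (cong node end-v₁)
    go : Dec (t ≡ C) → Refold.foldCap t ≡ cap T t
    go (yes p)  = trans (cong (λ b → if b then true else openCap t) (trans test (trans (cong (_== C) p) (==-refl C))))
                        (trans (sym cap₀) (cong (cap T) (sym p)))
    go (no t≢C) = trans (cong (λ b → if b then true else openCap t) (trans test (==-≢ t≢C))) (openCap-other t≢C)

  -- Equality up to the position inside the cap `C`, which neither the matrix nor the degrees can
  -- see.
  Agree : Port N → Port N → Set
  Agree x y = x ≡ y ⊎ (node x ≡ C × node y ≡ C)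

  refold-shift : ∀ l → Refold.shift (node (newEnd v (proj₁ l)) , proj₂ l) ≡
                       (node (newEnd v (proj₁ (foldMove e₀ l))) , proj₂ (foldMove e₀ l))
  refold-shift = Refold.shift-loc

  fold-inner : ∀ b → foldMove b (b , two) ≡ (b , one)
  fold-inner false = refl
  fold-inner true  = refl

  fold-outer : ∀ b → foldMove b (not b , one) ≡ (b , two)
  fold-outer false = refl
  fold-outer true  = refl

  refold-agree : ∀ i e → Agree (end (Refold.folded) i e) (end T i e)
  refold-agree i e with kind i
  ... | inj₁ (inj₁ refl) = by-end {λ e → Agree (end Refold.folded v e) (end T v e)} e₀
        (inj₁ (trans (Refold.shift-base e₀) (trans (cong (λ x → node x , zero) end-v₀) (sym base₀))))
        (inj₂ (trans (cong node (Refold.shift-base (not e₀))) (cong node end-v₁) , refl)) e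
  ... | inj₁ (inj₂ refl) = by-end {λ e → Agree (end Refold.folded w e) (end T w e)} e₁
        (inj₁ (trans Refold.shift-one (trans (cong (λ x → node x , zero) end-v₀) (sym w-A))))
        (inj₂ (trans (cong node Refold.shift-two) (cong node end-v₁) , w-C′)) e
  ... | inj₂ r = inj₁ (trans (cong (Refold.shift) (newEnd-regular r e)) (go (spots r e)))
    where
    go : ∀ {x} → Spot x → Refold.shift (open′ x) ≡ x
    go first = trans (cong (Refold.shift) (trans (open-A one) (cong (λ x → node x , two) (sym end-v₀))))
      (trans (refold-shift (e₀ , two)) (trans (cong (λ l → node (newEnd v (proj₁ l)) , proj₂ l) (fold-inner e₀)) (cong (λ x → node x , one) end-v₀)))
    go second = trans (cong (Refold.shift) (trans (open-A two) (cong (λ x → node x , one) (sym end-v₁))))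
      (trans (refold-shift (not e₀ , one)) (trans (cong (λ l → node (newEnd v (proj₁ l)) , proj₂ l) (fold-outer e₀)) (cong (λ x → node x , two) end-v₀)))
    go {x} (away p q) = trans (cong (Refold.shift) (open-away p))
      (Refold.shift-away (by-end {λ b → node x ≢ node (newEnd v b)} e₀
        (λ h → p (trans h (cong node end-v₀))) (λ h → q (trans h (cong node end-v₁)))))

  agree-node : ∀ {x y} → Agree x y → node x ≡ node y
  agree-node (inj₁ e)       = cong node e
  agree-node (inj₂ (p , q)) = trans p (sym q)

  weigh-capʳ : ∀ x y → cap T (node y) ≡ true → weigh (cap T) x y ≡ + 0
  weigh-capʳ x y c = trans (weigh-skew (cap T) y x) (cong -_ (weigh-cap (cap T) x c))

  weigh-agree : ∀ {x x' y y'} → Agree x x' → Agree y y' → weigh (cap T) x y ≡ weigh (cap T) x' y'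
  weigh-agree (inj₁ refl) (inj₁ refl) = refl
  weigh-agree {y = y} {y'} (inj₂ (p , q)) _ =
    trans (weigh-cap (cap T) y (trans (cong (cap T) p) cap₀)) (sym (weigh-cap (cap T) y' (trans (cong (cap T) q) cap₀)))
  weigh-agree {x} {x'} _ (inj₂ (p , q)) =
    trans (weigh-capʳ x _ (trans (cong (cap T) p) cap₀)) (sym (weigh-capʳ x' _ (trans (cong (cap T) q) cap₀)))

  refold-matrix : matrix Refold.folded ≈ matrix T
  refold-matrix i j = Σb-cong₂ (λ e e' → trans
    (cong (λ b → if (node (end Refold.folded i e) == node (end Refold.folded j e')) ∧ not b
                 then turn (proj₂ (end Refold.folded i e)) (proj₂ (end Refold.folded j e')) else + 0) (refold-cap _))
    (weigh-agree (refold-agree i e) (refold-agree j e')))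

  refold-degree : ∀ u t → degree Refold.folded u t ≡ degree T u t
  refold-degree u t = sum2-cong (λ j → cong₂ (λ x y → ((x == t) xor (y == t)) ∧ u j)
    (agree-node (refold-agree j false)) (agree-node (refold-agree j true)))

  -- Folding the unfolded triangulation gives back `T` up to `Agree`. As mutation at `v` is an
  -- involution, the step for the fold can be read in the other direction.
  unfold-step : Step T v unfolded
  unfold-step = let m , φ , h = Refold.fold-step in
    (λ i j → trans (mutate-cong v (λ i j → sym (trans (m i j) (refold-matrix i j))) i j) (mutate-involutive v (matrix unfolded) i j)) ,
    iso-inverse φ , λ u t → trans (sym (h (from φ u) t)) (trans (degree-cong Refold.folded (to-from φ u) t) (refold-degree u t))

-- Every mutation is a flip

_≟ₚ_ : ∀ {N} (x y : Port N) → Dec (x ≡ y)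
(t , p) ≟ₚ (s , q) = map′ (λ { (refl , refl) → refl }) (λ { refl → refl , refl }) ((t ≟ s) ×-dec (p ≟ q))

anyBool? : ∀ {P : Bool → Set} → (∀ b → Dec (P b)) → Dec (∃ P)
anyBool? P? with P? false | P? true
... | yes p | _     = yes (false , p)
... | no _  | yes q = yes (true , q)
... | no p  | no q  = no λ { (false , r) → p r ; (true , r) → q r }

no-isolated : ∀ {n} {B : Mat n} → Connected B → ∀ {v w} → v ≢ w → ¬ (∀ j → B v j ≡ + 0)
no-isolated con {v} {w} v≢w h with con v w
... | ε = v≢w refl
... | adj ◅ _ = adj (h _)

-- If both pairs of sides fold, the two partners hold all four outer ports at `v`, and neither is
-- adjacent to `v`. So `v` would be isolated in the quiver, against connectedness.
module TwoPartners {N n : ℕ} (T : Triangulation N n) (v : Fin n)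
  (tri : ∀ e → cap T (node (end T v e)) ≡ false) (base : ∀ e → end T v e ≡ (node (end T v e) , zero))
  (b : Bool) (w : Fin n) (e : Bool)
  (w-one : end T w e ≡ (node (end T v b) , one)) (w-two : end T w (not e) ≡ (node (end T v (not b)) , two))
  (x : Fin n) (d : Bool)
  (x-one : end T x d ≡ (node (end T v (not b)) , one)) (x-two : end T x (not d) ≡ (node (end T v b) , two)) where

  open Around T v tri base

  module W = Partner T v tri base b w e w-one w-two
  module X = Partner T v tri base (not b) x d x-one
    (trans x-two (cong (λ c → node (end T v c) , two) (sym (Boolₚ.not-involutive b))))

  isolated : ∀ j → matrix T v j ≡ + 0
  isolated j with j ≟ v | j ≟ w | j ≟ x
  ... | yes refl | _ | _ = skew-diagonal {B = matrix T} (matrix-skew T) j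
  ... | _ | yes refl | _ = W.matrix-vw
  ... | _ | _ | yes refl = X.matrix-vw
  ... | no j≢v | no j≢w | no j≢x = no-common-node T {v} {j} (λ c e' p → off c (proj₂ (end T j e')) e' (cong (_, proj₂ (end T j e')) (sym p)))
    where
    off : ∀ c p e' → end T j e' ≢ loc (c , p)
    off c zero e' q = j≢v (alone c q)
    off c one e' q with c Bool.≟ b
    ... | yes refl = j≢w (W.w-alone q)
    ... | no c≢b with Boolₚ.¬-not c≢b
    ...   | refl = j≢x (X.w-alone q)
    off c two e' q with c Bool.≟ b
    ... | yes refl = j≢x (X.w-alone′ (trans q (cong (λ c → loc (c , two)) (sym (Boolₚ.not-involutive b)))))
    ... | no c≢b with Boolₚ.¬-not c≢b
    ...   | refl = j≢w (W.w-alone′ q)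

module _ {N n : ℕ} (T : Triangulation N n) (con : Connected (matrix T)) (v : Fin n) where

  open Rotate T v

  from-rotated : ∀ T' → Step rotated v T' → Step T v T'
  from-rotated T' (m , φ , h) = (λ i j → trans (mutate-cong v (≈-sym rotated-matrix) i j) (m i j)) , φ , h

  FoldAt : Bool → Set
  FoldAt b = ∃[ i ] ∃[ e ] end rotated i e ≡ (node (end T v b) , one) × end rotated i (not e) ≡ (node (end T v (not b)) , two)

  foldAt? : ∀ b → Dec (FoldAt b)
  foldAt? b = Finₚ.any? (λ i → anyBool? (λ e → (_ ≟ₚ _) ×-dec (_ ≟ₚ _)))

  based : (∀ e → cap T (node (end T v e)) ≡ false) → ∀ e → end rotated v e ≡ (node (end T v e) , zero)
  based tri e = rotated-base e (tri e)

  not-not : ∀ b {p} → _≡_ {A = Port N} (node (end T v (not (not b))) , p) (node (end T v b) , p)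
  not-not b {p} = cong (λ c → node (end T v c) , p) (Boolₚ.not-involutive b)

  double-fold : (∀ e → cap T (node (end T v e)) ≡ false) → ∀ b → FoldAt b → ¬ FoldAt (not b)
  double-fold tri b (w , e , p , q) (x , d , r , s) =
    no-isolated con (Partner.w≢v rotated v tri (based tri) b w e p q ∘ sym)
      (λ j → trans (sym (rotated-matrix v j)) (TwoPartners.isolated rotated v tri (based tri) b w e p q x d r (trans s (not-not b)) j))

  -- An arc ending at a cap is unfolded. Otherwise both its triangles are proper, and the flip is a
  -- fold or an ordinary one according to whether a partner exists.
  mutation-step : ∃[ T' ] Step T v T'
  mutation-step with anyBool? (λ e → cap T (node (end T v (not e))) Bool.≟ true)
  ... | yes (e , c) = UnfoldArc.unfolded rotated v e tri (rotated-base e tri) c ,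
                      from-rotated (UnfoldArc.unfolded rotated v e tri (rotated-base e tri) c) (UnfoldArc.unfold-step rotated v e tri (rotated-base e tri) c)
    where
    tri : cap T (node (end T v e)) ≡ false
    -- `cap-twins` applied to `v` and itself says that its two ends are not both caps.
    tri = trans (cong (λ d → cap T (node (end T v d))) (sym (Boolₚ.not-involutive e))) (proj₂ (cap-twins T v (not e) v (not e) c refl))
  ... | no h = folds (anyBool? foldAt?)
    where
    tri : ∀ e → cap T (node (end T v e)) ≡ false
    tri e = not-true (λ c → h (not e , trans (cong (λ d → cap T (node (end T v d))) (Boolₚ.not-involutive e)) c))
    folds : Dec (∃ FoldAt) → ∃[ T' ] Step T v T'
    folds (no k) = FlipArc.flipped rotated v tri (based tri) noFold ,
                   from-rotated (FlipArc.flipped rotated v tri (based tri) noFold) (FlipArc.flip-step rotated v tri (based tri) noFold)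
      where
      noFold : ∀ b i e → end rotated i e ≡ (node (end T v b) , one) → end rotated i (not e) ≢ (node (end T v (not b)) , two)
      noFold b i e p q = k (b , i , e , p , q)
    folds (yes (b , f@(w , e , p , q))) = FoldArc.folded rotated v tri (based tri) b w e p q noFold ,
        from-rotated (FoldArc.folded rotated v tri (based tri) b w e p q noFold) (FoldArc.fold-step rotated v tri (based tri) b w e p q noFold)
      where
      noFold : ∀ i e → end rotated i e ≡ (node (end T v (not b)) , one) → end rotated i (not e) ≢ (node (end T v b) , two)
      noFold i d r s = double-fold tri b f (i , d , r , trans s (sym (not-not b)))

module _ {N n : ℕ} (T : Triangulation N n) (σ τ : Fin n → Fin n) (στ : ∀ i → σ (τ i) ≡ i) (τσ : ∀ i → τ (σ i) ≡ i) where

  σ-injective : ∀ {i j} → σ i ≡ σ j → i ≡ j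
  σ-injective {i} {j} e = trans (sym (τσ i)) (trans (cong τ e) (τσ j))

  relabelled : Triangulation N n
  relabelled = record
    { end = end T ∘ σ ; cap = cap T ; apart = apart T ∘ σ
    ; port-twins = λ i e j e' i≢j → port-twins T (σ i) e (σ j) e' (i≢j ∘ σ-injective)
    ; cap-twins = λ i e j e' → cap-twins T (σ i) e (σ j) e'
    ; cap-twin = λ i e c → let j , e' , j≢ , p = cap-twin T (σ i) e c in
        τ j , e' , (λ q → j≢ (trans (sym (στ j)) (cong σ q))) , trans (cong (λ x → node (end T x e')) (στ j)) p
    ; cap-two = λ i e j e' k e'' c p q f g → σ-injective
        (cap-two T (σ i) e (σ j) e' (σ k) e'' c p q (f ∘ σ-injective) (g ∘ σ-injective))
    ; occupied = λ t → let i , e , p = occupied T t in τ i , e , trans (cong (λ x → node (end T x e)) (στ i)) p }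

  relabelling : LinearIso n
  relabelling = record { to = _∘ σ ; from = _∘ τ ; to-cong = λ e → e ∘ σ ; from-cong = λ e → e ∘ τ
    ; to-⊕ = λ _ _ _ → refl ; from-⊕ = λ _ _ _ → refl ; to-from = λ u i → cong u (τσ i) ; from-to = λ u i → cong u (στ i) }

  relabelling-intertwines : Intertwines T relabelled relabelling
  relabelling-intertwines u t = sum2-bijection σ τ στ τσ (λ j → at T j t ∧ u j)

-- Properties preserved by mutation-equivalence

-- Both implications are proved together because `sym'` exchanges them; the backward one for `mut`
-- comes from involutivity.
mutEq-invariant : ∀ {n} (P : Mat n → Set) → (∀ {B C} → B ≈ C → P B → P C) → (∀ {B} k → P B → P (mutate k B)) →
  (∀ {B} (σ τ : Fin n → Fin n) → (∀ i → σ (τ i) ≡ i) → (∀ i → τ (σ i) ≡ i) → P B → P (λ i j → B (σ i) (σ j))) →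
  ∀ {B C} → MutEq B C → (P B → P C) × (P C → P B)
mutEq-invariant P resp mutates relabels = go
  where
  go : ∀ {B C} → MutEq B C → (P B → P C) × (P C → P B)
  go (base e) = resp e , resp (≈-sym e)
  go (sym' p) = let f , g = go p in g , f
  go (trans' p q) = let f , g = go p ; f' , g' = go q in f' ∘ f , g ∘ g'
  go {B} {C} (mut k e) = resp (≈-sym e) ∘ mutates k ,
    resp (≈-trans (mutate-cong k e) (mutate-involutive k B)) ∘ mutates k
  go {B} {C} (iso σ e) = resp (≈-sym e) ∘ relabels (σ ⟨$⟩ʳ_) (σ ⟨$⟩ˡ_) (λ i → inverseʳ σ) (λ i → inverseˡ σ) ,
    resp (λ i j → trans (e _ _) (cong₂ B (inverseʳ σ) (inverseʳ σ))) ∘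
    relabels (σ ⟨$⟩ˡ_) (σ ⟨$⟩ʳ_) (λ i → inverseˡ σ) (λ i → inverseʳ σ)

connected-≈ : ∀ {n} {B C : Mat n} → B ≈ C → Connected B → Connected C
connected-≈ e con i j = Star.map (λ h q → h (trans (e _ _) q)) (con i j)

-- An edge disappears only when it is cancelled by a path through `k`, and the two edges of that
-- path survive with reversed direction.
connected-mutate : ∀ {n} {B : Mat n} k → Connected B → Connected (mutate k B)
connected-mutate {n} {B} k con i j = along (con i j)
  where
  edge : ∀ {i j} → Adj B i j → Star (Adj (mutate k B)) i j
  edge {i} {j} h with mutate k B i j ℤ.≟ + 0
  ... | no p = p ◅ ε
  ... | yes p = into ◅ out ◅ ε
    where
    off : i ≢ k × j ≢ k
    off = (λ { refl → h (trans (sym (ℤₚ.neg-involutive _)) (cong -_ (trans (sym (mutate-row k B j)) p))) }) ,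
          (λ { refl → h (trans (sym (ℤₚ.neg-involutive _)) (cong -_ (trans (sym (mutate-col k B i)) p))) })
    eq : B i j ℤ.+ bump (B i k) (B k j) ≡ + 0
    eq = trans (sym (mutate-off k B (proj₁ off) (proj₂ off))) p
    into : Adj (mutate k B) i k
    into q = h (trans (sym (ℤₚ.+-identityʳ _)) (trans (cong (λ x → B i j ℤ.+ bump x (B k j))
      (sym (trans (sym (ℤₚ.neg-involutive _)) (cong -_ (trans (sym (mutate-col k B i)) q))))) eq))
    out : Adj (mutate k B) k j
    out q = h (trans (sym (ℤₚ.+-identityʳ _)) (trans (cong (λ x → B i j ℤ.+ x)
      (sym (trans (cong (bump (B i k)) (trans (sym (ℤₚ.neg-involutive _)) (cong -_ (trans (sym (mutate-row k B j)) q)))) (bump-zeroʳ (B i k))))) eq))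
  along : ∀ {i j} → Star (Adj B) i j → Star (Adj (mutate k B)) i j
  along ε = ε
  along (h ◅ p) = edge h ◅◅ along p

connected-relabel : ∀ {n} {B : Mat n} (σ τ : Fin n → Fin n) → (∀ i → σ (τ i) ≡ i) → (∀ i → τ (σ i) ≡ i) →
                    Connected B → Connected (λ i j → B (σ i) (σ j))
connected-relabel {B = B} σ τ στ τσ con i j = subst₂ (Star (Adj (λ i j → B (σ i) (σ j)))) (τσ i) (τσ j)
  (Star.gmap τ (λ {x} {y} h q → h (trans (sym (cong₂ B (στ x) (στ y))) q)) (con (σ i) (σ j)))

-- The reference `T` stays fixed along the chain of mutations, and so does the number of nodes; the
-- isomorphisms are composed starting from it.
Triangulated : ∀ {N n} → Triangulation N n → Mat n → Set
Triangulated T C = Connected C × ∃[ T' ] matrix T' ≈ C × ∃[ φ ] Intertwines T T' φ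

mutEq-triangulated : ∀ {N n} (T : Triangulation N n) {B C : Mat n} → MutEq B C → Connected B → matrix T ≈ B → Triangulated T C
mutEq-triangulated T p con m = proj₁ (mutEq-invariant (Triangulated T)
  (λ e (con , T' , m , h) → connected-≈ e con , T' , ≈-trans m e , h)
  mutates
  (λ {B} σ τ στ τσ (con , T' , m , φ , h) → connected-relabel {B = B} σ τ στ τσ con , relabelled T' σ τ στ τσ , (λ i j → m (σ i) (σ j)) ,
    iso-compose φ (relabelling T' σ τ στ τσ) , λ u t → trans (relabelling-intertwines T' σ τ στ τσ (to φ u) t) (h u t))
  p) (con , T , m , iso-id , λ _ _ → refl)
  where
  mutates : ∀ {B} k → Triangulated T B → Triangulated T (mutate k B)
  mutates k (con , T' , m , φ , h) with mutation-step T' (connected-≈ (≈-sym m) con) k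
  ... | T'' , m' , ψ , h' = connected-mutate k con , T'' , ≈-trans (≈-sym m') (mutate-cong k m) ,
        iso-compose φ ψ , λ u t → trans (h' (to φ u) t) (h u t)

-- The cycle space

weight : ∀ {n} → Vect n → ℕ
weight {zero}  u = 0
weight {suc n} u = (if u zero then 1 else 0) ℕ.+ weight (u ∘ suc)

weight-cong : ∀ {n} {u w : Vect n} → u ≗ w → weight u ≡ weight w
weight-cong {zero}  e = refl
weight-cong {suc n} e = cong₂ (λ b s → (if b then 1 else 0) ℕ.+ s) (e zero) (weight-cong (e ∘ suc))

weight-≤ : ∀ {n} {u z : Vect n} → (∀ k → z k ≡ true → u k ≡ true) → weight (u ⊕ z) ≤ weight u
weight-≤ {zero} h = z≤n
weight-≤ {suc n} {u} {z} h = ℕₚ.+-mono-≤ (bit (u zero) (z zero) (h zero)) (weight-≤ (h ∘ suc))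
  where
  bit : ∀ a b → (b ≡ true → a ≡ true) → (if a xor b then 1 else 0) ≤ (if a then 1 else 0)
  bit true  true  _ = z≤n
  bit true  false _ = ℕₚ.≤-refl
  bit false false _ = z≤n
  bit false true  h = contradiction (h refl) λ ()

weight-< : ∀ {n} {u z : Vect n} → (∀ k → z k ≡ true → u k ≡ true) → ∀ k → z k ≡ true → weight (u ⊕ z) ℕ.< weight u
weight-< {suc n} {u} {z} h zero e rewrite e | h zero e = s≤s (weight-≤ (h ∘ suc))
weight-< {suc n} {u} {z} h (suc k) e =
  ℕₚ.+-mono-≤-< (bit (u zero) (z zero) (h zero)) (weight-< (h ∘ suc) k e)
  where
  bit : ∀ a b → (b ≡ true → a ≡ true) → (if a xor b then 1 else 0) ≤ (if a then 1 else 0)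
  bit true  true  _ = z≤n
  bit true  false _ = ℕₚ.≤-refl
  bit false false _ = z≤n
  bit false true  h = contradiction (h refl) λ ()

module _ {n : ℕ} {P : Vect n → Set} where

  span-zero : ∀ {u} → (∀ k → u k ≡ false) → Span P u
  span-zero h = [] , [] , h

  span-add : ∀ {z u} → P z → Span P (u ⊕ z) → Span P u
  span-add {z} {u} p (ps , all , e) = z ∷ ps , p ∷ all ,
    λ i → trans (restore (u i) (z i)) (cong (z i xor_) (e i))
    where
    restore : ∀ a b → a ≡ b xor (a xor b)
    restore true  true  = refl
    restore true  false = refl
    restore false true  = refl
    restore false false = refl

  span-one : ∀ {z} → P z → Span P z
  span-one {z} p = span-add p (span-zero (λ k → xor-self (z k)))

  span-⊕ : ∀ {u w} → Span P u → Span P w → Span P (u ⊕ w)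
  span-⊕ {u} {w} (ps , all , e) s = go ps all u e
    where
    go : ∀ ps → All P ps → ∀ u → (∀ i → u i ≡ xorSum ps i) → Span P (u ⊕ w)
    go [] [] u e = proj₁ s , proj₁ (proj₂ s) , λ i → trans (cong (_xor w i) (e i)) (proj₂ (proj₂ s) i)
    go (z ∷ ps) (p ∷ all) u e with go ps all (xorSum ps) (λ _ → refl)
    ... | qs , all' , e' = z ∷ qs , p ∷ all' , λ i → trans (cong (_xor w i) (e i))
          (trans (Boolₚ.xor-assoc (z i) (xorSum ps i) (w i)) (cong (z i xor_) (e' i)))

next-lower : ∀ {l} (i : Fin l) → toℕ (next (inject₁ i)) ≡ suc (toℕ (inject₁ i))
next-lower i = trans (cong toℕ (next-inject₁ i)) (cong suc (sym (Finₚ.toℕ-inject₁ i)))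

-- A closed walk, cut down to its first return to a value, is simple.
simple-period : ∀ {N} (t : ℕ → Fin N) → ∃[ a ] ∃[ d ] 1 ≤ d × t (a ℕ.+ d) ≡ t a ×
                (∀ (i j : Fin d) → t (a ℕ.+ toℕ i) ≡ t (a ℕ.+ toℕ j) → i ≡ j)
simple-period {N} t with Finₚ.pigeonhole (ℕₚ.n<1+n N) (t ∘ toℕ)
... | i , j , i<j , e = shrink (toℕ j ℕ.∸ toℕ i) (<-wellFounded _) (toℕ i) (ℕₚ.m<n⇒0<n∸m i<j)
      (trans (cong t (ℕₚ.m+[n∸m]≡n (ℕₚ.<⇒≤ i<j))) (sym e))
  where
  shrink : ∀ d → Acc ℕ._<_ d → ∀ a → 1 ≤ d → t (a ℕ.+ d) ≡ t a → ∃[ a ] ∃[ d ] 1 ≤ d × t (a ℕ.+ d) ≡ t a ×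
           (∀ (i j : Fin d) → t (a ℕ.+ toℕ i) ≡ t (a ℕ.+ toℕ j) → i ≡ j)
  shrink d (acc rec) a 1≤d e
    with Finₚ.any? {n = d} (λ i → Finₚ.any? {n = d} (λ j → (toℕ i ℕ.<? toℕ j) ×-dec (t (a ℕ.+ toℕ i) ≟ t (a ℕ.+ toℕ j))))
  ... | yes (i , j , i<j , p) = shrink (toℕ j ℕ.∸ toℕ i)
          (rec (ℕₚ.≤-<-trans (ℕₚ.m∸n≤m (toℕ j) (toℕ i)) (Finₚ.toℕ<n j))) (a ℕ.+ toℕ i) (ℕₚ.m<n⇒0<n∸m i<j)
          (trans (cong t (trans (ℕₚ.+-assoc a (toℕ i) _) (cong (a ℕ.+_) (ℕₚ.m+[n∸m]≡n (ℕₚ.<⇒≤ i<j))))) (sym p))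
  ... | no h = a , d , 1≤d , e , λ i j p → case ℕₚ.<-cmp (toℕ i) (toℕ j) of λ
          { (tri< i<j _ _) → contradiction (i , j , i<j , p) h
          ; (tri≈ _ q _) → Finₚ.toℕ-injective q
          ; (tri> _ _ j<i) → contradiction (j , i , j<i , sym p) h }

module _ {N n : ℕ} (T : Triangulation N n) where

  Joins : Fin n → Fin N → Fin N → Set
  Joins v s t = ∃[ e ] node (end T v e) ≡ s × node (end T v (not e)) ≡ t

  joins-at : ∀ {v s t} → Joins v s t → ∀ x → at T v x ≡ (s == x) xor (t == x)
  joins-at (false , refl , refl) x = refl
  joins-at {v} (true , refl , refl) x = Boolₚ.xor-comm (node (end T v false) == x) _

  joins-meet : ∀ {v s t} → Joins v s t → ∀ j → meet T v j ≡ at T j s xor at T j t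
  joins-meet (false , refl , refl) j = refl
  joins-meet {v} (true , refl , refl) j = Boolₚ.xor-comm (at T j (node (end T v false))) _

  joins-sym : ∀ {v s t} → Joins v s t → Joins v t s
  joins-sym {v} (e , p , q) = not e , q , trans (cong (λ e → node (end T v e)) (Boolₚ.not-involutive e)) p

  joins-≢ : ∀ {v s t} → Joins v s t → s ≢ t
  joins-≢ {v} (e , refl , refl) = apart T v e

  joins-end : ∀ {v s t} → Joins v s t → ∀ e → node (end T v e) ≡ s ⊎ node (end T v e) ≡ t
  joins-end (false , p , q) false = inj₁ p
  joins-end (false , p , q) true  = inj₂ q
  joins-end (true  , p , q) false = inj₂ q
  joins-end (true  , p , q) true  = inj₁ p

  joins-unique : ∀ {v s t s' t'} → Joins v s t → Joins v s' t' → (s ≡ s' × t ≡ t') ⊎ (s ≡ t' × t ≡ s')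
  joins-unique (false , refl , refl) (false , refl , refl) = inj₁ (refl , refl)
  joins-unique (true  , refl , refl) (true  , refl , refl) = inj₁ (refl , refl)
  joins-unique (false , refl , refl) (true  , refl , refl) = inj₂ (refl , refl)
  joins-unique (true  , refl , refl) (false , refl , refl) = inj₂ (refl , refl)

  at-joins : ∀ {v t} → at T v t ≡ true → ∃[ s ] Joins v t s
  at-joins {v} p with end-at T {v} p
  ... | e , q = _ , e , q , refl

  odd-adjacent : ∀ {i j} → meet T i j ≡ true → Adj (matrix T) i j
  odd-adjacent {i} {j} m e = contradiction (trans (sym m) (trans (sym (gram T i j)) (cong mod2 e))) λ ()

  adjacent-sym : ∀ {i j} → Adj (matrix T) i j → Adj (matrix T) j i
  adjacent-sym {i} {j} h e = h (trans (matrix-skew T j i) (cong -_ e))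

  -- A simple cycle of length `2 + l` in the multigraph. For length two the stops do not exclude
  -- running back along the same arc, and `turning` does; for greater length the arcs are distinct
  -- because the stops are.
  record Ring (l : ℕ) : Set where
    field
      arc      : Fin (2 ℕ.+ l) → Fin n
      stop     : Fin (2 ℕ.+ l) → Fin N
      distinct : ∀ i j → stop i ≡ stop j → i ≡ j
      joins    : ∀ i → Joins (arc i) (stop i) (stop (next i))
      turning  : arc (suc zero) ≢ arc zero

  module _ {l : ℕ} (R : Ring l) where
    open Ring R

    ring-degree : ∀ t → degree T (indicator arc) t ≡ false
    ring-degree t = begin
      sum2 (λ j → at T j t ∧ indicator arc j)
        ≡⟨ trans (sum2-cong (λ j → Boolₚ.∧-comm (at T j t) (indicator arc j))) (indicator-sum arc (λ j → at T j t)) ⟩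
      sum2 (λ i → at T (arc i) t)
        ≡⟨ sum2-cong (λ i → joins-at (joins i) t) ⟩
      sum2 (λ i → (stop i == t) xor (stop (next i) == t))
        ≡⟨ sum2-xor (λ i → stop i == t) (λ i → stop (next i) == t) ⟩
      sum2 (λ i → stop i == t) xor sum2 (λ i → stop (next i) == t)
        ≡⟨ cong (sum2 (λ i → stop i == t) xor_) (sum2-bijection next prev next-prev prev-next (λ i → stop i == t)) ⟩
      sum2 (λ i → stop i == t) xor sum2 (λ i → stop i == t)
        ≡⟨ xor-self (sum2 (λ i → stop i == t)) ⟩
      false ∎
      where open ≡-Reasoning

    ring-radical : Radical (matrix T) (indicator arc)
    ring-radical = constant-radical T false ring-degree

  digon-injective : (R : Ring 0) → ∀ a b → Ring.arc R a ≡ Ring.arc R b → a ≡ b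
  digon-injective R zero zero _ = refl
  digon-injective R (suc zero) (suc zero) _ = refl
  digon-injective R zero (suc zero) e = contradiction (sym e) (Ring.turning R)
  digon-injective R (suc zero) zero e = contradiction e (Ring.turning R)

  digon-basic : (R : Ring 0) → BasicRadical (matrix T) (indicator (Ring.arc R))
  digon-basic R = ring-radical R , inj₁ (arc zero , arc (suc zero) , turning ∘ sym ,
      λ k → mk⇔ (λ e → case indicator-∋ arc k e of λ { (zero , p) → inj₁ (sym p) ; (suc zero , p) → inj₂ (sym p) })
                λ { (inj₁ refl) → indicator-∈ arc (digon-injective R) zero ; (inj₂ refl) → indicator-∈ arc (digon-injective R) (suc zero) })
    where open Ring R

  module _ {l : ℕ} (R : Ring (suc l)) where
    open Ring R

    arc-injective : ∀ a b → arc a ≡ arc b → a ≡ b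
    arc-injective a b e with joins-unique (joins a) (subst (λ v → Joins v (stop b) (stop (next b))) (sym e) (joins b))
    ... | inj₁ (p , _) = distinct a b p
    ... | inj₂ (p , q) = contradiction (trans (cong next (sym (distinct a (next b) p))) (distinct (next a) b q)) (next²≢ b)

    consecutive : ∀ a → meet T (arc a) (arc (next a)) ≡ true
    consecutive a = begin
      meet T (arc a) (arc (next a))
        ≡⟨ joins-meet (joins a) (arc (next a)) ⟩
      at T (arc (next a)) (stop a) xor at T (arc (next a)) (stop (next a))
        ≡⟨ cong₂ _xor_ (joins-at (joins (next a)) (stop a)) (joins-at (joins (next a)) (stop (next a))) ⟩
      ((stop (next a) == stop a) xor (stop (next (next a)) == stop a)) xor
      ((stop (next a) == stop (next a)) xor (stop (next (next a)) == stop (next a)))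
        ≡⟨ cong₂ _xor_
             (cong₂ _xor_ (==-≢ (next≢ a ∘ distinct _ _)) (==-≢ (next²≢ a ∘ distinct _ _)))
             (cong₂ _xor_ (==-refl (stop (next a))) (==-≢ (next≢ (next a) ∘ distinct _ _))) ⟩
      true ∎
      where open ≡-Reasoning

    -- Consecutive arcs share exactly one node, so their entry is odd; other distinct arcs share
    -- none, so their entry vanishes. Hence a simple cycle of the multigraph induces a cycle in the
    -- quiver.
    ring-adjacency : ∀ a b → Adj (matrix T) (arc a) (arc b) ⇔ (b ≡ next a ⊎ a ≡ next b)
    ring-adjacency a b = mk⇔ to-next from-next
      where
      from-next : b ≡ next a ⊎ a ≡ next b → Adj (matrix T) (arc a) (arc b)
      from-next (inj₁ refl) = odd-adjacent (consecutive a)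
      from-next (inj₂ refl) = adjacent-sym {arc b} {arc (next b)} (odd-adjacent (consecutive b))
      to-next : Adj (matrix T) (arc a) (arc b) → b ≡ next a ⊎ a ≡ next b
      to-next h with common-node T {arc a} {arc b} h
      ... | e , e' , p with joins-end (joins a) e | joins-end (joins b) e'
      ...   | inj₁ q | inj₁ r = contradiction (distinct a b (trans (sym q) (trans p r))) (λ { refl → h (skew-diagonal {B = matrix T} (matrix-skew T) (arc a)) })
      ...   | inj₁ q | inj₂ r = inj₂ (distinct a (next b) (trans (sym q) (trans p r)))
      ...   | inj₂ q | inj₁ r = inj₁ (sym (distinct (next a) b (trans (sym q) (trans p r))))
      ...   | inj₂ q | inj₂ r = contradiction (next-injective {a = a} {b} (distinct (next a) (next b) (trans (sym q) (trans p r))))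
                (λ { refl → h (skew-diagonal {B = matrix T} (matrix-skew T) (arc a)) })

    cycle-basic : BasicRadical (matrix T) (indicator arc)
    cycle-basic = ring-radical R , inj₂ (l , arc , arc-injective ,
      (λ k → mk⇔ (indicator-∋ arc k) λ { (a , refl) → indicator-∈ arc arc-injective a }) , ring-adjacency)

  ring-basic : ∀ {l} (R : Ring l) → BasicRadical (matrix T) (indicator (Ring.arc R))
  ring-basic {zero}  = digon-basic
  ring-basic {suc l} = cycle-basic

  ring-nonempty : ∀ {l} (R : Ring l) → indicator (Ring.arc R) (Ring.arc R zero) ≡ true
  ring-nonempty {zero}  R = indicator-∈ (Ring.arc R) (digon-injective R) zero
  ring-nonempty {suc l} R = indicator-∈ (Ring.arc R) (arc-injective R) zero

  -- At a node of even degree, an arc of the support by which the node is entered is accompanied by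
  -- another by which it can be left. So walks in the support never get stuck, and by finiteness
  -- they close up.
  module Walk (u : Vect n) (even : ∀ t → degree T u t ≡ false) where

    State : Set
    State = ∃[ v ] Bool × u v ≡ true

    exit : State → Fin N
    exit (v , e , _) = node (end T v e)

    abstract
      advance : (s : State) → ∃[ s' ] proj₁ s' ≢ proj₁ s × Joins (proj₁ s') (exit s) (exit s')
      advance (v , e , p) with even-other (λ j → at T j (node (end T v e)) ∧ u j) v (even (node (end T v e))) (cong₂ _∧_ (at-end T v e) p)
      ... | k , k≢v , q with end-at T {k} (∧-splitˡ q)
      ...   | e' , r = (k , not e' , ∧-splitʳ {at T k (node (end T v e))} q) , k≢v , e' , r , refl

    walk : State → ℕ → State
    walk s zero    = s
    walk s (suc m) = proj₁ (advance (walk s m))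

    ring-in : State → ∃[ l ] Σ (Ring l) λ R → ∀ i → u (Ring.arc R i) ≡ true
    ring-in s with simple-period (λ m → exit (walk s m))
    -- A period of one would make an arc join a node to itself.
    ... | a , suc zero , _ , back , _ = contradiction
          (trans (sym back) (cong (λ m → exit (walk s m)) (ℕₚ.+-comm a 1)))
          (joins-≢ (proj₂ (proj₂ (advance (walk s a)))))
    ... | a , suc (suc l) , _ , back , distinct = l , record
          { arc = λ i → proj₁ (walk s (suc (a ℕ.+ toℕ i))) ; stop = λ i → exit (walk s (a ℕ.+ toℕ i)) ; distinct = distinct
          ; joins = λ i → subst (Joins _ _) (arrive i) (proj₂ (proj₂ (advance (walk s (a ℕ.+ toℕ i)))))
          ; turning = λ e → proj₁ (proj₂ (advance (walk s (suc (a ℕ.+ 0))))) (trans (cong (λ m → proj₁ (walk s (suc m))) (sym (ℕₚ.+-suc a 0))) e) } ,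
          λ i → proj₂ (proj₂ (walk s (suc (a ℕ.+ toℕ i))))
      where
      arrive : ∀ (i : Fin (2 ℕ.+ l)) → exit (walk s (suc (a ℕ.+ toℕ i))) ≡ exit (walk s (a ℕ.+ toℕ (next i)))
      arrive i with top? i
      ... | top = trans (cong (λ m → exit (walk s m)) (trans (sym (ℕₚ.+-suc a _)) (cong (λ m → a ℕ.+ suc m) (Finₚ.toℕ-fromℕ (suc l)))))
                        (trans back (sym (cong (λ m → exit (walk s m)) (trans (cong (λ i → a ℕ.+ toℕ i) (next-fromℕ (suc l))) (ℕₚ.+-identityʳ a)))))
      ... | below i = cong (λ m → exit (walk s m)) (trans (sym (ℕₚ.+-suc a _)) (cong (a ℕ.+_) (sym (next-lower i))))

  true? : ∀ (u : Vect n) → Dec (∃[ k ] u k ≡ true)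
  true? u = Finₚ.any? (λ k → u k Bool.≟ true)

  cycle-space-spanned : ∀ u → (∀ t → degree T u t ≡ false) → V00 (matrix T) u
  cycle-space-spanned u = go u (<-wellFounded (weight u))
    where
    go : ∀ u → Acc ℕ._<_ (weight u) → (∀ t → degree T u t ≡ false) → V00 (matrix T) u
    go u (acc rec) even with true? u
    ... | no h = span-zero (λ k → not-true (λ p → h (k , p)))
    ... | yes (k , p) with Walk.ring-in u even (k , false , p)
    ...   | l , R , inside = span-add (ring-basic R) (go (u ⊕ indicator (Ring.arc R))
              (rec (weight-< sub (Ring.arc R zero) (ring-nonempty R)))
              (λ t → trans (degree-⊕ T u (indicator (Ring.arc R)) t) (cong₂ _xor_ (even t) (ring-degree R t))))
      where
      sub : ∀ k → indicator (Ring.arc R) k ≡ true → u k ≡ true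
      sub k e with indicator-∋ (Ring.arc R) k e
      ... | a , refl = inside a

-- Basic radical vectors of odd degree

module _ {N n : ℕ} (T : Triangulation N n) where

  Covered : (Fin 4 → Fin N) → Fin n → Set
  Covered f v = ∃[ a ] ∃[ b ] Joins T v (f a) (f b)

  -- A node of odd degree is an end of some arc of the support. Choosing a preimage under `f` for
  -- each node therefore embeds the nodes in a set of four.
  covered-bound : (f : Fin 4 → Fin N) → ∀ {z} → (∀ t → degree T z t ≡ true) → (∀ v → z v ≡ true → Covered f v) → N ≤ 4
  covered-bound f {z} odd cov = Finₚ.injective⇒≤ {f = proj₁ ∘ hit} λ {s} {t} e →
      trans (sym (proj₂ (hit s))) (trans (cong f e) (proj₂ (hit t)))
    where
    hit : ∀ t → ∃[ a ] f a ≡ t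
    hit t with sum2-witness (λ j → at T j t ∧ z j) (odd t)
    ... | v , p with cov v (∧-splitʳ {at T v t} p) | end-at T {v} (∧-splitˡ p)
    ...   | a , b , J | e , refl with joins-end T J e
    ...     | inj₁ q = a , sym q
    ...     | inj₂ q = b , sym q

  at-other : ∀ {v s t x} → Joins T v s t → x ≢ s → x ≢ t → at T v x ≡ false
  at-other J p q = trans (joins-at T J _) (cong₂ _xor_ (==-≢ (p ∘ sym)) (==-≢ (q ∘ sym)))

  joins-both : ∀ {v s t} → at T v s ≡ true → at T v t ≡ true → s ≢ t → Joins T v s t
  joins-both {v} {s} {t} p q s≢t with at-joins T {v} p
  ... | x , J with t ≟ x
  ...   | yes refl = J
  ...   | no t≢x   = contradiction (trans (sym q) (at-other J (s≢t ∘ sym) t≢x)) λ ()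

  parallel-matrix : ∀ {i j s t} (G : Joins T i s t) (J : Joins T j s t) → cap T s ≡ false → cap T t ≡ false →
    matrix T i j ≡ turn (proj₂ (end T i (proj₁ G))) (proj₂ (end T j (proj₁ J))) ℤ.+
                   turn (proj₂ (end T i (not (proj₁ G)))) (proj₂ (end T j (not (proj₁ J))))
  parallel-matrix {i} {j} {s} {t} G@(e , p , q) J@(d , r , o) cs ct = begin
    matrix T i j
      ≡⟨ trans (Σb-from e (λ e → Σb (w e))) (cong₂ ℤ._+_ (Σb-from d (w e)) (Σb-from d (w (not e)))) ⟩
    (w e d ℤ.+ w e (not d)) ℤ.+ (w (not e) d ℤ.+ w (not e) (not d))
      ≡⟨ cong₂ ℤ._+_
           (trans (cong (λ x → w e d ℤ.+ x) (weigh-apart (cap T) (λ h → joins-≢ T G (trans (sym p) (trans h o))))) (ℤₚ.+-identityʳ (w e d)))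
           (trans (cong (λ x → x ℤ.+ w (not e) (not d)) (weigh-apart (cap T) (λ h → joins-≢ T G (trans (sym r) (trans (sym h) q)))))
                  (ℤₚ.+-identityˡ (w (not e) (not d)))) ⟩
    w e d ℤ.+ w (not e) (not d)
      ≡⟨ cong₂ ℤ._+_ (same p r cs) (same q o ct) ⟩
    turn (proj₂ (end T i e)) (proj₂ (end T j d)) ℤ.+ turn (proj₂ (end T i (not e))) (proj₂ (end T j (not d))) ∎
    where
    open ≡-Reasoning
    w : Bool → Bool → ℤ
    w e d = weigh (cap T) (end T i e) (end T j d)
    same : ∀ {x y : Port N} {s} → node x ≡ s → node y ≡ s → cap T s ≡ false → weigh (cap T) x y ≡ turn (proj₂ x) (proj₂ y)
    same refl refl c = weigh-same (cap T) c _ _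

  distinct-ports : ∀ {i j s t} (G : Joins T i s t) (J : Joins T j s t) → cap T s ≡ false → cap T t ≡ false → i ≢ j →
                   proj₂ (end T i (proj₁ G)) ≢ proj₂ (end T j (proj₁ J))
  distinct-ports {i} {j} (e , p , q) (d , r , o) cs ct i≢j h = contradiction
    (trans (sym (proj₁ (port-twins T i e j d i≢j (cong₂ _,_ (trans p (sym r)) h) (trans (cong (cap T) p) cs)))) (trans (cong (cap T) q) ct)) λ ()

  parallel-uncapped : ∀ {i j r s t} → Joins T i s t → Joins T j s t → Joins T r s t → i ≢ j → i ≢ r → j ≢ r → cap T s ≡ false
  parallel-uncapped {i} {j} {r} (e , refl , q) (d , p , _) (c , p' , _) i≢j i≢r j≢r = not-true
    (λ k → j≢r (cap-two T i e j d r c k p p' (i≢j ∘ sym) (i≢r ∘ sym)))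

  opposite-turns : ∀ p q r → (p ≡ q ⊎ p ≡ r ⊎ q ≡ r) ⊎ turn p r ≡ - turn p q
  opposite-turns = check₃ (λ p q r →
    ((p ≟ q) ⊎-dec (p ≟ r) ⊎-dec (q ≟ r)) ⊎-dec (turn p r ℤ.≟ - turn p q)) refl

  opposite-turn : ∀ {p q r} → p ≢ q → p ≢ r → q ≢ r → turn p r ≡ - turn p q
  opposite-turn {p} {q} {r} f g h with opposite-turns p q r
  ... | inj₁ e = ⊥-elim ([ f , [ g , h ]′ ]′ e)
  ... | inj₂ e = e

  -- A cap carries only two arcs, so both nodes are proper triangles whose three ports are filled by
  -- the three arcs. In each of them the turns from `i` to `j` and from `i` to `r` have opposite
  -- signs, hence the two entries are negatives of each other.
  three-parallel : ∀ {i j r s t} → Joins T i s t → Joins T j s t → Joins T r s t → i ≢ j → i ≢ r → j ≢ r →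
                   Adj (matrix T) i j → Adj (matrix T) i r
  three-parallel {i} {j} {r} F G H i≢j i≢r j≢r adj e = adj (begin
    matrix T i j                                       ≡⟨ parallel-matrix F G cs ct ⟩
    turn a b ℤ.+ turn a' b'                            ≡⟨ sym (ℤₚ.neg-involutive _) ⟩
    - (- (turn a b ℤ.+ turn a' b'))                    ≡⟨ cong -_ (ℤₚ.neg-distrib-+ (turn a b) (turn a' b')) ⟩
    - (- turn a b ℤ.+ - turn a' b')                    ≡⟨ cong -_ (sym (cong₂ ℤ._+_
        (opposite-turn (distinct-ports F G cs ct i≢j) (distinct-ports F H cs ct i≢r) (distinct-ports G H cs ct j≢r))
        (opposite-turn (distinct-ports F' G' ct cs i≢j) (distinct-ports F' H' ct cs i≢r) (distinct-ports G' H' ct cs j≢r)))) ⟩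
    - (turn a c ℤ.+ turn a' c')                        ≡⟨ cong -_ (sym (parallel-matrix F H cs ct)) ⟩
    - matrix T i r                                     ≡⟨ cong -_ e ⟩
    + 0                                                ∎)
    where
    open ≡-Reasoning
    F' = joins-sym T F
    G' = joins-sym T G
    H' = joins-sym T H
    cs = parallel-uncapped F G H i≢j i≢r j≢r
    ct = parallel-uncapped F' G' H' i≢j i≢r j≢r
    a = proj₂ (end T i (proj₁ F))
    b = proj₂ (end T j (proj₁ G))
    c = proj₂ (end T r (proj₁ H))
    a' = proj₂ (end T i (not (proj₁ F)))
    b' = proj₂ (end T j (not (proj₁ G)))
    c' = proj₂ (end T r (not (proj₁ H)))

  non-adjacent-even : ∀ {i j} → matrix T i j ≡ + 0 → meet T i j ≡ false
  non-adjacent-even {i} {j} e = trans (sym (gram T i j)) (cong mod2 e)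

  xor-true : ∀ {a b} → a xor b ≡ true → (a ≡ true × b ≡ false) ⊎ (a ≡ false × b ≡ true)
  xor-true {true}  {false} _ = inj₁ (refl , refl)
  xor-true {false} {true}  _ = inj₂ (refl , refl)

  common-at : ∀ {i j} → Adj (matrix T) i j → ∃[ t ] at T i t ≡ true × at T j t ≡ true
  common-at {i} {j} h with common-node T {i} {j} h
  ... | e , e' , p = node (end T i e) , at-end T i e , trans (cong (at T j) p) (at-end T j e')

  -- Adjacent arcs share a node; an even number of shared nodes then means both.
  even-parallel : ∀ {i j s t} → Joins T i s t → Adj (matrix T) i j → meet T i j ≡ false → Joins T j s t
  even-parallel {i} {j} {s} {t} G h m = go (xor≡false (trans (sym (joins-meet T G j)) m)) (common-node T {i} {j} h)
    where
    go : at T j s ≡ at T j t → (∃[ e ] ∃[ e' ] node (end T i e) ≡ node (end T j e')) → Joins T j s t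
    go q (e , e' , p) with joins-end T G e
    ... | inj₁ r = let k = trans (cong (at T j) (trans (sym r) p)) (at-end T j e') in joins-both k (trans (sym q) k) (joins-≢ T G)
    ... | inj₂ r = let k = trans (cong (at T j) (trans (sym r) p)) (at-end T j e') in joins-both (trans q k) k (joins-≢ T G)

  meet-sym : ∀ i j → meet T i j ≡ meet T j i
  meet-sym i j = trans (sym (gram T i j)) (trans (mod2-skew (matrix-skew T) i j) (gram T j i))

  parallel-meets : ∀ {i j s t} → Joins T i s t → Joins T j s t → ∀ k → meet T i k ≡ meet T j k
  parallel-meets G J k = trans (joins-meet T G k) (sym (joins-meet T J k))

  module LongCycle {l : ℕ} {c : Fin (4 ℕ.+ l) → Fin n} (cyc : Cyclic (matrix T) (suc l) c)
                   {z : Vect n} (image : ∀ k → z k ≡ true ⇔ (∃[ a ] c a ≡ k)) (odd : ∀ t → degree T z t ≡ true) where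

    c₀ p c₂ : Fin n
    c₀ = c zero
    p  = c one
    c₂ = c two

    next-zero′ : next {3 ℕ.+ l} zero ≡ one
    next-zero′ = next-inject₁ zero

    next-one : next {3 ℕ.+ l} one ≡ two
    next-one = next-inject₁ one

    next-two : next {3 ℕ.+ l} two ≡ suc two
    next-two = next-inject₁ two

    p~c₀ : Adj (matrix T) p c₀
    p~c₀ = Equivalence.from (adjacency cyc one zero) (inj₂ (sym next-zero′))

    p~c₂ : Adj (matrix T) p c₂
    p~c₂ = Equivalence.from (adjacency cyc one two) (inj₁ (sym next-one))

    c₀≁c₂ : matrix T c₀ c₂ ≡ + 0
    c₀≁c₂ = cycle-nonedge cyc zero two (λ e → case trans e next-zero′ of λ ()) (λ e → case trans e next-two of λ ())

    neighbours : ∀ {k} → z k ≡ true → Adj (matrix T) p k → k ≡ c₀ ⊎ k ≡ c₂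
    neighbours {k} h adj with Equivalence.to (image k) h
    ... | b , refl with Equivalence.to (adjacency cyc one b) adj
    ...   | inj₁ e = inj₂ (cong c (trans e next-one))
    ...   | inj₂ e = inj₁ (cong c (next-injective {a = b} {zero} (trans (sym e) (sym next-zero′))))

    -- A fourth vertex adjacent to both neighbours of p closes the cycle.
    finish : ∀ {k} (f : Fin 4 → Fin N) → z k ≡ true → k ≢ p → Adj (matrix T) c₀ k → Adj (matrix T) c₂ k →
             Covered f c₀ → Covered f p → Covered f c₂ → Covered f k → N ≤ 4
    finish {k} f h k≢p a₀ a₂ C₀ Cp C₂ Ck with Equivalence.to (image k) h
    ... | b , refl = covered-bound f odd λ v zv → every v (Equivalence.to (image v) zv)
      where
      b≡3 : b ≡ suc two
      b≡3 with Equivalence.to (adjacency cyc two b) a₂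
      ... | inj₁ e = trans e next-two
      ... | inj₂ e = contradiction (cong c (next-injective {a = b} {one} (trans (sym e) (sym next-one)))) k≢p
      closes : zero ≡ next b
      closes with Equivalence.to (adjacency cyc zero b) a₀
      ... | inj₁ e = contradiction (cong c (trans e next-zero′)) k≢p
      ... | inj₂ e = e
      -- Position three is followed by position zero only in a cycle of length four.
      short : ∀ l (b : Fin (4 ℕ.+ l)) → b ≡ suc two → zero ≡ next b → ∀ (a : Fin (4 ℕ.+ l)) → a ≡ zero ⊎ a ≡ one ⊎ a ≡ two ⊎ a ≡ b
      short zero    b refl e zero            = inj₁ refl
      short zero    b refl e one             = inj₂ (inj₁ refl)
      short zero    b refl e two             = inj₂ (inj₂ (inj₁ refl))
      short zero    b refl e (suc two)       = inj₂ (inj₂ (inj₂ refl))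
      short (suc l) b refl e a = case trans e (next-inject₁ {4 ℕ.+ l} (suc two)) of λ ()
      every : ∀ v → ∃[ a ] c a ≡ v → Covered f v
      every v (a , refl) with short l b b≡3 closes a
      ... | inj₁ refl = C₀
      ... | inj₂ (inj₁ refl) = Cp
      ... | inj₂ (inj₂ (inj₁ refl)) = C₂
      ... | inj₂ (inj₂ (inj₂ refl)) = Ck

    four : Fin N → Fin N → Fin N → Fin N → Fin 4 → Fin N
    four x y s t zero      = x
    four x y s t one       = y
    four x y s t two       = s
    four x y s t (suc two) = t

    z₀ : z c₀ ≡ true
    z₀ = Equivalence.from (image c₀) (zero , refl)

    zp : z p ≡ true
    zp = Equivalence.from (image p) (one , refl)

    z₂ : z c₂ ≡ true
    z₂ = Equivalence.from (image c₂) (two , refl)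

    distinct : ∀ {a b} → a ≢ b → c a ≢ c b
    distinct = cycle-distinct cyc

    -- If `c₂` also touches `x`, it is parallel to `c₀`, as the two are not adjacent; odd degree at
    -- their far end `y` gives a third arc `k` there, which avoids `x` because it is not adjacent to
    -- `p`. If `c₂` touches `x'`, odd degree at `x` gives a third arc `k`, which must be parallel to
    -- `p`. Either way `k` is adjacent to both `c₀` and `c₂` and closes a cycle of length four on
    -- four nodes.
    common : ∀ {x x'} → Joins T p x x' → at T c₀ x ≡ true → at T c₀ x' ≡ false → meet T p c₂ ≡ true → N ≤ 4
    common {x} {x'} P m₀ m₀' m₂ with at-joins T {c₀} m₀
    ... | y , J₀ with xor-true (trans (sym (joins-meet T P c₂)) m₂)
    ...   | inj₁ (q , q') with odd-third (λ j → at T j y ∧ z j) c₀ c₂ (distinct λ ()) (odd y)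
                              (cong₂ _∧_ y₀ z₀) (cong₂ _∧_ y₂ z₂)
      where
      y₀ : at T c₀ y ≡ true
      y₀ = trans (joins-at T J₀ y) (cong₂ _xor_ (==-≢ (joins-≢ T J₀)) (==-refl y))
      y₂ : at T c₂ y ≡ true
      y₂ = trans (sym (xor≡false (trans (sym (joins-meet T J₀ c₂)) (non-adjacent-even c₀≁c₂)))) q
    ...     | k , k≢c₀ , k≢c₂ , r with at-joins T {k} (∧-splitˡ {at T k y} r)
    ...       | y' , K = finish (four x x' y y') zk (λ { refl → contradiction (trans (sym (∧-splitˡ {at T k y} r)) (at-other P (joins-≢ T J₀ ∘ sym) y≢x')) λ () })
                    (odd-adjacent T (trans (joins-meet T J₀ k) (cong₂ _xor_ kx (∧-splitˡ {at T k y} r))))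
                    (odd-adjacent T (trans (joins-meet T J₂ k) (cong₂ _xor_ kx (∧-splitˡ {at T k y} r))))
                    (zero , two , J₀) (zero , one , P) (zero , two , J₂) (two , suc two , K)
      where
      zk : z k ≡ true
      zk = ∧-splitʳ {at T k y} r
      y≢x' : y ≢ x'
      y≢x' refl = contradiction (trans (sym m₀') (trans (joins-at T J₀ y) (cong₂ _xor_ (==-≢ (joins-≢ T J₀)) (==-refl y)))) λ ()
      J₂ : Joins T c₂ x y
      J₂ = joins-both q (trans (sym (xor≡false (trans (sym (joins-meet T J₀ c₂)) (non-adjacent-even c₀≁c₂)))) q) (joins-≢ T J₀)
      kx : at T k x ≡ false
      kx = not-true λ h → [ k≢c₀ , k≢c₂ ]′ (neighbours zk (odd-adjacent T
             (trans (joins-meet T P k) (cong₂ _xor_ h (at-other (joins-both h (∧-splitˡ {at T k y} r) (joins-≢ T J₀)) (joins-≢ T P ∘ sym) (y≢x' ∘ sym))))))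
    common {x} {x'} P m₀ m₀' m₂ | y , J₀ | inj₂ (q , q')
          with odd-third (λ j → at T j x ∧ z j) c₀ p (distinct λ ()) (odd x) (cong₂ _∧_ m₀ z₀)
                 (cong₂ _∧_ (trans (joins-at T P x) (cong₂ _xor_ (==-refl x) (==-≢ (joins-≢ T P ∘ sym)))) zp)
             | at-joins T {c₂} q'
    ... | k , k≢c₀ , k≢p , r | y₂ , J₂ = finish (four x x' y y₂) zk k≢p
            (adjacent-sym T {k} {c₀} (odd-adjacent T (trans (joins-meet T K c₀) (cong₂ _xor_ m₀ m₀'))))
            (adjacent-sym T {k} {c₂} (odd-adjacent T (trans (joins-meet T K c₂) (cong₂ _xor_ q q'))))
            (zero , two , J₀) (zero , one , P) (one , suc two , J₂) (zero , one , K)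
      where
      zk : z k ≡ true
      zk = ∧-splitʳ {at T k x} r
      kx : at T k x ≡ true
      kx = ∧-splitˡ {at T k x} r
      kx' : at T k x' ≡ true
      kx' with at T k x' in h
      ... | true  = refl
      ... | false = ⊥-elim ([ k≢c₀ , (λ { refl → contradiction (trans (sym kx) q) λ () }) ]′
                      (neighbours zk (odd-adjacent T (trans (joins-meet T P k) (cong₂ _xor_ kx h)))))
      K : Joins T k x x'
      K = joins-both kx kx' (joins-≢ T P)

    -- An even entry between `p` and a neighbour makes them parallel. With two even entries three
    -- arcs are parallel and `c₀`, `c₂` are adjacent; with one, the other neighbour meets `c₀` or
    -- `c₂` oddly through the parallel arc. Both contradict that `c₀` and `c₂` are not adjacent, and
    -- two odd entries lead to `common`.
    long-cycle-bound : N ≤ 4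
    long-cycle-bound = go (meet T p c₀) (meet T p c₂) refl refl
      where
      P : Joins T p (node (end T p false)) (node (end T p true))
      P = false , refl , refl
      go : ∀ a b → meet T p c₀ ≡ a → meet T p c₂ ≡ b → N ≤ 4
      go true true m₀ m₂ with xor-true m₀
      ... | inj₁ (q , q') = common P q q' m₂
      ... | inj₂ (q , q') = common (joins-sym T P) q' q m₂
      go true false m₀ m₂ = contradiction
        (trans (sym m₀) (trans (parallel-meets P (even-parallel P p~c₂ m₂) c₀) (trans (meet-sym c₂ c₀) (non-adjacent-even c₀≁c₂)))) λ ()
      go false true m₀ m₂ = contradiction
        (trans (sym m₂) (trans (parallel-meets P (even-parallel P p~c₀ m₀) c₂) (non-adjacent-even c₀≁c₂))) λ ()
      go false false m₀ m₂ = contradiction c₀≁c₂ (three-parallel (even-parallel P p~c₀ m₀) P (even-parallel P p~c₂ m₂)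
        (distinct λ ()) (distinct λ ()) (distinct λ ()) (adjacent-sym T {p} {c₀} p~c₀))

  -- At a node common to two arcs of the triangle, odd degree requires the third one too. Three arcs
  -- through one node end at no more than four nodes.
  triangle-bound : ∀ {c} → Cyclic (matrix T) 0 c → ∀ {z} → (∀ k → z k ≡ true ⇔ (∃[ a ] c a ≡ k)) → (∀ t → degree T z t ≡ true) → N ≤ 4
  triangle-bound {c} cyc {z} image odd with common-at {c zero} {c one} (Equivalence.from (adjacency cyc zero one) (inj₁ refl))
  ... | t , p , q with odd-third (λ j → at T j t ∧ z j) (c zero) (c one) (cycle-distinct cyc λ ()) (odd t)
                         (cong₂ _∧_ p (Equivalence.from (image _) (zero , refl))) (cong₂ _∧_ q (Equivalence.from (image _) (one , refl)))
  ...   | k , k≢0 , k≢1 , r with Equivalence.to (image k) (∧-splitʳ {at T k t} r)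
  ...     | zero , refl = contradiction refl k≢0
  ...     | one  , refl = contradiction refl k≢1
  ...     | two  , refl with at-joins T {c zero} p | at-joins T {c one} q | at-joins T {c two} (∧-splitˡ {at T (c two) t} r)
  ...       | x , X | y , Y | w , W = covered-bound f odd λ v h → every v (Equivalence.to (image v) h)
    where
    f : Fin 4 → Fin N
    f zero      = t
    f one       = x
    f two       = y
    f (suc two) = w
    every : ∀ v → ∃[ a ] c a ≡ v → Covered f v
    every v (zero , refl) = zero , one , X
    every v (one  , refl) = zero , two , Y
    every v (two  , refl) = zero , suc two , W

  basic-odd-bound : ∀ {z} → BasicRadical (matrix T) z → (∀ t → degree T z t ≡ true) → N ≤ 4
  basic-odd-bound {z} (rad , inj₁ (i , j , i≢j , ⇔)) odd = covered-bound f odd λ v h →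
      case Equivalence.to (⇔ v) h of λ { (inj₁ refl) → zero , one , false , refl , refl
                                       ; (inj₂ refl) → two , suc two , false , refl , refl }
    where
    f : Fin 4 → Fin N
    f zero      = node (end T i false)
    f one       = node (end T i true)
    f two       = node (end T j false)
    f (suc two) = node (end T j true)
  basic-odd-bound (rad , inj₂ (zero  , c , inj , image , adj)) odd = triangle-bound (cyclic inj adj) image odd
  basic-odd-bound (rad , inj₂ (suc l , c , inj , image , adj)) odd = LongCycle.long-cycle-bound (cyclic inj adj) image odd

  basic-span-even : Connected (matrix T) → 5 ≤ N → ∀ {u} → V00 (matrix T) u → ∀ t → degree T u t ≡ false
  basic-span-even con 5≤N {u} (ps , all , e) t = trans (degree-cong T e t) (go ps all)
    where
    even : ∀ {z} → BasicRadical (matrix T) z → degree T z t ≡ false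
    even {z} b = not-true λ h → ℕₚ.<-irrefl refl (ℕₚ.≤-trans 5≤N
      (basic-odd-bound b (λ s → trans (radical-constant T con (proj₁ b) s t) h)))
    go : ∀ ps → All (BasicRadical (matrix T)) ps → degree T (xorSum ps) t ≡ false
    go []       []        = sum2-false (λ j → Boolₚ.∧-zeroʳ (at T j t))
    go (z ∷ ps) (b ∷ all) = trans (degree-⊕ T z (xorSum ps) t) (cong₂ _xor_ (even b) (go ps all))

-- Surfaces with at most four nodes

-- Gaussian elimination, pivoting on the first column.
kernel : ∀ m (A : Fin m → Fin (suc m) → Bool) →
         Σ (Fin (suc m) → Bool) λ x → (∃[ a ] x a ≡ true) × (∀ r → sum2 (λ a → A r a ∧ x a) ≡ false)
kernel zero    A = (λ _ → true) , (zero , refl) , λ ()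
kernel (suc m) A with Finₚ.any? (λ r → A r zero Bool.≟ true)
... | no h = (λ a → a == zero) , (zero , refl) ,
      λ r → trans (sum2-cong (λ a → Boolₚ.∧-comm (A r a) (a == zero))) (trans (sum2-δ zero (A r)) (not-true (λ p → h (r , p))))
... | yes (r₀ , pivot) with kernel m (λ r a → A (punchIn r₀ r) (suc a) xor (A (punchIn r₀ r) zero ∧ A r₀ (suc a)))
...   | x , (a , xa) , solves = full , (suc a , xa) , rows
  where
  x₀ : Bool
  x₀ = sum2 (λ a → A r₀ (suc a) ∧ x a)
  full : Fin (suc (suc m)) → Bool
  full zero    = x₀
  full (suc a) = x a
  rows : ∀ r → sum2 (λ a → A r a ∧ full a) ≡ false
  rows r with r₀ ≟ r
  ... | yes refl = trans (cong (λ b → (b ∧ x₀) xor x₀) pivot) (xor-self x₀)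
  ... | no r₀≢r = begin
    (A r zero ∧ x₀) xor sum2 (λ a → A r (suc a) ∧ x a)
      ≡⟨ cong (_xor sum2 (λ a → A r (suc a) ∧ x a)) (sym (sum2-∧ (A r zero) (λ a → A r₀ (suc a) ∧ x a))) ⟩
    sum2 (λ a → A r zero ∧ (A r₀ (suc a) ∧ x a)) xor sum2 (λ a → A r (suc a) ∧ x a)
      ≡⟨ sym (sum2-xor (λ a → A r zero ∧ (A r₀ (suc a) ∧ x a)) (λ a → A r (suc a) ∧ x a)) ⟩
    sum2 (λ a → (A r zero ∧ (A r₀ (suc a) ∧ x a)) xor (A r (suc a) ∧ x a))
      ≡⟨ sum2-cong (λ a → collect (A r zero) (A r₀ (suc a)) (A r (suc a)) (x a)) ⟩
    sum2 (λ a → (A r (suc a) xor (A r zero ∧ A r₀ (suc a))) ∧ x a)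
      ≡⟨ cong (λ s → sum2 (λ a → (A s (suc a) xor (A s zero ∧ A r₀ (suc a))) ∧ x a)) (sym (Finₚ.punchIn-punchOut r₀≢r)) ⟩
    sum2 (λ a → (A (punchIn r₀ (punchOut r₀≢r)) (suc a) xor (A (punchIn r₀ (punchOut r₀≢r)) zero ∧ A r₀ (suc a))) ∧ x a)
      ≡⟨ solves (punchOut r₀≢r) ⟩
    false ∎
    where
    open ≡-Reasoning
    collect : ∀ a b c y → (a ∧ (b ∧ y)) xor (c ∧ y) ≡ (c xor (a ∧ b)) ∧ y
    collect = solve 4 (λ a b c y → a :* (b :* y) :+ c :* y := (c :+ a :* b) :* y) refl where open xor-∧-Solver

record Listing {n} (u : Vect n) (m : ℕ) : Set where
  field
    element   : Fin m → Fin n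
    element-injective : ∀ a b → element a ≡ element b → a ≡ b
    image     : ∀ k → u k ≡ true ⇔ (∃[ a ] element a ≡ k)

listing : ∀ {n} (u : Vect n) → Listing u (weight u)
listing {zero}  u = record { element = λ () ; element-injective = λ () ; image = λ () }
listing {suc n} u with u zero in eq | listing (u ∘ suc)
... | false | L = record
  { element = suc ∘ element ; element-injective = λ a b e → element-injective a b (Finₚ.suc-injective e)
  ; image = λ { zero    → mk⇔ (λ e → contradiction (trans (sym e) eq) λ ()) λ ()
              ; (suc k) → mk⇔ (λ e → let a , p = Equivalence.to (image k) e in a , cong suc p)
                              (λ { (a , p) → Equivalence.from (image k) (a , Finₚ.suc-injective p) }) } }
  where open Listing L
... | true | L = record
  { element = first ; element-injective = inj
  ; image = λ { zero    → mk⇔ (λ _ → zero , refl) (λ _ → eq)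
              ; (suc k) → mk⇔ (λ e → let a , p = Equivalence.to (image k) e in suc a , cong suc p)
                              (λ { (zero , ()) ; (suc a , p) → Equivalence.from (image k) (a , Finₚ.suc-injective p) }) } }
  where
  open Listing L
  first : Fin (suc (weight (u ∘ suc))) → Fin (suc n)
  first zero    = zero
  first (suc a) = suc (element a)
  inj : ∀ a b → first a ≡ first b → a ≡ b
  inj zero    zero    _ = refl
  inj (suc a) (suc b) e = cong suc (element-injective a b (Finₚ.suc-injective e))

triangle-basic : ∀ {n} {B : Mat n} → SkewSym B → ∀ {u} → Radical B u → (c : Fin 3 → Fin n) → (∀ a b → c a ≡ c b → a ≡ b) →
                 (∀ k → u k ≡ true ⇔ (∃[ a ] c a ≡ k)) → (∀ a b → a ≢ b → Adj B (c a) (c b)) → BasicRadical B u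
triangle-basic {B = B} sk rad c inj image adj = rad , inj₂ (0 , c , inj , image , λ a b → mk⇔
  (λ h → [ (λ { refl → contradiction (skew-diagonal {B = B} sk (c a)) h }) , id ]′ (near a b))
  (λ h → adj a b (λ { refl → [ (λ e → next≢ a (sym e)) , (λ e → next≢ a (sym e)) ]′ h })))
  where
  near : ∀ (a b : Fin 3) → a ≡ b ⊎ b ≡ next a ⊎ a ≡ next b
  near = check₂ (λ a b → (a ≟ b) ⊎-dec (b ≟ next a) ⊎-dec (a ≟ next b)) refl

third : ∀ {n} → 3 ≤ n → (p q : Fin n) → ∃[ r ] r ≢ p × r ≢ q
third (s≤s (s≤s (s≤s _))) p q with zero ≟ p | zero ≟ q | one ≟ p | one ≟ q | two ≟ p | two ≟ q
... | no a | no b | _ | _ | _ | _ = zero , a , b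
... | _ | _ | no a | no b | _ | _ = one , a , b
... | _ | _ | _ | _ | no a | no b = two , a , b
... | yes refl | _ | yes () | _ | _ | _
... | yes refl | _ | _ | _ | yes () | _
... | _ | _ | yes refl | _ | yes () | _
... | _ | yes refl | _ | yes () | _ | _
... | _ | yes refl | _ | _ | _ | yes ()
... | _ | _ | _ | yes refl | _ | yes ()

module _ {N n : ℕ} (T : Triangulation N n) where

  at-total : ∀ j → sum2 (at T j) ≡ false
  at-total j = trans (sum2-xor (λ t → node (end T j false) == t) (λ t → node (end T j true) == t))
    (cong₂ _xor_ (point (node (end T j false))) (point (node (end T j true))))
    where
    point : ∀ s → sum2 (λ t → s == t) ≡ true
    point s = trans (sum2-single s (λ t t≢s → ==-≢ (t≢s ∘ sym))) (==-refl s)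

  degree-total : ∀ u → sum2 (degree T u) ≡ false
  degree-total u = trans (sum2-swap (λ t j → at T j t ∧ u j))
    (sum2-false (λ j → trans (sum2-cong (λ t → Boolₚ.∧-comm (at T j t) (u j)))
      (trans (sum2-∧ (u j) (at T j)) (trans (cong (u j ∧_) (at-total j)) (Boolₚ.∧-zeroʳ (u j))))))

  degree-listing : ∀ {u m} (L : Listing u m) t → degree T u t ≡ sum2 (λ a → at T (Listing.element L a) t)
  degree-listing {u} L t = support-sum {u = u} (Listing.element L) (Listing.element-injective L) (Listing.image L) (λ j → at T j t)

  meet-sum : ∀ i j → meet T i j ≡ sum2 (λ t → at T i t ∧ at T j t)
  meet-sum i j = sym (begin
    sum2 (λ t → ((s == t) xor (s' == t)) ∧ at T j t)
      ≡⟨ sum2-cong (λ t → Boolₚ.∧-distribʳ-xor (at T j t) (s == t) (s' == t)) ⟩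
    sum2 (λ t → ((s == t) ∧ at T j t) xor ((s' == t) ∧ at T j t))
      ≡⟨ sum2-xor (λ t → (s == t) ∧ at T j t) (λ t → (s' == t) ∧ at T j t) ⟩
    sum2 (λ t → (s == t) ∧ at T j t) xor sum2 (λ t → (s' == t) ∧ at T j t)
      ≡⟨ cong₂ _xor_ (point s) (point s') ⟩
    meet T i j ∎)
    where
    open ≡-Reasoning
    s s' : Fin N
    s  = node (end T i false)
    s' = node (end T i true)
    point : ∀ s → sum2 (λ t → (s == t) ∧ at T j t) ≡ at T j s
    point s = trans (sum2-cong (λ t → cong (_∧ at T j t) (==-sym s t))) (sum2-δ s (at T j))

-- N arcs in a graph with N nodes contain a cycle.
shrink : ∀ {N n} (T : Triangulation N n) u → N ≤ weight u → 1 ≤ N →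
         ∃[ z ] (∀ k → z k ≡ true → u k ≡ true) × (∃[ k ] z k ≡ true) × (∀ t → degree T z t ≡ false)
-- One equation for each node except `zero`, in as many unknowns as nodes, so there is a nonzero
-- solution. The omitted equation follows because the degrees have even sum.
shrink {suc m} {n} T u N≤ _ with kernel m (λ r a → at T (Listing.element (listing u) (inject≤ a N≤)) (suc r))
... | x , (a₀ , xa₀) , solves = z , sub , (c a₀ , trans (z-at a₀) xa₀) , even
  where
  open Listing (listing u)
  c : Fin (suc m) → Fin n
  c a = element (inject≤ a N≤)
  c-injective : ∀ a b → c a ≡ c b → a ≡ b
  c-injective a b e = Finₚ.inject≤-injective N≤ N≤ a b (element-injective _ _ e)
  z : Vect n
  z k = sum2 (λ a → (k == c a) ∧ x a)
  z-at : ∀ a → z (c a) ≡ x a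
  z-at a = trans (sum2-cong (λ b → cong (_∧ x b) (==-iff {k = b} {a} (λ e → c-injective b a (sym e)) (λ e → cong c (sym e))))) (sum2-δ a x)
  sub : ∀ k → z k ≡ true → u k ≡ true
  sub k h with sum2-witness (λ a → (k == c a) ∧ x a) h
  ... | a , p = Equivalence.from (image k) (inject≤ a N≤ , sym (==-sound (∧-splitˡ p)))
  degree-z : ∀ t → degree T z t ≡ sum2 (λ a → at T (c a) t ∧ x a)
  degree-z t = begin
    sum2 (λ k → at T k t ∧ sum2 (λ a → (k == c a) ∧ x a))
      ≡⟨ sum2-cong (λ k → sym (sum2-∧ (at T k t) (λ a → (k == c a) ∧ x a))) ⟩
    sum2 (λ k → sum2 (λ a → at T k t ∧ ((k == c a) ∧ x a)))
      ≡⟨ sum2-swap (λ k a → at T k t ∧ ((k == c a) ∧ x a)) ⟩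
    sum2 (λ a → sum2 (λ k → at T k t ∧ ((k == c a) ∧ x a)))
      ≡⟨ sum2-cong (λ a → trans (sum2-cong (λ k → reorder (at T k t) (k == c a) (x a))) (sum2-δ (c a) (λ k → at T k t ∧ x a))) ⟩
    sum2 (λ a → at T (c a) t ∧ x a) ∎
    where
    open ≡-Reasoning
    reorder : ∀ a b y → a ∧ (b ∧ y) ≡ b ∧ (a ∧ y)
    reorder = solve 3 (λ a b y → a :* (b :* y) := b :* (a :* y)) refl where open xor-∧-Solver
  even : ∀ t → degree T z t ≡ false
  even (suc r) = trans (degree-z (suc r)) (solves r)
  even zero    = trans (sym (Boolₚ.xor-identityʳ _))
    (trans (cong (degree T z zero xor_) (sym (sum2-false {f = degree T z ∘ suc} (λ r → even (suc r))))) (degree-total T z))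

bits : Fin 4 → Fin 4 → Fin 4 → Bool
bits s s' t = (s == t) xor (s' == t)

two-of-four : ∀ (s t : Fin 4) → s ≡ t ⊎ (allᵇ (bits s t) ≡ false × allᵇ (not ∘ bits s t) ≡ false)
two-of-four = check₂ (λ s t → (s ≟ t) ⊎-dec ((allᵇ (bits s t) Bool.≟ false) ×-dec (allᵇ (not ∘ bits s t) Bool.≟ false))) refl

module Odd {N n : ℕ} (T : Triangulation N n) (u : Vect n) (odd : ∀ t → degree T u t ≡ true) where

  radical : Radical (matrix T) u
  radical = constant-radical T true odd

  not-empty : Listing u 0 → 1 ≤ N → ⊥
  not-empty L (s≤s _) = contradiction (trans (sym (odd zero)) (degree-listing T L zero)) λ ()

  -- The degrees add up to twice the number of arcs; if all are odd, the number of nodes is even.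
  even-nodes : sum2 {N} (λ _ → true) ≡ false
  even-nodes = trans (sum2-cong (sym ∘ odd)) (degree-total T u)

  pair-basic : Listing u 2 → BasicRadical (matrix T) u
  pair-basic L = radical , inj₁ (element zero , element one , (λ e → case element-injective _ _ e of λ ()) ,
    λ k → mk⇔ (λ h → case Equivalence.to (image k) h of λ { (zero , p) → inj₁ (sym p) ; (one , p) → inj₂ (sym p) })
              λ { (inj₁ refl) → Equivalence.from (image k) (zero , refl) ; (inj₂ refl) → Equivalence.from (image k) (one , refl) })
    where open Listing L

span-cong : ∀ {n} {P : Vect n → Set} {u w : Vect n} → u ≗ w → Span P u → Span P w
span-cong e (ps , all , h) = ps , all , λ i → trans (sym (e i)) (h i)

allᵇ-true : ∀ {m} {f : Fin m → Bool} → (∀ i → f i ≡ true) → allᵇ f ≡ true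
allᵇ-true {zero}  h = refl
allᵇ-true {suc m} h = cong₂ _∧_ (h zero) (allᵇ-true (h ∘ suc))

allᵇ-cong : ∀ {m} {f g : Fin m → Bool} → f ≗ g → allᵇ f ≡ allᵇ g
allᵇ-cong {zero}  h = refl
allᵇ-cong {suc m} h = cong₂ _∧_ (h zero) (allᵇ-cong (h ∘ suc))

rest : (p p' q q' : Fin 4) → Fin 4 → Bool
rest p p' q q' t = not (bits p p' t xor bits q q' t)

-- Two 2-subsets of a 4-set whose symmetric difference is a 2-subset meet in one point.
meets-of-four : ∀ p p' q q' → (p ≡ p' ⊎ q ≡ q' ⊎ allᵇ (rest p p' q q') ≡ true ⊎ allᵇ (not ∘ rest p p' q q') ≡ true) ⊎
  (sum2 (λ t → bits p p' t ∧ bits q q' t) ≡ true × sum2 (λ t → bits p p' t ∧ rest p p' q q' t) ≡ true ×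
   sum2 (λ t → bits q q' t ∧ rest p p' q q' t) ≡ true)
meets-of-four = check₄ (λ p p' q q' →
  ((p ≟ p') ⊎-dec (q ≟ q') ⊎-dec (allᵇ (rest p p' q q') Bool.≟ true) ⊎-dec (allᵇ (not ∘ rest p p' q q') Bool.≟ true)) ⊎-dec
  ((sum2 (λ t → bits p p' t ∧ bits q q' t) Bool.≟ true) ×-dec (sum2 (λ t → bits p p' t ∧ rest p p' q q' t) Bool.≟ true) ×-dec
   (sum2 (λ t → bits q q' t ∧ rest p p' q q' t) Bool.≟ true))) refl

adjacent-neighbour : ∀ {n} {B : Mat n} → Connected B → ∀ {p q} → p ≢ q → ∃[ r ] Adj B p r
adjacent-neighbour con {p} {q} p≢q with con p q
... | ε       = contradiction refl p≢q
... | adj ◅ _ = _ , adj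

module _ {n : ℕ} where

  -- Three arcs giving odd degree at four nodes form a star, so any two of them share exactly one
  -- node. The ends of the third arc are determined by those of the other two, which makes this a
  -- finite check.
  four-nodes-three : (T : Triangulation 4 n) {u : Vect n} → (∀ t → degree T u t ≡ true) → Listing u 3 → BasicRadical (matrix T) u
  four-nodes-three T {u} odd L = triangle-basic (matrix-skew T) (constant-radical T true odd) element element-injective image adj
    where
    open Listing L
    v₀ = element zero
    v₁ = element one
    v₂ = element two
    s s' : Fin n → Fin 4
    s v  = node (end T v false)
    s' v = node (end T v true)
    third-bits : ∀ t → at T v₂ t ≡ rest (s v₀) (s' v₀) (s v₁) (s' v₁) t
    third-bits t = solve-for (at T v₀ t) (at T v₁ t) (at T v₂ t) (trans (sym (degree-listing T L t)) (odd t))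
      where
      solve-for : ∀ a b c → a xor (b xor (c xor false)) ≡ true → c ≡ not (a xor b)
      solve-for true  true  true  _ = refl
      solve-for true  false false _ = refl
      solve-for false true  false _ = refl
      solve-for false false true  _ = refl
    two-ends : ∀ v → allᵇ (at T v) ≡ false × allᵇ (not ∘ at T v) ≡ false
    two-ends v with two-of-four (s v) (s' v)
    ... | inj₁ e = contradiction e (apart T v false)
    ... | inj₂ (p , q) = p , q
    meets : meet T v₀ v₁ ≡ true × meet T v₀ v₂ ≡ true × meet T v₁ v₂ ≡ true
    meets with meets-of-four (s v₀) (s' v₀) (s v₁) (s' v₁)
    ... | inj₁ (inj₁ e) = contradiction e (apart T v₀ false)
    ... | inj₁ (inj₂ (inj₁ e)) = contradiction e (apart T v₁ false)
    ... | inj₁ (inj₂ (inj₂ (inj₁ e))) = contradiction (trans (sym (proj₁ (two-ends v₂))) (trans (allᵇ-cong third-bits) e)) λ ()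
    ... | inj₁ (inj₂ (inj₂ (inj₂ e))) = contradiction (trans (sym (proj₂ (two-ends v₂))) (trans (allᵇ-cong (cong not ∘ third-bits)) e)) λ ()
    ... | inj₂ (p , q , r) = trans (meet-sum T v₀ v₁) p ,
      trans (meet-sum T v₀ v₂) (trans (sum2-cong (λ t → cong (at T v₀ t ∧_) (third-bits t))) q) ,
      trans (meet-sum T v₁ v₂) (trans (sum2-cong (λ t → cong (at T v₁ t ∧_) (third-bits t))) r)
    both : ∀ {i j} → meet T i j ≡ true → Adj (matrix T) i j × Adj (matrix T) j i
    both {i} {j} m = odd-adjacent T m , adjacent-sym T {i} {j} (odd-adjacent T m)
    adj : ∀ a b → a ≢ b → Adj (matrix T) (element a) (element b)
    adj zero zero h = contradiction refl h
    adj one one h = contradiction refl h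
    adj two two h = contradiction refl h
    adj zero one h = proj₁ (both (proj₁ meets))
    adj one zero h = proj₂ (both (proj₁ meets))
    adj zero two h = proj₁ (both (proj₁ (proj₂ meets)))
    adj two zero h = proj₂ (both (proj₁ (proj₂ meets)))
    adj one two h = proj₁ (both (proj₂ (proj₂ meets)))
    adj two one h = proj₂ (both (proj₂ (proj₂ meets)))

  -- A single arc misses two of the four nodes.
  four-nodes-one : (T : Triangulation 4 n) {u : Vect n} → (∀ t → degree T u t ≡ true) → ¬ Listing u 1
  four-nodes-one T odd L with two-of-four (node (end T (Listing.element L zero) false)) (node (end T (Listing.element L zero) true))
  ... | inj₁ e = apart T (Listing.element L zero) false e
  ... | inj₂ (p , _) = contradiction (trans (sym p) (allᵇ-true {f = at T (Listing.element L zero)} (λ t →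
          trans (sym (Boolₚ.xor-identityʳ _)) (trans (sym (degree-listing T L t)) (odd t))))) λ ()

  joins-two : (T : Triangulation 2 n) → ∀ v → Joins T v zero one
  joins-two T v = joins-both T (proj₁ (both (node (end T v false)) (node (end T v true)) (apart T v false)))
                               (proj₂ (both (node (end T v false)) (node (end T v true)) (apart T v false))) λ ()
    where
    both : ∀ (s t : Fin 2) → s ≢ t → (s == zero) xor (t == zero) ≡ true × (s == one) xor (t == one) ≡ true
    both zero zero h = contradiction refl h
    both one  one  h = contradiction refl h
    both zero one  h = refl , refl
    both one  zero h = refl , refl

  -- Two triangles glued along all their sides: the once-punctured torus.
  two-nodes : (T : Triangulation 2 n) → Connected (matrix T) → 3 ≤ n → ∀ {u} → (∀ t → degree T u t ≡ true) → Fin n → V00 (matrix T) u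
  two-nodes T con 3≤n {u} odd p = go (third 3≤n p p)
    where
    J : ∀ v → Joins T v zero one
    J = joins-two T
    at-all : ∀ v t → at T v t ≡ true
    at-all v zero = joins-at T (J v) zero
    at-all v one  = joins-at T (J v) one
    go : (∃[ r ] r ≢ p × r ≢ p) → V00 (matrix T) u
    go (x , x≢p , _) with adjacent-neighbour con (x≢p ∘ sym)
    ... | q , p~q with third 3≤n p q
    ...   | r , r≢p , r≢q = span-add
            (triangle-basic (matrix-skew T) (constant-radical T true odd-triangle) c c-injective
              (λ k → mk⇔ (indicator-∋ c k) λ { (a , refl) → indicator-∈ c c-injective a }) adj)
            (cycle-space-spanned T (u ⊕ indicator c) (λ t → trans (degree-⊕ T u (indicator c) t) (cong₂ _xor_ (odd t) (odd-triangle t))))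
      where
      p≢q : p ≢ q
      p≢q refl = p~q (skew-diagonal {B = matrix T} (matrix-skew T) p)
      p~r : Adj (matrix T) p r
      p~r = three-parallel T (J p) (J q) (J r) p≢q (r≢p ∘ sym) (r≢q ∘ sym) p~q
      q~p : Adj (matrix T) q p
      q~p = adjacent-sym T {p} {q} p~q
      q~r : Adj (matrix T) q r
      q~r = three-parallel T (J q) (J p) (J r) (p≢q ∘ sym) (r≢q ∘ sym) (r≢p ∘ sym) q~p
      c : Fin 3 → Fin n
      c zero = p
      c one  = q
      c two  = r
      c-injective : ∀ a b → c a ≡ c b → a ≡ b
      c-injective zero zero _ = refl
      c-injective one one _ = refl
      c-injective two two _ = refl
      c-injective zero one e = contradiction e p≢q
      c-injective one zero e = contradiction (sym e) p≢q
      c-injective zero two e = contradiction (sym e) r≢p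
      c-injective two zero e = contradiction e r≢p
      c-injective one two e = contradiction (sym e) r≢q
      c-injective two one e = contradiction e r≢q
      adj : ∀ a b → a ≢ b → Adj (matrix T) (c a) (c b)
      adj zero zero h = contradiction refl h
      adj one one h = contradiction refl h
      adj two two h = contradiction refl h
      adj zero one h = p~q
      adj one zero h = q~p
      adj zero two h = p~r
      adj two zero h = adjacent-sym T {p} {r} p~r
      adj one two h = q~r
      adj two one h = adjacent-sym T {q} {r} q~r
      odd-triangle : ∀ t → degree T (indicator c) t ≡ true
      odd-triangle t = trans (trans (sum2-cong (λ j → Boolₚ.∧-comm (at T j t) (indicator c j))) (indicator-sum c (λ j → at T j t)))
        (cong₂ _xor_ (at-all p t) (cong₂ _xor_ (at-all q t) (cong (_xor false) (at-all r t))))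

  -- One or three nodes contradict parity. With two nodes all arcs are parallel and a triangle
  -- absorbs the odd part. With four nodes the support must have two arcs, a basic pair, or three, a
  -- star.
  few-elements : ∀ N (T : Triangulation N n) → Connected (matrix T) → 3 ≤ n → N ≤ 4 → ∀ {u} → (∀ t → degree T u t ≡ true) →
                 ∀ m → Listing u m → m ℕ.< N → V00 (matrix T) u
  few-elements 1 T con 3≤n _ {u} odd m L _ = contradiction (Odd.even-nodes T u odd) λ ()
  few-elements 3 T con 3≤n _ {u} odd m L _ = contradiction (Odd.even-nodes T u odd) λ ()
  few-elements 2 T con 3≤n _ {u} odd 0 L _ = ⊥-elim (Odd.not-empty T u odd L (s≤s z≤n))
  few-elements 2 T con 3≤n _ odd (suc m) L _ = two-nodes T con 3≤n odd (Listing.element L zero)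
  few-elements 4 T con 3≤n _ {u} odd 0 L _ = ⊥-elim (Odd.not-empty T u odd L (s≤s z≤n))
  few-elements 4 T con 3≤n _ odd 1 L _ = ⊥-elim (four-nodes-one T odd L)
  few-elements 4 T con 3≤n _ {u} odd 2 L _ = span-one (Odd.pair-basic T u odd L)
  few-elements 4 T con 3≤n _ odd 3 L _ = span-one (four-nodes-three T odd L)
  few-elements 4 T con 3≤n _ odd (suc (suc (suc (suc m)))) L (s≤s (s≤s (s≤s (s≤s ()))))
  few-elements (suc (suc (suc (suc (suc N))))) T con 3≤n (s≤s (s≤s (s≤s (s≤s ()))))

  small-spanned : ∀ {N} (T : Triangulation N n) → Connected (matrix T) → 3 ≤ n → N ≤ 4 → ∀ u → Radical (matrix T) u → V00 (matrix T) u
  small-spanned {N} T con 3≤n N≤4 u rad = start (sym (ℕₚ.suc-pred n {{ℕ.>-nonZero (ℕₚ.≤-trans (s≤s z≤n) 3≤n)}}))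
    where
    odd-case : ∀ u → Acc ℕ._<_ (weight u) → 1 ≤ N → (∀ t → degree T u t ≡ true) → V00 (matrix T) u
    -- A support with at least `N` arcs contains a vector of even degree, whose removal keeps all
    -- degrees odd and makes the support smaller.
    odd-case u (acc rec) 1≤N odd with N ℕ.≤? weight u
    ... | no h = few-elements N T con 3≤n N≤4 odd (weight u) (listing u) (ℕₚ.≰⇒> h)
    ... | yes N≤ with shrink T u N≤ 1≤N
    ...   | z , sub , (k , zk) , even = span-cong
              (λ i → trans (Boolₚ.xor-assoc (u i) (z i) (z i)) (trans (cong (u i xor_) (xor-self (z i))) (Boolₚ.xor-identityʳ (u i))))
              (span-⊕ (odd-case (u ⊕ z) (rec (weight-< sub k zk)) 1≤N
                 (λ t → trans (degree-⊕ T u z t) (cong₂ _xor_ (odd t) (even t))))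
                (cycle-space-spanned T z even))
    positive : ∀ {N} → Fin N → 1 ≤ N
    positive zero    = s≤s z≤n
    positive (suc _) = s≤s z≤n
    start : ∀ {n'} → n ≡ suc n' → V00 (matrix T) u
    start refl = go (degree T u t₀) refl
      where
      t₀ : Fin N
      t₀ = node (end T zero false)
      go : ∀ b → degree T u t₀ ≡ b → V00 (matrix T) u
      go false e = cycle-space-spanned T u (λ t → trans (radical-constant T con {u} rad t t₀) e)
      go true  e = odd-case u (<-wellFounded (weight u)) (positive t₀) (λ t → trans (radical-constant T con {u} rad t t₀) e)

-- Triangulations from block decompositions

-- Discarding the unused nodes of a triangulation.
module Compress {n M : ℕ} {Node : Set} (code : Node → Fin M) (code-injective : ∀ {x y} → code x ≡ code y → x ≡ y)
  (rawEnd : Fin n → Bool → Node × Fin 3) (rawCap : Node → Bool)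
  (raw-apart : ∀ i e → proj₁ (rawEnd i e) ≢ proj₁ (rawEnd i (not e)))
  (raw-port-twins : ∀ i e j e' → i ≢ j → rawEnd i e ≡ rawEnd j e' → rawCap (proj₁ (rawEnd i e)) ≡ false →
                    rawCap (proj₁ (rawEnd i (not e))) ≡ true × proj₁ (rawEnd j (not e')) ≡ proj₁ (rawEnd i (not e)))
  (raw-cap-twins : ∀ i e j e' → rawCap (proj₁ (rawEnd i e)) ≡ true → proj₁ (rawEnd j e') ≡ proj₁ (rawEnd i e) →
                   rawEnd j (not e') ≡ rawEnd i (not e) × rawCap (proj₁ (rawEnd i (not e))) ≡ false)
  (raw-cap-twin : ∀ i e → rawCap (proj₁ (rawEnd i e)) ≡ true → ∃[ j ] ∃[ e' ] j ≢ i × proj₁ (rawEnd j e') ≡ proj₁ (rawEnd i e))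
  (raw-cap-two : ∀ i e j e' k e'' → rawCap (proj₁ (rawEnd i e)) ≡ true → proj₁ (rawEnd j e') ≡ proj₁ (rawEnd i e) →
                 proj₁ (rawEnd k e'') ≡ proj₁ (rawEnd i e) → j ≢ i → k ≢ i → j ≡ k) where

  raw : Fin n → Bool → Node
  raw i e = proj₁ (rawEnd i e)

  used? : ∀ t → Dec (∃[ i ] ∃[ e ] code (raw i e) ≡ t)
  used? t = Finₚ.any? (λ i → anyBool? (λ e → code (raw i e) ≟ t))

  used : Vect M
  used t = does (used? t)

  used-true : ∀ {t} → (∃[ i ] ∃[ e ] code (raw i e) ≡ t) → used t ≡ true
  used-true {t} = dec-true (used? t)

  true-used : ∀ {t} → used t ≡ true → ∃[ i ] ∃[ e ] code (raw i e) ≡ t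
  true-used {t} h with used? t
  ... | yes p = p
  ... | no _  = contradiction h λ ()

  open Listing (listing used)

  N : ℕ
  N = weight used

  index : Fin n → Bool → Fin N
  index i e = proj₁ (Equivalence.to (image (code (raw i e))) (used-true (i , e , refl)))

  element-index : ∀ i e → element (index i e) ≡ code (raw i e)
  element-index i e = proj₂ (Equivalence.to (image (code (raw i e))) (used-true (i , e , refl)))

  index-to : ∀ {i e j e'} → index i e ≡ index j e' → raw i e ≡ raw j e'
  index-to {i} {e} {j} {e'} p = code-injective (trans (sym (element-index i e)) (trans (cong element p) (element-index j e')))

  index-from : ∀ {i e j e'} → raw i e ≡ raw j e' → index i e ≡ index j e'
  index-from {i} {e} {j} {e'} p = element-injective _ _ (trans (element-index i e) (trans (cong code p) (sym (element-index j e'))))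

  owner : ∀ a → ∃[ i ] ∃[ e ] code (raw i e) ≡ element a
  owner a = true-used (Equivalence.from (image (element a)) (a , refl))

  newCap : Fin N → Bool
  newCap a = rawCap (raw (proj₁ (owner a)) (proj₁ (proj₂ (owner a))))

  newCap-index : ∀ i e → newCap (index i e) ≡ rawCap (raw i e)
  newCap-index i e = cong rawCap (code-injective (trans (proj₂ (proj₂ (owner (index i e)))) (element-index i e)))

  newEnd : Fin n → Bool → Port N
  newEnd i e = index i e , proj₂ (rawEnd i e)

  end-to : ∀ {i e j e'} → newEnd i e ≡ newEnd j e' → rawEnd i e ≡ rawEnd j e'
  end-to p = cong₂ _,_ (index-to (cong proj₁ p)) (cong proj₂ p)

  end-from : ∀ {i e j e'} → rawEnd i e ≡ rawEnd j e' → newEnd i e ≡ newEnd j e'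
  end-from p = cong₂ _,_ (index-from (cong proj₁ p)) (cong proj₂ p)

  compressed : Triangulation N n
  compressed = record
    { end = newEnd ; cap = newCap
    ; apart = λ i e p → raw-apart i e (index-to p)
    ; port-twins = λ i e j e' i≢j p c → let q , r = raw-port-twins i e j e' i≢j (end-to p) (trans (sym (newCap-index i e)) c) in
        trans (newCap-index i (not e)) q , index-from r
    ; cap-twins = λ i e j e' c p → let q , r = raw-cap-twins i e j e' (trans (sym (newCap-index i e)) c) (index-to p) in
        end-from q , trans (newCap-index i (not e)) r
    ; cap-twin = λ i e c → let j , e' , f , p = raw-cap-twin i e (trans (sym (newCap-index i e)) c) in j , e' , f , index-from p
    ; cap-two = λ i e j e' k e'' c p q → raw-cap-two i e j e' k e'' (trans (sym (newCap-index i e)) c) (index-to p) (index-to q)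
    ; occupied = λ a → let i , e , p = owner a in i , e , element-injective _ _ (trans (element-index i e) p) }

sumFin-cong : ∀ {m} {f g : Fin m → ℤ} → f ≗ g → sumFin f ≡ sumFin g
sumFin-cong {zero}  e = refl
sumFin-cong {suc m} e = cong₂ ℤ._+_ (e zero) (sumFin-cong (e ∘ suc))

sumFin-zero : ∀ {m} {f : Fin m → ℤ} → (∀ i → f i ≡ + 0) → sumFin f ≡ + 0
sumFin-zero {zero}  e = refl
sumFin-zero {suc m} e = cong₂ ℤ._+_ (e zero) (sumFin-zero (e ∘ suc))

sumFin-single : ∀ {m} (k : Fin m) {f : Fin m → ℤ} → (∀ i → i ≢ k → f i ≡ + 0) → sumFin f ≡ f k
sumFin-single zero    {f} e = trans (cong (λ x → f zero ℤ.+ x) (sumFin-zero (λ i → e (suc i) λ ()))) (ℤₚ.+-identityʳ (f zero))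
sumFin-single (suc k) {f} e = trans (cong (λ x → x ℤ.+ sumFin (f ∘ suc)) (e zero λ ()))
  (trans (ℤₚ.+-identityˡ _) (sumFin-single k (λ i i≢k → e (suc i) (i≢k ∘ Finₚ.suc-injective))))

sumFin-two : ∀ {m} (k l : Fin m) → k ≢ l → {f : Fin m → ℤ} → (∀ i → i ≢ k → i ≢ l → f i ≡ + 0) → sumFin f ≡ f k ℤ.+ f l
sumFin-two zero zero h e = contradiction refl h
sumFin-two zero (suc l) h {f} e = cong (λ x → f zero ℤ.+ x) (sumFin-single l (λ i p → e (suc i) (λ ()) (p ∘ Finₚ.suc-injective)))
sumFin-two (suc k) zero h {f} e = trans (cong (λ x → f zero ℤ.+ x) (sumFin-single k (λ i p → e (suc i) (p ∘ Finₚ.suc-injective) (λ ()))))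
  (ℤₚ.+-comm (f zero) (f (suc k)))
sumFin-two (suc k) (suc l) h {f} e = trans (cong (λ x → x ℤ.+ sumFin (f ∘ suc)) (e zero (λ ()) (λ ())))
  (trans (ℤₚ.+-identityˡ _) (sumFin-two k l (h ∘ cong suc) (λ i p q → e (suc i) (p ∘ Finₚ.suc-injective) (q ∘ Finₚ.suc-injective))))

δ-yes : ∀ {n} {i j : Fin n} w → i ≡ j → δ i j w ≡ w
δ-yes {i = i} {j} w e with i ≟ j
... | yes _ = refl
... | no h  = contradiction e h

δ-no : ∀ {n} {i j : Fin n} w → i ≢ j → δ i j w ≡ + 0
δ-no {i = i} {j} w h with i ≟ j
... | yes e = contradiction e h
... | no _  = refl

δ-sum : ∀ {n m} (i j : Fin n) (h : Fin m → ℤ) → sumFin (λ b → δ i j (h b)) ≡ δ i j (sumFin h)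
δ-sum {m = m} i j h with i ≟ j
... | yes _ = refl
... | no _  = sumFin-zero {m} (λ _ → refl)

-- The port of a vertex of a block in the triangle of that block, and the number of
-- the cap at its other end (zero for an outlet).
blockPort blockCap : (t : BlockType) → Fin (size t) → Fin 3
blockPort I    zero = zero
blockPort I    one  = one
blockPort II   a    = a
blockPort IIIa zero = zero
blockPort IIIa (suc _) = one
blockPort IIIb zero = zero
blockPort IIIb (suc _) = two
blockPort IV   zero = zero
blockPort IV   one  = two
blockPort IV   (suc (suc _)) = one
blockPort V    zero = zero
blockPort V    one  = one
blockPort V    two  = one
blockPort V    (suc (suc (suc _))) = two
blockCap I    _ = zero
blockCap II   _ = zero
blockCap IIIa zero = zero
blockCap IIIa (suc _) = one
blockCap IIIb zero = zero
blockCap IIIb (suc _) = one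
blockCap IV   zero = zero
blockCap IV   one  = zero
blockCap IV   (suc (suc _)) = one
blockCap V    zero = zero
blockCap V    one  = one
blockCap V    two  = one
blockCap V    (suc (suc (suc _))) = two

byType : ∀ {P : ∀ t → Fin (size t) → Set} (P? : ∀ t a → Dec (P t a)) →
         {True (Finₚ.all? (P? I))} → {True (Finₚ.all? (P? II))} → {True (Finₚ.all? (P? IIIa))} →
         {True (Finₚ.all? (P? IIIb))} → {True (Finₚ.all? (P? IV))} → {True (Finₚ.all? (P? V))} → ∀ t a → P t a
byType P? {w} I    = toWitness w
byType P? {_} {w} II   = toWitness w
byType P? {_} {_} {w} IIIa = toWitness w
byType P? {_} {_} {_} {w} IIIb = toWitness w
byType P? {_} {_} {_} {_} {w} IV = toWitness w
byType P? {_} {_} {_} {_} {_} {w} V = toWitness w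

block-turn : ∀ t a b → blockMat t a b ≡ turn (blockPort t a) (blockPort t b)
block-turn = byType (λ t a → Finₚ.all? λ b → blockMat t a b ℤ.≟ turn (blockPort t a) (blockPort t b))

block-outlet : ∀ t a → outlet t a ≡ (blockCap t a == zero)
block-outlet = byType (λ t a → outlet t a Bool.≟ (blockCap t a == zero))

block-port-twins : ∀ t a b → a ≡ b ⊎ blockPort t a ≢ blockPort t b ⊎ (blockCap t a ≢ zero × blockCap t b ≡ blockCap t a)
block-port-twins = byType (λ t a → Finₚ.all? λ b →
  (a ≟ b) ⊎-dec (¬? (blockPort t a ≟ blockPort t b)) ⊎-dec ((¬? (blockCap t a ≟ zero)) ×-dec (blockCap t b ≟ blockCap t a)))

block-cap-twins : ∀ t a b → (blockCap t a ≡ zero ⊎ blockCap t b ≢ blockCap t a) ⊎ blockPort t b ≡ blockPort t a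
block-cap-twins = byType (λ t a → Finₚ.all? λ b →
  ((blockCap t a ≟ zero) ⊎-dec (¬? (blockCap t b ≟ blockCap t a))) ⊎-dec (blockPort t b ≟ blockPort t a))

block-cap-twin : ∀ t a → blockCap t a ≡ zero ⊎ (∃[ b ] b ≢ a × blockCap t b ≡ blockCap t a)
block-cap-twin = byType (λ t a → (blockCap t a ≟ zero) ⊎-dec Finₚ.any? (λ b → (¬? (b ≟ a)) ×-dec (blockCap t b ≟ blockCap t a)))

block-cap-two : ∀ t a b c → (blockCap t a ≡ zero ⊎ blockCap t b ≢ blockCap t a ⊎ blockCap t c ≢ blockCap t a) ⊎ (b ≡ a ⊎ c ≡ a) ⊎ b ≡ c
block-cap-two = byType (λ t a → Finₚ.all? λ b → Finₚ.all? λ c →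
  ((blockCap t a ≟ zero) ⊎-dec (¬? (blockCap t b ≟ blockCap t a)) ⊎-dec (¬? (blockCap t c ≟ blockCap t a))) ⊎-dec
  ((b ≟ a) ⊎-dec (c ≟ a)) ⊎-dec (b ≟ c))

module FromBlocks {n : ℕ} {B : Mat n} (D : BlockDecomposition B) where
  open BlockDecomposition D

  Occurrence : Set
  Occurrence = Σ (Fin K) λ k → Fin (size (t k))

  vertex : Occurrence → Fin n
  vertex (k , a) = f k a

  capOf portOf : Occurrence → Fin 3
  capOf (k , a)  = blockCap (t k) a
  portOf (k , a) = blockPort (t k) a

  outlet-cap : ∀ x → outlet (t (proj₁ x)) (proj₂ x) ≡ true → capOf x ≡ zero
  outlet-cap (k , a) h = ==-sound (trans (sym (block-outlet (t k) a)) h)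

  glued : ∀ x y → vertex x ≡ vertex y →
          x ≡ y ⊎ (proj₁ x ≢ proj₁ y × capOf x ≡ zero × capOf y ≡ zero × (∀ z → vertex z ≡ vertex x → z ≡ x ⊎ z ≡ y))
  glued x@(k , a) y@(k' , a') p with glue k a k' a' p
  ... | inj₁ (refl , refl) = inj₁ refl
  ... | inj₂ (k≢k' , o , o' , only) = inj₂ (k≢k' , outlet-cap x o , outlet-cap y o' ,
          λ { (l , b) q → [ (λ { (refl , refl) → inj₁ refl }) , (λ { (refl , refl) → inj₂ refl }) ]′ (only l b q) })

  same-block : ∀ {k a b} → f k a ≡ f k b → a ≡ b
  same-block {k} {a} {b} p with glued (k , a) (k , b) p
  ... | inj₁ refl = refl
  ... | inj₂ (h , _) = contradiction refl h

  capped-unique : ∀ {x y} → vertex x ≡ vertex y → capOf y ≢ zero → x ≡ y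
  capped-unique {x} {y} p h with glued x y p
  ... | inj₁ e = e
  ... | inj₂ (_ , _ , c , _) = contradiction c h

  -- The three ways a vertex lies in the blocks: as a non-outlet, hence in one block only; as two
  -- outlets glued together; or as an outlet left unglued, a side without a neighbouring block.
  data Shape (v : Fin n) : Set where
    capped : ∀ x → vertex x ≡ v → capOf x ≢ zero → Shape v
    paired : ∀ x y → vertex x ≡ v → vertex y ≡ v → proj₁ x ≢ proj₁ y → Shape v
    lone   : ∀ x → vertex x ≡ v → capOf x ≡ zero → (∀ z → vertex z ≡ v → z ≡ x) → Shape v

  shape : ∀ v → Shape v
  shape v with onto v
  ... | k , a , p with capOf (k , a) ≟ zero
  ...   | no h = capped (k , a) p h
  ...   | yes c with Finₚ.any? (λ l → (¬? (k ≟ l)) ×-dec Finₚ.any? (λ b → f l b ≟ v))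
  ...     | yes (l , k≢l , b , q) = paired (k , a) (l , b) p q k≢l
  ...     | no h = lone (k , a) p c λ z q → [ id , (λ { (z≢ , _) → contradiction (proj₁ z , z≢ ∘ sym , proj₂ z , q) h }) ]′
                     (glued z (k , a) (trans q (sym p)))

  -- What lies at an end of an arc. The far end of an unglued outlet gets a node of its own, so that
  -- every arc has two ends.
  data Kind : Set where
    block cap-end : Occurrence → Kind
    dead          : Fin n → Kind

  shapeKind : ∀ {v} → Shape v → Bool → Kind
  shapeKind (capped x _ _)     false = block x
  shapeKind (capped x _ _)     true  = cap-end x
  shapeKind (paired x y _ _ _) false = block x
  shapeKind (paired x y _ _ _) true  = block y
  shapeKind (lone x _ _ _)     false = block x
  shapeKind {v} (lone x _ _ _) true  = dead v

  kind : Fin n → Bool → Kind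
  kind v = shapeKind (shape v)

  data End (v : Fin n) : Kind → Kind → Set where
    block-cap   : ∀ x → vertex x ≡ v → capOf x ≢ zero → End v (block x) (cap-end x)
    cap-block   : ∀ x → vertex x ≡ v → capOf x ≢ zero → End v (cap-end x) (block x)
    block-block : ∀ x y → vertex x ≡ v → capOf x ≡ zero → proj₁ x ≢ proj₁ y → End v (block x) (block y)
    block-dead  : ∀ x → vertex x ≡ v → capOf x ≡ zero → End v (block x) (dead v)
    dead-block  : ∀ x → vertex x ≡ v → capOf x ≡ zero → End v (dead v) (block x)

  ends : ∀ v e → End v (kind v e) (kind v (not e))
  ends v e = go (shape v) e
    where
    go : ∀ s e → End v (shapeKind s e) (shapeKind s (not e))
    go (capped x p h) false = block-cap x p h
    go (capped x p h) true  = cap-block x p h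
    go (paired x y p q h) e with glued x y (trans p (sym q))
    ... | inj₁ refl = contradiction refl h
    go (paired x y p q h) false | inj₂ (_ , c , c' , _) = block-block x y p c h
    go (paired x y p q h) true  | inj₂ (_ , c , c' , _) = block-block y x q c' (h ∘ sym)
    go (lone x p c _) false = block-dead x p c
    go (lone x p c _) true  = dead-block x p c

  -- Every block is given a triangle, numbered `zero`, and two possible caps; block `V` has both.
  -- Nodes at which no arc ends are discarded by `Compress`.
  Node : Set
  Node = (Fin K × Fin 3) ⊎ Fin n

  code : Node → Fin (K ℕ.* 3 ℕ.+ n)
  code (inj₁ (k , c)) = combine k c ↑ˡ n
  code (inj₂ v)       = (K ℕ.* 3) ↑ʳ v

  code-injective : ∀ {x y} → code x ≡ code y → x ≡ y
  code-injective {inj₁ (k , c)} {inj₁ (l , d)} e with Finₚ.combine-injective k c l d (Finₚ.↑ˡ-injective n _ _ e)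
  ... | refl , refl = refl
  code-injective {inj₂ v} {inj₂ w} e = cong inj₂ (Finₚ.↑ʳ-injective (K ℕ.* 3) _ _ e)
  code-injective {inj₁ (k , c)} {inj₂ w} e with trans (sym (Finₚ.splitAt-↑ˡ (K ℕ.* 3) (combine k c) n))
      (trans (cong (splitAt (K ℕ.* 3)) e) (Finₚ.splitAt-↑ʳ (K ℕ.* 3) n w))
  ... | ()
  code-injective {inj₂ v} {inj₁ (l , d)} e with trans (sym (Finₚ.splitAt-↑ʳ (K ℕ.* 3) n v))
      (trans (cong (splitAt (K ℕ.* 3)) e) (Finₚ.splitAt-↑ˡ (K ℕ.* 3) (combine l d) n))
  ... | ()

  place : Kind → Node × Fin 3
  place (block x)   = inj₁ (proj₁ x , zero) , portOf x
  place (cap-end x) = inj₁ (proj₁ x , capOf x) , zero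
  place (dead v)    = inj₂ v , zero

  isCap : Node → Bool
  isCap (inj₁ (_ , c)) = not (c == zero)
  isCap (inj₂ _)       = false

  nodeOf : Kind → Node
  nodeOf = proj₁ ∘ place

  cap-true : ∀ {c : Fin 3} → c ≢ zero → not (c == zero) ≡ true
  cap-true h = cong not (==-≢ h)

  raw-apart : ∀ {v p q} → End v p q → nodeOf p ≢ nodeOf q
  raw-apart (block-cap x _ h) e = h (sym (cong (proj₂ ∘ [ id , (λ _ → proj₁ x , zero) ]′) e))
  raw-apart (cap-block x _ h) e = h (cong (proj₂ ∘ [ id , (λ _ → proj₁ x , zero) ]′) e)
  raw-apart (block-block x y _ _ h) e = h (cong (proj₁ ∘ [ id , (λ _ → proj₁ x , zero) ]′) e)
  raw-apart (block-dead _ _ _) ()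
  raw-apart (dead-block _ _ _) ()

  inj₁-injective : ∀ {A C : Set} {x y : A} → _≡_ {A = A ⊎ C} (inj₁ x) (inj₁ y) → x ≡ y
  inj₁-injective refl = refl

  block-twins : ∀ {x y} → place (block x) ≡ place (block y) → x ≡ y ⊎ (capOf x ≢ zero × proj₁ y ≡ proj₁ x × capOf y ≡ capOf x)
  block-twins {k , a} {l , b} e with cong proj₁ (inj₁-injective (cong proj₁ e))
  ... | refl with block-port-twins (t k) a b
  ...   | inj₁ refl = inj₁ refl
  ...   | inj₂ (inj₁ h) = contradiction (cong proj₂ e) h
  ...   | inj₂ (inj₂ (h , c)) = inj₂ (h , refl , c)

  outlet-alone : ∀ {i j} x → vertex x ≡ i → capOf x ≡ zero → ∀ {q q'} → End j q q' → i ≢ j → place (block x) ≢ place q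
  outlet-alone x p c (block-cap y q _) i≢j e with block-twins {x} {y} e
  ... | inj₁ refl = i≢j (trans (sym p) q)
  ... | inj₂ (h , _) = h c
  outlet-alone x p c (cap-block y q g) i≢j e = g (sym (cong proj₂ (inj₁-injective (cong proj₁ e))))
  outlet-alone x p c (block-block y _ q _ _) i≢j e with block-twins {x} {y} e
  ... | inj₁ refl = i≢j (trans (sym p) q)
  ... | inj₂ (h , _) = h c
  outlet-alone x p c (block-dead y q _) i≢j e with block-twins {x} {y} e
  ... | inj₁ refl = i≢j (trans (sym p) q)
  ... | inj₂ (h , _) = h c
  outlet-alone x p c (dead-block y _ _) i≢j ()

  raw-port-twins : ∀ {i j p p' q q'} → End i p p' → End j q q' → i ≢ j → place p ≡ place q → isCap (nodeOf p) ≡ false →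
                   isCap (nodeOf p') ≡ true × nodeOf q' ≡ nodeOf p'
  raw-port-twins (cap-block x _ h) _ _ _ c = contradiction (trans (sym c) (cap-true h)) λ ()
  raw-port-twins (dead-block x _ _) (dead-block y _ _) i≢j e _ with cong proj₁ e
  ... | refl = contradiction refl i≢j
  raw-port-twins (dead-block x _ _) (block-cap y _ _) _ () _
  raw-port-twins (dead-block x _ _) (cap-block y _ _) _ () _
  raw-port-twins (dead-block x _ _) (block-block y _ _ _ _) _ () _
  raw-port-twins (dead-block x _ _) (block-dead y _ _) _ () _
  raw-port-twins {i} {j} (block-cap x p h) E i≢j e _ = go E e
    where
    go : ∀ {q q'} → End j q q' → place (block x) ≡ place q → isCap (nodeOf (cap-end x)) ≡ true × nodeOf q' ≡ nodeOf (cap-end x)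
    go (block-cap y q _) e with block-twins {x} {y} e
    ... | inj₁ refl = contradiction (trans (sym p) q) i≢j
    ... | inj₂ (_ , r , s) = cap-true h , cong₂ (λ k c → inj₁ (k , c)) r s
    go (cap-block y q g) e = contradiction (sym (cong proj₂ (inj₁-injective (cong proj₁ e)))) g
    go (block-block y _ q c _) e with block-twins {x} {y} e
    ... | inj₁ refl = contradiction (trans (sym p) q) i≢j
    ... | inj₂ (_ , r , s) = contradiction (trans (sym s) c) h
    go (block-dead y q c) e with block-twins {x} {y} e
    ... | inj₁ refl = contradiction (trans (sym p) q) i≢j
    ... | inj₂ (_ , r , s) = contradiction (trans (sym s) c) h
    go (dead-block y _ _) ()
  raw-port-twins (block-block x z p c _) E i≢j e _ = contradiction e (outlet-alone x p c E i≢j)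
  raw-port-twins (block-dead x p c) E i≢j e _ = contradiction e (outlet-alone x p c E i≢j)

  data CapEnd (v : Fin n) : Kind → Kind → Set where
    cap-block : ∀ x → vertex x ≡ v → capOf x ≢ zero → CapEnd v (cap-end x) (block x)

  cap-shape : ∀ {v p q} → End v p q → isCap (nodeOf p) ≡ true → CapEnd v p q
  cap-shape (cap-block x p h) _ = cap-block x p h

  same-cap : ∀ {i j p p' q q'} → End i p p' → End j q q' → isCap (nodeOf p) ≡ true → nodeOf q ≡ nodeOf p →
             CapEnd i p p' × CapEnd j q q'
  same-cap E F c e = cap-shape E c , cap-shape F (trans (cong isCap e) c)

  raw-cap-twins : ∀ {i j p p' q q'} → End i p p' → End j q q' → isCap (nodeOf p) ≡ true → nodeOf q ≡ nodeOf p →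
                  place q' ≡ place p' × isCap (nodeOf p') ≡ false
  raw-cap-twins E F c e with same-cap E F c e
  ... | cap-block (k , a) p h , cap-block (l , b) q g with inj₁-injective e
  ...   | e' with cong proj₁ e'
  ...     | refl with block-cap-twins (t k) a b
  ...       | inj₁ (inj₁ z) = contradiction z h
  ...       | inj₁ (inj₂ z) = contradiction (cong proj₂ e') z
  ...       | inj₂ r = cong (inj₁ (k , zero) ,_) r , refl

  cap-end-of : ∀ y → capOf y ≢ zero → kind (vertex y) true ≡ cap-end y
  cap-end-of y h = go (shape (vertex y))
    where
    go : (s : Shape (vertex y)) → shapeKind s true ≡ cap-end y
    go (capped x p _) = cong cap-end (capped-unique p h)
    go (paired x z p q g) with capped-unique p h | capped-unique q h
    ... | refl | refl = contradiction refl g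
    go (lone x p c _) with capped-unique p h
    ... | refl = contradiction c h

  raw-cap-twin : ∀ i e → isCap (nodeOf (kind i e)) ≡ true → ∃[ j ] ∃[ e' ] j ≢ i × nodeOf (kind j e') ≡ nodeOf (kind i e)
  raw-cap-twin i e c = go (cap-shape (ends i e) c)
    where
    go : ∀ {p q} → CapEnd i p q → ∃[ j ] ∃[ e' ] j ≢ i × nodeOf (kind j e') ≡ nodeOf p
    go (cap-block (k , a) p h) with block-cap-twin (t k) a
    ... | inj₁ z = contradiction z h
    ... | inj₂ (b , b≢a , s) = f k b , true , (λ q → b≢a (same-block (trans q (sym p)))) ,
            trans (cong nodeOf (cap-end-of (k , b) (λ z → h (trans (sym s) z)))) (cong (λ c → inj₁ (k , c)) s)

  raw-cap-two : ∀ {i j k p p' q q' r r'} → End i p p' → End j q q' → End k r r' → isCap (nodeOf p) ≡ true →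
                nodeOf q ≡ nodeOf p → nodeOf r ≡ nodeOf p → j ≢ i → k ≢ i → j ≡ k
  raw-cap-two E F G c e e' j≢i k≢i with same-cap E F c e | same-cap E G c e'
  ... | cap-block (k , a) p h , cap-block (l , b) q _ | cap-block _ _ _ , cap-block (m , d) r _
    with cong proj₁ (inj₁-injective e) | cong proj₁ (inj₁-injective e')
  ...   | refl | refl with block-cap-two (t k) a b d
  ...     | inj₁ (inj₁ z) = contradiction z h
  ...     | inj₁ (inj₂ (inj₁ z)) = contradiction (cong proj₂ (inj₁-injective e)) z
  ...     | inj₁ (inj₂ (inj₂ z)) = contradiction (cong proj₂ (inj₁-injective e')) z
  ...     | inj₂ (inj₁ (inj₁ refl)) = contradiction (trans (sym q) p) j≢i
  ...     | inj₂ (inj₁ (inj₂ refl)) = contradiction (trans (sym r) p) k≢i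
  ...     | inj₂ (inj₂ refl) = trans (sym q) r

  rawEnd : Fin n → Bool → Node × Fin 3
  rawEnd v e = place (kind v e)

  abstract
    rawEnd-apart : ∀ i e → proj₁ (rawEnd i e) ≢ proj₁ (rawEnd i (not e))
    rawEnd-apart i e = raw-apart (ends i e)

    rawEnd-port-twins : ∀ i e j e' → i ≢ j → rawEnd i e ≡ rawEnd j e' → isCap (proj₁ (rawEnd i e)) ≡ false →
                        isCap (proj₁ (rawEnd i (not e))) ≡ true × proj₁ (rawEnd j (not e')) ≡ proj₁ (rawEnd i (not e))
    rawEnd-port-twins i e j e' = raw-port-twins (ends i e) (ends j e')

    rawEnd-cap-twins : ∀ i e j e' → isCap (proj₁ (rawEnd i e)) ≡ true → proj₁ (rawEnd j e') ≡ proj₁ (rawEnd i e) →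
                       rawEnd j (not e') ≡ rawEnd i (not e) × isCap (proj₁ (rawEnd i (not e))) ≡ false
    rawEnd-cap-twins i e j e' = raw-cap-twins (ends i e) (ends j e')

    rawEnd-cap-two : ∀ i e j e' k e'' → isCap (proj₁ (rawEnd i e)) ≡ true → proj₁ (rawEnd j e') ≡ proj₁ (rawEnd i e) →
                     proj₁ (rawEnd k e'') ≡ proj₁ (rawEnd i e) → j ≢ i → k ≢ i → j ≡ k
    rawEnd-cap-two i e j e' k e'' = raw-cap-two (ends i e) (ends j e') (ends k e'')

  open Compress code code-injective rawEnd isCap rawEnd-apart rawEnd-port-twins rawEnd-cap-twins raw-cap-twin rawEnd-cap-two

  triangulation : Triangulation N n
  triangulation = compressed

  pairWeight : Kind → Kind → ℤ
  pairWeight (block x) (block y) = if proj₁ x == proj₁ y then turn (portOf x) (portOf y) else + 0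
  pairWeight _         _         = + 0

  weigh-kind : ∀ i e j e' → weigh newCap (newEnd i e) (newEnd j e') ≡ pairWeight (kind i e) (kind j e')
  weigh-kind i e j e' = go (kind i e) (kind j e') refl refl
    where
    index-apart : ∀ {p q} → kind i e ≡ p → kind j e' ≡ q → nodeOf p ≢ nodeOf q → weigh newCap (newEnd i e) (newEnd j e') ≡ + 0
    index-apart r s h = weigh-apart newCap (λ z → h (trans (cong nodeOf (sym r)) (trans (index-to z) (cong nodeOf s))))
    go : ∀ p q → kind i e ≡ p → kind j e' ≡ q → weigh newCap (newEnd i e) (newEnd j e') ≡ pairWeight p q
    go (cap-end x) q r s = weigh-cap newCap (newEnd j e') (trans (newCap-index i e) (trans (cong (isCap ∘ nodeOf) r) (is-cap (subst (λ p → End i p (kind i (not e))) r (ends i e)))))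
      where
      is-cap : ∀ {x q} → End i (cap-end x) q → isCap (nodeOf (cap-end x)) ≡ true
      is-cap (cap-block x _ h) = cap-true h
    go (block x) (block y) r s = decide (proj₁ x ≟ proj₁ y)
      where
      decide : Dec (proj₁ x ≡ proj₁ y) → weigh newCap (newEnd i e) (newEnd j e') ≡ pairWeight (block x) (block y)
      decide (no h) = trans (index-apart r s (h ∘ cong proj₁ ∘ inj₁-injective))
                            (sym (cong (λ c → if c then turn (portOf x) (portOf y) else + 0) (==-≢ h)))
      decide (yes h) = trans
        (cong₂ (λ c d → if c ∧ not d then turn (proj₂ (newEnd i e)) (proj₂ (newEnd j e')) else + 0)
          (trans (cong (index i e ==_) (sym (index-from (trans (cong nodeOf r) (trans (cong (λ k → inj₁ (k , zero)) h) (cong nodeOf (sym s)))))))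
                 (==-refl (index i e)))
          (trans (newCap-index i e) (cong (isCap ∘ nodeOf) r)))
        (trans (cong₂ turn (cong (proj₂ ∘ place) r) (cong (proj₂ ∘ place) s))
               (sym (cong (λ c → if c then turn (portOf x) (portOf y) else + 0) (trans (cong (proj₁ x ==_) (sym h)) (==-refl (proj₁ x))))))
    go (block x) (cap-end y) r s = index-apart r s (λ z → is-cap (subst (λ p → End j p (kind j (not e'))) s (ends j e')) (sym (cong proj₂ (inj₁-injective z))))
      where
      is-cap : ∀ {x q} → End j (cap-end x) q → capOf x ≢ zero
      is-cap (cap-block x _ h) = h
    go (block x) (dead v) r s = index-apart r s λ ()
    go (dead v) (block y) r s = index-apart r s λ ()
    go (dead v) (cap-end y) r s = index-apart r s λ ()
    go (dead v) (dead w) r s with v ≟ w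
    ... | yes refl = weigh-port newCap (end-from (trans (cong place r) (cong place (sym s))))
    ... | no h     = index-apart r s (λ { refl → h refl })

  value : (∀ k → Fin (size (t k)) → ℤ) → Kind → ℤ
  value G (block (k , a)) = G k a
  value G (cap-end _)     = + 0
  value G (dead _)        = + 0

  -- A vertex occurs in one block or two, and these are the ends of kind `block`; the other ends
  -- contribute zero, as do caps and the added nodes in the matrix.
  occurrence-sum : ∀ v (G : ∀ k → Fin (size (t k)) → ℤ) →
                   sumFin (λ k → sumFin (λ a → δ (f k a) v (G k a))) ≡ Σb (λ e → value G (kind v e))
  occurrence-sum v G = go (shape v)
    where
    row : Fin K → ℤ
    row k = sumFin (λ a → δ (f k a) v (G k a))
    row-at : ∀ x → vertex x ≡ v → row (proj₁ x) ≡ G (proj₁ x) (proj₂ x)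
    row-at (k , a) p = trans (sumFin-single a (λ b h → δ-no _ (λ q → h (same-block (trans q (sym p)))))) (δ-yes _ p)
    row-off : ∀ k → (∀ a → f k a ≢ v) → row k ≡ + 0
    row-off k h = sumFin-zero (λ a → δ-no _ (h a))
    single : ∀ x → vertex x ≡ v → (∀ z → vertex z ≡ v → z ≡ x) → sumFin row ≡ G (proj₁ x) (proj₂ x)
    single x p only = trans (sumFin-single (proj₁ x) (λ k h → row-off k (λ a q → h (cong proj₁ (only (k , a) q))))) (row-at x p)
    go : (s : Shape v) → sumFin row ≡ Σb (λ e → value G (shapeKind s e))
    go (capped x p h) = trans (single x p (λ z q → capped-unique (trans q (sym p)) h)) (sym (ℤₚ.+-identityʳ _))
    go (lone x p c only) = trans (single x p only) (sym (ℤₚ.+-identityʳ _))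
    go (paired x y p q h) = trans (sumFin-two (proj₁ x) (proj₁ y) h (λ k g g' → row-off k (λ a r → off k a r g g')))
                                  (cong₂ ℤ._+_ (row-at x p) (row-at y q))
      where
      off : ∀ k a → f k a ≡ v → k ≢ proj₁ x → k ≢ proj₁ y → ⊥
      off k a r g g' with glued x y (trans p (sym q))
      ... | inj₁ refl = h refl
      ... | inj₂ (_ , _ , _ , only) = [ (λ { refl → g refl }) , (λ { refl → g' refl }) ]′ (only (k , a) (trans r (sym p)))

  block-row : ∀ k p j → sumFin (λ b → δ (f k b) j (turn p (blockPort (t k) b))) ≡
              Σb (λ e' → value (λ l b → if k == l then turn p (blockPort (t l) b) else + 0) (kind j e'))
  block-row k p j = trans (sym (trans (sumFin-single k off) (on))) (occurrence-sum j G)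
    where
    G : ∀ l → Fin (size (t l)) → ℤ
    G l b = if k == l then turn p (blockPort (t l) b) else + 0
    off : ∀ l → l ≢ k → sumFin (λ b → δ (f l b) j (G l b)) ≡ + 0
    off l h = sumFin-zero (λ b → trans (cong (λ c → δ (f l b) j (if c then turn p (blockPort (t l) b) else + 0)) (==-≢ (h ∘ sym))) (δ-zero (f l b)))
      where
      δ-zero : ∀ x → δ x j (+ 0) ≡ + 0
      δ-zero x with x ≟ j
      ... | yes _ = refl
      ... | no _  = refl
    on : sumFin (λ b → δ (f k b) j (G k b)) ≡ sumFin (λ b → δ (f k b) j (turn p (blockPort (t k) b)))
    on = sumFin-cong (λ b → cong (λ c → δ (f k b) j (if c then turn p (blockPort (t k) b) else + 0)) (==-refl k))

  triangulation-matrix : matrix triangulation ≈ B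
  triangulation-matrix i j = sym (begin
    B i j
      ≡⟨ sumB i j ⟩
    sumFin (λ k → sumFin (λ a → sumFin (λ b → δ (f k a) i (δ (f k b) j (blockMat (t k) a b)))))
      ≡⟨ sumFin-cong (λ k → sumFin-cong (λ a → δ-sum (f k a) i (λ b → δ (f k b) j (blockMat (t k) a b)))) ⟩
    sumFin (λ k → sumFin (λ a → δ (f k a) i (sumFin (λ b → δ (f k b) j (blockMat (t k) a b)))))
      ≡⟨ occurrence-sum i (λ k a → sumFin (λ b → δ (f k b) j (blockMat (t k) a b))) ⟩
    Σb (λ e → value (λ k a → sumFin (λ b → δ (f k b) j (blockMat (t k) a b))) (kind i e))
      ≡⟨ Σb-cong (λ e → expand (kind i e)) ⟩
    Σb (λ e → Σb (λ e' → pairWeight (kind i e) (kind j e')))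
      ≡⟨ Σb-cong₂ (λ e e' → sym (weigh-kind i e j e')) ⟩
    matrix triangulation i j ∎)
    where
    open ≡-Reasoning
    same : ∀ k a q → value (λ l b → if k == l then turn (blockPort (t k) a) (blockPort (t l) b) else + 0) q ≡ pairWeight (block (k , a)) q
    same k a (block y)   = refl
    same k a (cap-end y) = refl
    same k a (dead v)    = refl
    expand : ∀ p → value (λ k a → sumFin (λ b → δ (f k b) j (blockMat (t k) a b))) p ≡ Σb (λ e' → pairWeight p (kind j e'))
    expand (cap-end _) = refl
    expand (dead _)    = refl
    expand (block (k , a)) = trans (sumFin-cong (λ b → cong (δ (f k b) j) (block-turn (t k) a b)))
      (trans (block-row k (blockPort (t k) a) j) (Σb-cong (λ e' → same k a (kind j e'))))

-- Dimensions

infixr 5 _∷ᵛ_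
_∷ᵛ_ : ∀ {n} → Bool → Vect n → Vect (suc n)
(b ∷ᵛ u) zero    = b
(b ∷ᵛ u) (suc i) = u i

∷ᵛ-cong : ∀ {n} b {u w : Vect n} → u ≗ w → (b ∷ᵛ u) ≗ (b ∷ᵛ w)
∷ᵛ-cong b e zero    = refl
∷ᵛ-cong b e (suc i) = e i

-- The finitely many vectors are enumerated coordinate by coordinate; `resp` lets a vector be
-- replaced by the enumerated one with the same values.
anyVect? : ∀ {n} {P : Vect n → Set} → (∀ {u w} → u ≗ w → P u → P w) → (∀ u → Dec (P u)) → Dec (∃ P)
anyVect? {zero} resp P? with P? (λ ())
... | yes p = yes (_ , p)
... | no h  = no λ { (u , p) → h (resp (λ ()) p) }
anyVect? {suc n} resp P? with anyVect? (λ e → resp (∷ᵛ-cong false e)) (λ u → P? (false ∷ᵛ u))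
                           | anyVect? (λ e → resp (∷ᵛ-cong true e)) (λ u → P? (true ∷ᵛ u))
... | yes (u , p) | _ = yes (_ , p)
... | no _ | yes (u , p) = yes (_ , p)
... | no h | no k = no λ { (u , p) → [ (λ e → h (u ∘ suc , resp (expand e) p)) , (λ e → k (u ∘ suc , resp (expand e) p)) ]′ (either (u zero)) }
  where
  either : ∀ b → b ≡ false ⊎ b ≡ true
  either false = inj₁ refl
  either true  = inj₂ refl
  expand : ∀ {b} {u : Vect (suc n)} → u zero ≡ b → u ≗ (b ∷ᵛ (u ∘ suc))
  expand e zero    = e
  expand e (suc i) = refl

record Subspace {n} (U : Vect n → Set) : Set where
  field
    resp : ∀ {u w} → u ≗ w → U u → U w
    add  : ∀ {u w} → U u → U w → U (u ⊕ w)
    dec  : ∀ u → Dec (U u)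

comb-lift : ∀ {n d} (cs : Vec Bool d) (ws : Vec (Vect n) d) → comb cs (Vec.map (false ∷ᵛ_) ws) ≗ (false ∷ᵛ comb cs ws)
comb-lift []       []       zero    = refl
comb-lift []       []       (suc i) = refl
comb-lift (c ∷ cs) (w ∷ ws) zero    = trans (cong₂ _xor_ (Boolₚ.∧-zeroʳ c) (comb-lift cs ws zero)) refl
comb-lift (c ∷ cs) (w ∷ ws) (suc i) = cong ((c ∧ w i) xor_) (comb-lift cs ws (suc i))

-- Induction on the number of coordinates: a basis of the part with first coordinate `false`,
-- together with one vector with first coordinate `true` if there is any.
subspace-dim : ∀ {n} {U : Vect n → Set} → Subspace U → ∃[ d ] Dim U d
subspace-dim {zero} S = 0 , [] , (λ ()) , (λ _ _ ()) , λ v _ → [] , v , (λ ()) , λ ()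
subspace-dim {suc n} {U} S with subspace-dim (record
    { resp = λ e → resp (∷ᵛ-cong false e)
    ; add = λ p q → resp (λ { zero → refl ; (suc i) → refl }) (add p q)
    ; dec = λ u → dec (false ∷ᵛ u) })
  where open Subspace S
... | d , ws , inV , indep , span with anyVect? (λ e → Subspace.resp S (∷ᵛ-cong true e)) (λ u → Subspace.dec S (true ∷ᵛ u))
...   | no h = d , Vec.map (false ∷ᵛ_) ws ,
        (λ k → subst U (sym (Vecₚ.lookup-map k (false ∷ᵛ_) ws)) (inV k)) ,
        (λ cs z → indep cs (λ i → trans (sym (comb-lift cs ws (suc i))) (z (suc i)))) ,
        λ v p → reduce v p (v zero) refl
  where
  reduce : ∀ v → U v → ∀ b → v zero ≡ b → ∃[ cs ] ∃[ w ] (ZeroSpace w × (∀ i → v i ≡ comb cs (Vec.map (false ∷ᵛ_) ws) i xor w i))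
  reduce v p true  e = contradiction (v ∘ suc , Subspace.resp S (λ { zero → e ; (suc i) → refl }) p) h
  reduce v p false e with span (v ∘ suc) (Subspace.resp S (λ { zero → e ; (suc i) → refl }) p)
  ... | cs , w , z , eq = cs , (false ∷ᵛ w) , (λ { zero → refl ; (suc i) → z i }) , λ
          { zero → trans e (sym (cong (_xor false) (comb-lift cs ws zero)))
          ; (suc i) → trans (eq i) (cong (_xor w i) (sym (comb-lift cs ws (suc i)))) }
...   | yes (u₀ , p₀) = suc d , (true ∷ᵛ u₀) ∷ Vec.map (false ∷ᵛ_) ws ,
        (λ { zero → p₀ ; (suc k) → subst U (sym (Vecₚ.lookup-map k (false ∷ᵛ_) ws)) (inV k) }) , independent ,
        λ v p → reduce v p (v zero) refl
  where
  independent : ∀ cs → ZeroSpace (comb cs ((true ∷ᵛ u₀) ∷ Vec.map (false ∷ᵛ_) ws)) → ∀ k → lookup cs k ≡ false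
  independent (true ∷ cs) z = contradiction (trans (sym (z zero)) (cong (true xor_) (comb-lift cs ws zero))) λ ()
  independent (false ∷ cs) z zero = refl
  independent (false ∷ cs) z (suc k) = indep cs (λ i → trans (sym (comb-lift cs ws (suc i))) (z (suc i))) k
  reduce : ∀ v → U v → ∀ b → v zero ≡ b →
           ∃[ cs ] ∃[ w ] (ZeroSpace w × (∀ i → v i ≡ comb cs ((true ∷ᵛ u₀) ∷ Vec.map (false ∷ᵛ_) ws) i xor w i))
  reduce v p b e with span (λ i → v (suc i) xor (b ∧ u₀ i)) (lower b e)
    where
    lower : ∀ b → v zero ≡ b → U (false ∷ᵛ (λ i → v (suc i) xor (b ∧ u₀ i)))
    lower false e = Subspace.resp S (λ { zero → e ; (suc i) → sym (Boolₚ.xor-identityʳ (v (suc i))) }) p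
    lower true  e = Subspace.resp S (λ { zero → cong (_xor true) e ; (suc i) → refl }) (Subspace.add S p p₀)
  ... | cs , w , z , eq = b ∷ cs , (false ∷ᵛ w) , (λ { zero → refl ; (suc i) → z i }) , λ
          { zero → trans e (sym (trans (Boolₚ.xor-identityʳ _) (trans (cong ((b ∧ true) xor_) (comb-lift cs ws zero))
                     (trans (Boolₚ.xor-identityʳ _) (Boolₚ.∧-identityʳ b)))))
          ; (suc i) → trans (regroup (v (suc i)) (b ∧ u₀ i) _ (eq i))
                     (trans (sym (Boolₚ.xor-assoc (b ∧ u₀ i) (comb cs ws i) (w i)))
                       (cong (λ x → ((b ∧ u₀ i) xor x) xor w i) (sym (comb-lift cs ws (suc i))))) }
    where
    regroup : ∀ a b c → a xor b ≡ c → a ≡ b xor c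
    regroup a b _ refl = trans (sym (Boolₚ.xor-identityʳ a)) (trans (cong (a xor_) (sym (xor-self b))) (swap a b))
      where
      swap : ∀ a b → a xor (b xor b) ≡ b xor (a xor b)
      swap = solve 2 (λ a b → a :+ (b :+ b) := b :+ (a :+ b)) refl where open xor-∧-Solver

quotDim-⇔ : ∀ {n} {U U' W W' : Vect n → Set} {d} → (∀ u → U u → U' u) → (∀ u → U' u → U u) →
            (∀ u → W u → W' u) → (∀ u → W' u → W u) → QuotDim U W d → QuotDim U' W' d
quotDim-⇔ f g h k (ws , inV , indep , span) = ws , (λ i → f _ (inV i)) , (λ cs p → indep cs (k _ p)) ,
  λ v p → let cs , w , q , e = span v (g v p) in cs , w , h w q , e

iso-zero : ∀ {n} (φ : LinearIso n) {u} → (∀ i → u i ≡ false) → ∀ i → to φ u i ≡ false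
iso-zero φ {u} z i = trans (to-cong φ {u} {u ⊕ u} (λ k → trans (z k) (sym (xor-self (u k)))) i)
  (trans (to-⊕ φ u u i) (xor-self (to φ u i)))

iso-comb : ∀ {n d} (φ : LinearIso n) (cs : Vec Bool d) (ws : Vec (Vect n) d) → comb cs (Vec.map (to φ) ws) ≗ to φ (comb cs ws)
iso-comb φ [] [] i = sym (iso-zero φ (λ _ → refl) i)
iso-comb φ (c ∷ cs) (w ∷ ws) i = trans (cong ((c ∧ to φ w i) xor_) (iso-comb φ cs ws i))
  (trans (cong (_xor to φ (comb cs ws) i) (scale c)) (sym (to-⊕ φ (λ k → c ∧ w k) (comb cs ws) i)))
  where
  scale : ∀ c → c ∧ to φ w i ≡ to φ (λ k → c ∧ w k) i
  scale true  = refl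
  scale false = sym (iso-zero φ (λ _ → refl) i)

iso-dim : ∀ {n} {U W : Vect n → Set} {d} (φ : LinearIso n) → (∀ u → U u → W (to φ u)) → (∀ u → W u → U (from φ u)) →
          Dim U d → Dim W d
iso-dim {U = U} {W} φ f g (ws , inV , indep , span) = Vec.map (to φ) ws ,
  (λ k → subst W (sym (Vecₚ.lookup-map k (to φ) ws)) (f _ (inV k))) ,
  (λ cs z → indep cs (λ i → trans (sym (from-to φ (comb cs ws) i))
     (iso-zero (iso-inverse φ) (λ k → trans (sym (iso-comb φ cs ws k)) (z k)) i))) ,
  λ v p → let cs , w , z , e = span (from φ v) (g v p) in cs , to φ w , iso-zero φ z ,
    λ i → trans (sym (to-from φ v i)) (trans (to-cong φ e i) (trans (to-⊕ φ (comb cs ws) w i)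
            (cong (_xor to φ w i) (sym (iso-comb φ cs ws i)))))

-- Radical spaces and the conclusions for surfaces

radical-≈ : ∀ {n} {B C : Mat n} {u} → B ≈ C → Radical B u → Radical C u
radical-≈ {u = u} e h i = trans (sum2-cong (λ j → cong (λ x → mod2 x ∧ u j) (sym (e i j)))) (h i)

radical-resp : ∀ {n} {B : Mat n} {u w} → u ≗ w → Radical B u → Radical B w
radical-resp {B = B} e h i = trans (sum2-cong (λ j → cong (mod2 (B i j) ∧_) (sym (e j)))) (h i)

radical-⊕ : ∀ {n} {B : Mat n} {u w} → Radical B u → Radical B w → Radical B (u ⊕ w)
radical-⊕ {B = B} {u} {w} h k i = trans (sum2-cong (λ j → Boolₚ.∧-distribˡ-xor (mod2 (B i j)) (u j) (w j)))
  (trans (sum2-xor (λ j → mod2 (B i j) ∧ u j) (λ j → mod2 (B i j) ∧ w j)) (cong₂ _xor_ (h i) (k i)))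

radical-zero : ∀ {n} {B : Mat n} {u} → (∀ k → u k ≡ false) → Radical B u
radical-zero {B = B} z i = sum2-false (λ j → trans (cong (mod2 (B i j) ∧_) (z j)) (Boolₚ.∧-zeroʳ _))

radical-subspace : ∀ {n} (B : Mat n) → Subspace (Radical B)
radical-subspace B = record { resp = λ {u} {w} → radical-resp {B = B} {u} {w} ; add = λ {u} {w} → radical-⊕ {B = B} {u} {w}
                            ; dec = λ u → Finₚ.all? (λ i → _ Bool.≟ false) }

span-radical : ∀ {n} {B : Mat n} {u} → V00 B u → Radical B u
span-radical {B = B} {u} (ps , all , e) = radical-resp {B = B} {xorSum ps} {u} (λ i → sym (e i)) (go ps all)
  where
  go : ∀ ps → All (BasicRadical B) ps → Radical B (xorSum ps)
  go []       []              = radical-zero {B = B} (λ _ → refl)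
  go (z ∷ ps) ((r , _) ∷ all) = radical-⊕ {B = B} {z} {xorSum ps} r (go ps all)

isCycle-≈ : ∀ {n} {B C : Mat n} {u} → B ≈ C → IsCycle B u → IsCycle C u
isCycle-≈ e (l , c , inj , image , adj) = l , c , inj , image , λ a b → mk⇔
  (λ h → Equivalence.to (adj a b) (λ q → h (trans (sym (e _ _)) q)))
  (λ h q → Equivalence.from (adj a b) h (trans (e _ _) q))

basic-≈ : ∀ {n} {B C : Mat n} {u} → B ≈ C → BasicRadical B u → BasicRadical C u
basic-≈ {u = u} e (r , inj₁ p) = radical-≈ {u = u} e r , inj₁ p
basic-≈ {u = u} e (r , inj₂ p) = radical-≈ {u = u} e r , inj₂ (isCycle-≈ {u = u} e p)

span-mono : ∀ {n} {P Q : Vect n → Set} → (∀ {u} → P u → Q u) → ∀ {u} → Span P u → Span Q u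
span-mono {P = P} {Q} f (ps , all , e) = ps , go all , e
  where
  go : ∀ {ps} → All P ps → All Q ps
  go []        = []
  go (p ∷ all) = f p ∷ go all

quotDim-zero : ∀ {n} {U W : Vect n → Set} → (∀ u → U u → W u) → QuotDim U W 0
quotDim-zero f = [] , (λ ()) , (λ _ _ ()) , λ v p → [] , v , f v p , λ i → refl

module _ {N n : ℕ} (T : Triangulation N n) where

  CycleSpace : Vect n → Set
  CycleSpace u = ∀ t → degree T u t ≡ false

  cycleSpace-subspace : Subspace CycleSpace
  cycleSpace-subspace = record
    { resp = λ e h t → trans (sym (degree-cong T e t)) (h t)
    ; add = λ {u} {w} h k t → trans (degree-⊕ T u w t) (cong₂ _xor_ (h t) (k t))
    ; dec = λ u → Finₚ.all? (λ t → degree T u t Bool.≟ false) }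

module _ {N n : ℕ} (T : Triangulation N n) (con : Connected (matrix T)) (3≤n : 3 ≤ n) where

  -- For more than four nodes the common degree is a linear form on `V0` with kernel `V00`. The
  -- quotient is a line or zero according to whether a radical vector of odd degree exists.
  surface-quotient : Σ ℕ λ d → QuotDim (V0 (matrix T)) (V00 (matrix T)) d × d ≤ 1
  surface-quotient with N ℕ.≤? 4
  ... | yes N≤4 = 0 , quotDim-zero (small-spanned T con 3≤n N≤4) , z≤n
  ... | no N≰4 with anyVect? (λ {u} {w} e (r , k , t , p) → radical-resp {B = matrix T} {u} {w} e r , k , t , trans (sym (degree-cong T e t)) p)
                     (λ u → Subspace.dec (radical-subspace (matrix T)) u ×-dec odd? u)
    where
    odd? : ∀ u → Dec (∃[ k ] ∃[ t ] degree T u t ≡ true)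
    odd? u = map′ (λ { (t , p) → tt , t , p }) (λ { (_ , t , p) → t , p }) (Finₚ.any? (λ t → degree T u t Bool.≟ true))
  ...   | no h = 0 , quotDim-zero (λ u r → cycle-space-spanned T u (λ t → not-true (λ p → h (u , r , tt , t , p)))) , z≤n
  ...   | yes (u₀ , r₀ , _ , t₀ , p₀) = 1 , (u₀ ∷ [] , (λ { zero → r₀ }) , independent , spans) , s≤s z≤n
    where
    5≤N : 5 ≤ N
    5≤N = ℕₚ.≰⇒> N≰4
    independent : ∀ cs → V00 (matrix T) (comb cs (u₀ ∷ [])) → ∀ k → lookup cs k ≡ false
    independent (false ∷ []) _ zero = refl
    independent (true ∷ []) s zero = contradiction
      (trans (sym p₀) (trans (degree-cong T (λ i → sym (Boolₚ.xor-identityʳ (u₀ i))) t₀) (basic-span-even T con 5≤N s t₀))) λ ()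
    spans : ∀ v → V0 (matrix T) v → ∃[ cs ] ∃[ w ] (V00 (matrix T) w × (∀ i → v i ≡ comb cs (u₀ ∷ []) i xor w i))
    spans v r = go (degree T v t₀) refl
      where
      go : ∀ b → degree T v t₀ ≡ b → ∃[ cs ] ∃[ w ] (V00 (matrix T) w × (∀ i → v i ≡ comb cs (u₀ ∷ []) i xor w i))
      go false p = false ∷ [] , v , cycle-space-spanned T v (λ t → trans (radical-constant T con {v} r t t₀) p) , λ i → refl
      go true  p = true ∷ [] , v ⊕ u₀ , cycle-space-spanned T (v ⊕ u₀) (λ t → trans (degree-⊕ T v u₀ t)
          (cong₂ _xor_ (trans (radical-constant T con {v} r t t₀) p) (trans (radical-constant T con {u₀} r₀ t t₀) p₀))) ,
        λ i → restore (v i) (u₀ i)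
        where
        restore : ∀ a b → a ≡ (b xor false) xor (a xor b)
        restore true  true  = refl
        restore true  false = refl
        restore false true  = refl
        restore false false = refl

-- V₀₀ is V₀ if there are at most four nodes, and the cycle space otherwise.
surface-dim : ∀ {N n} (T T' : Triangulation N n) → Connected (matrix T) → Connected (matrix T') → 3 ≤ n →
              (φ : LinearIso n) → Intertwines T T' φ → Σ ℕ λ d → Dim (V00 (matrix T)) d × Dim (V00 (matrix T')) d
surface-dim {N} {n} T T' con con' 3≤n φ h with N ℕ.≤? 4
... | yes N≤4 = let d , D = subspace-dim (radical-subspace (matrix T)) in
  d , quotDim-⇔ (small-spanned T con 3≤n N≤4) (λ u → span-radical {B = matrix T}) (λ _ z → z) (λ _ z → z) D ,
      quotDim-⇔ (small-spanned T' con' 3≤n N≤4) (λ u → span-radical {B = matrix T'}) (λ _ z → z) (λ _ z → z)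
        (iso-dim φ (transport T T' con φ h) (transport T' T con' (iso-inverse φ) (intertwines-inverse {T = T} {T'} {φ} h)) D)
  where
  i₀ : Fin n
  i₀ = inject≤ zero 3≤n
  transport : ∀ (T T' : Triangulation N n) → Connected (matrix T) → (φ : LinearIso n) → Intertwines T T' φ →
              ∀ u → Radical (matrix T) u → Radical (matrix T') (to φ u)
  transport T T' con φ h u r = constant-radical T' (degree T u (node (end T' i₀ false)))
    (λ t → trans (h u t) (radical-constant T con {u} r t (node (end T' i₀ false))))
... | no N≰4 = let d , D = subspace-dim (cycleSpace-subspace T) in
  d , quotDim-⇔ (cycle-space-spanned T) (λ u s → basic-span-even T con (ℕₚ.≰⇒> N≰4) s) (λ _ z → z) (λ _ z → z) D ,
      quotDim-⇔ (cycle-space-spanned T') (λ u s → basic-span-even T' con' (ℕₚ.≰⇒> N≰4) s) (λ _ z → z) (λ _ z → z)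
        (iso-dim φ (λ u z t → trans (h u t) (z t)) (λ u z t → trans (intertwines-inverse {T = T} {T'} {φ} h u t) (z t)) D)

Conclusion : ∀ {n} → Mat n → Set
Conclusion B = (Σ ℕ λ d → QuotDim (V0 B) (V00 B) d × d ≤ 1)
             × (∀ B' → MutEq B B' → Σ ℕ λ d → Dim (V00 B) d × Dim (V00 B') d)

quotDim-≈ : ∀ {n} {B C : Mat n} {d} → B ≈ C → QuotDim (V0 B) (V00 B) d → QuotDim (V0 C) (V00 C) d
quotDim-≈ {B = B} {C} e = quotDim-⇔ (λ u → radical-≈ {u = u} e) (λ u → radical-≈ {u = u} (≈-sym e))
  (λ _ → span-mono (λ {u} → basic-≈ {u = u} e)) (λ _ → span-mono (λ {u} → basic-≈ {u = u} (≈-sym e)))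

dim-≈ : ∀ {n} {B C : Mat n} {d} → B ≈ C → Dim (V00 B) d → Dim (V00 C) d
dim-≈ e = quotDim-⇔ (λ _ → span-mono (λ {u} → basic-≈ {u = u} e)) (λ _ → span-mono (λ {u} → basic-≈ {u = u} (≈-sym e))) (λ _ z → z) (λ _ z → z)

surface-conclusion : ∀ {N n} {B : Mat n} (T : Triangulation N n) → matrix T ≈ B → Connected B → 3 ≤ n → Conclusion B
surface-conclusion {B = B} T m con 3≤n = quotient , dims
  where
  con' : Connected (matrix T)
  con' = connected-≈ (≈-sym m) con
  quotient : Σ ℕ λ d → QuotDim (V0 B) (V00 B) d × d ≤ 1
  quotient = let d , q , le = surface-quotient T con' 3≤n in d , quotDim-≈ m q , le
  dims : ∀ B' → MutEq B B' → Σ ℕ λ d → Dim (V00 B) d × Dim (V00 B') d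
  dims B' p with mutEq-triangulated T p con m
  ... | conB' , T' , m' , φ , h with surface-dim T T' con' (connected-≈ (≈-sym m') conB') 3≤n φ h
  ...   | d , D₁ , D₂ = d , dim-≈ m D₁ , dim-≈ m' D₂

-- The mutation classes of X₆ and X₇

oddℕ-* : ∀ a b → oddℕ (a ℕ.* b) ≡ oddℕ a ∧ oddℕ b
oddℕ-* zero    b = refl
oddℕ-* (suc a) b = trans (oddℕ-+ b (a ℕ.* b)) (trans (cong (oddℕ b xor_) (oddℕ-* a b)) (absorb (oddℕ a) (oddℕ b)))
  where
  absorb : ∀ x y → y xor (x ∧ y) ≡ not x ∧ y
  absorb true  true  = refl
  absorb true  false = refl
  absorb false true  = refl
  absorb false false = refl

-- Parities of the positive and the negative part. The parity of an entry does not determine how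
-- mutation acts modulo 2, but these two together do.
plus minus : ℤ → Bool
plus x  = mod2 [ x ]₊
minus x = mod2 [ - x ]₊

plus-pos : ∀ a → plus (+ a) ≡ oddℕ a
plus-pos a = cong oddℕ (ℕₚ.⊔-identityʳ a)

minus-pos : ∀ a → minus (+ a) ≡ false
minus-pos zero    = refl
minus-pos (suc a) = refl

plus-neg : ∀ a → plus (- (+ a)) ≡ false
plus-neg = minus-pos

minus-neg : ∀ a → minus (- (+ a)) ≡ oddℕ a
minus-neg a = trans (cong plus (ℤₚ.neg-involutive (+ a))) (plus-pos a)

mod2-split : ∀ x → mod2 x ≡ plus x xor minus x
mod2-split x with by-sign x
... | inj₁ (a , refl) = sym (trans (cong₂ _xor_ (plus-pos a) (minus-pos a)) (Boolₚ.xor-identityʳ (oddℕ a)))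
... | inj₂ (a , refl) = trans (mod2-neg (+ a)) (sym (cong₂ _xor_ (plus-neg a) (minus-neg a)))

bump-parity : ∀ x y → mod2 (bump x y) ≡ (plus x ∧ plus y) xor (minus x ∧ minus y)
bump-parity x y with by-sign x | by-sign y
... | inj₁ (a , refl) | inj₁ (b , refl) = trans (cong mod2 (bump-pp a b)) (trans (oddℕ-* a b)
      (sym (trans (cong₂ _xor_ (cong₂ _∧_ (plus-pos a) (plus-pos b)) (cong₂ _∧_ (minus-pos a) (minus-pos b))) (Boolₚ.xor-identityʳ _))))
... | inj₁ (a , refl) | inj₂ (b , refl) = trans (cong mod2 (bump-pn a b))
      (sym (cong₂ _xor_ (trans (cong₂ _∧_ (plus-pos a) (plus-neg b)) (Boolₚ.∧-zeroʳ _)) (cong (_∧ minus (- (+ b))) (minus-pos a))))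
... | inj₂ (a , refl) | inj₁ (b , refl) = trans (cong mod2 (bump-np a b))
      (sym (cong₂ _xor_ (cong (_∧ plus (+ b)) (plus-neg a)) (trans (cong₂ _∧_ (minus-neg a) (minus-pos b)) (Boolₚ.∧-zeroʳ _))))
... | inj₂ (a , refl) | inj₂ (b , refl) = trans (cong mod2 (bump-nn a b)) (trans (mod2-neg (+ (a ℕ.* b))) (trans (oddℕ-* a b)
      (sym (cong₂ _xor_ (cong₂ _∧_ (plus-neg a) (plus-neg b)) (cong₂ _∧_ (minus-neg a) (minus-neg b))))))

-- The transvection of a flip, read off the matrix instead of a triangulation: its coefficients are
-- the parities of the weights of arrows leaving `k`.
module RadicalMutation {n : ℕ} {B : Mat n} (sk : SkewSym B) (k : Fin n) where

  g : Vect n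
  g j = plus (B k j)

  gk : g k ≡ false
  gk = cong plus (skew-diagonal {B = B} sk k)

  open Transvection k g gk public

  mutated-parity : ∀ i j → mod2 (mutate k B i j) ≡
                   mod2 (B i j) xor ((plus (B i k) ∧ plus (B k j)) xor (minus (B i k) ∧ minus (B k j)))
  mutated-parity = mutate-elim k B (λ i j x → mod2 x ≡ mod2 (B i j) xor ((plus (B i k) ∧ plus (B k j)) xor (minus (B i k) ∧ minus (B k j))))
    (λ j → trans (mod2-neg (B k j)) (sym (trans (cong (mod2 (B k j) xor_)
      (cong (λ x → (plus x ∧ plus (B k j)) xor (minus x ∧ minus (B k j))) (skew-diagonal {B = B} sk k))) (Boolₚ.xor-identityʳ _))))
    (λ i → trans (mod2-neg (B i k)) (sym (trans (cong (mod2 (B i k) xor_)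
      (trans (cong (λ x → (plus (B i k) ∧ plus x) xor (minus (B i k) ∧ minus x)) (skew-diagonal {B = B} sk k))
             (cong₂ _xor_ (Boolₚ.∧-zeroʳ (plus (B i k))) (Boolₚ.∧-zeroʳ (minus (B i k)))))) (Boolₚ.xor-identityʳ _))))
    (λ i j _ _ → trans (mod2-+ (B i j) _) (cong (mod2 (B i j) xor_) (bump-parity (B i k) (B k j))))

  -- Row `k` of the radical condition: the arrows out of `k` and the arrows into `k` have the same
  -- sum over `u`.
  balanced : ∀ {u} → Radical B u → sum2 (λ j → minus (B k j) ∧ u j) ≡ form u
  balanced {u} r = sym (xor≡false (trans (sym (sum2-xor (λ j → plus (B k j) ∧ u j) (λ j → minus (B k j) ∧ u j)))
    (trans (sum2-cong (λ j → trans (sym (Boolₚ.∧-distribʳ-xor (u j) (plus (B k j)) (minus (B k j)))) (cong (_∧ u j) (sym (mod2-split (B k j)))))) (r k))))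

  -- By `balanced` the two correction terms in row `i` contribute `p ∧ form u` and `q ∧ form u`. The
  -- change of coordinate `k` contributes `form u` times the entry at `k`, which is `p xor q`, and
  -- cancels both.
  mutated-radical : ∀ u → Radical B u → Radical (mutate k B) (apply u)
  mutated-radical u r i = begin
    sum2 (λ j → mod2 (mutate k B i j) ∧ apply u j)
      ≡⟨ sum2-cong (λ j → trans (cong (_∧ apply u j) (mutated-parity i j)) (expand (b j) p (g j) q (m j) (u j) (j == k) (form u))) ⟩
    sum2 (λ j → ((b j ∧ u j) xor ((p ∧ (g j ∧ u j)) xor (q ∧ (m j ∧ u j)))) xor ((j == k) ∧ (h j ∧ form u)))
      ≡⟨ sum2-xor (λ j → (b j ∧ u j) xor ((p ∧ (g j ∧ u j)) xor (q ∧ (m j ∧ u j)))) (λ j → (j == k) ∧ (h j ∧ form u)) ⟩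
    sum2 (λ j → (b j ∧ u j) xor ((p ∧ (g j ∧ u j)) xor (q ∧ (m j ∧ u j)))) xor sum2 (λ j → (j == k) ∧ (h j ∧ form u))
      ≡⟨ cong₂ _xor_
           (trans (sum2-xor (λ j → b j ∧ u j) (λ j → (p ∧ (g j ∧ u j)) xor (q ∧ (m j ∧ u j))))
             (cong₂ _xor_ (r i) (trans (sum2-xor (λ j → p ∧ (g j ∧ u j)) (λ j → q ∧ (m j ∧ u j)))
               (cong₂ _xor_ (sum2-∧ p (λ j → g j ∧ u j)) (trans (sum2-∧ q (λ j → m j ∧ u j)) (cong (q ∧_) (balanced {u} r)))))))
           (sum2-δ k (λ j → h j ∧ form u)) ⟩
    ((p ∧ form u) xor (q ∧ form u)) xor (h k ∧ form u)
      ≡⟨ cong (λ x → ((p ∧ form u) xor (q ∧ form u)) xor (x ∧ form u)) h-k ⟩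
    ((p ∧ form u) xor (q ∧ form u)) xor ((p xor q) ∧ form u)
      ≡⟨ cancel p q (form u) ⟩
    false ∎
    where
    open ≡-Reasoning
    p q : Bool
    p = plus (B i k)
    q = minus (B i k)
    b m h : Vect n
    b j = mod2 (B i j)
    m j = minus (B k j)
    h j = b j xor ((p ∧ g j) xor (q ∧ m j))
    h-k : h k ≡ p xor q
    h-k = trans (cong (λ x → b k xor ((p ∧ plus x) xor (q ∧ minus x))) (skew-diagonal {B = B} sk k))
      (trans (cong (b k xor_) (cong₂ _xor_ (Boolₚ.∧-zeroʳ p) (Boolₚ.∧-zeroʳ q))) (trans (Boolₚ.xor-identityʳ (b k)) (mod2-split (B i k))))
    expand : ∀ b p g q m u d s → (b xor ((p ∧ g) xor (q ∧ m))) ∧ (u xor (d ∧ s)) ≡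
             ((b ∧ u) xor ((p ∧ (g ∧ u)) xor (q ∧ (m ∧ u)))) xor (d ∧ ((b xor ((p ∧ g) xor (q ∧ m))) ∧ s))
    expand = solve 8 (λ b p g q m u d s → (b :+ (p :* g :+ q :* m)) :* (u :+ d :* s) :=
               (b :* u :+ (p :* (g :* u) :+ q :* (m :* u))) :+ d :* ((b :+ (p :* g :+ q :* m)) :* s)) refl where open xor-∧-Solver
    cancel : ∀ p q s → ((p ∧ s) xor (q ∧ s)) xor ((p xor q) ∧ s) ≡ false
    cancel true  true  true  = refl
    cancel true  true  false = refl
    cancel true  false true  = refl
    cancel true  false false = refl
    cancel false true  true  = refl
    cancel false true  false = refl
    cancel false false true  = refl
    cancel false false false = refl

-- The coefficients of the inverse transvection are minus (B k j) instead of plus (B k j);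
-- on radical vectors the two agree.
radical-unmutate : ∀ {n} {B : Mat n} (sk : SkewSym B) k u → Radical (mutate k B) u → Radical B (RadicalMutation.apply sk k u)
radical-unmutate {B = B} sk k u r =
  radical-≈ {u = RadicalMutation.apply sk k u} (mutate-involutive k B)
    (radical-resp {B = mutate k (mutate k B)} {RadicalMutation.apply sk' k u} {RadicalMutation.apply sk k u} same (RadicalMutation.mutated-radical sk' k u r))
  where
  sk' : SkewSym (mutate k B)
  sk' = mutate-skew k sk
  forms : RadicalMutation.form sk' k u ≡ RadicalMutation.form sk k u
  forms = trans (sym (RadicalMutation.balanced sk' k {u} r))
    (sum2-cong (λ j → cong (_∧ u j) (cong plus (trans (cong -_ (mutate-row k B j)) (ℤₚ.neg-involutive (B k j))))))
  same : RadicalMutation.apply sk' k u ≗ RadicalMutation.apply sk k u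
  same j = cong (λ s → u j xor ((j == k) ∧ s)) forms

RadicalIso : ∀ {n} → Mat n → Mat n → Set
RadicalIso {n} B C = SkewSym C × Σ (LinearIso n) λ φ → (∀ u → Radical B u → Radical C (to φ u)) × (∀ u → Radical C u → Radical B (from φ u))

radical-relabel : ∀ {n} {B : Mat n} (σ τ : Fin n → Fin n) → (∀ i → σ (τ i) ≡ i) → (∀ i → τ (σ i) ≡ i) → ∀ {u} →
                  Radical B u → Radical (λ i j → B (σ i) (σ j)) (u ∘ σ)
radical-relabel {B = B} σ τ στ τσ {u} r i = trans (sum2-bijection σ τ στ τσ (λ j → mod2 (B (σ i) j) ∧ u j)) (r (σ i))

radical-unlabel : ∀ {n} {B : Mat n} (σ τ : Fin n → Fin n) → (∀ i → σ (τ i) ≡ i) → (∀ i → τ (σ i) ≡ i) → ∀ {u} →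
                  Radical (λ i j → B (σ i) (σ j)) u → Radical B (u ∘ τ)
radical-unlabel {B = B} σ τ στ τσ {u} r =
  radical-≈ {u = u ∘ τ} (λ i j → cong₂ B (στ i) (στ j)) (radical-relabel {B = λ i j → B (σ i) (σ j)} τ σ τσ στ {u} r)

mutEq-radical : ∀ {n} {B C : Mat n} → SkewSym B → MutEq B C → RadicalIso B C
mutEq-radical {n} {B} sk p = proj₁ (mutEq-invariant (RadicalIso B)
  (λ e (sk , φ , f , g) → (λ i j → trans (sym (e j i)) (trans (sk i j) (cong -_ (e i j)))) , φ ,
     (λ u r → radical-≈ {u = to φ u} e (f u r)) , (λ u r → g u (radical-≈ {u = u} (≈-sym e) r)))
  (λ {C} k (sk , φ , f , g) → mutate-skew k sk , iso-compose φ (RadicalMutation.transvection sk k) ,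
     (λ u r → RadicalMutation.mutated-radical sk k (to φ u) (f u r)) ,
     (λ u r → g _ (radical-unmutate sk k u r)))
  (λ {C} σ τ στ τσ (sk , φ , f , g) → (λ i j → sk (σ i) (σ j)) ,
     iso-compose φ (record { to = _∘ σ ; from = _∘ τ ; to-cong = λ e → e ∘ σ ; from-cong = λ e → e ∘ τ
       ; to-⊕ = λ _ _ _ → refl ; from-⊕ = λ _ _ _ → refl ; to-from = λ u i → cong u (τσ i) ; from-to = λ u i → cong u (στ i) }) ,
     (λ u r → radical-relabel {B = C} σ τ στ τσ {to φ u} (f u r)) ,
     (λ u r → g _ (radical-unlabel {B = C} σ τ στ τσ {u} r)))
  p) (sk , iso-id , (λ u r → r) , (λ u r → r))

-- Certificates for finite mutation classes

allVec : ∀ {n} → (Vec Bool n → Bool) → Bool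
allVec {zero}  f = f []
allVec {suc n} f = allVec (f ∘ (false ∷_)) ∧ allVec (f ∘ (true ∷_))

allVec-sound : ∀ {n} {f : Vec Bool n → Bool} → allVec f ≡ true → ∀ v → f v ≡ true
allVec-sound e []          = e
allVec-sound e (false ∷ v) = allVec-sound (∧-splitˡ e) v
allVec-sound {f = f} e (true ∷ v) = allVec-sound (∧-splitʳ {allVec (f ∘ (false ∷_))} e) v

module _ {n : ℕ} {B : Mat n} (σ τ : Fin n → Fin n) (στ : ∀ i → σ (τ i) ≡ i) (τσ : ∀ i → τ (σ i) ≡ i) where

  private
    σ-inj : ∀ {i j} → σ i ≡ σ j → i ≡ j
    σ-inj {i} {j} e = trans (sym (τσ i)) (trans (cong τ e) (τσ j))

  mutate-relabel : ∀ k → mutate k (λ i j → B (σ i) (σ j)) ≈ (λ i j → mutate (σ k) B (σ i) (σ j))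
  mutate-relabel k = mutate-elim k (λ i j → B (σ i) (σ j)) (λ i j x → x ≡ mutate (σ k) B (σ i) (σ j))
    (λ j → sym (mutate-row (σ k) B (σ j))) (λ i → sym (mutate-col (σ k) B (σ i)))
    (λ i j i≢k j≢k → sym (mutate-off (σ k) B (i≢k ∘ σ-inj) (j≢k ∘ σ-inj)))

  basic-relabel : ∀ {u} → BasicRadical B u → BasicRadical (λ i j → B (σ i) (σ j)) (u ∘ σ)
  basic-relabel {u} (r , shape) = radical-relabel {B = B} σ τ στ τσ {u} r , relabel-shape shape
    where
    relabel-shape : _ ⊎ IsCycle B u → _ ⊎ IsCycle (λ i j → B (σ i) (σ j)) (u ∘ σ)
    relabel-shape (inj₁ (i , j , i≢j , ⇔)) = inj₁ (τ i , τ j , (λ e → i≢j (trans (sym (στ i)) (trans (cong σ e) (στ j)))) ,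
      λ k → mk⇔ (λ h → [ (λ e → inj₁ (trans (sym (τσ k)) (cong τ e))) , (λ e → inj₂ (trans (sym (τσ k)) (cong τ e))) ]′ (Equivalence.to (⇔ (σ k)) h))
                (λ h → Equivalence.from (⇔ (σ k)) ([ (λ e → inj₁ (trans (cong σ e) (στ i))) , (λ e → inj₂ (trans (cong σ e) (στ j))) ]′ h)))
    relabel-shape (inj₂ (l , c , inj , image , adj)) = inj₂ (l , τ ∘ c ,
      (λ a b e → inj a b (trans (sym (στ (c a))) (trans (cong σ e) (στ (c b))))) ,
      (λ k → mk⇔ (λ h → let a , p = Equivalence.to (image (σ k)) h in a , trans (cong τ p) (τσ k))
                 (λ { (a , p) → Equivalence.from (image (σ k)) (a , trans (sym (στ (c a))) (cong σ p)) })) ,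
      (λ a b → mk⇔ (λ h → Equivalence.to (adj a b) (λ e → h (trans (cong₂ B (στ (c a)) (στ (c b))) e)))
                   (λ h e → Equivalence.from (adj a b) h (trans (sym (cong₂ B (στ (c a)) (στ (c b)))) e))))

  span-relabel : ∀ {u} → V00 B u → V00 (λ i j → B (σ i) (σ j)) (u ∘ σ)
  span-relabel {u} (ps , all , e) = List.map (_∘ σ) ps , go all , λ i → trans (e (σ i)) (sums ps i)
    where
    go : ∀ {ps} → All (BasicRadical B) ps → All (BasicRadical (λ i j → B (σ i) (σ j))) (List.map (_∘ σ) ps)
    go []        = []
    go (p ∷ all) = basic-relabel p ∷ go all
    sums : ∀ ps i → xorSum ps (σ i) ≡ xorSum (List.map (_∘ σ) ps) i
    sums []       i = refl
    sums (z ∷ ps) i = cong (z (σ i) xor_) (sums ps i)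

table : ∀ {n m} → Vec (Vec ℤ m) n → Fin n → Fin m → ℤ
table rows i j = lookup (lookup rows i) j

-- In the two exceptional classes pairs of vertices and triangles suffice to span the radical.
data Generator (n : ℕ) : Set where
  pair   : Fin n → Fin n → Generator n
  triple : Fin n → Fin n → Fin n → Generator n

vertices : ∀ {n} → Generator n → ∃[ m ] (Fin m → Fin n)
vertices (pair i j)     = 2 , lookup (i ∷ j ∷ [])
vertices (triple i j k) = 3 , lookup (i ∷ j ∷ k ∷ [])

vector : ∀ {n} → Generator n → Vect n
vector p = indicator (proj₂ (vertices p))

radicalᵇ : ∀ {n} → Mat n → Vect n → Bool
radicalᵇ B u = allᵇ (λ i → not (sum2 (λ j → mod2 (B i j) ∧ u j)))

not-sound : ∀ {b} → not b ≡ true → b ≡ false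
not-sound {false} _ = refl

radicalᵇ-sound : ∀ {n} {B : Mat n} {u} → radicalᵇ B u ≡ true → Radical B u
radicalᵇ-sound {B = B} {u} e i = not-sound (allᵇ-sound {f = λ i → not (sum2 (λ j → mod2 (B i j) ∧ u j))} e i)

radicalᵇ-complete : ∀ {n} {B : Mat n} {u} → Radical B u → radicalᵇ B u ≡ true
radicalᵇ-complete {B = B} {u} r = allᵇ-true {f = λ i → not (sum2 (λ j → mod2 (B i j) ∧ u j))} (λ i → cong not (r i))

distinctᵇ : ∀ {n m} → (Fin m → Fin n) → Bool
distinctᵇ c = allᵇ (λ a → allᵇ (λ b → not (c a == c b) Bool.∨ (a == b)))

adjacentᵇ : ∀ {n m} → Mat n → (Fin m → Fin n) → Bool
adjacentᵇ B c = allᵇ (λ a → allᵇ (λ b → (a == b) Bool.∨ not (does (B (c a) (c b) ℤ.≟ + 0))))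

isPair : ∀ {n} → Generator n → Bool
isPair (pair _ _)     = true
isPair (triple _ _ _) = false

validᵇ : ∀ {n} → Mat n → Generator n → Bool
validᵇ B p = radicalᵇ B (vector p) ∧ (distinctᵇ (proj₂ (vertices p)) ∧ (isPair p Bool.∨ adjacentᵇ B (proj₂ (vertices p))))

∨-right : ∀ {a b} → a ≡ false → a Bool.∨ b ≡ true → b ≡ true
∨-right refl h = h

distinct-sound : ∀ {n m} (c : Fin m → Fin n) → distinctᵇ c ≡ true → ∀ a b → c a ≡ c b → a ≡ b
distinct-sound c e a b p = ==-sound (∨-right {not (c a == c b)} (cong not (trans (cong (_== c b) p) (==-refl (c b))))
  (allᵇ-sound {f = λ b → not (c a == c b) Bool.∨ (a == b)} (allᵇ-sound {f = λ a → allᵇ (λ b → not (c a == c b) Bool.∨ (a == b))} e a) b))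

adjacent-sound : ∀ {n m} (B : Mat n) (c : Fin m → Fin n) → adjacentᵇ B c ≡ true → ∀ a b → a ≢ b → Adj B (c a) (c b)
adjacent-sound B c e a b h z = contradiction (trans (sym (dec-true (B (c a) (c b) ℤ.≟ + 0) z)) (not-sound (∨-right (==-≢ h)
  (allᵇ-sound {f = λ b → (a == b) Bool.∨ not (does (B (c a) (c b) ℤ.≟ + 0))}
    (allᵇ-sound {f = λ a → allᵇ (λ b → (a == b) Bool.∨ not (does (B (c a) (c b) ℤ.≟ + 0)))} e a) b)))) λ ()

valid-basic : ∀ {n} {B : Mat n} → SkewSym B → ∀ p → validᵇ B p ≡ true → BasicRadical B (vector p)
valid-basic {B = B} sk q@(pair i j) e = radicalᵇ-sound {B = B} {vector q} (∧-splitˡ e) , inj₁ (i , j , i≢j ,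
    λ k → mk⇔ (λ h → case indicator-∋ c k h of λ { (zero , p) → inj₁ (sym p) ; (one , p) → inj₂ (sym p) })
              λ { (inj₁ refl) → indicator-∈ c inj zero ; (inj₂ refl) → indicator-∈ c inj one })
  where
  c = proj₂ (vertices q)
  inj : ∀ a b → c a ≡ c b → a ≡ b
  inj = distinct-sound c (∧-splitˡ (∧-splitʳ {radicalᵇ B (vector q)} e))
  i≢j : i ≢ j
  i≢j p = case inj zero one p of λ ()
valid-basic {B = B} sk q@(triple i j k) e = triangle-basic sk (radicalᵇ-sound {B = B} {vector q} (∧-splitˡ e)) c inj
    (λ k → mk⇔ (indicator-∋ c k) λ { (a , refl) → indicator-∈ c inj a }) adj
  where
  c = proj₂ (vertices q)
  rest-true = ∧-splitʳ {radicalᵇ B (vector q)} e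
  inj : ∀ a b → c a ≡ c b → a ≡ b
  inj = distinct-sound c (∧-splitˡ rest-true)
  adj : ∀ a b → a ≢ b → Adj B (c a) (c b)
  adj = adjacent-sound B c (∧-splitʳ {distinctᵇ c} rest-true)

-- A pivot of a generator is a vertex where the other generators of the list vanish.
combine-generators : ∀ {n} → List (Fin n × Generator n) → Vect n → Vect n
combine-generators []             u i = false
combine-generators ((v , p) ∷ ps) u i = (u v ∧ vector p i) xor combine-generators ps u i

validList : ∀ {n} → Mat n → List (Fin n × Generator n) → Bool
validList B []             = true
validList B ((v , p) ∷ ps) = validᵇ B p ∧ validList B ps

combination-span : ∀ {n} {B : Mat n} → SkewSym B → ∀ ps u → validList B ps ≡ true → V00 B (combine-generators ps u)
combination-span sk [] u e = span-zero (λ _ → refl)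
combination-span {B = B} sk ((v , p) ∷ ps) u e = span-⊕ (scaled (u v)) (combination-span sk ps u (∧-splitʳ {validᵇ B p} e))
  where
  scaled : ∀ b → V00 B (λ i → b ∧ vector p i)
  scaled true  = span-one (valid-basic sk p (∧-splitˡ e))
  scaled false = span-zero (λ _ → refl)

-- For the candidate `v`: it is not radical, or it equals the combination of generators whose
-- coefficients are read off at the pivots.
spannedᵇ : ∀ {n} → Mat n → List (Fin n × Generator n) → Vec Bool n → Bool
spannedᵇ B ps v = not (radicalᵇ B (lookup v)) Bool.∨ allᵇ (λ i → does (combine-generators ps (lookup v) i Bool.≟ lookup v i))

-- As mutation commutes with relabelling, closure of finitely many representatives under mutation at
-- each vertex, up to a permutation, closes the whole class. The other fields certify that the
-- radical of each representative is spanned by basic vectors.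
record FiniteClass (n m : ℕ) : Set where
  field
    rep         : Fin m → Mat n
    target      : Fin m → Fin n → Fin m
    perm perm⁻¹ : Fin m → Fin n → Fin n → Fin n
    generators  : Fin m → List (Fin n × Generator n)
    skew        : ∀ r → SkewSym (rep r)
    closed      : ∀ r k i j → mutate k (rep r) i j ≡ rep (target r k) (perm r k i) (perm r k j)
    inverse     : ∀ r k i → perm r k (perm⁻¹ r k i) ≡ i
    inverse′    : ∀ r k i → perm⁻¹ r k (perm r k i) ≡ i
    valid       : ∀ r → validList (rep r) (generators r) ≡ true
    spanned     : ∀ r → allVec (spannedᵇ (rep r) (generators r)) ≡ true

module FiniteClassFacts {n m : ℕ} (F : FiniteClass n m) where
  open FiniteClass F

  rep-spanned : ∀ r u → Radical (rep r) u → V00 (rep r) u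
  rep-spanned r u rad = span-cong
    (λ i → trans (check (λ i → combine-generators (generators r) (lookup v) i Bool.≟ lookup v i) spans i) (Vecₚ.lookup∘tabulate u i))
    (combination-span (skew r) (generators r) (lookup v) (valid r))
    where
    v : Vec Bool n
    v = tabulate u
    v-radical : radicalᵇ (rep r) (lookup v) ≡ true
    v-radical = radicalᵇ-complete {B = rep r} {lookup v}
      (radical-resp {B = rep r} {u} {lookup v} (λ i → sym (Vecₚ.lookup∘tabulate u i)) rad)
    spans : allᵇ (λ i → does (combine-generators (generators r) (lookup v) i Bool.≟ lookup v i)) ≡ true
    spans = ∨-right {not (radicalᵇ (rep r) (lookup v))} (cong not v-radical)
      (allVec-sound {f = spannedᵇ (rep r) (generators r)} (spanned r) v)

  Member : Mat n → Set
  Member B = ∃[ r ] Σ (Fin n → Fin n) λ σ → Σ (Fin n → Fin n) λ τ → (∀ i → σ (τ i) ≡ i) × (∀ i → τ (σ i) ≡ i) ×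
             B ≈ (λ i j → rep r (σ i) (σ j))

  member-mutate : ∀ {B} k → Member B → Member (mutate k B)
  member-mutate k (r , σ , τ , στ , τσ , e) = target r (σ k) , perm r (σ k) ∘ σ , τ ∘ perm⁻¹ r (σ k) ,
    (λ i → trans (cong (perm r (σ k)) (στ _)) (inverse r (σ k) i)) ,
    (λ i → trans (cong τ (inverse′ r (σ k) (σ i))) (τσ i)) ,
    λ i j → trans (mutate-cong k e i j) (trans (mutate-relabel {B = rep r} σ τ στ τσ k i j) (closed r (σ k) (σ i) (σ j)))

  member-mutEq : ∀ {B C} → MutEq B C → (Member B → Member C) × (Member C → Member B)
  member-mutEq = mutEq-invariant Member (λ e (r , σ , τ , στ , τσ , h) → r , σ , τ , στ , τσ , ≈-trans (≈-sym e) h) member-mutate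
    (λ σ' τ' στ' τσ' (r , σ , τ , στ , τσ , h) → r , σ ∘ σ' , τ' ∘ τ , (λ i → trans (cong σ (στ' (τ i))) (στ i)) ,
      (λ i → trans (cong τ' (τσ (σ' i))) (τσ' i)) , λ i j → h (σ' i) (σ' j))

  member-skew : ∀ {B} → Member B → SkewSym B
  member-skew (r , σ , _ , _ , _ , e) i j = trans (e j i) (trans (skew r (σ i) (σ j)) (cong -_ (sym (e i j))))

  member-spanned : ∀ {B} → Member B → ∀ u → Radical B u → V00 B u
  member-spanned {B} (r , σ , τ , στ , τσ , e) u rad = span-mono (λ {w} → basic-≈ {u = w} (≈-sym e))
    (span-cong {w = u} (λ i → cong u (τσ i)) (span-relabel {B = rep r} σ τ στ τσ {u ∘ τ}
      (rep-spanned r (u ∘ τ) (radical-unlabel {B = rep r} σ τ στ τσ {u} (radical-≈ {u = u} e rad)))))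

  -- `V00` equals `V0` throughout the class, so the quotient is zero and the dimensions agree by the
  -- isomorphism of radicals along mutations.
  class-conclusion : ∀ {B} → Member B → Conclusion B
  class-conclusion {B} mem = (0 , quotDim-zero (member-spanned mem) , z≤n) , dims
    where
    radical-dim : ∀ {C d} → Member C → Dim (Radical C) d → Dim (V00 C) d
    radical-dim {C} mem = quotDim-⇔ (member-spanned mem) (λ u → span-radical {B = C}) (λ _ z → z) (λ _ z → z)
    both : ∀ B' → Member B' → ∃ (Dim (Radical B)) → RadicalIso B B' → Σ ℕ λ d → Dim (V00 B) d × Dim (V00 B') d
    both B' mem' (d , D) (_ , φ , f , g) = d , radical-dim mem D , radical-dim mem' (iso-dim {U = Radical B} {Radical B'} φ f g D)
    dims : ∀ B' → MutEq B B' → Σ ℕ λ d → Dim (V00 B) d × Dim (V00 B') d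
    dims B' p = both B' (proj₁ (member-mutEq p) mem) (subspace-dim (radical-subspace B)) (mutEq-radical (member-skew mem) p)

open import Agda.Builtin.FromNat using (fromNat)

-- The five quivers of type X₆ and the two of type X₇

-- The inverse of a permutation found by search. The last position is returned untested, as the only
-- one left.
preimage : ∀ {m n} → (Fin (suc m) → Fin n) → Fin n → Fin (suc m)
preimage {zero}  f i = zero
preimage {suc m} f i = if f zero == i then zero else suc (preimage (f ∘ suc) i)

X6-1 : Mat 6
X6-1 = fromEdges
  ( (0 , 2 , 1) ∷ (0 , 4 , 1) ∷ (1 , 0 , 1) ∷ (1 , 2 , 1) ∷ (2 , 3 , 1) ∷ (2 , 5 , 1)
  ∷ (3 , 0 , 1) ∷ (3 , 4 , 1) ∷ (4 , 1 , 1) ∷ (4 , 5 , 1) ∷ (5 , 0 , 1) ∷ [])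

X6-3 : Mat 6
X6-3 = fromEdges
  ( (0 , 1 , 1) ∷ (0 , 2 , 1) ∷ (1 , 4 , 1) ∷ (2 , 1 , 1) ∷ (2 , 3 , 1) ∷ (2 , 5 , 1)
  ∷ (3 , 0 , 1) ∷ (3 , 4 , 1) ∷ (4 , 2 , 1) ∷ (4 , 5 , 1) ∷ (5 , 0 , 1) ∷ [])

X6-4 : Mat 6
X6-4 = fromEdges
  ( (0 , 5 , 1) ∷ (1 , 0 , 1) ∷ (1 , 2 , 1) ∷ (2 , 3 , 1) ∷ (3 , 0 , 1) ∷ (3 , 4 , 1)
  ∷ (4 , 1 , 1) ∷ (5 , 2 , 1) ∷ (5 , 4 , 1) ∷ [])

X6-quivers : Vec (Mat 6) 5
X6-quivers = X6 true ∷ X6-1 ∷ X6 false ∷ X6-3 ∷ X6-4 ∷ []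

-- Row r, column k: the mutation of the r-th quiver at k is the quiver with this number,
-- relabelled by the permutation in the corresponding place of the next table.
X6-targets : Vec (Vec (Fin 5) 6) 5
X6-targets =
  ( (1 ∷ 0 ∷ 0 ∷ 0 ∷ 0 ∷ 2 ∷ [])
  ∷ (0 ∷ 3 ∷ 3 ∷ 3 ∷ 3 ∷ 4 ∷ [])
  ∷ (3 ∷ 2 ∷ 2 ∷ 2 ∷ 2 ∷ 0 ∷ [])
  ∷ (1 ∷ 1 ∷ 2 ∷ 4 ∷ 1 ∷ 1 ∷ [])
  ∷ (3 ∷ 1 ∷ 3 ∷ 1 ∷ 3 ∷ 1 ∷ []) ∷ [])

X6-permutations : Vec (Vec (Vec (Fin 6) 6) 6) 5
X6-permutations =
  ( ((0 ∷ 1 ∷ 2 ∷ 3 ∷ 4 ∷ 5 ∷ [])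
   ∷ (0 ∷ 2 ∷ 1 ∷ 3 ∷ 4 ∷ 5 ∷ [])
   ∷ (0 ∷ 2 ∷ 1 ∷ 3 ∷ 4 ∷ 5 ∷ [])
   ∷ (0 ∷ 1 ∷ 2 ∷ 4 ∷ 3 ∷ 5 ∷ [])
   ∷ (0 ∷ 1 ∷ 2 ∷ 4 ∷ 3 ∷ 5 ∷ [])
   ∷ (0 ∷ 1 ∷ 2 ∷ 3 ∷ 4 ∷ 5 ∷ []) ∷ [])
  ∷ ((0 ∷ 1 ∷ 2 ∷ 3 ∷ 4 ∷ 5 ∷ [])
   ∷ (0 ∷ 1 ∷ 2 ∷ 3 ∷ 4 ∷ 5 ∷ [])
   ∷ (1 ∷ 2 ∷ 0 ∷ 3 ∷ 4 ∷ 5 ∷ [])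
   ∷ (0 ∷ 3 ∷ 4 ∷ 1 ∷ 2 ∷ 5 ∷ [])
   ∷ (1 ∷ 3 ∷ 4 ∷ 2 ∷ 0 ∷ 5 ∷ [])
   ∷ (0 ∷ 1 ∷ 2 ∷ 3 ∷ 4 ∷ 5 ∷ []) ∷ [])
  ∷ ((2 ∷ 0 ∷ 1 ∷ 4 ∷ 5 ∷ 3 ∷ [])
   ∷ (0 ∷ 2 ∷ 1 ∷ 3 ∷ 4 ∷ 5 ∷ [])
   ∷ (0 ∷ 2 ∷ 1 ∷ 3 ∷ 4 ∷ 5 ∷ [])
   ∷ (0 ∷ 1 ∷ 2 ∷ 4 ∷ 3 ∷ 5 ∷ [])
   ∷ (0 ∷ 1 ∷ 2 ∷ 4 ∷ 3 ∷ 5 ∷ [])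
   ∷ (0 ∷ 1 ∷ 2 ∷ 3 ∷ 4 ∷ 5 ∷ []) ∷ [])
  ∷ ((2 ∷ 0 ∷ 1 ∷ 3 ∷ 4 ∷ 5 ∷ [])
   ∷ (0 ∷ 1 ∷ 2 ∷ 3 ∷ 4 ∷ 5 ∷ [])
   ∷ (1 ∷ 2 ∷ 0 ∷ 5 ∷ 3 ∷ 4 ∷ [])
   ∷ (1 ∷ 0 ∷ 3 ∷ 2 ∷ 5 ∷ 4 ∷ [])
   ∷ (2 ∷ 5 ∷ 3 ∷ 1 ∷ 4 ∷ 0 ∷ [])
   ∷ (2 ∷ 5 ∷ 4 ∷ 1 ∷ 0 ∷ 3 ∷ []) ∷ [])
  ∷ ((3 ∷ 0 ∷ 1 ∷ 4 ∷ 5 ∷ 2 ∷ [])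
   ∷ (2 ∷ 5 ∷ 4 ∷ 1 ∷ 0 ∷ 3 ∷ [])
   ∷ (1 ∷ 0 ∷ 3 ∷ 2 ∷ 5 ∷ 4 ∷ [])
   ∷ (2 ∷ 1 ∷ 0 ∷ 5 ∷ 4 ∷ 3 ∷ [])
   ∷ (1 ∷ 2 ∷ 5 ∷ 0 ∷ 3 ∷ 4 ∷ [])
   ∷ (0 ∷ 1 ∷ 2 ∷ 3 ∷ 4 ∷ 5 ∷ []) ∷ []) ∷ [])

X6-generators : Vec (List (Fin 6 × Generator 6)) 5
X6-generators =
  ( ((2 , pair 1 2) ∷ (3 , pair 1 3) ∷ (4 , pair 1 4) ∷ (5 , pair 1 5) ∷ [])
  ∷ ((3 , pair 1 3) ∷ (5 , pair 1 5) ∷ (4 , pair 2 4) ∷ (0 , triple 0 1 2) ∷ [])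
  ∷ ((2 , pair 1 2) ∷ (3 , pair 1 3) ∷ (4 , pair 1 4) ∷ (5 , pair 1 5) ∷ [])
  ∷ ((3 , pair 1 3) ∷ (5 , pair 1 5) ∷ (4 , pair 0 4) ∷ (2 , triple 0 1 2) ∷ [])
  ∷ ((3 , pair 1 3) ∷ (5 , pair 1 5) ∷ (2 , pair 0 2) ∷ (4 , pair 0 4) ∷ []) ∷ [])

X6-class : FiniteClass 6 5
X6-class = record
  { rep = lookup X6-quivers ; target = λ r → lookup (lookup X6-targets r)
  ; perm = perm ; perm⁻¹ = λ r k → preimage (perm r k) ; generators = lookup X6-generators
  ; skew = check₃ (λ r i j → lookup X6-quivers r j i ℤ.≟ - lookup X6-quivers r i j) refl
  ; closed = check₄ (λ r k i j → mutate k (lookup X6-quivers r) i j ℤ.≟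
               lookup X6-quivers (lookup (lookup X6-targets r) k) (perm r k i) (perm r k j)) refl
  ; inverse = check₃ (λ r k i → perm r k (preimage (perm r k) i) ≟ i) refl
  ; inverse′ = check₃ (λ r k i → preimage (perm r k) (perm r k i) ≟ i) refl
  ; valid = check (λ r → validList (lookup X6-quivers r) (lookup X6-generators r) Bool.≟ true) refl
  ; spanned = check (λ r → allVec (spannedᵇ (lookup X6-quivers r) (lookup X6-generators r)) Bool.≟ true) refl }
  where
  perm : Fin 5 → Fin 6 → Fin 6 → Fin 6
  perm r k = lookup (lookup (lookup X6-permutations r) k)

-- The mutation of `X7` at `0`.
X7-1 : Mat 7
X7-1 = fromEdges
  ( (0 , 2 , 1) ∷ (0 , 4 , 1) ∷ (0 , 6 , 1) ∷ (1 , 0 , 1) ∷ (1 , 2 , 1) ∷ (2 , 3 , 1)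
  ∷ (2 , 5 , 1) ∷ (3 , 0 , 1) ∷ (3 , 4 , 1) ∷ (4 , 1 , 1) ∷ (4 , 5 , 1) ∷ (5 , 0 , 1)
  ∷ (5 , 6 , 1) ∷ (6 , 1 , 1) ∷ (6 , 3 , 1) ∷ [])

X7-quivers : Vec (Mat 7) 2
X7-quivers = X7 ∷ X7-1 ∷ []

X7-targets : Vec (Vec (Fin 2) 7) 2
X7-targets =
  ( (1 ∷ 0 ∷ 0 ∷ 0 ∷ 0 ∷ 0 ∷ 0 ∷ [])
  ∷ (0 ∷ 1 ∷ 1 ∷ 1 ∷ 1 ∷ 1 ∷ 1 ∷ []) ∷ [])

X7-permutations : Vec (Vec (Vec (Fin 7) 7) 7) 2
X7-permutations =
  ( ((0 ∷ 1 ∷ 2 ∷ 3 ∷ 4 ∷ 5 ∷ 6 ∷ [])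
   ∷ (0 ∷ 2 ∷ 1 ∷ 3 ∷ 4 ∷ 5 ∷ 6 ∷ [])
   ∷ (0 ∷ 2 ∷ 1 ∷ 3 ∷ 4 ∷ 5 ∷ 6 ∷ [])
   ∷ (0 ∷ 1 ∷ 2 ∷ 4 ∷ 3 ∷ 5 ∷ 6 ∷ [])
   ∷ (0 ∷ 1 ∷ 2 ∷ 4 ∷ 3 ∷ 5 ∷ 6 ∷ [])
   ∷ (0 ∷ 1 ∷ 2 ∷ 3 ∷ 4 ∷ 6 ∷ 5 ∷ [])
   ∷ (0 ∷ 1 ∷ 2 ∷ 3 ∷ 4 ∷ 6 ∷ 5 ∷ []) ∷ [])
  ∷ ((0 ∷ 1 ∷ 2 ∷ 3 ∷ 4 ∷ 5 ∷ 6 ∷ [])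
   ∷ (1 ∷ 2 ∷ 0 ∷ 4 ∷ 5 ∷ 6 ∷ 3 ∷ [])
   ∷ (2 ∷ 0 ∷ 1 ∷ 4 ∷ 5 ∷ 6 ∷ 3 ∷ [])
   ∷ (1 ∷ 4 ∷ 5 ∷ 2 ∷ 0 ∷ 6 ∷ 3 ∷ [])
   ∷ (2 ∷ 4 ∷ 5 ∷ 0 ∷ 1 ∷ 6 ∷ 3 ∷ [])
   ∷ (1 ∷ 4 ∷ 5 ∷ 6 ∷ 3 ∷ 2 ∷ 0 ∷ [])
   ∷ (2 ∷ 4 ∷ 5 ∷ 6 ∷ 3 ∷ 0 ∷ 1 ∷ []) ∷ []) ∷ [])

X7-generators : Vec (List (Fin 7 × Generator 7)) 2
X7-generators =
  ( ((2 , pair 1 2) ∷ (3 , pair 1 3) ∷ (4 , pair 1 4) ∷ (5 , pair 1 5) ∷ (6 , pair 1 6) ∷ [])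
  ∷ ((3 , pair 1 3) ∷ (5 , pair 1 5) ∷ (4 , pair 2 4) ∷ (6 , pair 2 6) ∷ (0 , triple 0 1 2) ∷ []) ∷ [])

X7-class : FiniteClass 7 2
X7-class = record
  { rep = lookup X7-quivers ; target = λ r → lookup (lookup X7-targets r)
  ; perm = perm ; perm⁻¹ = λ r k → preimage (perm r k) ; generators = lookup X7-generators
  ; skew = check₃ (λ r i j → lookup X7-quivers r j i ℤ.≟ - lookup X7-quivers r i j) refl
  ; closed = check₄ (λ r k i j → mutate k (lookup X7-quivers r) i j ℤ.≟
               lookup X7-quivers (lookup (lookup X7-targets r) k) (perm r k i) (perm r k j)) refl
  ; inverse = check₃ (λ r k i → perm r k (preimage (perm r k) i) ≟ i) refl
  ; inverse′ = check₃ (λ r k i → preimage (perm r k) (perm r k i) ≟ i) refl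
  ; valid = check (λ r → validList (lookup X7-quivers r) (lookup X7-generators r) Bool.≟ true) refl
  ; spanned = check (λ r → allVec (spannedᵇ (lookup X7-quivers r) (lookup X7-generators r)) Bool.≟ true) refl }
  where
  perm : Fin 2 → Fin 7 → Fin 7 → Fin 7
  perm r k = lookup (lookup (lookup X7-permutations r) k)

X6-member : ∀ o → FiniteClassFacts.Member X6-class (X6 o)
X6-member true  = 0 , id , id , (λ _ → refl) , (λ _ → refl) , λ _ _ → refl
X6-member false = 2 , id , id , (λ _ → refl) , (λ _ → refl) , λ _ _ → refl

X7-member : FiniteClassFacts.Member X7-class X7
X7-member = 0 , id , id , (λ _ → refl) , (λ _ → refl) , λ _ _ → refl

X6-conclusion : ∀ {n} {B : Mat n} → MutEqX6 B → Conclusion B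
X6-conclusion (refl , o , p) = class-conclusion (proj₂ (member-mutEq p) (X6-member o))
  where open FiniteClassFacts X6-class

X7-conclusion : ∀ {n} {B : Mat n} → MutEqX7 B → Conclusion B
X7-conclusion (refl , p) = class-conclusion (proj₂ (member-mutEq p) X7-member)
  where open FiniteClassFacts X7-class

theorem1p3 : ∀ {n} (B : Mat n) → SkewSym B → Connected B →
    FiniteMutationType B → 3 ≤ n →
    (∀ (S : Vect n) → IsDoubleEdge B S ⊎ IsNonOrientedCycle B S → V0 B S)
    × (BlockDecomposable B ⊎ MutEqX6 B ⊎ MutEqX7 B →
    (Σ ℕ λ d → QuotDim (V0 B) (V00 B) d × d ≤ 1)
    × (∀ B' → MutEq B B' → Σ ℕ λ d → Dim (V00 B) d × Dim (V00 B') d))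
theorem1p3 B sk con fin 3≤n =
  (λ S → [ double-edge-radical sk fin S , nonOriented-radical sk fin S ]′) ,
  [ (λ D → surface-conclusion (FromBlocks.triangulation D) (FromBlocks.triangulation-matrix D) con 3≤n) ,
    [ X6-conclusion , X7-conclusion ]′ ]′
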